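{- Let $c\psi_{2}(n)$ be defined by the generating function $$\sum_{n=0}^{\infty} c\psi_2(n) q^n = \frac{(q^4;q^4)_{\infty}^2}{(q;q)_{\infty}^2(q^2;q^2)_{\infty}}.$$ Let $n,\alpha\in\mathbb{Z}_{\ge 1}$ be such that $6n\equiv -1\pmod{5^{\alpha}}$. Then $c\psi_{2}(n)\equiv 0\pmod{5^{\alpha}}$.
   Context: $(a;b)_\infty$ denotes the $q$-Pochhammer symbol $(q^a;q^b)_{\infty} = \prod_{m\ge 0}(1-q^{bm+a})$. The function $c\psi_2(n)$ counts generalized $2$-colored Frobenius partitions of $n$ in the sense of Drake (equivalently $c\psi_{2,0}(n)$ in the notation of Jiang--Rolen--Woodbury); the generating function above determines it. -}

module Defs where

open import Data.Nat as ℕ using (ℕ; zero; suc; _≤ᵇ_)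
open import Data.Nat.DivMod using (_%_)
open import Data.Bool using (if_then_else_)
open import Data.Integer as ℤ using (ℤ; 0ℤ; 1ℤ; -1ℤ)

Series : Set
Series = ℕ → ℤ

one : Series
one zero    = 1ℤ
one (suc _) = 0ℤ

sumTo : ℕ → (ℕ → ℤ) → ℤ
sumTo zero    f = f 0
sumTo (suc n) f = sumTo n f ℤ.+ f (suc n)

_⊛_ : Series → Series → Series
(f ⊛ g) n = sumTo n (λ i → f i ℤ.* g (n ℕ.∸ i))

infixl 7 _⊛_

-- the polynomial 1 - q^k   (k ≥ 1 intended)
oneMinusQ : ℕ → Series
oneMinusQ k zero    = 1ℤ
oneMinusQ k (suc m) = if (suc m ℕ.≡ᵇ k) then -1ℤ else 0ℤ

-- the series 1/(1 - q^k) = Σ_j q^{jk}   (k ≥ 1)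
invOneMinusQ : ℕ → Series
invOneMinusQ zero    n = 0ℤ   -- not used (k ≥ 1 always below)
invOneMinusQ (suc k) n = if (n % suc k ℕ.≡ᵇ 0) then 1ℤ else 0ℤ

prodTo : ℕ → (ℕ → Series) → ℕ → ℕ → Series
prodTo zero    F a b = one
prodTo (suc N) F a b = prodTo N F a b ⊛ F (b ℕ.* N ℕ.+ a)

-- (q^a;q^b)_∞ = Π_{m≥0} (1 - q^{bm+a})  for a,b ≥ 1.  Its coefficient of q^n
-- is determined by the finitely many factors with bm + a ≤ n, so we take the
-- product of the first (n+1) factors (bm + a ≥ m + 1 > n for m ≥ n).
qPoch : ℕ → ℕ → Series
qPoch a b n = prodTo (suc n) oneMinusQ a b n

qPochInv : ℕ → ℕ → Series
qPochInv a b n = prodTo (suc n) invOneMinusQ a b n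

cψ₂ : ℕ → ℤ
cψ₂ = qPoch 4 4 ⊛ qPoch 4 4 ⊛ qPochInv 1 1 ⊛ qPochInv 1 1 ⊛ qPochInv 2 2

-- Write E(q) = (q;q)_∞ and P(q) = ψ(q²) = E(q⁴)²/E(q²), so that Σ cψ₂(n) qⁿ = P/E². Three identities,
-- in which R is the Rogers-Ramanujan quotient,
--   E(q)/E(q²⁵) = R(q⁵) - q - q²/R(q⁵),
--   P(q) = (R(q⁵) + q²/R(q⁵)) P(q⁵) - (E(q)/E(q²⁵)) q⁵ P(q²⁵),
--   R⁵ - 11q - q²/R⁵ = E(q)⁶/E(q⁵)⁶,
-- reduce the extraction of every fifth coefficient to the operator U : Σ a(n) qⁿ ↦ Σ a(5n) qⁿ on the
-- powers of w = q E(q²⁵)/E(q), which is a root of an equation of degree 5 over t(q⁵), t = q E(q⁵)⁶/E(q)⁶.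
-- With Y = q P(q⁵) and s = √(1 + 22t + 125t²), the numerators of the generating series along the
-- progressions 6n ≡ -1 (mod 5^α) are integer combinations of P tᵐ, Y s tᵐ for even α and of P s tᵐ, Y tᵐ
-- for odd α, with coefficients whose 5-adic valuations grow by at least one from each α to the next.
--
-- The first identity follows from E² = φ(-q) E(q²) in an exponent class mod 5 where 5 is inert for the
-- quadratic form on the right. The same device expresses the 5-dissections of ψ(q²) and φ(q) through two
-- unknown series Ψ and Φ; these satisfy the equations that express ψ(q²)² and φ(q)² through ψ(q⁴) and
-- φ(q²), and such equations determine their solutions, so Ψ = ψ(q²) and Φ = φ(q). For the third
-- identity, the equation of X₁(10) shows that the quotient of both sides is invariant under q ↦ q².

module Submission where

open import Defs
open import Algebra.Bundles using (CommutativeRing; RawRing)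
open import Algebra.Structures using (IsCommutativeRing)
open import Algebra.Solver.Ring.AlmostCommutativeRing using (AlmostCommutativeRing; fromCommutativeRing; _-Raw-AlmostCommutative⟶_)
import Algebra.Solver.Ring
open import Data.Bool.Base using (T; true; false; if_then_else_)
open import Data.Empty using (⊥-elim)
open import Data.Fin using (#_)
open import Data.Fin.Base as Fin using (Fin; zero; suc)
open import Data.Integer.Base as ℤ using (ℤ; 0ℤ; 1ℤ; -1ℤ; +_)
open import Data.Integer.Divisibility using (_∣_)
import Data.Integer.Properties as ℤ
import Data.Integer.Solver
open import Data.Maybe.Base using (Maybe; just; nothing)
open import Data.Nat.Base as ℕ using (ℕ; zero; suc; z≤n; s≤s)
open import Data.Nat.Divisibility as ℕ∣ using () renaming (_∣_ to _∣ℕ_)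
open import Data.Nat.DivMod using (_%_; m<n⇒m%n≡m; [m+n]%n≡m%n)
import Data.Nat.Properties as ℕ
import Data.Nat.Solver
open import Data.Product.Base using (∃; ∃₂; _×_; _,_; proj₁; proj₂)
open import Data.Sum.Base using (_⊎_; inj₁; inj₂)
open import Data.Vec.Base using (Vec; []; _∷_; lookup; map)
import Data.Vec.Properties as Vec
open import Level using (0ℓ)
open import Relation.Binary.PropositionalEquality as ≡ using (_≡_; cong; cong₂)
open import Relation.Nullary using (yes; no)

-- `U` alone gains nothing: U(w³) begins with 9t and U(w⁴) with 4t. The gain comes from weighting tᵐ
-- with 5²ᵐ, up to fixed offsets. In `Dw` and `Gw` the coefficient of wᵐ has valuation at least m/2,
-- so `U` turns wᵏ into terms tᵐ whose coefficients have valuation about (5m - k)/2; an input term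
-- 5²ⁱ tⁱ then yields terms tᵐ of valuation above 2m, and the offsets are tuned so that a whole
-- factor 5 is left even at the smallest m. That P, Y and the root s occur together is forced: the
-- second identity splits P into P(q⁵) and Y(q⁵) with the factors κ and F, and κ/F = s/Gw is not a
-- polynomial in w.
--
-- All identities live in ℤ[[q]]. The fractional power of q in the Rogers-Ramanujan continued
-- fraction is absorbed into R, a series with constant term 1. Most identities are proved by one of
-- three devices: ring normalisation modulo R r = 1, comparison of classes mod 5 in an equality of
-- products, and uniqueness of the solution of an equation between f(q) and f(q²).

module CψCongruence where

  open Data.Integer.Solver.+-*-Solver using () renaming (solve to solveℤ; _:+_ to _⊞_; _:*_ to _⊠_; _:=_ to _≜_)
  open Data.Nat.Solver.+-*-Solver using () renaming (solve to solveℕ; _:+_ to _⊕_; _:*_ to _⊗_; _:=_ to _⊜_; con to nat)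

  -- Convolution of integer sequences

  tl : Series → Series
  tl f n = f (suc n)

  -- Recursion on the head and tail of the first factor, so that the ring laws follow by structural
  -- induction; `⊛` sums towards the last index instead.
  conv : Series → Series → Series
  conv f g zero    = f 0 ℤ.* g 0
  conv f g (suc n) = f 0 ℤ.* g (suc n) ℤ.+ conv (tl f) g n

  sumTo-suc : ∀ n f → sumTo (suc n) f ≡ f 0 ℤ.+ sumTo n (tl f)
  sumTo-suc zero    f = ≡.refl
  sumTo-suc (suc n) f = ≡.trans (cong (ℤ._+ f (suc (suc n))) (sumTo-suc n f)) (ℤ.+-assoc (f 0) _ _)

  ⊛-conv : ∀ f g n → (f ⊛ g) n ≡ conv f g n
  ⊛-conv f g zero    = ≡.refl
  ⊛-conv f g (suc n) = ≡.trans (sumTo-suc n _) (cong (λ z → f 0 ℤ.* g (suc n) ℤ.+ z) (⊛-conv (tl f) g n))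

  conv-cong-≤ : ∀ n {f f′ g g′} → (∀ i → i ℕ.≤ n → f i ≡ f′ i) → (∀ i → i ℕ.≤ n → g i ≡ g′ i) → conv f g n ≡ conv f′ g′ n
  conv-cong-≤ zero    p r = cong₂ ℤ._*_ (p 0 z≤n) (r 0 z≤n)
  conv-cong-≤ (suc n) p r = cong₂ ℤ._+_ (cong₂ ℤ._*_ (p 0 z≤n) (r (suc n) ℕ.≤-refl))
    (conv-cong-≤ n (λ i i≤n → p (suc i) (s≤s i≤n)) (λ i i≤n → r i (ℕ.m≤n⇒m≤1+n i≤n)))

  conv-distribʳ : ∀ f g h n → conv (λ i → f i ℤ.+ g i) h n ≡ conv f h n ℤ.+ conv g h n
  conv-distribʳ f g h zero    = ℤ.*-distribʳ-+ (h 0) (f 0) (g 0)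
  conv-distribʳ f g h (suc n) = ≡.trans
    (cong (λ z → (f 0 ℤ.+ g 0) ℤ.* h (suc n) ℤ.+ z) (conv-distribʳ (tl f) (tl g) h n))
    (lemma (f 0) (g 0) (h (suc n)) (conv (tl f) h n) (conv (tl g) h n))
    where
    lemma : ∀ a b c x y → (a ℤ.+ b) ℤ.* c ℤ.+ (x ℤ.+ y) ≡ (a ℤ.* c ℤ.+ x) ℤ.+ (b ℤ.* c ℤ.+ y)
    lemma = solveℤ 5 (λ a b c x y → (a ⊞ b) ⊠ c ⊞ (x ⊞ y) ≜ (a ⊠ c ⊞ x) ⊞ (b ⊠ c ⊞ y)) ≡.refl

  conv-scale : ∀ c f g n → conv (λ i → c ℤ.* f i) g n ≡ c ℤ.* conv f g n
  conv-scale c f g zero    = ℤ.*-assoc c (f 0) (g 0)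
  conv-scale c f g (suc n) = ≡.trans (cong (λ z → c ℤ.* f 0 ℤ.* g (suc n) ℤ.+ z) (conv-scale c (tl f) g n))
    (lemma c (f 0) (g (suc n)) (conv (tl f) g n))
    where
    lemma : ∀ c a b x → c ℤ.* a ℤ.* b ℤ.+ c ℤ.* x ≡ c ℤ.* (a ℤ.* b ℤ.+ x)
    lemma = solveℤ 4 (λ c a b x → c ⊠ a ⊠ b ⊞ c ⊠ x ≜ c ⊠ (a ⊠ b ⊞ x)) ≡.refl

  conv-zeroˡ : ∀ g n → conv (λ _ → 0ℤ) g n ≡ 0ℤ
  conv-zeroˡ g zero    = ≡.refl
  conv-zeroˡ g (suc n) = ≡.trans (ℤ.+-identityˡ _) (conv-zeroˡ g n)

  conv-sucʳ : ∀ f g n → conv f g (suc n) ≡ conv f (tl g) n ℤ.+ f (suc n) ℤ.* g 0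
  conv-sucʳ f g zero    = ≡.refl
  conv-sucʳ f g (suc n) = ≡.trans (cong (λ z → f 0 ℤ.* g (suc (suc n)) ℤ.+ z) (conv-sucʳ (tl f) g n))
    (≡.sym (ℤ.+-assoc (f 0 ℤ.* g (suc (suc n))) _ _))

  conv-comm : ∀ f g n → conv f g n ≡ conv g f n
  conv-comm f g zero    = ℤ.*-comm (f 0) (g 0)
  conv-comm f g (suc n) = ≡.trans (cong (λ z → f 0 ℤ.* g (suc n) ℤ.+ z) (conv-comm (tl f) g n))
    (≡.trans (≡.trans (ℤ.+-comm (f 0 ℤ.* g (suc n)) _) (cong (λ z → conv g (tl f) n ℤ.+ z) (ℤ.*-comm (f 0) _)))
      (≡.sym (conv-sucʳ g f n)))

  conv-assoc : ∀ f g h n → conv (conv f g) h n ≡ conv f (conv g h) n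
  conv-assoc f g h zero    = ℤ.*-assoc (f 0) (g 0) (h 0)
  conv-assoc f g h (suc n) = ≡.trans
    (cong (λ z → f 0 ℤ.* g 0 ℤ.* h (suc n) ℤ.+ z) (≡.trans
      (conv-distribʳ (λ i → f 0 ℤ.* tl g i) (conv (tl f) g) h n)
      (cong₂ ℤ._+_ (conv-scale (f 0) (tl g) h n) (conv-assoc (tl f) g h n))))
    (lemma (f 0) (g 0) (h (suc n)) (conv (tl g) h n) (conv (tl f) (conv g h) n))
    where
    lemma : ∀ a b c x y → a ℤ.* b ℤ.* c ℤ.+ (a ℤ.* x ℤ.+ y) ≡ a ℤ.* (b ℤ.* c ℤ.+ x) ℤ.+ y
    lemma = solveℤ 5 (λ a b c x y → a ⊠ b ⊠ c ⊞ (a ⊠ x ⊞ y) ≜ a ⊠ (b ⊠ c ⊞ x) ⊞ y) ≡.refl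

  -- Power series

  -- Wrapped, since ⊛ unfolds as soon as a coefficient is compared.
  record PowerSeries : Set where
    constructor series
    field coeff : Series

  open PowerSeries public

  infix 4 _≈_ _≈[_]_
  infixl 6 _+_ _-_
  infixl 7 _*_
  infix 8 -_

  record _≈_ (f g : PowerSeries) : Set where
    constructor coeffwise
    field coeff-≡ : ∀ n → coeff f n ≡ coeff g n

  open _≈_ public

  -- Congruence modulo `qⁿ`. The strict bound makes `n = 0` vacuous, so inductions on the precision
  -- start for free, and a factor `q` turns precision `n` into `suc n`.
  record _≈[_]_ (f : PowerSeries) (n : ℕ) (g : PowerSeries) : Set where
    constructor below
    field coeff-< : ∀ i → i ℕ.< n → coeff f i ≡ coeff g i

  open _≈[_]_ public

  opaque
    _+_ : PowerSeries → PowerSeries → PowerSeries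
    f + g = series λ n → coeff f n ℤ.+ coeff g n

    -_ : PowerSeries → PowerSeries
    - f = series λ n → ℤ.- coeff f n

    _*_ : PowerSeries → PowerSeries → PowerSeries
    f * g = series (coeff f ⊛ coeff g)

    const : ℤ → PowerSeries
    const c = series λ { zero → c ; (suc _) → 0ℤ }

    tail : PowerSeries → PowerSeries
    tail f = series (tl (coeff f))

    q : PowerSeries
    q = series λ { 1 → 1ℤ ; _ → 0ℤ }

  _-_ : PowerSeries → PowerSeries → PowerSeries
  f - g = f + - g

  0# 1# : PowerSeries
  0# = const 0ℤ
  1# = const 1ℤ

  ≈-refl : ∀ {f} → f ≈ f
  ≈-refl = coeffwise λ _ → ≡.refl

  ≈-sym : ∀ {f g} → f ≈ g → g ≈ f
  ≈-sym p = coeffwise λ n → ≡.sym (coeff-≡ p n)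

  ≈-trans : ∀ {f g h} → f ≈ g → g ≈ h → f ≈ h
  ≈-trans p r = coeffwise λ n → ≡.trans (coeff-≡ p n) (coeff-≡ r n)

  opaque
    unfolding _+_ -_ _*_ const tail q

    coeff-+ : ∀ f g n → coeff (f + g) n ≡ coeff f n ℤ.+ coeff g n
    coeff-+ f g n = ≡.refl

    coeff-neg : ∀ f n → coeff (- f) n ≡ ℤ.- coeff f n
    coeff-neg f n = ≡.refl

    coeff-* : ∀ f g n → coeff (f * g) n ≡ conv (coeff f) (coeff g) n
    coeff-* f g = ⊛-conv (coeff f) (coeff g)

    coeff-⊛ : ∀ f g n → coeff (f * g) n ≡ (coeff f ⊛ coeff g) n
    coeff-⊛ f g n = ≡.refl

    coeff-const-zero : ∀ c → coeff (const c) 0 ≡ c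
    coeff-const-zero c = ≡.refl

    coeff-const-suc : ∀ c n → coeff (const c) (suc n) ≡ 0ℤ
    coeff-const-suc c n = ≡.refl

    coeff-tail : ∀ f n → coeff (tail f) n ≡ coeff f (suc n)
    coeff-tail f n = ≡.refl

    coeff-const* : ∀ c f n → coeff (const c * f) n ≡ c ℤ.* coeff f n
    coeff-const* c f zero    = ≡.refl
    coeff-const* c f (suc n) = ≡.trans (⊛-conv (coeff (const c)) (coeff f) (suc n))
      (≡.trans (cong (λ z → c ℤ.* coeff f (suc n) ℤ.+ z) (conv-zeroˡ (coeff f) n)) (ℤ.+-identityʳ _))

    coeff-q*-zero : ∀ f → coeff (q * f) 0 ≡ 0ℤ
    coeff-q*-zero f = ≡.refl

    coeff-q*-suc : ∀ f n → coeff (q * f) (suc n) ≡ coeff f n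
    coeff-q*-suc f n = ≡.trans (⊛-conv (coeff q) (coeff f) (suc n)) (≡.trans (ℤ.+-identityˡ _) (lemma n))
      where
      lemma : ∀ n → conv (tl (coeff q)) (coeff f) n ≡ coeff f n
      lemma zero    = ℤ.*-identityˡ _
      lemma (suc n) = ≡.trans (cong₂ ℤ._+_ (ℤ.*-identityˡ (coeff f (suc n))) (conv-zeroˡ (coeff f) n)) (ℤ.+-identityʳ _)

    +-*-isCommutativeRing : IsCommutativeRing _≈_ _+_ _*_ -_ 0# 1#
    +-*-isCommutativeRing = record
      { isRing = record
        { +-isAbelianGroup = record
          { isGroup = record
            { isMonoid = record
              { isSemigroup = record
                { isMagma = record
                  { isEquivalence = record { refl = ≈-refl ; sym = ≈-sym ; trans = ≈-trans }
                  ; ∙-cong = λ p r → coeffwise λ n → cong₂ ℤ._+_ (coeff-≡ p n) (coeff-≡ r n) }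
                ; assoc = λ f g h → coeffwise λ n → ℤ.+-assoc (coeff f n) (coeff g n) (coeff h n) }
              ; identity = (λ f → coeffwise (0+ f)) , (λ f → coeffwise λ n → ≡.trans (ℤ.+-comm (coeff f n) _) (0+ f n)) }
            ; inverse = (λ f → coeffwise (inverse f)) , (λ f → coeffwise λ n → ≡.trans (ℤ.+-comm (coeff f n) _) (inverse f n))
            ; ⁻¹-cong = λ p → coeffwise λ n → cong ℤ.-_ (coeff-≡ p n) }
          ; comm = λ f g → coeffwise λ n → ℤ.+-comm (coeff f n) (coeff g n) }
        ; *-cong = λ {f} {f′} {g} {g′} p r → coeffwise λ n → ≡.trans (coeff-* f g n)
            (≡.trans (conv-cong-≤ n (λ i _ → coeff-≡ p i) (λ i _ → coeff-≡ r i)) (≡.sym (coeff-* f′ g′ n)))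
        ; *-assoc = λ f g h → coeffwise λ n → begin
            coeff (f * g * h) n
              ≡⟨ coeff-* (f * g) h n ⟩
            conv (coeff (f * g)) (coeff h) n
              ≡⟨ conv-cong-≤ n (λ i _ → coeff-* f g i) (λ _ _ → ≡.refl) ⟩
            conv (conv (coeff f) (coeff g)) (coeff h) n
              ≡⟨ conv-assoc (coeff f) (coeff g) (coeff h) n ⟩
            conv (coeff f) (conv (coeff g) (coeff h)) n
              ≡⟨ conv-cong-≤ n (λ _ _ → ≡.refl) (λ i _ → coeff-* g h i) ⟨
            conv (coeff f) (coeff (g * h)) n
              ≡⟨ coeff-* f (g * h) n ⟨
            coeff (f * (g * h)) n ∎
        ; *-identity = (λ f → coeffwise (1* f)) , (λ f → coeffwise λ n → ≡.trans (comm f 1# n) (1* f n))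
        ; distrib = (λ f g h → coeffwise λ n → ≡.trans (comm f (g + h) n)
                      (≡.trans (distribʳ f g h n) (cong₂ ℤ._+_ (comm g f n) (comm h f n))))
                  , (λ f g h → coeffwise (distribʳ f g h)) }
      ; *-comm = λ f g → coeffwise (comm f g) }
      where
      open ≡.≡-Reasoning
      0+ : ∀ f n → coeff (0# + f) n ≡ coeff f n
      0+ f zero    = ℤ.+-identityˡ _
      0+ f (suc n) = ℤ.+-identityˡ _
      inverse : ∀ f n → coeff (- f + f) n ≡ coeff 0# n
      inverse f zero    = ℤ.+-inverseˡ (coeff f 0)
      inverse f (suc n) = ℤ.+-inverseˡ (coeff f (suc n))
      comm : ∀ f g n → coeff (f * g) n ≡ coeff (g * f) n
      comm f g n = ≡.trans (coeff-* f g n) (≡.trans (conv-comm (coeff f) (coeff g) n) (≡.sym (coeff-* g f n)))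
      1* : ∀ f n → coeff (1# * f) n ≡ coeff f n
      1* f n = ≡.trans (coeff-const* 1ℤ f n) (ℤ.*-identityˡ _)
      distribʳ : ∀ h f g n → coeff ((f + g) * h) n ≡ coeff (f * h + g * h) n
      distribʳ h f g n = ≡.trans (coeff-* (f + g) h n)
        (≡.trans (conv-distribʳ (coeff f) (coeff g) (coeff h) n) (≡.sym (cong₂ ℤ._+_ (coeff-* f h n) (coeff-* g h n))))

    const-+ : ∀ a b → const (a ℤ.+ b) ≈ const a + const b
    const-+ a b = coeffwise λ { zero → ≡.refl ; (suc _) → ≡.refl }

    const-* : ∀ a b → const (a ℤ.* b) ≈ const a * const b
    const-* a b = coeffwise λ n → ≡.trans (lemma n) (≡.sym (coeff-const* a (const b) n))
      where
      lemma : ∀ n → coeff (const (a ℤ.* b)) n ≡ a ℤ.* coeff (const b) n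
      lemma zero    = ≡.refl
      lemma (suc n) = ≡.sym (ℤ.*-zeroʳ a)

    const-neg : ∀ a → const (ℤ.- a) ≈ - const a
    const-neg a = coeffwise λ { zero → ≡.refl ; (suc _) → ≡.refl }

  powerSeriesRing : CommutativeRing 0ℓ 0ℓ
  powerSeriesRing = record { isCommutativeRing = +-*-isCommutativeRing }

  open CommutativeRing powerSeriesRing public
    using (setoid; reflexive; +-cong; +-congˡ; +-congʳ; *-cong; *-congˡ; *-congʳ; -‿cong; +-assoc; +-comm; *-assoc; *-comm; +-identityˡ; +-identityʳ; *-identityˡ; *-identityʳ; zeroˡ; zeroʳ; -‿inverseʳ; distribˡ; distribʳ)
  open import Algebra.Properties.CommutativeSemiring.Exp (CommutativeRing.commutativeSemiring powerSeriesRing) public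
    using (_^_; ^-homo-*; ^-cong; ^-assocʳ; ^-distrib-*)
  open import Relation.Binary.Reasoning.Setoid setoid public using (begin_; _∎; step-≈-⟩; step-≈-⟨)

  powerSeriesACR : AlmostCommutativeRing 0ℓ 0ℓ
  powerSeriesACR = fromCommutativeRing powerSeriesRing

  ℤ-rawRing : RawRing 0ℓ 0ℓ
  ℤ-rawRing = CommutativeRing.rawRing ℤ.+-*-commutativeRing

  const-morphism : ℤ-rawRing -Raw-AlmostCommutative⟶ powerSeriesACR
  const-morphism = record
    { ⟦_⟧ = const
    ; +-homo = const-+
    ; *-homo = const-*
    ; -‿homo = const-neg
    ; 0-homo = ≈-refl
    ; 1-homo = ≈-refl
    }

  const≟ : ∀ a b → Maybe (const a ≈ const b)
  const≟ a b with a ℤ.≟ b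
  ... | yes ≡.refl = just ≈-refl
  ... | no _       = nothing

  open Algebra.Solver.Ring ℤ-rawRing powerSeriesACR const-morphism const≟ public
    using (Polynomial; op; con; var; _:^_; :-_; _:+_; _:*_; _:-_; [+]; [*]; ⟦_⟧; solve; _:=_)

  v₀ : ∀ {n} → Polynomial (suc n)
  v₀ = var zero

  v₁ : ∀ {n} → Polynomial (2 ℕ.+ n)
  v₁ = var (suc zero)

  v₂ : ∀ {n} → Polynomial (3 ℕ.+ n)
  v₂ = var (suc (suc zero))

  v₃ : ∀ {n} → Polynomial (4 ℕ.+ n)
  v₃ = var (suc (suc (suc zero)))

  -- Congruence modulo powers of q

  ≈[]-refl : ∀ {n f} → f ≈[ n ] f
  ≈[]-refl = below λ _ _ → ≡.refl

  ≈[]-sym : ∀ {n f g} → f ≈[ n ] g → g ≈[ n ] f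
  ≈[]-sym p = below λ i i<n → ≡.sym (coeff-< p i i<n)

  ≈[]-trans : ∀ {n f g h} → f ≈[ n ] g → g ≈[ n ] h → f ≈[ n ] h
  ≈[]-trans p r = below λ i i<n → ≡.trans (coeff-< p i i<n) (coeff-< r i i<n)

  ≈⇒≈[] : ∀ {n f g} → f ≈ g → f ≈[ n ] g
  ≈⇒≈[] p = below λ i _ → coeff-≡ p i

  ≈[]-zero : ∀ {f g} → f ≈[ 0 ] g
  ≈[]-zero = below λ _ ()

  ≈[]-mono : ∀ {m n f g} → m ℕ.≤ n → f ≈[ n ] g → f ≈[ m ] g
  ≈[]-mono m≤n p = below λ i i<m → coeff-< p i (ℕ.<-≤-trans i<m m≤n)

  ≈[]⇒≈ : ∀ {f g} → (∀ n → f ≈[ n ] g) → f ≈ g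
  ≈[]⇒≈ p = coeffwise λ n → coeff-< (p (suc n)) n ℕ.≤-refl

  ≈[]-resp : ∀ {n f f′ g g′} → f′ ≈ f → g′ ≈ g → f ≈[ n ] g → f′ ≈[ n ] g′
  ≈[]-resp p r h = ≈[]-trans (≈⇒≈[] p) (≈[]-trans h (≈⇒≈[] (≈-sym r)))

  +-cong-[] : ∀ {n f f′ g g′} → f ≈[ n ] f′ → g ≈[ n ] g′ → f + g ≈[ n ] f′ + g′
  +-cong-[] {n} {f} {f′} {g} {g′} p r = below λ i i<n → ≡.trans (coeff-+ f g i)
    (≡.trans (cong₂ ℤ._+_ (coeff-< p i i<n) (coeff-< r i i<n)) (≡.sym (coeff-+ f′ g′ i)))

  neg-cong-[] : ∀ {n f f′} → f ≈[ n ] f′ → - f ≈[ n ] - f′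
  neg-cong-[] {n} {f} {f′} p = below λ i i<n → ≡.trans (coeff-neg f i)
    (≡.trans (cong ℤ.-_ (coeff-< p i i<n)) (≡.sym (coeff-neg f′ i)))

  *-cong-[] : ∀ {n f f′ g g′} → f ≈[ n ] f′ → g ≈[ n ] g′ → f * g ≈[ n ] f′ * g′
  *-cong-[] {n} {f} {f′} {g} {g′} p r = below λ i i<n → ≡.trans (coeff-* f g i)
    (≡.trans (conv-cong-≤ i (λ j j≤i → coeff-< p j (ℕ.≤-<-trans j≤i i<n)) (λ j j≤i → coeff-< r j (ℕ.≤-<-trans j≤i i<n)))
      (≡.sym (coeff-* f′ g′ i)))

  q*-cong-[] : ∀ {n f g} → f ≈[ n ] g → q * f ≈[ suc n ] q * g
  q*-cong-[] {n} {f} {g} p = below lemma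
    where
    lemma : ∀ i → i ℕ.< suc n → coeff (q * f) i ≡ coeff (q * g) i
    lemma zero    _         = ≡.trans (coeff-q*-zero f) (≡.sym (coeff-q*-zero g))
    lemma (suc i) (s≤s i<n) = ≡.trans (coeff-q*-suc f i) (≡.trans (coeff-< p i i<n) (≡.sym (coeff-q*-suc g i)))

  q^*-cong-[] : ∀ k {n f g} → f ≈[ n ] g → q ^ k * f ≈[ k ℕ.+ n ] q ^ k * g
  q^*-cong-[] zero    {n} {f} {g} p = ≈[]-resp (*-identityˡ f) (*-identityˡ g) p
  q^*-cong-[] (suc k) {n} {f} {g} p = ≈[]-resp (*-assoc q (q ^ k) f) (*-assoc q (q ^ k) g) (q*-cong-[] (q^*-cong-[] k p))

  q^*≈[]0 : ∀ {k n} f → n ℕ.≤ k → q ^ k * f ≈[ n ] 0#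
  q^*≈[]0 {k} f n≤k = ≈[]-mono (ℕ.≤-trans n≤k (ℕ.m≤m+n k 0))
    (≈[]-trans (q^*-cong-[] k {0} {f} {0#} ≈[]-zero) (≈⇒≈[] (zeroʳ (q ^ k))))

  q*-cancel : ∀ {f g} → q * f ≈ q * g → f ≈ g
  q*-cancel {f} {g} p = coeffwise λ n → ≡.trans (≡.sym (coeff-q*-suc f n)) (≡.trans (coeff-≡ p (suc n)) (coeff-q*-suc g n))

  uncons : ∀ f → f ≈ const (coeff f 0) + q * tail f
  uncons f = coeffwise λ n → ≡.sym (≡.trans (coeff-+ _ _ n) (lemma n))
    where
    lemma : ∀ n → coeff (const (coeff f 0)) n ℤ.+ coeff (q * tail f) n ≡ coeff f n
    lemma zero    = ≡.trans (cong₂ ℤ._+_ (coeff-const-zero _) (coeff-q*-zero _)) (ℤ.+-identityʳ _)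
    lemma (suc n) = ≡.trans (cong₂ ℤ._+_ (coeff-const-suc (coeff f 0) n) (≡.trans (coeff-q*-suc _ n) (coeff-tail f n))) (ℤ.+-identityˡ _)

  tail-cong-[] : ∀ {n f g} → f ≈[ suc n ] g → tail f ≈[ n ] tail g
  tail-cong-[] {n} {f} {g} p = below λ i i<n → ≡.trans (coeff-tail f i) (≡.trans (coeff-< p (suc i) (s≤s i<n)) (≡.sym (coeff-tail g i)))

  tail-unique : ∀ {f} c g → f ≈ const c + q * g → tail f ≈ g
  tail-unique {f} c g p = coeffwise λ n → ≡.trans (coeff-tail f n) (≡.trans (coeff-≡ p (suc n)) (≡.trans (coeff-+ _ _ (suc n))
    (≡.trans (cong₂ ℤ._+_ (coeff-const-suc c n) (coeff-q*-suc g n)) (ℤ.+-identityˡ _))))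

  head-unique : ∀ {f} c g → f ≈ const c + q * g → coeff f 0 ≡ c
  head-unique {f} c g p = ≡.trans (coeff-≡ p 0) (≡.trans (coeff-+ _ _ 0)
    (≡.trans (cong₂ ℤ._+_ (coeff-const-zero c) (coeff-q*-zero g)) (ℤ.+-identityʳ c)))

  coeff₀-* : ∀ f g → coeff (f * g) 0 ≡ coeff f 0 ℤ.* coeff g 0
  coeff₀-* f g = coeff-* f g 0

  const-cong : ∀ {a b} → a ≡ b → const a ≈ const b
  const-cong ≡.refl = ≈-refl

  -- Substitutions q ↦ q p

  -- σ f = f(q p), for a power series p.
  record Substitution : Set where
    field
      σ        : PowerSeries → PowerSeries
      p        : PowerSeries
      σ-uncons : ∀ f → σ f ≈ const (coeff f 0) + q * (p * σ (tail f))

  module Subst (S : Substitution) where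
    open Substitution S public

    -- In `σ-uncons` the recursive occurrence of `σ` carries a factor `q`, so agreement modulo `qⁿ`
    -- one level down gives agreement modulo `qⁿ⁺¹`. The laws for constants, sums, scalar multiples
    -- and products below rest on the same induction.
    cong-[] : ∀ n {f g} → f ≈[ n ] g → σ f ≈[ n ] σ g
    cong-[] zero    h = ≈[]-zero
    cong-[] (suc n) {f} {g} h = ≈[]-resp (σ-uncons f) (σ-uncons g)
      (+-cong-[] (≈⇒≈[] (const-cong (coeff-< h 0 (s≤s z≤n)))) (q*-cong-[] (*-cong-[] ≈[]-refl (cong-[] n (tail-cong-[] h)))))

    σ-cong : ∀ {f g} → f ≈ g → σ f ≈ σ g
    σ-cong h = ≈[]⇒≈ λ n → cong-[] n (≈⇒≈[] h)

    σ-cons : ∀ c g → σ (const c + q * g) ≈ const c + q * (p * σ g)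
    σ-cons c g = ≈-trans (σ-uncons _) (+-cong (const-cong (head-unique c g ≈-refl))
      (*-congˡ (*-congˡ (σ-cong (tail-unique c g ≈-refl)))))

    private
      by-uncons : ∀ {f} c g → f ≈ const c + q * g → σ f ≈ const c + q * (p * σ g)
      by-uncons c g h = ≈-trans (σ-cong h) (σ-cons c g)

    σ-const : ∀ c → σ (const c) ≈ const c
    σ-const c = ≈[]⇒≈ (go c)
      where
      go : ∀ c n → σ (const c) ≈[ n ] const c
      go c zero    = ≈[]-zero
      go c (suc n) = ≈[]-resp
        (by-uncons c 0# (solve 2 (λ c q → c := c :+ q :* con 0ℤ) ≈-refl (const c) q))
        (solve 3 (λ c q p → c := c :+ q :* (p :* con 0ℤ)) ≈-refl (const c) q p)
        (+-cong-[] ≈[]-refl (q*-cong-[] (*-cong-[] ≈[]-refl (go 0ℤ n))))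

    σ-+ : ∀ f g → σ (f + g) ≈ σ f + σ g
    σ-+ f g = ≈[]⇒≈ λ n → go n f g
      where
      go : ∀ n f g → σ (f + g) ≈[ n ] σ f + σ g
      go zero    f g = ≈[]-zero
      go (suc n) f g = ≈[]-resp
        (by-uncons (a ℤ.+ b) (tail f + tail g) (begin
          f + g
            ≈⟨ +-cong (uncons f) (uncons g) ⟩
          (const a + q * tail f) + (const b + q * tail g)
            ≈⟨ solve 5 (λ a b q x y → (a :+ q :* x) :+ (b :+ q :* y) := (a :+ b) :+ q :* (x :+ y)) ≈-refl (const a) (const b) q (tail f) (tail g) ⟩
          (const a + const b) + q * (tail f + tail g)
            ≈⟨ +-congʳ (const-+ a b) ⟨
          const (a ℤ.+ b) + q * (tail f + tail g) ∎))
        (begin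
          σ f + σ g
            ≈⟨ +-cong (σ-uncons f) (σ-uncons g) ⟩
          (const a + q * (p * σ (tail f))) + (const b + q * (p * σ (tail g)))
            ≈⟨ solve 6 (λ a b q p x y → (a :+ q :* (p :* x)) :+ (b :+ q :* (p :* y)) := (a :+ b) :+ q :* (p :* (x :+ y))) ≈-refl
               (const a) (const b) q p (σ (tail f)) (σ (tail g)) ⟩
          (const a + const b) + q * (p * (σ (tail f) + σ (tail g)))
            ≈⟨ +-congʳ (const-+ a b) ⟨
          const (a ℤ.+ b) + q * (p * (σ (tail f) + σ (tail g))) ∎)
        (+-cong-[] ≈[]-refl (q*-cong-[] (*-cong-[] ≈[]-refl (go n (tail f) (tail g)))))
        where
        a = coeff f 0
        b = coeff g 0

    σ-q* : ∀ f → σ (q * f) ≈ q * (p * σ f)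
    σ-q* f = ≈-trans
      (by-uncons 0ℤ f (solve 1 (λ x → x := con 0ℤ :+ x) ≈-refl (q * f)))
      (solve 1 (λ x → con 0ℤ :+ x := x) ≈-refl (q * (p * σ f)))

    σ-const* : ∀ c f → σ (const c * f) ≈ const c * σ f
    σ-const* c f = ≈[]⇒≈ λ n → go n f
      where
      go : ∀ n f → σ (const c * f) ≈[ n ] const c * σ f
      go zero    f = ≈[]-zero
      go (suc n) f = ≈[]-resp
        (by-uncons (c ℤ.* a) (const c * tail f) (begin
          const c * f
            ≈⟨ *-congˡ (uncons f) ⟩
          const c * (const a + q * tail f)
            ≈⟨ solve 4 (λ c a q x → c :* (a :+ q :* x) := c :* a :+ q :* (c :* x)) ≈-refl (const c) (const a) q (tail f) ⟩
          const c * const a + q * (const c * tail f)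
            ≈⟨ +-congʳ (const-* c a) ⟨
          const (c ℤ.* a) + q * (const c * tail f) ∎))
        (begin
          const c * σ f
            ≈⟨ *-congˡ (σ-uncons f) ⟩
          const c * (const a + q * (p * σ (tail f)))
            ≈⟨ solve 5 (λ c a q p x → c :* (a :+ q :* (p :* x)) := c :* a :+ q :* (p :* (c :* x))) ≈-refl (const c) (const a) q p (σ (tail f)) ⟩
          const c * const a + q * (p * (const c * σ (tail f)))
            ≈⟨ +-congʳ (const-* c a) ⟨
          const (c ℤ.* a) + q * (p * (const c * σ (tail f))) ∎)
        (+-cong-[] ≈[]-refl (q*-cong-[] (*-cong-[] ≈[]-refl (go n (tail f)))))
        where
        a = coeff f 0

    -- Peeling only `f` leaves a scalar multiple of `g` plus `q` times a shorter product, so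
    -- additivity and compatibility with scalars suffice before the recursive call.
    σ-* : ∀ f g → σ (f * g) ≈ σ f * σ g
    σ-* f g = ≈[]⇒≈ λ n → go n f g
      where
      go : ∀ n f g → σ (f * g) ≈[ n ] σ f * σ g
      go zero    f g = ≈[]-zero
      go (suc n) f g = ≈[]-resp
        (begin
          σ (f * g)
            ≈⟨ σ-cong (≈-trans (*-congʳ (uncons f))
                 (solve 4 (λ a q x g → (a :+ q :* x) :* g := a :* g :+ q :* (x :* g)) ≈-refl (const a) q (tail f) g)) ⟩
          σ (const a * g + q * (tail f * g))
            ≈⟨ ≈-trans (σ-+ _ _) (+-cong (σ-const* a g) (σ-q* _)) ⟩
          const a * σ g + q * (p * σ (tail f * g)) ∎)
        (≈-trans (*-congʳ (σ-uncons f))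
          (solve 5 (λ a q p x g → (a :+ q :* (p :* x)) :* g := a :* g :+ q :* (p :* (x :* g))) ≈-refl (const a) q p (σ (tail f)) (σ g)))
        (+-cong-[] ≈[]-refl (q*-cong-[] (*-cong-[] ≈[]-refl (go n (tail f) g))))
        where
        a = coeff f 0

    σ-neg : ∀ f → σ (- f) ≈ - σ f
    σ-neg f = begin
      σ (- f)              ≈⟨ σ-cong (solve 1 (λ x → :- x := con (ℤ.- 1ℤ) :* x) ≈-refl f) ⟩
      σ (const _ * f)      ≈⟨ σ-const* _ f ⟩
      const (ℤ.- 1ℤ) * σ f ≈⟨ solve 1 (λ x → con (ℤ.- 1ℤ) :* x := :- x) ≈-refl (σ f) ⟩
      - σ f                ∎

    σ-q : σ q ≈ q * p
    σ-q = begin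
      σ q              ≈⟨ σ-cong (solve 1 (λ x → x := x :* con 1ℤ) ≈-refl q) ⟩
      σ (q * 1#)       ≈⟨ σ-q* 1# ⟩
      q * (p * σ 1#)   ≈⟨ *-congˡ (*-congˡ (σ-const 1ℤ)) ⟩
      q * (p * 1#)     ≈⟨ solve 2 (λ x p → x :* (p :* con 1ℤ) := x :* p) ≈-refl q p ⟩
      q * p            ∎

    σ-^ : ∀ f n → σ (f ^ n) ≈ σ f ^ n
    σ-^ f zero    = σ-const 1ℤ
    σ-^ f (suc n) = ≈-trans (σ-* f (f ^ n)) (*-congˡ (σ-^ f n))

    -- Pushes a substitution through a whole expression at once, the expression being given as a
    -- polynomial of the ring solver.
    σ-eval : ∀ {n} (e : Polynomial n) (ρ : Vec PowerSeries n) → σ (⟦ e ⟧ ρ) ≈ ⟦ e ⟧ (map σ ρ)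
    σ-eval (op [+] a b) ρ = ≈-trans (σ-+ _ _) (+-cong (σ-eval a ρ) (σ-eval b ρ))
    σ-eval (op [*] a b) ρ = ≈-trans (σ-* _ _) (*-cong (σ-eval a ρ) (σ-eval b ρ))
    σ-eval (con c)      ρ = σ-const c
    σ-eval (var x)      ρ rewrite Vec.lookup-map x σ ρ = ≈-refl
    σ-eval (a :^ n)     ρ = ≈-trans (σ-^ _ n) (^-cong′ n (σ-eval a ρ))
      where
      ^-cong′ : ∀ n {f g} → f ≈ g → f ^ n ≈ g ^ n
      ^-cong′ zero    h = ≈-refl
      ^-cong′ (suc n) h = *-cong h (^-cong′ n h)
    σ-eval (:- a)       ρ = ≈-trans (σ-neg _) (-‿cong (σ-eval a ρ))

  -- A substitution is determined by the image of `q`. Equations between composites of dilations and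
  -- sign changes thus reduce to equations between signed powers of `q`.
  σ-unique : (S T : Substitution) → Substitution.p S ≈ Substitution.p T → ∀ f → Substitution.σ S f ≈ Substitution.σ T f
  σ-unique S T p≈p f = ≈[]⇒≈ λ n → go n f
    where
    module S = Substitution S
    module T = Substitution T
    go : ∀ n f → S.σ f ≈[ n ] T.σ f
    go zero    f = ≈[]-zero
    go (suc n) f = ≈[]-resp (S.σ-uncons f) (T.σ-uncons f)
      (+-cong-[] ≈[]-refl (q*-cong-[] (*-cong-[] (≈⇒≈[] p≈p) (go n (tail f)))))

  infixr 9 _∘ₛ_

  _∘ₛ_ : Substitution → Substitution → Substitution
  S ∘ₛ T = record
    { σ = λ f → S.σ (T.σ f)
    -- S(T(q)) = S(q · T.p) = q · S.p · S(T.p).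
    ; p = S.p * S.σ T.p
    ; σ-uncons = λ f → begin
        S.σ (T.σ f)
          ≈⟨ S.σ-cong (T.σ-uncons f) ⟩
        S.σ (const (coeff f 0) + q * (T.p * T.σ (tail f)))
          ≈⟨ S.σ-cons (coeff f 0) _ ⟩
        const (coeff f 0) + q * (S.p * S.σ (T.p * T.σ (tail f)))
          ≈⟨ +-congˡ (*-congˡ (≈-trans (*-congˡ (S.σ-* _ _)) (≈-sym (*-assoc _ _ _)))) ⟩
        const (coeff f 0) + q * (S.p * S.σ T.p * S.σ (T.σ (tail f))) ∎
    }
    where
    module S = Subst S
    module T = Subst T

  identityₛ : Substitution
  identityₛ = record
    { σ = λ f → f
    ; p = 1#
    ; σ-uncons = λ f → ≈-trans (uncons f) (+-congˡ (*-congˡ (≈-sym (*-identityˡ _))))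
    }

  -- dilate k r f is q^r f(q^(k+1)); so dil 1, dil 3 and dil 4 below are q ↦ q², q⁴, q⁵.
  dilate : ℕ → ℕ → Series → Series
  dilate k zero    f zero    = f 0
  dilate k (suc r) f zero    = 0ℤ
  dilate k zero    f (suc n) = dilate k k (tl f) n
  dilate k (suc r) f (suc n) = dilate k r f n

  alternate : Series → Series
  alternate f zero    = f 0
  alternate f (suc n) = ℤ.- alternate (tl f) n

  opaque
    dil : ℕ → PowerSeries → PowerSeries
    dil k f = series (dilate k 0 (coeff f))

    sgn : PowerSeries → PowerSeries
    sgn f = series (alternate (coeff f))

  opaque
    unfolding dil sgn tail

    coeff-dil : ∀ k f n → coeff (dil k f) n ≡ dilate k 0 (coeff f) n
    coeff-dil k f n = ≡.refl

    coeff-tail-dil : ∀ k f n → coeff (tail (dil k f)) n ≡ dilate k k (coeff (tail f)) n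
    coeff-tail-dil k f n = ≡.refl

    coeff-sgn-zero : ∀ f → coeff (sgn f) 0 ≡ coeff f 0
    coeff-sgn-zero f = ≡.refl

    coeff-tail-sgn : ∀ f n → coeff (tail (sgn f)) n ≡ ℤ.- coeff (sgn (tail f)) n
    coeff-tail-sgn f n = ≡.refl

  dilate-shift : ∀ k r f n → coeff (q ^ r * dil k f) n ≡ dilate k r (coeff f) n
  dilate-shift k zero    f n       = ≡.trans (coeff-≡ (*-identityˡ (dil k f)) n) (coeff-dil k f n)
  dilate-shift k (suc r) f zero    = ≡.trans (coeff-≡ (*-assoc q (q ^ r) (dil k f)) 0) (coeff-q*-zero (q ^ r * dil k f))
  dilate-shift k (suc r) f (suc n) = ≡.trans (coeff-≡ (*-assoc q (q ^ r) (dil k f)) (suc n))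
    (≡.trans (coeff-q*-suc (q ^ r * dil k f) n) (dilate-shift k r f n))

  dil-uncons : ∀ k f → dil k f ≈ const (coeff f 0) + q * (q ^ k * dil k (tail f))
  dil-uncons k f = ≈-trans (uncons (dil k f)) (+-cong (const-cong (coeff-dil k f 0)) (*-cong ≈-refl
    (coeffwise λ n → ≡.trans (coeff-tail-dil k f n) (≡.sym (dilate-shift k k (tail f) n)))))

  sgn-uncons : ∀ f → sgn f ≈ const (coeff f 0) + q * (- 1# * sgn (tail f))
  sgn-uncons f = ≈-trans (uncons (sgn f)) (+-cong (const-cong (coeff-sgn-zero f)) (*-congˡ (≈-trans
    (coeffwise λ n → ≡.trans (coeff-tail-sgn f n) (≡.sym (coeff-neg (sgn (tail f)) n)))
    (solve 1 (λ x → :- x := :- con 1ℤ :* x) ≈-refl (sgn (tail f))))))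

  dilₛ : ℕ → Substitution
  dilₛ k = record { σ = dil k ; p = q ^ k ; σ-uncons = dil-uncons k }

  sgnₛ : Substitution
  sgnₛ = record { σ = sgn ; p = - 1# ; σ-uncons = sgn-uncons }

  -- q-adic limits and inverses

  module lim (A : ℕ → PowerSeries) (cauchy : ∀ n → A (suc n) ≈[ n ] A n) where

    limit : PowerSeries
    -- `A n` is final only below index `n`, so coefficient `n` is read off from `A (suc n)`.
    limit = series λ n → coeff (A (suc n)) n

    A-≈[] : ∀ {n} m → n ℕ.≤ m → A m ≈[ n ] A n
    A-≈[] {n} m n≤m with ℕ.m≤n⇒m<n∨m≡n n≤m
    ... | inj₂ ≡.refl = ≈[]-refl
    A-≈[] {n} (suc m) _ | inj₁ (s≤s n≤m) = ≈[]-trans (≈[]-mono n≤m (cauchy m)) (A-≈[] m n≤m)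

    limit-≈[] : ∀ {n} m → n ℕ.≤ m → limit ≈[ n ] A m
    limit-≈[] m n≤m = below λ i i<n → ≡.sym (coeff-< (A-≈[] m (ℕ.≤-trans i<n n≤m)) i ℕ.≤-refl)

    limit-unique : ∀ {f} → (∀ n → f ≈[ n ] A n) → f ≈ limit
    limit-unique h = ≈[]⇒≈ λ n → ≈[]-trans (h n) (≈[]-sym (limit-≈[] n ℕ.≤-refl))

  module _ (f : PowerSeries) where
    private
      -- Iterates the fixed-point equation i = 1 - q · tail f · i of the inverse; the factor `q`
      -- settles one more coefficient at each step.
      approx : ℕ → PowerSeries
      approx zero    = 0#
      approx (suc n) = 1# - q * (tail f * approx n)

      approx-cauchy : ∀ n → approx (suc n) ≈[ n ] approx n
      approx-cauchy zero    = ≈[]-zero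
      approx-cauchy (suc n) = +-cong-[] ≈[]-refl (neg-cong-[] (q*-cong-[] (*-cong-[] ≈[]-refl (approx-cauchy n))))

      module Approx = lim approx approx-cauchy

    -- The inverse of 1 + q tail f, so of f when f has constant term 1.
    inv : PowerSeries
    inv = Approx.limit

    *-inv : coeff f 0 ≡ 1ℤ → f * inv ≈ 1#
    *-inv f₀≡1 = begin
      f * inv
        ≈⟨ *-congʳ (≈-trans (uncons f) (+-congʳ (const-cong f₀≡1))) ⟩
      (1# + q * tail f) * inv
        ≈⟨ solve 3 (λ q t i → (con 1ℤ :+ q :* t) :* i := i :+ q :* (t :* i)) ≈-refl q (tail f) inv ⟩
      inv + q * (tail f * inv)
        ≈⟨ +-congʳ fixed ⟩
      1# - q * (tail f * inv) + q * (tail f * inv)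
        ≈⟨ solve 1 (λ x → con 1ℤ :- x :+ x := con 1ℤ) ≈-refl _ ⟩
      1# ∎
      where
      fixed : inv ≈ 1# - q * (tail f * inv)
      fixed = ≈[]⇒≈ λ { zero → ≈[]-zero ; (suc n) → ≈[]-trans (Approx.limit-≈[] (suc n) ℕ.≤-refl)
        (+-cong-[] ≈[]-refl (neg-cong-[] (q*-cong-[] (*-cong-[] ≈[]-refl (≈[]-sym (Approx.limit-≈[] n ℕ.≤-refl)))))) }

  -- Dissections mod 5 and theta series

  q² q³ q⁴ : PowerSeries
  q² = q * q
  q³ = q * q²
  q⁴ = q * q³

  d : PowerSeries → PowerSeries
  d = dil 4

  module D = Subst (dilₛ 4)

  d-q : d q ≈ q * q⁴
  d-q = ≈-trans D.σ-q (solve 1 (λ q → q :* q :^ 4 := q :* (q :* (q :* (q :* q)))) ≈-refl q)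

  -- The five sequences rotate at each index, and the one just used re-enters without its head. By
  -- `dis-uncons` a dissection obeys the same recursion.
  interleave : Series → Series → Series → Series → Series → Series
  interleave a₀ a₁ a₂ a₃ a₄ zero    = a₀ 0
  interleave a₀ a₁ a₂ a₃ a₄ (suc n) = interleave a₁ a₂ a₃ a₄ (tl a₀) n

  dis : PowerSeries → PowerSeries → PowerSeries → PowerSeries → PowerSeries → PowerSeries
  dis a₀ a₁ a₂ a₃ a₄ = d a₀ + q * d a₁ + q² * d a₂ + q³ * d a₃ + q⁴ * d a₄

  dis-cong : ∀ {a₀ a₁ a₂ a₃ a₄ b₀ b₁ b₂ b₃ b₄} → a₀ ≈ b₀ → a₁ ≈ b₁ → a₂ ≈ b₂ → a₃ ≈ b₃ → a₄ ≈ b₄ →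
             dis a₀ a₁ a₂ a₃ a₄ ≈ dis b₀ b₁ b₂ b₃ b₄
  dis-cong e₀ e₁ e₂ e₃ e₄ = +-cong (+-cong (+-cong (+-cong (D.σ-cong e₀) (*-congˡ (D.σ-cong e₁)))
    (*-congˡ (D.σ-cong e₂))) (*-congˡ (D.σ-cong e₃))) (*-congˡ (D.σ-cong e₄))

  dis-uncons : ∀ a₀ a₁ a₂ a₃ a₄ → dis a₀ a₁ a₂ a₃ a₄ ≈ const (coeff a₀ 0) + q * dis a₁ a₂ a₃ a₄ (tail a₀)
  dis-uncons a₀ a₁ a₂ a₃ a₄ = ≈-trans
    (+-congʳ (+-congʳ (+-congʳ (+-congʳ (dil-uncons 4 a₀)))))
    (solve 7 (λ c q x₁ x₂ x₃ x₄ t →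
        (c :+ q :* (q :^ 4 :* t)) :+ q :* x₁ :+ (q :* q) :* x₂ :+ (q :* (q :* q)) :* x₃ :+ (q :* (q :* (q :* q))) :* x₄
        := c :+ q :* (x₁ :+ q :* x₂ :+ (q :* q) :* x₃ :+ (q :* (q :* q)) :* x₄ :+ (q :* (q :* (q :* q))) :* t))
      ≈-refl (const (coeff a₀ 0)) q (d a₁) (d a₂) (d a₃) (d a₄) (d (tail a₀)))

  opaque
    unfolding tail

    coeff-tail-≡ : ∀ f → coeff (tail f) ≡ tl (coeff f)
    coeff-tail-≡ f = ≡.refl

  coeff-dis : ∀ a₀ a₁ a₂ a₃ a₄ n → coeff (dis a₀ a₁ a₂ a₃ a₄) n ≡ interleave (coeff a₀) (coeff a₁) (coeff a₂) (coeff a₃) (coeff a₄) n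
  coeff-dis a₀ a₁ a₂ a₃ a₄ zero    = head-unique _ _ (dis-uncons a₀ a₁ a₂ a₃ a₄)
  coeff-dis a₀ a₁ a₂ a₃ a₄ (suc n) = ≡.trans (≡.sym (coeff-tail _ n))
    (≡.trans (coeff-≡ (tail-unique _ _ (dis-uncons a₀ a₁ a₂ a₃ a₄)) n)
    (≡.trans (coeff-dis a₁ a₂ a₃ a₄ (tail a₀) n)
      (cong (λ t → interleave (coeff a₁) (coeff a₂) (coeff a₃) (coeff a₄) t n) (coeff-tail-≡ a₀))))

  comp : ℕ → PowerSeries → PowerSeries
  comp i f = series λ n → coeff f (i ℕ.+ n ℕ.* 5)

  comp-cong : ∀ i {f g} → f ≈ g → comp i f ≈ comp i g
  comp-cong i h = coeffwise λ n → coeff-≡ h (i ℕ.+ n ℕ.* 5)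

  interleave-comp : ∀ f n → interleave (λ k → f (k ℕ.* 5)) (λ k → f (1 ℕ.+ k ℕ.* 5)) (λ k → f (2 ℕ.+ k ℕ.* 5))
    (λ k → f (3 ℕ.+ k ℕ.* 5)) (λ k → f (4 ℕ.+ k ℕ.* 5)) n ≡ f n
  interleave-comp f zero    = ≡.refl
  interleave-comp f (suc n) = interleave-comp (tl f) n

  dissect : ∀ f → f ≈ dis (comp 0 f) (comp 1 f) (comp 2 f) (comp 3 f) (comp 4 f)
  dissect f = coeffwise λ n → ≡.sym (≡.trans (coeff-dis _ _ _ _ _ n) (interleave-comp (coeff f) n))

  interleave₀ : ∀ a₀ a₁ a₂ a₃ a₄ n → interleave a₀ a₁ a₂ a₃ a₄ (n ℕ.* 5) ≡ a₀ n
  interleave₀ a₀ a₁ a₂ a₃ a₄ zero    = ≡.refl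
  interleave₀ a₀ a₁ a₂ a₃ a₄ (suc n) = interleave₀ (tl a₀) (tl a₁) (tl a₂) (tl a₃) (tl a₄) n

  module _ {a₀ a₁ a₂ a₃ a₄ : PowerSeries} where

    comp₀-dis : comp 0 (dis a₀ a₁ a₂ a₃ a₄) ≈ a₀
    comp₀-dis = coeffwise λ n → ≡.trans (coeff-dis _ _ _ _ _ (n ℕ.* 5)) (interleave₀ _ _ _ _ _ n)

    comp₁-dis : comp 1 (dis a₀ a₁ a₂ a₃ a₄) ≈ a₁
    comp₁-dis = coeffwise λ n → ≡.trans (coeff-dis _ _ _ _ _ (1 ℕ.+ n ℕ.* 5)) (interleave₀ _ _ _ _ _ n)

    comp₂-dis : comp 2 (dis a₀ a₁ a₂ a₃ a₄) ≈ a₂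
    comp₂-dis = coeffwise λ n → ≡.trans (coeff-dis _ _ _ _ _ (2 ℕ.+ n ℕ.* 5)) (interleave₀ _ _ _ _ _ n)

    comp₄-dis : comp 4 (dis a₀ a₁ a₂ a₃ a₄) ≈ a₄
    comp₄-dis = coeffwise λ n → ≡.trans (coeff-dis _ _ _ _ _ (4 ℕ.+ n ℕ.* 5)) (interleave₀ _ _ _ _ _ n)

  -- Sparse series with prescribed exponents and signs

  alt : ℕ → ℤ
  alt zero    = 1ℤ
  alt (suc n) = ℤ.- alt n

  thetaTo : (ℕ → ℕ) → (ℕ → ℤ) → ℕ → PowerSeries
  thetaTo e s zero    = 0#
  thetaTo e s (suc n) = thetaTo e s n + const (s n) * q ^ e n

  -- Makes the n-th partial sum exact modulo `qⁿ`, so that such series can be compared through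
  -- partial sums of equal length.
  Dominates : (ℕ → ℕ) → Set
  Dominates e = ∀ k → k ℕ.≤ e k

  module _ (e : ℕ → ℕ) (s : ℕ → ℤ) (k≤e : Dominates e) where
    private
      cauchy : ∀ n → thetaTo e s (suc n) ≈[ n ] thetaTo e s n
      cauchy n = ≈[]-trans
        (+-cong-[] ≈[]-refl (≈[]-resp (*-comm (const (s n)) (q ^ e n)) ≈-refl (q^*≈[]0 (const (s n)) (k≤e n))))
        (≈⇒≈[] (+-identityʳ _))

      module Θ = lim (thetaTo e s) cauchy

    opaque
      theta : PowerSeries
      theta = Θ.limit

      theta-≈[] : ∀ {n} m → n ℕ.≤ m → theta ≈[ n ] thetaTo e s m
      theta-≈[] = Θ.limit-≈[]

      theta-unique : ∀ {f} → (∀ n → f ≈[ n ] thetaTo e s n) → f ≈ theta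
      theta-unique = Θ.limit-unique

  theta-cong : ∀ {e e′ s s′ k≤e k≤e′} → (∀ n → e n ≡ e′ n) → (∀ n → s n ≡ s′ n) → theta e s k≤e ≈ theta e′ s′ k≤e′
  theta-cong {e} {e′} {s} {s′} {k≤e} {k≤e′} p r = theta-unique e′ s′ k≤e′ λ n →
    ≈[]-trans (theta-≈[] e s k≤e n ℕ.≤-refl) (≈⇒≈[] (go n))
    where
    go : ∀ n → thetaTo e s n ≈ thetaTo e′ s′ n
    go zero    = ≈-refl
    go (suc n) rewrite p n | r n = +-congʳ (go n)

  theta-scale : ∀ {e s s′ k≤e} a → (∀ n → s n ≡ a ℤ.* s′ n) → theta e s k≤e ≈ const a * theta e s′ k≤e
  theta-scale {e} {s} {s′} {k≤e} a r = ≈[]⇒≈ λ n → ≈[]-trans (theta-≈[] e s k≤e n ℕ.≤-refl)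
    (≈[]-trans (≈⇒≈[] (go n)) (*-cong-[] ≈[]-refl (≈[]-sym (theta-≈[] e s′ k≤e n ℕ.≤-refl))))
    where
    go : ∀ n → thetaTo e s n ≈ const a * thetaTo e s′ n
    go zero    = ≈-sym (zeroʳ _)
    go (suc n) = ≈-trans (+-cong (go n) (*-congʳ (≈-trans (const-cong (r n)) (const-* a (s′ n)))))
      (solve 4 (λ a x b y → a :* x :+ a :* b :* y := a :* (x :+ b :* y)) ≈-refl (const a) (thetaTo e s′ n) (const (s′ n)) (q ^ e n))

  theta-dil : ∀ {e g s k≤e k≤g} c k → (∀ n → e n ≡ c ℕ.+ suc k ℕ.* g n) → theta e s k≤e ≈ q ^ c * dil k (theta g s k≤g)
  theta-dil {e} {g} {s} {k≤e} {k≤g} c k p = ≈[]⇒≈ λ n → ≈[]-trans (theta-≈[] e s k≤e n ℕ.≤-refl)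
    (≈[]-trans (≈⇒≈[] (go n)) (*-cong-[] ≈[]-refl (K.cong-[] n (≈[]-sym (theta-≈[] g s k≤g n ℕ.≤-refl)))))
    where
    module K = Subst (dilₛ k)
    term : ∀ n → dil k (const (s n) * q ^ g n) ≈ const (s n) * q ^ (suc k ℕ.* g n)
    term n = begin
      dil k (const (s n) * q ^ g n)         ≈⟨ K.σ-const* (s n) _ ⟩
      const (s n) * dil k (q ^ g n)         ≈⟨ *-congˡ (≈-trans (K.σ-^ q (g n)) (^-cong K.σ-q (≡.refl {x = g n}))) ⟩
      const (s n) * (q ^ suc k) ^ g n       ≈⟨ *-congˡ (^-assocʳ q (suc k) (g n)) ⟩
      const (s n) * q ^ (suc k ℕ.* g n)     ∎
    go : ∀ n → thetaTo e s n ≈ q ^ c * dil k (thetaTo g s n)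
    go zero    = ≈-sym (≈-trans (*-congˡ (K.σ-const 0ℤ)) (zeroʳ _))
    go (suc n) = begin
      thetaTo e s n + const (s n) * q ^ e n
        ≈⟨ +-cong (go n) (*-congˡ (≈-trans (^-cong (≈-refl {q}) (p n)) (^-homo-* q c (suc k ℕ.* g n)))) ⟩
      q ^ c * dil k (thetaTo g s n) + const (s n) * (q ^ c * q ^ (suc k ℕ.* g n))
        ≈⟨ solve 4 (λ x t a y → x :* t :+ a :* (x :* y) := x :* (t :+ a :* y)) ≈-refl
             (q ^ c) (dil k (thetaTo g s n)) (const (s n)) (q ^ (suc k ℕ.* g n)) ⟩
      q ^ c * (dil k (thetaTo g s n) + const (s n) * q ^ (suc k ℕ.* g n))
        ≈⟨ *-congˡ (≈-trans (K.σ-+ _ _) (+-congˡ (term n))) ⟨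
      q ^ c * dil k (thetaTo g s n + const (s n) * q ^ g n) ∎

  k≤r+k*m : ∀ r m .{{_ : ℕ.NonZero m}} → Dominates (λ k → r ℕ.+ k ℕ.* m)
  k≤r+k*m r m k = ℕ.≤-trans (ℕ.m≤m*n k m) (ℕ.m≤n+m (k ℕ.* m) r)

  module _ (e : ℕ → ℕ) (s : ℕ → ℤ) (k≤e : Dominates e) where

    residue : ∀ r m .{{_ : ℕ.NonZero m}} → PowerSeries
    residue r m = theta (λ k → e (r ℕ.+ k ℕ.* m)) (λ k → s (r ℕ.+ k ℕ.* m)) (λ k → ℕ.≤-trans (k≤r+k*m r m k) (k≤e _))

    private
      to : ∀ r m .{{_ : ℕ.NonZero m}} → ℕ → PowerSeries
      to r m = thetaTo (λ k → e (r ℕ.+ k ℕ.* m)) (λ k → s (r ℕ.+ k ℕ.* m))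

      residue-≈[] : ∀ r m .{{_ : ℕ.NonZero m}} n → to r m n ≈[ n ] residue r m
      residue-≈[] r m n = ≈[]-sym (theta-≈[] _ _ (λ k → ℕ.≤-trans (k≤r+k*m r m k) (k≤e _)) n ℕ.≤-refl)

    theta-split₂ : theta e s k≤e ≈ residue 0 2 + residue 1 2
    theta-split₂ = ≈[]⇒≈ λ n → ≈[]-trans (theta-≈[] e s k≤e (n ℕ.* 2) (ℕ.m≤m*n n 2))
      (≈[]-trans (≈⇒≈[] (go n)) (+-cong-[] (residue-≈[] 0 2 n) (residue-≈[] 1 2 n)))
      where
      go : ∀ n → thetaTo e s (n ℕ.* 2) ≈ to 0 2 n + to 1 2 n
      go zero    = ≈-sym (+-identityˡ _)
      go (suc n) = ≈-trans (+-congʳ (+-congʳ (go n)))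
        (solve 4 (λ x y u v → x :+ y :+ u :+ v := (x :+ u) :+ (y :+ v)) ≈-refl _ _ _ _)

    theta-split₅ : theta e s k≤e ≈ residue 0 5 + residue 1 5 + residue 2 5 + residue 3 5 + residue 4 5
    theta-split₅ = ≈[]⇒≈ λ n → ≈[]-trans (theta-≈[] e s k≤e (n ℕ.* 5) (ℕ.m≤m*n n 5))
      (≈[]-trans (≈⇒≈[] (go n)) (+-cong-[] (+-cong-[] (+-cong-[] (+-cong-[] (residue-≈[] 0 5 n) (residue-≈[] 1 5 n))
        (residue-≈[] 2 5 n)) (residue-≈[] 3 5 n)) (residue-≈[] 4 5 n)))
      where
      go : ∀ n → thetaTo e s (n ℕ.* 5) ≈ to 0 5 n + to 1 5 n + to 2 5 n + to 3 5 n + to 4 5 n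
      go zero    = solve 0 (con 0ℤ := con 0ℤ :+ con 0ℤ :+ con 0ℤ :+ con 0ℤ :+ con 0ℤ) ≈-refl
      go (suc n) = ≈-trans (+-congʳ (+-congʳ (+-congʳ (+-congʳ (+-congʳ (go n))))))
        (solve 10 (λ x₀ x₁ x₂ x₃ x₄ y₀ y₁ y₂ y₃ y₄ → x₀ :+ x₁ :+ x₂ :+ x₃ :+ x₄ :+ y₀ :+ y₁ :+ y₂ :+ y₃ :+ y₄
            := (x₀ :+ y₀) :+ (x₁ :+ y₁) :+ (x₂ :+ y₂) :+ (x₃ :+ y₃) :+ (x₄ :+ y₄)) ≈-refl _ _ _ _ _ _ _ _ _ _)

  -- The theorems of Euler and Gauss

  *-cancelˡ : ∀ {f x y} → coeff f 0 ≡ 1ℤ → f * x ≈ f * y → x ≈ y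
  *-cancelˡ {f} {x} {y} f₀≡1 h = begin
    x             ≈⟨ *-identityˡ x ⟨
    1# * x        ≈⟨ *-congʳ (*-inv f f₀≡1) ⟨
    f * inv f * x ≈⟨ solve 3 (λ f i x → f :* i :* x := f :* x :* i) ≈-refl f (inv f) x ⟩
    f * x * inv f ≈⟨ *-congʳ h ⟩
    f * y * inv f ≈⟨ solve 3 (λ f i x → f :* x :* i := f :* i :* x) ≈-refl f (inv f) y ⟩
    f * inv f * y ≈⟨ *-congʳ (*-inv f f₀≡1) ⟩
    1# * y        ≈⟨ *-identityˡ y ⟩
    y             ∎

  coeff₀-*-one : ∀ {f g} → coeff f 0 ≡ 1ℤ → coeff g 0 ≡ 1ℤ → coeff (f * g) 0 ≡ 1ℤ
  coeff₀-*-one {f} {g} p r = ≡.trans (coeff₀-* f g) (cong₂ ℤ._*_ p r)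

  -- Shanks' finite forms of the identities of Euler (ε = 0) and Gauss (ε = 1):
  -- P n G(qⁿ, n) is an explicit partial sum of a theta series, and it tends to lim P.
  module Shanks (ε : ℤ) where

    β γ P J F : ℕ → PowerSeries
    β n = 1# + const ε * q ^ n
    γ n = const ε + q ^ n

    P zero    = 1#
    P (suc n) = (1# - q ^ suc n) * P n * inv (β (suc n))

    J zero    = 1#
    J (suc n) = - (q * γ n) * J n * inv (1# - q ^ suc n)

    -- Truncation of G(y) = Σ Jⱼ yʲ. The recursion `J-suc` amounts to the q-difference equation (1 -
    -- q y) G(q y) = (1 + ε q y) G(y) for the full sum.
    G : PowerSeries → ℕ → PowerSeries
    G y zero    = 1#
    G y (suc n) = G y n + J (suc n) * y ^ suc n

    F n = P n * G (q ^ n) n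

    β₀ : ∀ n → coeff (β (suc n)) 0 ≡ 1ℤ
    β₀ n = head-unique 1ℤ (const ε * q ^ n)
      (solve 3 (λ e q u → con 1ℤ :+ e :* (q :* u) := con 1ℤ :+ q :* (e :* u)) ≈-refl (const ε) q (q ^ n))

    P-suc : ∀ n → β (suc n) * P (suc n) ≈ (1# - q ^ suc n) * P n
    P-suc n = begin
      β (suc n) * ((1# - q ^ suc n) * P n * inv (β (suc n)))
        ≈⟨ solve 3 (λ b x i → b :* (x :* i) := b :* i :* x) ≈-refl (β (suc n)) _ (inv (β (suc n))) ⟩
      β (suc n) * inv (β (suc n)) * ((1# - q ^ suc n) * P n)
        ≈⟨ *-congʳ (*-inv (β (suc n)) (β₀ n)) ⟩
      1# * ((1# - q ^ suc n) * P n)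
        ≈⟨ *-identityˡ _ ⟩
      (1# - q ^ suc n) * P n ∎

    J-suc : ∀ n → (1# - q ^ suc n) * J (suc n) ≈ - (q * γ n) * J n
    J-suc n = begin
      (1# - q ^ suc n) * (- (q * γ n) * J n * inv (1# - q ^ suc n))
        ≈⟨ solve 3 (λ b x i → b :* (x :* i) := b :* i :* x) ≈-refl (1# - q ^ suc n) _ (inv (1# - q ^ suc n)) ⟩
      (1# - q ^ suc n) * inv (1# - q ^ suc n) * (- (q * γ n) * J n)
        ≈⟨ *-congʳ (*-inv (1# - q ^ suc n) (head-unique 1ℤ (- q ^ n)
             (solve 2 (λ q u → con 1ℤ :- q :* u := con 1ℤ :+ q :* (:- u)) ≈-refl q (q ^ n)))) ⟩
      1# * (- (q * γ n) * J n)
        ≈⟨ *-identityˡ _ ⟩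
      - (q * γ n) * J n ∎

    -- The q-difference equation for the truncated sum: neighbouring terms cancel, and only a
    -- boundary term in `J n` survives.
    telescope : ∀ y n → (1# - q * y) * G (q * y) n ≈ (1# + const ε * (q * y)) * G y n - J n * y ^ n * (q * y) * γ n
    telescope y zero = solve 3 (λ e q y → (con 1ℤ :- q :* y) :* con 1ℤ
        := (con 1ℤ :+ e :* (q :* y)) :* con 1ℤ :- con 1ℤ :* con 1ℤ :* (q :* y) :* (e :+ con 1ℤ)) ≈-refl (const ε) q y
    telescope y (suc n) = begin
      (1# - q * y) * (G (q * y) n + J′ * (q * y) ^ suc n)
        ≈⟨ *-congˡ (+-congˡ (*-congˡ (^-distrib-* q y (suc n)))) ⟩
      (1# - q * y) * (G (q * y) n + J′ * (q * u * (y * Y)))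
        ≈⟨ solve 6 (λ q y u Y G J → (con 1ℤ :- q :* y) :* (G :+ J :* (q :* u :* (y :* Y)))
             := (con 1ℤ :- q :* y) :* G :+ (con 1ℤ :- q :* y) :* (J :* (q :* u :* (y :* Y)))) ≈-refl q y u Y (G (q * y) n) J′ ⟩
      (1# - q * y) * G (q * y) n + (1# - q * y) * (J′ * (q * u * (y * Y)))
        ≈⟨ +-congʳ (telescope y n) ⟩
      (1# + e * (q * y)) * G y n - J n * Y * (q * y) * (e + u) + (1# - q * y) * (J′ * (q * u * (y * Y)))
        ≈⟨ solve 8 (λ e q y u Y G J J′ → (con 1ℤ :+ e :* (q :* y)) :* G :- J :* Y :* (q :* y) :* (e :+ u) :+ (con 1ℤ :- q :* y) :* (J′ :* (q :* u :* (y :* Y)))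
             := (:- (q :* (e :+ u)) :* J) :* (y :* Y) :+ (con 1ℤ :+ e :* (q :* y)) :* G :+ (con 1ℤ :- q :* y) :* (J′ :* (q :* u :* (y :* Y))))
             ≈-refl e q y u Y (G y n) (J n) J′ ⟩
      - (q * (e + u)) * J n * (y * Y) + (1# + e * (q * y)) * G y n + (1# - q * y) * (J′ * (q * u * (y * Y)))
        ≈⟨ +-congʳ (+-congʳ (*-congʳ (J-suc n))) ⟨
      (1# - q * u) * J′ * (y * Y) + (1# + e * (q * y)) * G y n + (1# - q * y) * (J′ * (q * u * (y * Y)))
        ≈⟨ solve 7 (λ e q y u Y G J′ → (con 1ℤ :- q :* u) :* J′ :* (y :* Y) :+ (con 1ℤ :+ e :* (q :* y)) :* G :+ (con 1ℤ :- q :* y) :* (J′ :* (q :* u :* (y :* Y)))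
             := (con 1ℤ :+ e :* (q :* y)) :* (G :+ J′ :* (y :* Y)) :- J′ :* (y :* Y) :* (q :* y) :* (e :+ q :* u))
             ≈-refl e q y u Y (G y n) J′ ⟩
      (1# + e * (q * y)) * (G y n + J′ * (y * Y)) - J′ * (y * Y) * (q * y) * (e + q * u) ∎
      where
      e = const ε
      u = q ^ n
      Y = y ^ n
      J′ = J (suc n)

    -- Moving from y = qⁿ to y = qⁿ⁺¹ by the q-difference equation exchanges 1 - qⁿ⁺¹ for 1 + ε
    -- qⁿ⁺¹, which is exactly the factor by which `P (suc n)` differs from `P n`. What remains is
    -- the next term of a theta series.
    F-suc : ∀ n → F (suc n) ≈ F n + P (suc n) * J (suc n) * (q ^ n) ^ suc n * (1# + q ^ suc n)
    F-suc n = *-cancelˡ (β₀ n) (begin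
      β (suc n) * (P (suc n) * G x (suc n))
        ≈⟨ *-assoc _ _ _ ⟨
      β (suc n) * P (suc n) * G x (suc n)
        ≈⟨ *-congʳ (P-suc n) ⟩
      (1# - x) * P n * G x (suc n)
        ≈⟨ solve 3 (λ a b c → a :* b :* c := b :* (a :* c)) ≈-refl _ _ _ ⟩
      P n * ((1# - x) * G x (suc n))
        ≈⟨ *-congˡ (telescope u (suc n)) ⟩
      P n * ((1# + e * x) * (G u n + J′ * Y) - J′ * Y * x * (e + x))
        ≈⟨ solve 6 (λ e x P G J Y → P :* ((con 1ℤ :+ e :* x) :* (G :+ J :* Y) :- J :* Y :* x :* (e :+ x))
             := (con 1ℤ :+ e :* x) :* (P :* G) :+ (con 1ℤ :- x) :* P :* (J :* Y :* (con 1ℤ :+ x)))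
             ≈-refl e x (P n) (G u n) J′ Y ⟩
      β (suc n) * F n + (1# - x) * P n * (J′ * Y * (1# + x))
        ≈⟨ +-congˡ (*-congʳ (P-suc n)) ⟨
      β (suc n) * F n + β (suc n) * P (suc n) * (J′ * Y * (1# + x))
        ≈⟨ solve 6 (λ b F P J Y x → b :* F :+ b :* P :* (J :* Y :* (con 1ℤ :+ x)) := b :* (F :+ P :* J :* Y :* (con 1ℤ :+ x)))
             ≈-refl (β (suc n)) (F n) (P (suc n)) J′ Y x ⟩
      β (suc n) * (F n + P (suc n) * J′ * Y * (1# + x)) ∎)
      where
      e = const ε
      u = q ^ n
      x = q ^ suc n
      J′ = J (suc n)
      Y = u ^ suc n

    -- The factors 1 - qⁿ⁺¹ of `P` and `J` cancel. For ε = 0 this leaves a signed power of `q`; for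
    -- ε = 1 the product becomes twice a signed power of `q` after multiplication by 1 + qⁿ.
    PJ-suc : ∀ n → β (suc n) * (P (suc n) * J (suc n)) ≈ - (q * γ n) * (P n * J n)
    PJ-suc n = begin
      β (suc n) * (P (suc n) * J (suc n))   ≈⟨ *-assoc _ _ _ ⟨
      β (suc n) * P (suc n) * J (suc n)     ≈⟨ *-congʳ (P-suc n) ⟩
      (1# - q ^ suc n) * P n * J (suc n)    ≈⟨ solve 3 (λ a b c → a :* b :* c := b :* (a :* c)) ≈-refl _ _ _ ⟩
      P n * ((1# - q ^ suc n) * J (suc n))  ≈⟨ *-congˡ (J-suc n) ⟩
      P n * (- (q * γ n) * J n)             ≈⟨ solve 3 (λ a b c → b :* (a :* c) := a :* (b :* c)) ≈-refl _ _ _ ⟩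
      - (q * γ n) * (P n * J n)             ∎

    F≈[]P : ∀ n → F n ≈[ n ] P n
    F≈[]P n = ≈[]-trans (*-cong-[] ≈[]-refl (G≈[]1 n)) (≈⇒≈[] (≈-trans (*-comm _ _) (*-identityˡ _)))
      where
      G≈[]1 : ∀ m → G (q ^ n) m ≈[ n ] 1#
      G≈[]1 zero    = ≈[]-refl
      G≈[]1 (suc m) = ≈[]-trans (+-cong-[] (G≈[]1 m) (≈[]-resp
        (solve 3 (λ j x y → j :* (x :* y) := x :* (y :* j)) ≈-refl _ _ _) ≈-refl (q^*≈[]0 {n} ((q ^ n) ^ m * J (suc m)) ℕ.≤-refl)))
        (≈⇒≈[] (+-identityʳ _))

  eulerTo : ℕ → PowerSeries
  eulerTo zero    = 1#
  eulerTo (suc n) = eulerTo n * (1# - q ^ suc n)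

  private
    euler-cauchy : ∀ n → eulerTo (suc n) ≈[ n ] eulerTo n
    euler-cauchy n = ≈[]-trans (*-cong-[] ≈[]-refl (+-cong-[] ≈[]-refl (neg-cong-[]
        (≈[]-resp (≈-trans (≈-sym (*-identityˡ _)) (*-comm _ _)) ≈-refl (q^*≈[]0 {suc n} 1# (ℕ.n≤1+n n))))))
      (≈⇒≈[] (solve 1 (λ x → x :* (con 1ℤ :- con 0ℤ) := x) ≈-refl _))

  open lim eulerTo euler-cauchy public renaming (limit to E; limit-≈[] to E-≈[]; limit-unique to E-unique) using ()

  coeff-q^suc : ∀ n → coeff (q ^ suc n) 0 ≡ 0ℤ
  coeff-q^suc n = coeff-q*-zero _

  E₀ : coeff E 0 ≡ 1ℤ
  E₀ = ≡.trans (coeff-< (E-≈[] {1} 1 ℕ.≤-refl) 0 (s≤s z≤n)) (head-unique 1ℤ (- 1#)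
    (solve 1 (λ q → con 1ℤ :* (con 1ℤ :- q :* con 1ℤ) := con 1ℤ :+ q :* (:- con 1ℤ)) ≈-refl q))

  -- With m = n + 1, `sq` is m² and `pent₁`, `pent₂` are m(3m - 1)/2 and m(3m + 1)/2. Starting at m
  -- = 1 keeps the constant terms of the corresponding series outside the sums.
  tri sq pent₁ pent₂ : ℕ → ℕ
  tri zero    = 0
  tri (suc n) = suc n ℕ.+ tri n
  sq n    = suc n ℕ.* suc n
  pent₁ n = tri (suc n) ℕ.+ n ℕ.* suc n
  pent₂ n = pent₁ n ℕ.+ suc n

  tri-dom : Dominates tri
  tri-dom zero    = z≤n
  tri-dom (suc n) = ℕ.m≤m+n (suc n) (tri n)

  sq-dom : Dominates sq
  sq-dom n = ℕ.≤-trans (ℕ.n≤1+n n) (ℕ.m≤m*n (suc n) (suc n))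

  pent₁-dom : Dominates pent₁
  pent₁-dom n = ℕ.≤-trans (ℕ.≤-trans (ℕ.n≤1+n n) (tri-dom (suc n))) (ℕ.m≤m+n _ _)

  pent₂-dom : Dominates pent₂
  pent₂-dom n = ℕ.≤-trans (pent₁-dom n) (ℕ.m≤m+n _ _)

  sign one′ : ℕ → ℤ
  sign n = alt (suc n)
  one′ _ = 1ℤ

  φ φ₋ ψ : PowerSeries
  φ  = 1# + const (+ 2) * theta sq one′ sq-dom
  φ₋ = 1# + const (+ 2) * theta sq sign sq-dom
  ψ  = theta tri one′ tri-dom

  const-alt-suc : ∀ n → const (alt (suc n)) ≈ - const (alt n)
  const-alt-suc n = const-neg (alt n)

  pentagonal : E ≈ 1# + theta pent₁ sign pent₁-dom + theta pent₂ sign pent₂-dom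
  pentagonal = ≈[]⇒≈ λ n → ≈[]-trans (E-≈[] n ℕ.≤-refl) (≈[]-trans (≈⇒≈[] (≈-sym (P≈ n)))
    (≈[]-trans (≈[]-sym (F≈[]P n)) (≈[]-trans (≈⇒≈[] (F≈ n)) (+-cong-[] (+-cong-[] ≈[]-refl
      (≈[]-sym (theta-≈[] pent₁ sign pent₁-dom n ℕ.≤-refl))) (≈[]-sym (theta-≈[] pent₂ sign pent₂-dom n ℕ.≤-refl))))))
    where
    open Shanks 0ℤ
    P≈ : ∀ n → P n ≈ eulerTo n
    P≈ zero    = ≈-refl
    P≈ (suc n) = begin
      P (suc n)              ≈⟨ solve 2 (λ p x → p := (con 1ℤ :+ con 0ℤ :* x) :* p) ≈-refl (P (suc n)) (q ^ suc n) ⟩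
      β (suc n) * P (suc n)  ≈⟨ P-suc n ⟩
      (1# - q ^ suc n) * P n ≈⟨ *-comm _ _ ⟩
      P n * (1# - q ^ suc n) ≈⟨ *-congʳ (P≈ n) ⟩
      eulerTo (suc n)        ∎
    PJ : ∀ n → P n * J n ≈ const (alt n) * q ^ tri n
    PJ zero    = ≈-refl
    PJ (suc n) = begin
      P (suc n) * J (suc n)
        ≈⟨ solve 2 (λ p x → p := (con 1ℤ :+ con 0ℤ :* x) :* p) ≈-refl _ (q ^ suc n) ⟩
      β (suc n) * (P (suc n) * J (suc n))
        ≈⟨ PJ-suc n ⟩
      - (q * γ n) * (P n * J n)
        ≈⟨ *-congˡ (PJ n) ⟩
      - (q * γ n) * (const (alt n) * q ^ tri n)
        ≈⟨ solve 4 (λ q x a t → :- (q :* (con 0ℤ :+ x)) :* (a :* t) := (:- a) :* (q :* x :* t)) ≈-refl q (q ^ n) _ _ ⟩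
      - const (alt n) * (q ^ suc n * q ^ tri n)
        ≈⟨ *-cong (const-alt-suc n) (^-homo-* q (suc n) (tri n)) ⟨
      const (alt (suc n)) * q ^ tri (suc n) ∎
    F≈ : ∀ n → F n ≈ 1# + thetaTo pent₁ sign n + thetaTo pent₂ sign n
    F≈ zero    = solve 0 (con 1ℤ :* con 1ℤ := con 1ℤ :+ con 0ℤ :+ con 0ℤ) ≈-refl
    F≈ (suc n) = begin
      F (suc n)
        ≈⟨ F-suc n ⟩
      F n + P (suc n) * J (suc n) * (q ^ n) ^ suc n * (1# + q ^ suc n)
        ≈⟨ +-cong (F≈ n) (*-congʳ (*-cong (PJ (suc n)) (^-assocʳ q n (suc n)))) ⟩
      1# + A + B + c * q ^ tri (suc n) * q ^ (n ℕ.* suc n) * (1# + q ^ suc n)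
        ≈⟨ +-congˡ (*-congʳ (≈-trans (*-assoc _ _ _) (*-congˡ (≈-sym (^-homo-* q (tri (suc n)) (n ℕ.* suc n)))))) ⟩
      1# + A + B + c * q ^ pent₁ n * (1# + q ^ suc n)
        ≈⟨ solve 5 (λ A B c x y → con 1ℤ :+ A :+ B :+ c :* x :* (con 1ℤ :+ y) := con 1ℤ :+ (A :+ c :* x) :+ (B :+ c :* (x :* y)))
             ≈-refl A B c (q ^ pent₁ n) (q ^ suc n) ⟩
      1# + (A + c * q ^ pent₁ n) + (B + c * (q ^ pent₁ n * q ^ suc n))
        ≈⟨ +-congˡ (+-congˡ (*-congˡ (^-homo-* q (pent₁ n) (suc n)))) ⟨
      1# + (A + c * q ^ pent₁ n) + (B + c * q ^ pent₂ n) ∎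
      where
      A = thetaTo pent₁ sign n
      B = thetaTo pent₂ sign n
      c = const (alt (suc n))

  module Dil2 = Subst (dilₛ 1)
  module Dil4 = Subst (dilₛ 3)
  module Sgn = Subst sgnₛ

  E₂ E₄ E₋ : PowerSeries
  E₂ = dil 1 E
  E₄ = dil 3 E
  E₋ = sgn E

  -- For ε = 1 the products `P n` are those of (1 - qʲ)/(1 + qʲ), which tend to E²/E₂ on one side
  -- and, by Shanks' sums, to φ(-q) on the other.
  φ₋*E₂ : φ₋ * E₂ ≈ E * E
  φ₋*E₂ = ≈[]⇒≈ λ n → ≈[]-trans (*-cong-[]
      (≈[]-trans (+-cong-[] ≈[]-refl (*-cong-[] ≈[]-refl (theta-≈[] sq sign sq-dom n ℕ.≤-refl))) (≈[]-trans (≈⇒≈[] (≈-sym (F≈ n))) (F≈[]P n)))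
      (Dil2.cong-[] n (E-≈[] n ℕ.≤-refl)))
    (≈[]-trans (≈⇒≈[] (P*E₂ n)) (≈[]-sym (*-cong-[] (E-≈[] n ℕ.≤-refl) (E-≈[] n ℕ.≤-refl))))
    where
    open Shanks 1ℤ
    P*E₂ : ∀ n → P n * dil 1 (eulerTo n) ≈ eulerTo n * eulerTo n
    P*E₂ zero    = ≈-trans (*-congˡ (Dil2.σ-const 1ℤ)) ≈-refl
    P*E₂ (suc n) = begin
      P (suc n) * dil 1 (eulerTo n * (1# - x))
        ≈⟨ *-congˡ (Dil2.σ-eval (v₀ :* (con 1ℤ :- v₁)) (eulerTo n ∷ x ∷ [])) ⟩
      P (suc n) * (dil 1 (eulerTo n) * (1# - dil 1 x))
        ≈⟨ *-congˡ (*-congˡ (+-congˡ (-‿cong dil-x))) ⟩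
      P (suc n) * (dil 1 (eulerTo n) * (1# - x * x))
        ≈⟨ solve 3 (λ p e x → p :* (e :* (con 1ℤ :- x :* x)) := (con 1ℤ :+ con 1ℤ :* x) :* p :* e :* (con 1ℤ :- x)) ≈-refl (P (suc n)) (dil 1 (eulerTo n)) x ⟩
      β (suc n) * P (suc n) * dil 1 (eulerTo n) * (1# - x)
        ≈⟨ *-congʳ (*-congʳ (P-suc n)) ⟩
      (1# - x) * P n * dil 1 (eulerTo n) * (1# - x)
        ≈⟨ solve 3 (λ p e x → (con 1ℤ :- x) :* p :* e :* (con 1ℤ :- x) := (p :* e) :* ((con 1ℤ :- x) :* (con 1ℤ :- x))) ≈-refl (P n) (dil 1 (eulerTo n)) x ⟩
      P n * dil 1 (eulerTo n) * ((1# - x) * (1# - x))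
        ≈⟨ *-congʳ (P*E₂ n) ⟩
      eulerTo n * eulerTo n * ((1# - x) * (1# - x))
        ≈⟨ solve 2 (λ e x → e :* e :* (x :* x) := e :* x :* (e :* x)) ≈-refl (eulerTo n) (1# - x) ⟩
      eulerTo (suc n) * eulerTo (suc n) ∎
      where
      x = q ^ suc n
      dil-x : dil 1 x ≈ x * x
      dil-x = begin
        dil 1 x         ≈⟨ Dil2.σ-^ q (suc n) ⟩
        dil 1 q ^ suc n ≈⟨ ^-cong (≈-trans Dil2.σ-q (solve 1 (λ q → q :* (q :* con 1ℤ) := q :* q) ≈-refl q)) (≡.refl {x = suc n}) ⟩
        (q * q) ^ suc n ≈⟨ ^-distrib-* q q (suc n) ⟩
        x * x           ∎
    PJ : ∀ n → (1# + q ^ n) * (P n * J n) ≈ const (+ 2) * (const (alt n) * q ^ n)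
    PJ zero    = solve 0 ((con 1ℤ :+ con 1ℤ) :* (con 1ℤ :* con 1ℤ) := con (+ 2) :* (con 1ℤ :* con 1ℤ)) ≈-refl
    PJ (suc n) = begin
      (1# + q ^ suc n) * (P (suc n) * J (suc n))
        ≈⟨ *-congʳ (+-congˡ (≈-sym (*-identityˡ _))) ⟩
      β (suc n) * (P (suc n) * J (suc n))
        ≈⟨ PJ-suc n ⟩
      - (q * γ n) * (P n * J n)
        ≈⟨ solve 3 (λ q x p → :- (q :* (con 1ℤ :+ x)) :* p := :- q :* ((con 1ℤ :+ x) :* p)) ≈-refl q (q ^ n) (P n * J n) ⟩
      - q * ((1# + q ^ n) * (P n * J n))
        ≈⟨ *-congˡ (PJ n) ⟩
      - q * (const (+ 2) * (const (alt n) * q ^ n))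
        ≈⟨ solve 3 (λ q a x → :- q :* (con (+ 2) :* (a :* x)) := con (+ 2) :* (:- a :* (q :* x))) ≈-refl q _ _ ⟩
      const (+ 2) * (- const (alt n) * q ^ suc n)
        ≈⟨ *-congˡ (*-congʳ (const-alt-suc n)) ⟨
      const (+ 2) * (const (alt (suc n)) * q ^ suc n) ∎
    F≈ : ∀ n → F n ≈ 1# + const (+ 2) * thetaTo sq sign n
    F≈ zero    = solve 0 (con 1ℤ :* con 1ℤ := con 1ℤ :+ con (+ 2) :* con 0ℤ) ≈-refl
    F≈ (suc n) = begin
      F (suc n)
        ≈⟨ F-suc n ⟩
      F n + P (suc n) * J (suc n) * (q ^ n) ^ suc n * (1# + q ^ suc n)
        ≈⟨ +-cong (F≈ n) (solve 3 (λ p y x → p :* y :* (con 1ℤ :+ x) := (con 1ℤ :+ x) :* p :* y) ≈-refl _ _ _) ⟩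
      1# + const (+ 2) * A + (1# + q ^ suc n) * (P (suc n) * J (suc n)) * (q ^ n) ^ suc n
        ≈⟨ +-congˡ (*-cong (PJ (suc n)) (^-assocʳ q n (suc n))) ⟩
      1# + const (+ 2) * A + const (+ 2) * (c * q ^ suc n) * q ^ (n ℕ.* suc n)
        ≈⟨ solve 4 (λ A c x y → con 1ℤ :+ con (+ 2) :* A :+ con (+ 2) :* (c :* x) :* y := con 1ℤ :+ con (+ 2) :* (A :+ c :* (x :* y))) ≈-refl A c _ _ ⟩
      1# + const (+ 2) * (A + c * (q ^ suc n * q ^ (n ℕ.* suc n)))
        ≈⟨ +-congˡ (*-congˡ (+-congˡ (*-congˡ (^-homo-* q (suc n) (n ℕ.* suc n))))) ⟨
      1# + const (+ 2) * (A + c * q ^ sq n) ∎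
      where
      A = thetaTo sq sign n
      c = const (alt (suc n))

  -- Dissections of E, φ and ψ

  q^0* : ∀ x → q ^ 0 * x ≈ x
  q^0* = *-identityˡ

  q^1* : ∀ x → q ^ 1 * x ≈ q * x
  q^1* = solve 2 (λ q x → q :^ 1 :* x := q :* x) ≈-refl q

  q^2* : ∀ x → q ^ 2 * x ≈ q² * x
  q^2* = solve 2 (λ q x → q :^ 2 :* x := q :* q :* x) ≈-refl q

  q^3* : ∀ x → q ^ 3 * x ≈ q³ * x
  q^3* = solve 2 (λ q x → q :^ 3 :* x := q :* (q :* q) :* x) ≈-refl q

  q^4* : ∀ x → q ^ 4 * x ≈ q⁴ * x
  q^4* = solve 2 (λ q x → q :^ 4 :* x := q :* (q :* (q :* q)) :* x) ≈-refl q

  two-tri : ∀ n → 2 ℕ.* tri n ≡ n ℕ.* suc n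
  two-tri zero    = ≡.refl
  two-tri (suc n) = ≡.trans (ℕ.*-distribˡ-+ 2 (suc n) (tri n)) (≡.trans (cong (2 ℕ.* suc n ℕ.+_) (two-tri n))
    (solveℕ 1 (λ n → nat 2 ⊗ (nat 1 ⊕ n) ⊕ n ⊗ (nat 1 ⊕ n)
      ⊜ (nat 1 ⊕ n) ⊗ (nat 2 ⊕ n)) ≡.refl n))

  tri-residue : ∀ r k → tri (r ℕ.+ k ℕ.* 5) ≡ tri r ℕ.+ 5 ℕ.* (k ℕ.* r ℕ.+ 2 ℕ.* (k ℕ.* k) ℕ.+ tri k)
  tri-residue r k = ℕ.*-cancelˡ-≡ _ _ 2 (≡.trans (two-tri (r ℕ.+ k ℕ.* 5)) (≡.sym (≡.trans
    (solveℕ 4 (λ r k t u → nat 2 ⊗ (t ⊕ nat 5 ⊗ (k ⊗ r ⊕ nat 2 ⊗ (k ⊗ k) ⊕ u))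
       ⊜ nat 2 ⊗ t ⊕ nat 5 ⊗ (nat 2 ⊗ (k ⊗ r) ⊕ nat 4 ⊗ (k ⊗ k) ⊕ nat 2 ⊗ u)) ≡.refl r k (tri r) (tri k))
    (≡.trans (cong₂ (λ t u → t ℕ.+ 5 ℕ.* (2 ℕ.* (k ℕ.* r) ℕ.+ 4 ℕ.* (k ℕ.* k) ℕ.+ u)) (two-tri r) (two-tri k))
    (solveℕ 2 (λ r k → r ⊗ (nat 1 ⊕ r) ⊕ nat 5 ⊗ (nat 2 ⊗ (k ⊗ r) ⊕ nat 4 ⊗ (k ⊗ k) ⊕ k ⊗ (nat 1 ⊕ k))
       ⊜ (r ⊕ k ⊗ nat 5) ⊗ (nat 1 ⊕ (r ⊕ k ⊗ nat 5))) ≡.refl r k)))))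

  -- n(3n + 1)/2 from n = 0 on, so that Euler's series has two halves and no separate constant. Its
  -- exponents are (m² - 1)/24 with m = 6n + 1 here and m = 6n + 5 for `pent₁`.
  pent₀ : ℕ → ℕ
  pent₀ n = tri n ℕ.+ n ℕ.* n

  pent₀-dom : Dominates pent₀
  pent₀-dom n = ℕ.≤-trans (tri-dom n) (ℕ.m≤m+n _ _)

  theta-shift : ∀ {e s k≤e} (k≤e′ : Dominates (λ n → e (suc n))) →
    theta e s k≤e ≈ const (s 0) * q ^ e 0 + theta (λ n → e (suc n)) (λ n → s (suc n)) k≤e′
  theta-shift {e} {s} {k≤e} k≤e′ = ≈[]⇒≈ λ n → ≈[]-trans (theta-≈[] e s k≤e (suc n) (ℕ.n≤1+n n))
    (≈[]-trans (≈⇒≈[] (go n)) (+-cong-[] ≈[]-refl (≈[]-sym (theta-≈[] _ _ k≤e′ n ℕ.≤-refl))))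
    where
    go : ∀ n → thetaTo e s (suc n) ≈ const (s 0) * q ^ e 0 + thetaTo (λ n → e (suc n)) (λ n → s (suc n)) n
    go zero    = +-comm _ _
    go (suc n) = ≈-trans (+-congʳ (go n)) (+-assoc _ _ _)

  E-theta : E ≈ theta pent₀ alt pent₀-dom + theta pent₁ sign pent₁-dom
  E-theta = begin
    E
      ≈⟨ pentagonal ⟩
    1# + theta pent₁ sign pent₁-dom + theta pent₂ sign pent₂-dom
      ≈⟨ solve 2 (λ x y → con 1ℤ :+ x :+ y := con 1ℤ :* con 1ℤ :+ y :+ x) ≈-refl _ _ ⟩
    const (alt 0) * q ^ pent₀ 0 + theta pent₂ sign pent₂-dom + theta pent₁ sign pent₁-dom
      ≈⟨ +-congʳ (+-congˡ (theta-cong pent₂≡pent₀ (λ _ → ≡.refl))) ⟩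
    const (alt 0) * q ^ pent₀ 0 + theta (λ n → pent₀ (suc n)) sign (λ n → ℕ.≤-trans (ℕ.n≤1+n n) (pent₀-dom (suc n))) + theta pent₁ sign pent₁-dom
      ≈⟨ +-congʳ (theta-shift _) ⟨
    theta pent₀ alt pent₀-dom + theta pent₁ sign pent₁-dom ∎
    where
    pent₂≡pent₀ : ∀ n → pent₂ n ≡ pent₀ (suc n)
    pent₂≡pent₀ n = solveℕ 2 (λ n t → (t ⊕ n ⊗ (nat 1 ⊕ n)) ⊕ (nat 1 ⊕ n)
      ⊜ t ⊕ (nat 1 ⊕ n) ⊗ (nat 1 ⊕ n)) ≡.refl n (tri (suc n))

  module Class (e : ℕ → ℕ) (s : ℕ → ℤ) (k≤e : Dominates e) (r : ℕ) (g : ℕ → ℕ) (k≤g : Dominates g) where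

    part : PowerSeries
    part = theta g (λ k → s (r ℕ.+ k ℕ.* 5)) k≤g

    residue≈ : ∀ c → (∀ k → e (r ℕ.+ k ℕ.* 5) ≡ c ℕ.+ 5 ℕ.* g k) → residue e s k≤e r 5 ≈ q ^ c * d part
    residue≈ c = theta-dil c 4

  -- `m` is the quotient of `tri r` by 5, and the argument `c` of `class` is the remainder; the same
  -- convention holds in the three modules that follow.
  module TriClass (r m : ℕ) where
    g : ℕ → ℕ
    g k = m ℕ.+ (k ℕ.* r ℕ.+ 2 ℕ.* (k ℕ.* k)) ℕ.+ tri k

    dom : Dominates g
    dom k = ℕ.≤-trans (tri-dom k) (ℕ.m≤n+m (tri k) _)

    open Class tri one′ tri-dom r g dom public using (part)

    class : ∀ c → tri r ≡ c ℕ.+ 5 ℕ.* m → residue tri one′ tri-dom r 5 ≈ q ^ c * d part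
    class c h = Class.residue≈ tri one′ tri-dom r g dom c λ k → ≡.trans (tri-residue r k) (≡.trans (cong (ℕ._+ 5 ℕ.* (k ℕ.* r ℕ.+ 2 ℕ.* (k ℕ.* k) ℕ.+ tri k)) h)
      (solveℕ 5 (λ c m x y t → c ⊕ nat 5 ⊗ m ⊕ nat 5 ⊗ (x ⊕ y ⊕ t)
        ⊜ c ⊕ nat 5 ⊗ (m ⊕ (x ⊕ y) ⊕ t)) ≡.refl c m (k ℕ.* r) (2 ℕ.* (k ℕ.* k)) (tri k)))

  module Pent₀Class (r m : ℕ) where
    g : ℕ → ℕ
    g k = m ℕ.+ (3 ℕ.* (k ℕ.* r) ℕ.+ 7 ℕ.* (k ℕ.* k)) ℕ.+ tri k

    dom : Dominates g
    dom k = ℕ.≤-trans (tri-dom k) (ℕ.m≤n+m (tri k) _)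

    open Class pent₀ alt pent₀-dom r g dom public using (part)

    class : ∀ c → pent₀ r ≡ c ℕ.+ 5 ℕ.* m → residue pent₀ alt pent₀-dom r 5 ≈ q ^ c * d part
    class c h = Class.residue≈ pent₀ alt pent₀-dom r g dom c λ k → ≡.trans
      (≡.trans (cong (ℕ._+ (r ℕ.+ k ℕ.* 5) ℕ.* (r ℕ.+ k ℕ.* 5)) (tri-residue r k))
        (solveℕ 4 (λ r k t u → t ⊕ nat 5 ⊗ (k ⊗ r ⊕ nat 2 ⊗ (k ⊗ k) ⊕ u) ⊕ (r ⊕ k ⊗ nat 5) ⊗ (r ⊕ k ⊗ nat 5)
          ⊜ (t ⊕ r ⊗ r) ⊕ nat 5 ⊗ ((nat 3 ⊗ (k ⊗ r) ⊕ nat 7 ⊗ (k ⊗ k)) ⊕ u)) ≡.refl r k (tri r) (tri k)))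
      (≡.trans (cong (ℕ._+ 5 ℕ.* ((3 ℕ.* (k ℕ.* r) ℕ.+ 7 ℕ.* (k ℕ.* k)) ℕ.+ tri k)) h)
      (solveℕ 4 (λ c m x t → c ⊕ nat 5 ⊗ m ⊕ nat 5 ⊗ (x ⊕ t)
        ⊜ c ⊕ nat 5 ⊗ (m ⊕ x ⊕ t)) ≡.refl c m (3 ℕ.* (k ℕ.* r) ℕ.+ 7 ℕ.* (k ℕ.* k)) (tri k)))

  module Pent₁Class (r m : ℕ) where
    g : ℕ → ℕ
    g k = m ℕ.+ (3 ℕ.* (k ℕ.* r) ℕ.+ 2 ℕ.* k ℕ.+ 7 ℕ.* (k ℕ.* k)) ℕ.+ tri k

    dom : Dominates g
    dom k = ℕ.≤-trans (tri-dom k) (ℕ.m≤n+m (tri k) _)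

    open Class pent₁ sign pent₁-dom r g dom public using (part)

    class : ∀ c → pent₁ r ≡ c ℕ.+ 5 ℕ.* m → residue pent₁ sign pent₁-dom r 5 ≈ q ^ c * d part
    class c h = Class.residue≈ pent₁ sign pent₁-dom r g dom c λ k → ≡.trans
      (≡.trans (cong (ℕ._+ (r ℕ.+ k ℕ.* 5) ℕ.* suc (r ℕ.+ k ℕ.* 5)) (tri-residue (suc r) k))
        (solveℕ 4 (λ r k t u → t ⊕ nat 5 ⊗ (k ⊗ (nat 1 ⊕ r) ⊕ nat 2 ⊗ (k ⊗ k) ⊕ u) ⊕ (r ⊕ k ⊗ nat 5) ⊗ (nat 1 ⊕ (r ⊕ k ⊗ nat 5))
          ⊜ (t ⊕ r ⊗ (nat 1 ⊕ r)) ⊕ nat 5 ⊗ ((nat 3 ⊗ (k ⊗ r) ⊕ nat 2 ⊗ k ⊕ nat 7 ⊗ (k ⊗ k)) ⊕ u)) ≡.refl r k (tri (suc r)) (tri k)))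
      (≡.trans (cong (ℕ._+ 5 ℕ.* ((3 ℕ.* (k ℕ.* r) ℕ.+ 2 ℕ.* k ℕ.+ 7 ℕ.* (k ℕ.* k)) ℕ.+ tri k)) h)
      (solveℕ 4 (λ c m x t → c ⊕ nat 5 ⊗ m ⊕ nat 5 ⊗ (x ⊕ t)
        ⊜ c ⊕ nat 5 ⊗ (m ⊕ x ⊕ t)) ≡.refl c m (3 ℕ.* (k ℕ.* r) ℕ.+ 2 ℕ.* k ℕ.+ 7 ℕ.* (k ℕ.* k)) (tri k)))

  module SqClass (r m : ℕ) where
    g : ℕ → ℕ
    g k = m ℕ.+ (2 ℕ.* (k ℕ.* r) ℕ.+ k ℕ.+ 5 ℕ.* (k ℕ.* k)) ℕ.+ k

    dom : Dominates g
    dom k = ℕ.m≤n+m k _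

    open Class sq one′ sq-dom r g dom public using (part)

    class : ∀ c → sq r ≡ c ℕ.+ 5 ℕ.* m → residue sq one′ sq-dom r 5 ≈ q ^ c * d part
    class c h = Class.residue≈ sq one′ sq-dom r g dom c λ k → ≡.trans
      (solveℕ 2 (λ r k → (nat 1 ⊕ (r ⊕ k ⊗ nat 5)) ⊗ (nat 1 ⊕ (r ⊕ k ⊗ nat 5))
          ⊜ (nat 1 ⊕ r) ⊗ (nat 1 ⊕ r) ⊕ nat 5 ⊗ ((nat 2 ⊗ (k ⊗ r) ⊕ k ⊕ nat 5 ⊗ (k ⊗ k)) ⊕ k)) ≡.refl r k)
      (≡.trans (cong (ℕ._+ 5 ℕ.* ((2 ℕ.* (k ℕ.* r) ℕ.+ k ℕ.+ 5 ℕ.* (k ℕ.* k)) ℕ.+ k)) h)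
      (solveℕ 4 (λ c m x t → c ⊕ nat 5 ⊗ m ⊕ nat 5 ⊗ (x ⊕ t)
        ⊜ c ⊕ nat 5 ⊗ (m ⊕ x ⊕ t)) ≡.refl c m (2 ℕ.* (k ℕ.* r) ℕ.+ k ℕ.+ 5 ℕ.* (k ℕ.* k)) k))

  ×5-dom : ∀ {g} → Dominates g → Dominates (λ k → 5 ℕ.* g k)
  ×5-dom k≤g k = ℕ.≤-trans (k≤g k) (ℕ.m≤n*m _ 5)

  theta-dd : ∀ {e g s k≤e k≤g} c → (∀ k → e k ≡ c ℕ.+ 5 ℕ.* (5 ℕ.* g k)) → theta e s k≤e ≈ q ^ c * d (d (theta g s k≤g))
  theta-dd {k≤g = k≤g} c h = ≈-trans (theta-dil {k≤g = ×5-dom k≤g} c 4 h)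
    (*-congˡ (D.σ-cong (≈-trans (theta-dil 0 4 (λ _ → ≡.refl)) (q^0* _))))

  A₁ B₁ : PowerSeries
  A₁ = TriClass.part 0 0 + TriClass.part 4 2
  B₁ = TriClass.part 1 0 + TriClass.part 3 1

  -- For a triangular number T, 8T + 1 is the square of 2n + 1. Hence T is 0, 1 or 3 modulo 5, and T
  -- ≡ 3 means that 5 divides 2n + 1, which makes that class a copy of `ψ`.
  ψ-dis : ψ ≈ dis A₁ B₁ 0# (d ψ) 0#
  ψ-dis = begin
    ψ
      ≈⟨ theta-split₅ tri one′ tri-dom ⟩
    _ ≈⟨ +-cong (+-cong (+-cong (+-cong
           (≈-trans (TriClass.class 0 0 0 ≡.refl) (q^0* _))
           (≈-trans (TriClass.class 1 0 1 ≡.refl) (q^1* _)))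
           (≈-trans (theta-dd 3 middle) (q^3* _)))
           (≈-trans (TriClass.class 3 1 1 ≡.refl) (q^1* _)))
           (≈-trans (TriClass.class 4 2 0 ≡.refl) (q^0* _)) ⟩
    d (TriClass.part 0 0) + q * d (TriClass.part 1 0) + q³ * d (d ψ) + q * d (TriClass.part 3 1) + d (TriClass.part 4 2)
      ≈⟨ solve 6 (λ q a b c x y → a :+ q :* b :+ (q :* (q :* q)) :* c :+ q :* x :+ y
           := (a :+ y) :+ q :* (b :+ x) :+ (q :* q) :* con 0ℤ :+ (q :* (q :* q)) :* c :+ (q :* (q :* (q :* q))) :* con 0ℤ) ≈-refl q _ _ _ _ _ ⟩
    _ ≈⟨ +-cong (+-congʳ (+-cong (+-cong (≈-sym (D.σ-+ _ _)) (*-congˡ (≈-sym (D.σ-+ _ _)))) (*-congˡ (≈-sym (D.σ-const 0ℤ)))))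
           (*-congˡ (≈-sym (D.σ-const 0ℤ))) ⟩
    dis A₁ B₁ 0# (d ψ) 0# ∎
    where
    middle : ∀ k → tri (2 ℕ.+ k ℕ.* 5) ≡ 3 ℕ.+ 5 ℕ.* (5 ℕ.* tri k)
    middle k = ≡.trans (tri-residue 2 k) (cong (λ x → 3 ℕ.+ 5 ℕ.* x) (≡.trans
      (solveℕ 2 (λ k t → k ⊗ nat 2 ⊕ nat 2 ⊗ (k ⊗ k) ⊕ t ⊜ nat 2 ⊗ (k ⊗ (nat 1 ⊕ k)) ⊕ t) ≡.refl k (tri k))
      (≡.trans (cong (λ x → 2 ℕ.* x ℕ.+ tri k) (≡.sym (two-tri k)))
      (solveℕ 1 (λ t → nat 2 ⊗ (nat 2 ⊗ t) ⊕ t ⊜ nat 5 ⊗ t) ≡.refl (tri k)))))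

  φa φb : PowerSeries
  φa = const (+ 2) * (SqClass.part 0 0 + SqClass.part 3 3)
  φb = const (+ 2) * (SqClass.part 1 0 + SqClass.part 2 1)

  φ-dis : φ ≈ dis (d φ) φa 0# 0# φb
  φ-dis = begin
    φ
      ≈⟨ +-congˡ (*-congˡ (≈-trans (theta-split₅ sq one′ sq-dom) (+-cong (+-cong (+-cong (+-cong
           (≈-trans (SqClass.class 0 0 1 ≡.refl) (q^1* _))
           (≈-trans (SqClass.class 1 0 4 ≡.refl) (q^4* _)))
           (≈-trans (SqClass.class 2 1 4 ≡.refl) (q^4* _)))
           (≈-trans (SqClass.class 3 3 1 ≡.refl) (q^1* _)))
           (≈-trans (theta-dd 0 last) (q^0* _))))) ⟩
    1# + const (+ 2) * (q * d (SqClass.part 0 0) + q⁴ * d (SqClass.part 1 0) + q⁴ * d (SqClass.part 2 1) + q * d (SqClass.part 3 3) + d (d θ))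
      ≈⟨ solve 6 (λ q a b c x y → con 1ℤ :+ con (+ 2) :* (q :* a :+ (q :* (q :* (q :* q))) :* b :+ (q :* (q :* (q :* q))) :* c :+ q :* x :+ y)
           := (con 1ℤ :+ con (+ 2) :* y) :+ q :* (con (+ 2) :* (a :+ x)) :+ (q :* q) :* con 0ℤ :+ (q :* (q :* q)) :* con 0ℤ :+ (q :* (q :* (q :* q))) :* (con (+ 2) :* (b :+ c)))
           ≈-refl q _ _ _ _ _ ⟩
    _ ≈⟨ +-cong (+-cong (+-cong (+-cong (≈-sym dd) (*-congˡ (≈-sym (twice _ _)))) (*-congˡ (≈-sym (D.σ-const 0ℤ))))
           (*-congˡ (≈-sym (D.σ-const 0ℤ)))) (*-congˡ (≈-sym (twice _ _))) ⟩
    dis (d φ) φa 0# 0# φb ∎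
    where
    θ = theta sq one′ sq-dom
    twice : ∀ x y → d (const (+ 2) * (x + y)) ≈ const (+ 2) * (d x + d y)
    twice x y = ≈-trans (D.σ-const* (+ 2) _) (*-congˡ (D.σ-+ x y))
    affine : ∀ x → d (1# + const (+ 2) * x) ≈ 1# + const (+ 2) * d x
    affine x = ≈-trans (D.σ-+ _ _) (+-cong (D.σ-const 1ℤ) (D.σ-const* (+ 2) x))
    dd : d (d φ) ≈ 1# + const (+ 2) * d (d θ)
    dd = ≈-trans (D.σ-cong (affine θ)) (affine (d θ))
    last : ∀ k → sq (4 ℕ.+ k ℕ.* 5) ≡ 0 ℕ.+ 5 ℕ.* (5 ℕ.* sq k)
    last = solveℕ 1 (λ k → (nat 5 ⊕ k ⊗ nat 5) ⊗ (nat 5 ⊕ k ⊗ nat 5)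
      ⊜ nat 5 ⊗ (nat 5 ⊗ ((nat 1 ⊕ k) ⊗ (nat 1 ⊕ k)))) ≡.refl

  alt-residue : ∀ k → alt (k ℕ.* 5) ≡ alt k
  alt-residue zero    = ≡.refl
  alt-residue (suc k) = ≡.trans (ℤ.neg-involutive _) (≡.trans (ℤ.neg-involutive _) (cong ℤ.-_ (alt-residue k)))

  j₀ j₂ : PowerSeries
  j₀ = Pent₀Class.part 0 0 + Pent₀Class.part 3 3 + (Pent₁Class.part 1 1 + Pent₁Class.part 4 7)
  j₂ = Pent₀Class.part 1 0 + Pent₀Class.part 2 1 + (Pent₁Class.part 2 2 + Pent₁Class.part 3 4)

  -- As 24e + 1 = m² is a square, e is never 3 or 4 modulo 5, and e ≡ 1 means that 5 divides m.
  -- Since 5 ≡ -1 (mod 6), dividing m by 5 exchanges the two halves of Euler's series, with a change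
  -- of sign.
  E-dis : E ≈ dis j₀ (- d E) j₂ 0# 0#
  E-dis = begin
    E
      ≈⟨ E-theta ⟩
    _ ≈⟨ +-cong (≈-trans (theta-split₅ pent₀ alt pent₀-dom) (+-cong (+-cong (+-cong (+-cong
           (≈-trans (Pent₀Class.class 0 0 0 ≡.refl) (q^0* _))
           (≈-trans (Pent₀Class.class 1 0 2 ≡.refl) (q^2* _)))
           (≈-trans (Pent₀Class.class 2 1 2 ≡.refl) (q^2* _)))
           (≈-trans (Pent₀Class.class 3 3 0 ≡.refl) (q^0* _)))
           (≈-trans (theta-scale (ℤ.- 1ℤ) sign₀) (*-congˡ (≈-trans (theta-dd 1 exponent₀) (q^1* _))))))
         (≈-trans (theta-split₅ pent₁ sign pent₁-dom) (+-cong (+-cong (+-cong (+-cong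
           (≈-trans (theta-scale (ℤ.- 1ℤ) sign₁) (*-congˡ (≈-trans (theta-dd 1 exponent₁) (q^1* _))))
           (≈-trans (Pent₁Class.class 1 1 0 ≡.refl) (q^0* _)))
           (≈-trans (Pent₁Class.class 2 2 2 ≡.refl) (q^2* _)))
           (≈-trans (Pent₁Class.class 3 4 2 ≡.refl) (q^2* _)))
           (≈-trans (Pent₁Class.class 4 7 0 ≡.refl) (q^0* _)))) ⟩
    _ ≈⟨ solve 11 (λ q x₀ x₁ x₂ x₃ x₄ y₀ y₁ y₂ y₃ y₄ →
           (x₀ :+ q :* q :* x₁ :+ q :* q :* x₂ :+ x₃ :+ con (ℤ.- 1ℤ) :* (q :* x₄)) :+ (con (ℤ.- 1ℤ) :* (q :* y₀) :+ y₁ :+ q :* q :* y₂ :+ q :* q :* y₃ :+ y₄)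
           := (x₀ :+ x₃ :+ (y₁ :+ y₄)) :+ q :* (:- (y₀ :+ x₄)) :+ (q :* q) :* (x₁ :+ x₂ :+ (y₂ :+ y₃)) :+ (q :* (q :* q)) :* con 0ℤ :+ (q :* (q :* (q :* q))) :* con 0ℤ)
           ≈-refl q _ _ _ _ _ _ _ _ _ _ ⟩
    _ ≈⟨ +-cong (+-cong (+-cong (+-cong (≈-sym (sum₄ _ _ _ _)) (*-congˡ (≈-sym mid))) (*-congˡ (≈-sym (sum₄ _ _ _ _))))
           (*-congˡ (≈-sym (D.σ-const 0ℤ)))) (*-congˡ (≈-sym (D.σ-const 0ℤ))) ⟩
    dis j₀ (- d E) j₂ 0# 0# ∎
    where
    θ₀ = theta pent₀ alt pent₀-dom
    θ₁ = theta pent₁ sign pent₁-dom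
    sum₄ : ∀ a b c e → d (a + b + (c + e)) ≈ d a + d b + (d c + d e)
    sum₄ a b c e = ≈-trans (D.σ-+ _ _) (+-cong (D.σ-+ a b) (D.σ-+ c e))
    mid : d (- d E) ≈ - (d (d θ₀) + d (d θ₁))
    mid = ≈-trans (D.σ-neg _) (-‿cong (≈-trans (D.σ-cong (≈-trans (D.σ-cong E-theta) (D.σ-+ _ _))) (D.σ-+ _ _)))
    sign₀ : ∀ k → alt (4 ℕ.+ k ℕ.* 5) ≡ ℤ.- 1ℤ ℤ.* sign k
    sign₀ k = ≡.trans (ℤ.neg-involutive _) (≡.trans (ℤ.neg-involutive _) (≡.trans (alt-residue k)
      (≡.trans (≡.sym (ℤ.neg-involutive (alt k))) (≡.sym (ℤ.-1*i≡-i (sign k))))))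
    sign₁ : ∀ k → sign (0 ℕ.+ k ℕ.* 5) ≡ ℤ.- 1ℤ ℤ.* alt k
    sign₁ k = ≡.trans (cong ℤ.-_ (alt-residue k)) (≡.sym (ℤ.-1*i≡-i (alt k)))
    exponent₀ : ∀ k → pent₀ (4 ℕ.+ k ℕ.* 5) ≡ 1 ℕ.+ 5 ℕ.* (5 ℕ.* pent₁ k)
    exponent₀ k = ℕ.*-cancelˡ-≡ _ _ 2 (≡.trans (ℕ.*-distribˡ-+ 2 (tri (4 ℕ.+ k ℕ.* 5)) _) (≡.trans
      (cong (ℕ._+ 2 ℕ.* ((4 ℕ.+ k ℕ.* 5) ℕ.* (4 ℕ.+ k ℕ.* 5))) (two-tri (4 ℕ.+ k ℕ.* 5)))
      (≡.trans (solveℕ 1 (λ k → (nat 4 ⊕ k ⊗ nat 5) ⊗ (nat 5 ⊕ k ⊗ nat 5)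
           ⊕ nat 2 ⊗ ((nat 4 ⊕ k ⊗ nat 5) ⊗ (nat 4 ⊕ k ⊗ nat 5))
           ⊜ nat 2 ⊕ nat 25 ⊗ ((nat 1 ⊕ k) ⊗ (nat 2 ⊕ k) ⊕ nat 2 ⊗ (k ⊗ (nat 1 ⊕ k)))) ≡.refl k)
      (≡.trans (cong (λ x → 2 ℕ.+ 25 ℕ.* (x ℕ.+ 2 ℕ.* (k ℕ.* suc k))) (≡.sym (two-tri (suc k))))
      (solveℕ 2 (λ t y → nat 2 ⊕ nat 25 ⊗ (nat 2 ⊗ t ⊕ nat 2 ⊗ y)
           ⊜ nat 2 ⊗ (nat 1 ⊕ nat 5 ⊗ (nat 5 ⊗ (t ⊕ y)))) ≡.refl (tri (suc k)) (k ℕ.* suc k))))))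
    exponent₁ : ∀ k → pent₁ (0 ℕ.+ k ℕ.* 5) ≡ 1 ℕ.+ 5 ℕ.* (5 ℕ.* pent₀ k)
    exponent₁ k = ℕ.*-cancelˡ-≡ _ _ 2 (≡.trans (ℕ.*-distribˡ-+ 2 (tri (1 ℕ.+ k ℕ.* 5)) _) (≡.trans
      (cong (ℕ._+ 2 ℕ.* ((k ℕ.* 5) ℕ.* (1 ℕ.+ k ℕ.* 5))) (two-tri (1 ℕ.+ k ℕ.* 5)))
      (≡.trans (solveℕ 1 (λ k → (nat 1 ⊕ k ⊗ nat 5) ⊗ (nat 2 ⊕ k ⊗ nat 5)
           ⊕ nat 2 ⊗ ((k ⊗ nat 5) ⊗ (nat 1 ⊕ k ⊗ nat 5))
           ⊜ nat 2 ⊕ nat 25 ⊗ (k ⊗ (nat 1 ⊕ k) ⊕ nat 2 ⊗ (k ⊗ k))) ≡.refl k)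
      (≡.trans (cong (λ x → 2 ℕ.+ 25 ℕ.* (x ℕ.+ 2 ℕ.* (k ℕ.* k))) (≡.sym (two-tri k)))
      (solveℕ 2 (λ t y → nat 2 ⊕ nat 25 ⊗ (nat 2 ⊗ t ⊕ nat 2 ⊗ y)
           ⊜ nat 2 ⊗ (nat 1 ⊕ nat 5 ⊗ (nat 5 ⊗ (t ⊕ y)))) ≡.refl (tri k) (k ℕ.* k))))))

  -- Products and doubling formulas

  dilate-skip : ∀ k r f n → dilate k r f (r ℕ.+ n) ≡ dilate k 0 f n
  dilate-skip k zero    f n = ≡.refl
  dilate-skip k (suc r) f n = dilate-skip k r f n

  dilate-multiple : ∀ k f n → dilate k 0 f (n ℕ.* suc k) ≡ f n
  dilate-multiple k f zero    = ≡.refl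
  dilate-multiple k f (suc n) = ≡.trans (dilate-skip k k (tl f) (n ℕ.* suc k)) (dilate-multiple k (tl f) n)

  dil-injective : ∀ k {f g} → dil k f ≈ dil k g → f ≈ g
  dil-injective k {f} {g} h = coeffwise λ n → ≡.trans (≡.sym (value f n)) (≡.trans (coeff-≡ h (n ℕ.* suc k)) (value g n))
    where
    value : ∀ f n → coeff (dil k f) (n ℕ.* suc k) ≡ coeff f n
    value f n = ≡.trans (coeff-dil k f _) (dilate-multiple k (coeff f) n)

  dil₂-q : dil 1 q ≈ q²
  dil₂-q = ≈-trans Dil2.σ-q (solve 1 (λ q → q :* (q :* con 1ℤ) := q :* q) ≈-refl q)

  dil₂∘dil₂ : ∀ f → dil 1 (dil 1 f) ≈ dil 3 f
  dil₂∘dil₂ = σ-unique (dilₛ 1 ∘ₛ dilₛ 1) (dilₛ 3)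
    (≈-trans (*-congˡ (≈-trans (Dil2.σ-^ q 1) (^-cong dil₂-q (≡.refl {x = 1}))))
      (solve 1 (λ q → q :^ 1 :* (q :* q) :^ 1 := q :^ 3) ≈-refl q))

  dil₂∘dil₄ : ∀ f → dil 1 (dil 3 f) ≈ dil 7 f
  dil₂∘dil₄ = σ-unique (dilₛ 1 ∘ₛ dilₛ 3) (dilₛ 7)
    (≈-trans (*-congˡ (≈-trans (Dil2.σ-^ q 3) (^-cong dil₂-q (≡.refl {x = 3}))))
      (solve 1 (λ q → q :^ 1 :* (q :* q) :^ 3 := q :^ 7) ≈-refl q))

  sgn-q : sgn q ≈ - q
  sgn-q = ≈-trans Sgn.σ-q (solve 1 (λ q → q :* (:- con 1ℤ) := :- q) ≈-refl q)

  sgn∘dil₂ : ∀ f → sgn (dil 1 f) ≈ dil 1 f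
  sgn∘dil₂ = σ-unique (sgnₛ ∘ₛ dilₛ 1) (dilₛ 1)
    (≈-trans (*-congˡ (≈-trans (Sgn.σ-^ q 1) (^-cong sgn-q (≡.refl {x = 1}))))
      (solve 1 (λ q → (:- con 1ℤ) :* (:- q) :^ 1 := q :^ 1) ≈-refl q))

  sgn∘dil₄ : ∀ f → sgn (dil 3 f) ≈ dil 3 f
  sgn∘dil₄ f = ≈-trans (Sgn.σ-cong (≈-sym (dil₂∘dil₂ f))) (≈-trans (sgn∘dil₂ (dil 1 f)) (dil₂∘dil₂ f))

  sgn∘sgn : ∀ f → sgn (sgn f) ≈ f
  sgn∘sgn = σ-unique (sgnₛ ∘ₛ sgnₛ) identityₛ
    (≈-trans (*-congˡ (≈-trans (Sgn.σ-neg 1#) (-‿cong (Sgn.σ-const 1ℤ)))) (solve 0 (:- con 1ℤ :* (:- con 1ℤ) := con 1ℤ) ≈-refl))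

  d∘dil₂ : ∀ f → d (dil 1 f) ≈ dil 1 (d f)
  d∘dil₂ = σ-unique (dilₛ 4 ∘ₛ dilₛ 1) (dilₛ 1 ∘ₛ dilₛ 4) (begin
    q ^ 4 * d (q ^ 1)             ≈⟨ *-congˡ (≈-trans (D.σ-^ q 1) (^-cong d-q (≡.refl {x = 1}))) ⟩
    q ^ 4 * (q * q⁴) ^ 1          ≈⟨ solve 1 (λ q → q :^ 4 :* (q :* (q :* (q :* (q :* q)))) :^ 1 := q :^ 1 :* (q :* q) :^ 4) ≈-refl q ⟩
    q ^ 1 * q² ^ 4                ≈⟨ *-congˡ (≈-trans (Dil2.σ-^ q 4) (^-cong dil₂-q (≡.refl {x = 4}))) ⟨
    q ^ 1 * dil 1 (q ^ 4)         ∎)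

  d∘sgn : ∀ f → d (sgn f) ≈ sgn (d f)
  d∘sgn = σ-unique (dilₛ 4 ∘ₛ sgnₛ) (sgnₛ ∘ₛ dilₛ 4) (begin
    q ^ 4 * d (- 1#)      ≈⟨ *-congˡ (≈-trans (D.σ-neg 1#) (-‿cong (D.σ-const 1ℤ))) ⟩
    q ^ 4 * (- 1#)        ≈⟨ solve 1 (λ q → q :^ 4 :* (:- con 1ℤ) := :- con 1ℤ :* (:- q) :^ 4) ≈-refl q ⟩
    - 1# * (- q) ^ 4      ≈⟨ *-congˡ (≈-trans (Sgn.σ-^ q 4) (^-cong sgn-q (≡.refl {x = 4}))) ⟨
    - 1# * sgn (q ^ 4)    ∎)

  -- Compared on finite products. The index `n * 2` takes the factors of `E` and `E₋` in pairs: 1 -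
  -- q²ⁿ⁺¹ meets 1 + q²ⁿ⁺¹, and 1 - q²ⁿ⁺² is squared.
  E₋*E*E₄ : E₋ * E * E₄ ≈ E₂ * (E₂ * E₂)
  E₋*E*E₄ = ≈[]⇒≈ λ n → ≈[]-trans
    (*-cong-[] (*-cong-[] (Sgn.cong-[] n (E-≈[] (n ℕ.* 2) (ℕ.m≤m*n n 2))) (E-≈[] (n ℕ.* 2) (ℕ.m≤m*n n 2))) (Dil4.cong-[] n (E-≈[] n ℕ.≤-refl)))
    (≈[]-trans (≈⇒≈[] (go n)) (≈[]-sym (*-cong-[] (Dil2.cong-[] n (E-≈[] (n ℕ.* 2) (ℕ.m≤m*n n 2)))
      (*-cong-[] (Dil2.cong-[] n (E-≈[] n ℕ.≤-refl)) (Dil2.cong-[] n (E-≈[] n ℕ.≤-refl))))))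
    where
    sgn-u : ∀ n → sgn (q ^ (n ℕ.* 2)) ≈ q ^ (n ℕ.* 2)
    sgn-u zero    = Sgn.σ-const 1ℤ
    sgn-u (suc n) = ≈-trans (≈-trans (Sgn.σ-* _ _) (*-cong sgn-q (≈-trans (Sgn.σ-* _ _) (*-cong sgn-q (sgn-u n)))))
      (solve 2 (λ q u → :- q :* (:- q :* u) := q :* (q :* u)) ≈-refl q _)
    dil₂-u : ∀ n → dil 1 (q ^ n) ≈ q ^ (n ℕ.* 2)
    dil₂-u zero    = Dil2.σ-const 1ℤ
    dil₂-u (suc n) = ≈-trans (≈-trans (Dil2.σ-* _ _) (*-cong dil₂-q (dil₂-u n))) (*-assoc _ _ _)
    dil₄-u : ∀ n → dil 3 (q ^ n) ≈ dil 1 (q ^ (n ℕ.* 2))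
    dil₄-u n = ≈-trans (≈-sym (dil₂∘dil₂ _)) (Dil2.σ-cong (dil₂-u n))
    dil₂-square : ∀ n → dil 1 (q ^ n) ≈ q ^ n * q ^ n
    dil₂-square n = ≈-trans (≈-trans (Dil2.σ-^ q n) (^-cong dil₂-q (≡.refl {x = n}))) (^-distrib-* q q n)
    go : ∀ n → sgn (eulerTo (n ℕ.* 2)) * eulerTo (n ℕ.* 2) * dil 3 (eulerTo n) ≈ dil 1 (eulerTo (n ℕ.* 2)) * (dil 1 (eulerTo n) * dil 1 (eulerTo n))
    go zero    = ≈-trans (*-cong (*-congʳ (Sgn.σ-const 1ℤ)) (Dil4.σ-const 1ℤ))
      (≈-trans (solve 0 (con 1ℤ :* con 1ℤ :* con 1ℤ := con 1ℤ :* (con 1ℤ :* con 1ℤ)) ≈-refl)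
        (≈-sym (*-cong (Dil2.σ-const 1ℤ) (*-cong (Dil2.σ-const 1ℤ) (Dil2.σ-const 1ℤ)))))
    go (suc n) = begin
      sgn (e * (1# - q * u) * (1# - q * (q * u))) * (e * (1# - q * u) * (1# - q * (q * u))) * dil 3 (e′ * (1# - q * q ^ n))
        ≈⟨ *-cong (*-cong
             (≈-trans (Sgn.σ-eval (v₀ :* (con 1ℤ :- v₁ :* v₂) :* (con 1ℤ :- v₁ :* (v₁ :* v₂))) (e ∷ q ∷ u ∷ []))
               (*-cong (*-congˡ (+-congˡ (-‿cong (*-cong sgn-q (sgn-u n))))) (+-congˡ (-‿cong (*-cong sgn-q (*-cong sgn-q (sgn-u n))))))) ≈-refl)
             (≈-trans (Dil4.σ-eval (v₀ :* (con 1ℤ :- v₁ :* v₂)) (e′ ∷ q ∷ q ^ n ∷ []))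
               (*-congˡ (+-congˡ (-‿cong (*-cong Dil4.σ-q (≈-trans (dil₄-u n) (dil₂-square (n ℕ.* 2)))))))) ⟩
      sgn e * (1# - (- q) * u) * (1# - (- q) * ((- q) * u)) * (e * (1# - q * u) * (1# - q * (q * u))) * (dil 3 e′ * (1# - q * q ^ 3 * (u * u)))
        ≈⟨ solve 5 (λ s e f q u → s :* (con 1ℤ :- (:- q) :* u) :* (con 1ℤ :- (:- q) :* ((:- q) :* u)) :* (e :* (con 1ℤ :- q :* u) :* (con 1ℤ :- q :* (q :* u))) :* (f :* (con 1ℤ :- q :* q :^ 3 :* (u :* u)))
             := (s :* e :* f) :* ((con 1ℤ :- q :* q :* (u :* u)) :* (con 1ℤ :- q :* q :* (q :* q :* (u :* u))) :* ((con 1ℤ :- q :* q :* u) :* (con 1ℤ :- q :* q :* u)))) ≈-refl (sgn e) e (dil 3 e′) q u ⟩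
      sgn e * e * dil 3 e′ * ((1# - q² * (u * u)) * (1# - q² * (q² * (u * u))) * ((1# - q² * u) * (1# - q² * u)))
        ≈⟨ *-congʳ (go n) ⟩
      dil 1 e * (dil 1 e′ * dil 1 e′) * ((1# - q² * (u * u)) * (1# - q² * (q² * (u * u))) * ((1# - q² * u) * (1# - q² * u)))
        ≈⟨ solve 5 (λ e f a b c → e :* (f :* f) :* (a :* b :* (c :* c)) := (e :* a :* b) :* ((f :* c) :* (f :* c))) ≈-refl (dil 1 e) (dil 1 e′) _ _ _ ⟩
      dil 1 e * (1# - q² * (u * u)) * (1# - q² * (q² * (u * u))) * (dil 1 e′ * (1# - q² * u) * (dil 1 e′ * (1# - q² * u)))
        ≈⟨ *-cong
             (≈-trans (Dil2.σ-eval (v₀ :* (con 1ℤ :- v₁ :* v₂) :* (con 1ℤ :- v₁ :* (v₁ :* v₂))) (e ∷ q ∷ u ∷ []))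
               (*-cong (*-congˡ (+-congˡ (-‿cong (*-cong dil₂-q (dil₂-square (n ℕ.* 2)))))) (+-congˡ (-‿cong (*-cong dil₂-q (*-cong dil₂-q (dil₂-square (n ℕ.* 2))))))))
             (*-cong last last) ⟨
      dil 1 (e * (1# - q * u) * (1# - q * (q * u))) * (dil 1 (e′ * (1# - q * q ^ n)) * dil 1 (e′ * (1# - q * q ^ n))) ∎
      where
      u = q ^ (n ℕ.* 2)
      e = eulerTo (n ℕ.* 2)
      e′ = eulerTo n
      last : dil 1 (e′ * (1# - q * q ^ n)) ≈ dil 1 e′ * (1# - q² * u)
      last = ≈-trans (Dil2.σ-eval (v₀ :* (con 1ℤ :- v₁ :* v₂)) (e′ ∷ q ∷ q ^ n ∷ []))
        (*-congˡ (+-congˡ (-‿cong (*-cong dil₂-q (dil₂-u n)))))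

  private
    odd-square : ∀ k → sq (0 ℕ.+ k ℕ.* 2) ≡ 1 ℕ.+ 8 ℕ.* tri k
    odd-square k = ≡.trans
      (solveℕ 1 (λ k → (nat 1 ⊕ k ⊗ nat 2) ⊗ (nat 1 ⊕ k ⊗ nat 2) ⊜ nat 1 ⊕ nat 4 ⊗ (k ⊗ (nat 1 ⊕ k))) ≡.refl k)
      (≡.trans (cong (λ x → 1 ℕ.+ 4 ℕ.* x) (≡.sym (two-tri k)))
        (solveℕ 1 (λ t → nat 1 ⊕ nat 4 ⊗ (nat 2 ⊗ t) ⊜ nat 1 ⊕ nat 8 ⊗ t) ≡.refl (tri k)))

    even-square : ∀ k → sq (1 ℕ.+ k ℕ.* 2) ≡ 0 ℕ.+ 4 ℕ.* sq k
    even-square = solveℕ 1 (λ k → (nat 2 ⊕ k ⊗ nat 2) ⊗ (nat 2 ⊕ k ⊗ nat 2) ⊜ nat 4 ⊗ ((nat 1 ⊕ k) ⊗ (nat 1 ⊕ k))) ≡.refl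

    alt-even : ∀ k → alt (k ℕ.* 2) ≡ 1ℤ
    alt-even zero    = ≡.refl
    alt-even (suc k) = ≡.trans (ℤ.neg-involutive _) (alt-even k)

    odd-part : theta (λ k → sq (0 ℕ.+ k ℕ.* 2)) one′ (λ k → ℕ.≤-trans (k≤r+k*m 0 2 k) (sq-dom _)) ≈ q * dil 7 ψ
    odd-part = ≈-trans (theta-dil 1 7 odd-square) (q^1* _)

    even-part : theta (λ k → sq (1 ℕ.+ k ℕ.* 2)) one′ (λ k → ℕ.≤-trans (k≤r+k*m 1 2 k) (sq-dom _)) ≈ dil 3 (theta sq one′ sq-dom)
    even-part = ≈-trans (theta-dil 0 3 even-square) (q^0* _)

    dil₄-φ : dil 3 φ ≈ 1# + const (+ 2) * dil 3 (theta sq one′ sq-dom)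
    dil₄-φ = Dil4.σ-eval (con 1ℤ :+ con (+ 2) :* v₀) (theta sq one′ sq-dom ∷ [])

  φ-parity : φ ≈ dil 3 φ + const (+ 2) * (q * dil 7 ψ)
  φ-parity = begin
    1# + const (+ 2) * theta sq one′ sq-dom
      ≈⟨ +-congˡ (*-congˡ (≈-trans (theta-split₂ sq one′ sq-dom) (+-cong odd-part even-part))) ⟩
    1# + const (+ 2) * (q * dil 7 ψ + dil 3 (theta sq one′ sq-dom))
      ≈⟨ solve 2 (λ x y → con 1ℤ :+ con (+ 2) :* (x :+ y) := con 1ℤ :+ con (+ 2) :* y :+ con (+ 2) :* x) ≈-refl _ _ ⟩
    1# + const (+ 2) * dil 3 (theta sq one′ sq-dom) + const (+ 2) * (q * dil 7 ψ)
      ≈⟨ +-congʳ dil₄-φ ⟨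
    dil 3 φ + const (+ 2) * (q * dil 7 ψ) ∎

  φ₋-parity : φ₋ ≈ dil 3 φ - const (+ 2) * (q * dil 7 ψ)
  φ₋-parity = begin
    1# + const (+ 2) * theta sq sign sq-dom
      ≈⟨ +-congˡ (*-congˡ (≈-trans (theta-split₂ sq sign sq-dom) (+-cong
           (≈-trans (theta-scale {s′ = one′} (ℤ.- 1ℤ) (λ k → cong ℤ.-_ (alt-even k))) (*-congˡ odd-part))
           (≈-trans (theta-scale {s′ = one′} 1ℤ (λ k → ≡.trans (ℤ.neg-involutive _) (alt-even k))) (*-congˡ even-part))))) ⟩
    1# + const (+ 2) * (const (ℤ.- 1ℤ) * (q * dil 7 ψ) + const 1ℤ * dil 3 (theta sq one′ sq-dom))
      ≈⟨ solve 2 (λ x y → con 1ℤ :+ con (+ 2) :* (con (ℤ.- 1ℤ) :* x :+ con 1ℤ :* y) := con 1ℤ :+ con (+ 2) :* y :- con (+ 2) :* x) ≈-refl _ _ ⟩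
    1# + const (+ 2) * dil 3 (theta sq one′ sq-dom) - const (+ 2) * (q * dil 7 ψ)
      ≈⟨ +-congʳ dil₄-φ ⟨
    dil 3 φ - const (+ 2) * (q * dil 7 ψ) ∎

  sgn-φ₋ : sgn φ₋ ≈ φ
  sgn-φ₋ = begin
    sgn φ₋
      ≈⟨ Sgn.σ-cong φ₋-parity ⟩
    sgn (dil 3 φ - const (+ 2) * (q * dil 7 ψ))
      ≈⟨ Sgn.σ-eval (v₀ :- con (+ 2) :* (v₁ :* v₂)) (dil 3 φ ∷ q ∷ dil 7 ψ ∷ []) ⟩
    sgn (dil 3 φ) - const (+ 2) * (sgn q * sgn (dil 7 ψ))
      ≈⟨ +-cong (sgn∘dil₄ φ) (-‿cong (*-congˡ (*-cong sgn-q
           (≈-trans (Sgn.σ-cong (≈-sym (dil₂∘dil₄ ψ))) (≈-trans (sgn∘dil₂ _) (dil₂∘dil₄ ψ)))))) ⟩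
    dil 3 φ - const (+ 2) * ((- q) * dil 7 ψ)
      ≈⟨ solve 3 (λ x q y → x :- con (+ 2) :* ((:- q) :* y) := x :+ con (+ 2) :* (q :* y)) ≈-refl _ _ _ ⟩
    dil 3 φ + const (+ 2) * (q * dil 7 ψ)
      ≈⟨ φ-parity ⟨
    φ ∎

  φ*E₂ : φ * E₂ ≈ E₋ * E₋
  φ*E₂ = begin
    φ * E₂            ≈⟨ *-cong sgn-φ₋ (sgn∘dil₂ E) ⟨
    sgn φ₋ * sgn E₂   ≈⟨ Sgn.σ-* φ₋ E₂ ⟨
    sgn (φ₋ * E₂)     ≈⟨ Sgn.σ-cong φ₋*E₂ ⟩
    sgn (E * E)       ≈⟨ Sgn.σ-* E E ⟩
    E₋ * E₋           ∎

  dil₂φ₋*E₄ : dil 1 φ₋ * E₄ ≈ E₂ * E₂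
  dil₂φ₋*E₄ = begin
    dil 1 φ₋ * E₄      ≈⟨ *-congˡ (dil₂∘dil₂ E) ⟨
    dil 1 φ₋ * dil 1 E₂ ≈⟨ Dil2.σ-* φ₋ E₂ ⟨
    dil 1 (φ₋ * E₂)    ≈⟨ Dil2.σ-cong φ₋*E₂ ⟩
    dil 1 (E * E)      ≈⟨ Dil2.σ-* E E ⟩
    E₂ * E₂            ∎

  coeff₀-dil : ∀ k f → coeff (dil k f) 0 ≡ coeff f 0
  coeff₀-dil k f = coeff-dil k f 0

  E₂₀ : coeff E₂ 0 ≡ 1ℤ
  E₂₀ = ≡.trans (coeff₀-dil 1 E) E₀

  E₄₀ : coeff E₄ 0 ≡ 1ℤ
  E₄₀ = ≡.trans (coeff₀-dil 3 E) E₀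

  -- Written in terms of `E` at q, -q, q² and q⁴, this is the square of `E₋*E*E₄`.
  φ*φ₋ : φ * φ₋ ≈ dil 1 φ₋ * dil 1 φ₋
  φ*φ₋ = *-cancelˡ {E₂ * E₂ * (E₄ * E₄)} (coeff₀-*-one (coeff₀-*-one E₂₀ E₂₀) (coeff₀-*-one E₄₀ E₄₀)) (begin
    E₂ * E₂ * (E₄ * E₄) * (φ * φ₋)
      ≈⟨ solve 4 (λ a b x y → a :* a :* (b :* b) :* (x :* y) := (x :* a) :* (y :* a) :* (b :* b)) ≈-refl E₂ E₄ φ φ₋ ⟩
    φ * E₂ * (φ₋ * E₂) * (E₄ * E₄)
      ≈⟨ *-congʳ (*-cong φ*E₂ φ₋*E₂) ⟩
    E₋ * E₋ * (E * E) * (E₄ * E₄)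
      ≈⟨ solve 3 (λ a b c → a :* a :* (b :* b) :* (c :* c) := (a :* b :* c) :* (a :* b :* c)) ≈-refl E₋ E E₄ ⟩
    E₋ * E * E₄ * (E₋ * E * E₄)
      ≈⟨ *-cong E₋*E*E₄ E₋*E*E₄ ⟩
    E₂ * (E₂ * E₂) * (E₂ * (E₂ * E₂))
      ≈⟨ solve 1 (λ a → a :* (a :* a) :* (a :* (a :* a)) := a :* a :* (a :* a :* (a :* a))) ≈-refl E₂ ⟩
    E₂ * E₂ * (E₂ * E₂ * (E₂ * E₂))
      ≈⟨ *-congˡ (*-cong dil₂φ₋*E₄ dil₂φ₋*E₄) ⟨
    E₂ * E₂ * (dil 1 φ₋ * E₄ * (dil 1 φ₋ * E₄))
      ≈⟨ solve 3 (λ a b x → a :* a :* (x :* b :* (x :* b)) := a :* a :* (b :* b) :* (x :* x)) ≈-refl E₂ E₄ (dil 1 φ₋) ⟩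
    E₂ * E₂ * (E₄ * E₄) * (dil 1 φ₋ * dil 1 φ₋) ∎)

  -- After q ↦ q² the left side is a difference of squares, and its two factors are `φ` and `φ₋` by
  -- the parity formulas.
  φ₋-square : dil 1 φ * dil 1 φ - const (+ 4) * (q * (dil 3 ψ * dil 3 ψ)) ≈ φ₋ * φ₋
  φ₋-square = dil-injective 1 (begin
    dil 1 (dil 1 φ * dil 1 φ - const (+ 4) * (q * (dil 3 ψ * dil 3 ψ)))
      ≈⟨ Dil2.σ-eval (v₀ :* v₀ :- con (+ 4) :* (v₁ :* (v₂ :* v₂))) (dil 1 φ ∷ q ∷ dil 3 ψ ∷ []) ⟩
    dil 1 (dil 1 φ) * dil 1 (dil 1 φ) - const (+ 4) * (dil 1 q * (dil 1 (dil 3 ψ) * dil 1 (dil 3 ψ)))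
      ≈⟨ +-cong (*-cong (dil₂∘dil₂ φ) (dil₂∘dil₂ φ)) (-‿cong (*-congˡ (*-cong dil₂-q (*-cong (dil₂∘dil₄ ψ) (dil₂∘dil₄ ψ))))) ⟩
    dil 3 φ * dil 3 φ - const (+ 4) * (q * q * (dil 7 ψ * dil 7 ψ))
      ≈⟨ solve 3 (λ x q y → x :* x :- con (+ 4) :* (q :* q :* (y :* y)) := (x :+ con (+ 2) :* (q :* y)) :* (x :- con (+ 2) :* (q :* y))) ≈-refl _ _ _ ⟩
    (dil 3 φ + const (+ 2) * (q * dil 7 ψ)) * (dil 3 φ - const (+ 2) * (q * dil 7 ψ))
      ≈⟨ *-cong φ-parity φ₋-parity ⟨
    φ * φ₋
      ≈⟨ φ*φ₋ ⟩
    dil 1 φ₋ * dil 1 φ₋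
      ≈⟨ Dil2.σ-* φ₋ φ₋ ⟨
    dil 1 (φ₋ * φ₋) ∎)

  φ-square : φ * φ ≈ dil 1 φ * dil 1 φ + const (+ 4) * (q * (dil 3 ψ * dil 3 ψ))
  φ-square = begin
    φ * φ
      ≈⟨ *-cong sgn-φ₋ sgn-φ₋ ⟨
    sgn φ₋ * sgn φ₋
      ≈⟨ Sgn.σ-* φ₋ φ₋ ⟨
    sgn (φ₋ * φ₋)
      ≈⟨ Sgn.σ-cong φ₋-square ⟨
    sgn (dil 1 φ * dil 1 φ - const (+ 4) * (q * (dil 3 ψ * dil 3 ψ)))
      ≈⟨ Sgn.σ-eval (v₀ :* v₀ :- con (+ 4) :* (v₁ :* (v₂ :* v₂))) (dil 1 φ ∷ q ∷ dil 3 ψ ∷ []) ⟩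
    sgn (dil 1 φ) * sgn (dil 1 φ) - const (+ 4) * (sgn q * (sgn (dil 3 ψ) * sgn (dil 3 ψ)))
      ≈⟨ +-cong (*-cong (sgn∘dil₂ φ) (sgn∘dil₂ φ)) (-‿cong (*-congˡ (*-cong sgn-q (*-cong (sgn∘dil₄ ψ) (sgn∘dil₄ ψ))))) ⟩
    dil 1 φ * dil 1 φ - const (+ 4) * ((- q) * (dil 3 ψ * dil 3 ψ))
      ≈⟨ solve 3 (λ x q y → x :- con (+ 4) :* ((:- q) :* y) := x :+ con (+ 4) :* (q :* y)) ≈-refl _ _ _ ⟩
    dil 1 φ * dil 1 φ + const (+ 4) * (q * (dil 3 ψ * dil 3 ψ)) ∎

  const*-cancel : ∀ c {f g} .{{_ : ℤ.NonZero c}} → const c * f ≈ const c * g → f ≈ g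
  const*-cancel c {f} {g} h = coeffwise λ n → ℤ.*-cancelˡ-≡ c _ _
    (≡.trans (≡.sym (coeff-const* c f n)) (≡.trans (coeff-≡ h n) (coeff-const* c g n)))

  -- Compares `φ-square` with the square of `φ-parity`: the pure squares cancel by `φ-square` at q²,
  -- and the cross term 4q φ(q⁴) ψ(q⁸) is left. This is the claim at q⁴, multiplied by 4q.
  ψ-square : ψ * ψ ≈ φ * dil 1 ψ
  ψ-square = dil-injective 3 (q*-cancel (const*-cancel (+ 4) (begin
    const (+ 4) * (q * dil 3 (ψ * ψ))
      ≈⟨ *-congˡ (*-congˡ (Dil4.σ-* ψ ψ)) ⟩
    const (+ 4) * (q * (dil 3 ψ * dil 3 ψ))
      ≈⟨ solve 2 (λ x y → y := (x :+ y) :- x) ≈-refl (dil 1 φ * dil 1 φ) _ ⟩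
    (dil 1 φ * dil 1 φ + const (+ 4) * (q * (dil 3 ψ * dil 3 ψ))) - dil 1 φ * dil 1 φ
      ≈⟨ +-cong (≈-sym φ-square) (-‿cong (≈-trans (≈-sym (Dil2.σ-* φ φ)) (Dil2.σ-cong φ-square))) ⟩
    φ * φ - dil 1 (dil 1 φ * dil 1 φ + const (+ 4) * (q * (dil 3 ψ * dil 3 ψ)))
      ≈⟨ +-cong (*-cong φ-parity φ-parity) (-‿cong (≈-trans
           (Dil2.σ-eval (v₀ :* v₀ :+ con (+ 4) :* (v₁ :* (v₂ :* v₂))) (dil 1 φ ∷ q ∷ dil 3 ψ ∷ []))
           (+-cong (*-cong (dil₂∘dil₂ φ) (dil₂∘dil₂ φ)) (*-congˡ (*-cong dil₂-q (*-cong (dil₂∘dil₄ ψ) (dil₂∘dil₄ ψ))))))) ⟩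
    (dil 3 φ + const (+ 2) * (q * dil 7 ψ)) * (dil 3 φ + const (+ 2) * (q * dil 7 ψ)) - (dil 3 φ * dil 3 φ + const (+ 4) * (q * q * (dil 7 ψ * dil 7 ψ)))
      ≈⟨ solve 3 (λ x q y → (x :+ con (+ 2) :* (q :* y)) :* (x :+ con (+ 2) :* (q :* y)) :- (x :* x :+ con (+ 4) :* (q :* q :* (y :* y)))
           := con (+ 4) :* (q :* (x :* y))) ≈-refl _ _ _ ⟩
    const (+ 4) * (q * (dil 3 φ * dil 7 ψ))
      ≈⟨ *-congˡ (*-congˡ (*-congˡ (≈-trans (≈-sym (dil₂∘dil₄ ψ)) dil₂₄))) ⟩
    const (+ 4) * (q * (dil 3 φ * dil 3 (dil 1 ψ)))
      ≈⟨ *-congˡ (*-congˡ (Dil4.σ-* φ (dil 1 ψ))) ⟨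
    const (+ 4) * (q * dil 3 (φ * dil 1 ψ)) ∎)))
    where
    dil₂₄ : dil 1 (dil 3 ψ) ≈ dil 3 (dil 1 ψ)
    dil₂₄ = ≈-trans (Dil2.σ-cong (≈-sym (dil₂∘dil₂ ψ))) (dil₂∘dil₂ (dil 1 ψ))

  -- Equations such as f(q)² = h(q²) f(q²) determine a series with constant term 1,
  -- since they express its n-th coefficient through those of index at most n/2.
  conv-low : ∀ n {δ g} → (∀ i → i ℕ.< n → δ i ≡ 0ℤ) → conv δ g n ≡ δ n ℤ.* g 0
  conv-low zero    h = ≡.refl
  conv-low (suc n) {δ} {g} h = ≡.trans (cong₂ (λ x y → x ℤ.* g (suc n) ℤ.+ y) (h 0 (s≤s z≤n)) (conv-low n (λ i i<n → h (suc i) (s≤s i<n))))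
    (ℤ.+-identityˡ _)

  -- f - g vanishes below index n and f + g has constant term 2, so the n-th coefficient of f² - g²
  -- is twice that of f - g.
  sqrt-[] : ∀ {n f g} → coeff f 0 ≡ 1ℤ → coeff g 0 ≡ 1ℤ → f ≈[ n ] g → f * f ≈[ suc n ] g * g → f ≈[ suc n ] g
  sqrt-[] {n} {f} {g} f₀ g₀ p r = below go
    where
    δ = f - g
    δ-< : ∀ i → i ℕ.< n → coeff δ i ≡ 0ℤ
    δ-< i i<n = ≡.trans (coeff-+ f (- g) i) (≡.trans (cong₂ ℤ._+_ (coeff-< p i i<n) (coeff-neg g i)) (ℤ.+-inverseʳ (coeff g i)))
    product : coeff (δ * (f + g)) n ≡ 0ℤ
    product = ≡.trans (coeff-≡ (solve 2 (λ f g → (f :- g) :* (f :+ g) := f :* f :- g :* g) ≈-refl f g) n)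
      (≡.trans (coeff-+ _ _ n) (≡.trans (cong₂ ℤ._+_ (coeff-< r n ℕ.≤-refl) (coeff-neg (g * g) n)) (ℤ.+-inverseʳ (coeff (g * g) n))))
    δₙ : coeff δ n ≡ 0ℤ
    δₙ = ℤ.*-cancelʳ-≡ (coeff δ n) 0ℤ (+ 2) (≡.trans (cong (coeff δ n ℤ.*_) (≡.sym (≡.trans (coeff-+ f g 0) (cong₂ ℤ._+_ f₀ g₀))))
      (≡.trans (≡.sym (conv-low n δ-<)) (≡.trans (≡.sym (coeff-* δ (f + g) n)) product)))
    go : ∀ i → i ℕ.< suc n → coeff f i ≡ coeff g i
    go i i<1+n with ℕ.m≤n⇒m<n∨m≡n (ℕ.≤-pred i<1+n)
    ... | inj₁ i<n    = coeff-< p i i<n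
    ... | inj₂ ≡.refl = ℤ.i-j≡0⇒i≡j _ _ (≡.trans (≡.sym (≡.trans (coeff-+ f (- g) n) (cong (λ z → coeff f n ℤ.+ z) (coeff-neg g n)))) δₙ)

  -- The constant terms agree, the tails agree modulo `qⁿ`, and q ↦ q² puts q² in front of them.
  -- From precision 0 nothing would be gained, hence the `suc n` of the hypothesis.
  dil₂-improves : ∀ {n f g} → f ≈[ suc n ] g → dil 1 f ≈[ suc (suc n) ] dil 1 g
  dil₂-improves {n} {f} {g} h = ≈[]-resp (dil-uncons 1 f) (dil-uncons 1 g)
    (+-cong-[] (≈⇒≈[] (const-cong (coeff-< h 0 (s≤s z≤n)))) (q*-cong-[] (q^*-cong-[] 1 (Dil2.cong-[] n (tail-cong-[] h)))))

  theta-pair-unique : ∀ {f g h k} → coeff f 0 ≡ 1ℤ → coeff g 0 ≡ 1ℤ → coeff h 0 ≡ 1ℤ → coeff k 0 ≡ 1ℤ →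
    f * f ≈ dil 1 g * dil 1 f → g * g ≈ dil 1 g * dil 1 g + const (+ 4) * (q * (dil 1 f * dil 1 f)) →
    h * h ≈ dil 1 k * dil 1 h → k * k ≈ dil 1 k * dil 1 k + const (+ 4) * (q * (dil 1 h * dil 1 h)) →
    f ≈ h × g ≈ k
  theta-pair-unique {f} {g} {h} {k} f₀ g₀ h₀ k₀ ef eg eh ek = ≈[]⇒≈ (λ n → ≈[]-mono (ℕ.n≤1+n n) (proj₁ (go n))) , ≈[]⇒≈ (λ n → ≈[]-mono (ℕ.n≤1+n n) (proj₂ (go n)))
    where
    heads : ∀ {x y} → coeff x 0 ≡ 1ℤ → coeff y 0 ≡ 1ℤ → x ≈[ 1 ] y
    heads x₀ y₀ = below λ { zero _ → ≡.trans x₀ (≡.sym y₀) ; (suc _) (s≤s ()) }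
    go : ∀ n → (f ≈[ suc n ] h) × (g ≈[ suc n ] k)
    go zero    = heads f₀ h₀ , heads g₀ k₀
    go (suc n) =
        sqrt-[] f₀ h₀ f≈h (≈[]-resp ef eh (*-cong-[] (dil₂-improves g≈k) (dil₂-improves f≈h)))
      , sqrt-[] g₀ k₀ g≈k (≈[]-resp eg ek (+-cong-[] (*-cong-[] (dil₂-improves g≈k) (dil₂-improves g≈k))
          (*-cong-[] ≈[]-refl (≈[]-mono (ℕ.n≤1+n _) (q*-cong-[] (*-cong-[] (dil₂-improves f≈h) (dil₂-improves f≈h)))))))
      where
      f≈h = proj₁ (go n)
      g≈k = proj₂ (go n)

  square-unique : ∀ {f g} h → coeff f 0 ≡ 1ℤ → coeff g 0 ≡ 1ℤ → f * f ≈ h * dil 1 f → g * g ≈ h * dil 1 g → f ≈ g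
  square-unique {f} {g} h f₀ g₀ ef eg = ≈[]⇒≈ λ n → ≈[]-mono (ℕ.n≤1+n n) (go n)
    where
    go : ∀ n → f ≈[ suc n ] g
    go zero    = below λ { zero _ → ≡.trans f₀ (≡.sym g₀) ; (suc _) (s≤s ()) }
    go (suc n) = sqrt-[] f₀ g₀ (go n) (≈[]-resp ef eg (*-cong-[] ≈[]-refl (dil₂-improves (go n))))

  sqrt-unique : ∀ {f g} → coeff f 0 ≡ 1ℤ → coeff g 0 ≡ 1ℤ → f * f ≈ g * g → f ≈ g
  sqrt-unique {f} {g} f₀ g₀ h = ≈[]⇒≈ go
    where
    go : ∀ n → f ≈[ n ] g
    go zero    = ≈[]-zero
    go (suc n) = sqrt-[] f₀ g₀ (go n) (≈⇒≈[] h)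

  theta₀ : ∀ {e s k≤e} → coeff (theta e s k≤e) 0 ≡ coeff (const (s 0) * q ^ e 0) 0
  theta₀ {e} {s} {k≤e} = ≡.trans (coeff-< (theta-≈[] e s k≤e 1 ℕ.≤-refl) 0 (s≤s z≤n)) (coeff-≡ (+-identityˡ _) 0)

  ψ₀ : coeff ψ 0 ≡ 1ℤ
  ψ₀ = ≡.trans theta₀ (≡.trans (coeff-≡ (*-identityˡ 1#) 0) (coeff-const-zero 1ℤ))

  φ₀ : coeff φ 0 ≡ 1ℤ
  φ₀ = ≡.trans (coeff-+ 1# _ 0) (≡.trans (cong₂ ℤ._+_ (coeff-const-zero 1ℤ) (≡.trans (coeff-const* (+ 2) _ 0) (cong (+ 2 ℤ.*_)
    (≡.trans theta₀ (≡.trans (coeff-const* 1ℤ _ 0) (cong (1ℤ ℤ.*_) (coeff-q^suc 0))))))) ≡.refl)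

  -- Gauss's product for `ψ` by uniqueness: E₂²/E satisfies the equation f² = φ(q) f(q²) of `ψ`,
  -- because of `E₋*E*E₄` and the product for `φ`, and has the same constant term.
  ψ*E : ψ * E ≈ E₂ * E₂
  ψ*E = begin
    ψ * E
      ≈⟨ *-congʳ (square-unique φ ψ₀ (coeff₀-*-one (coeff₀-*-one E₂₀ E₂₀) inv₀) ψ-square quotient-square) ⟩
    E₂ * E₂ * inv E * E
      ≈⟨ solve 3 (λ a i e → a :* i :* e := a :* (e :* i)) ≈-refl _ _ _ ⟩
    E₂ * E₂ * (E * inv E)
      ≈⟨ *-congˡ (*-inv E E₀) ⟩
    E₂ * E₂ * 1#
      ≈⟨ solve 1 (λ x → x :* con 1ℤ := x) ≈-refl _ ⟩
    E₂ * E₂ ∎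
    where
    inv₀ : coeff (inv E) 0 ≡ 1ℤ
    inv₀ = ≡.trans (≡.sym (ℤ.*-identityˡ _)) (≡.trans (cong (ℤ._* coeff (inv E) 0) (≡.sym E₀))
      (≡.trans (≡.sym (coeff₀-* E (inv E))) (≡.trans (coeff-≡ (*-inv E E₀) 0) (coeff-const-zero 1ℤ))))
    χ = E₂ * E₂ * inv E
    χ*E : χ * E ≈ E₂ * E₂
    χ*E = ≈-trans (solve 3 (λ a i e → a :* i :* e := (e :* i) :* a) ≈-refl _ _ _) (≈-trans (*-congʳ (*-inv E E₀)) (*-identityˡ _))
    quotient-square : χ * χ ≈ φ * dil 1 χ
    quotient-square = *-cancelˡ {E₂ * E₂ * (E * E)} (coeff₀-*-one (coeff₀-*-one E₂₀ E₂₀) (coeff₀-*-one E₀ E₀)) (begin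
      E₂ * E₂ * (E * E) * (χ * χ)
        ≈⟨ solve 3 (λ a e x → a :* a :* (e :* e) :* (x :* x) := a :* a :* ((x :* e) :* (x :* e))) ≈-refl E₂ E χ ⟩
      E₂ * E₂ * (χ * E * (χ * E))
        ≈⟨ *-congˡ (*-cong χ*E χ*E) ⟩
      E₂ * E₂ * (E₂ * E₂ * (E₂ * E₂))
        ≈⟨ solve 1 (λ a → a :* a :* (a :* a :* (a :* a)) := a :* (a :* a) :* (a :* (a :* a))) ≈-refl E₂ ⟩
      E₂ * (E₂ * E₂) * (E₂ * (E₂ * E₂))
        ≈⟨ *-cong E₋*E*E₄ E₋*E*E₄ ⟨
      E₋ * E * E₄ * (E₋ * E * E₄)
        ≈⟨ solve 3 (λ a b c → a :* b :* c :* (a :* b :* c) := (a :* a) :* (b :* b) :* (c :* c)) ≈-refl E₋ E E₄ ⟩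
      E₋ * E₋ * (E * E) * (E₄ * E₄)
        ≈⟨ *-cong (*-congʳ (≈-sym φ*E₂)) (*-cong (≈-sym (dil₂∘dil₂ E)) (≈-sym (dil₂∘dil₂ E))) ⟩
      φ * E₂ * (E * E) * (dil 1 E₂ * dil 1 E₂)
        ≈⟨ *-congˡ (≈-trans (≈-sym (Dil2.σ-* E₂ E₂)) (≈-trans (Dil2.σ-cong (≈-sym χ*E)) (Dil2.σ-* χ E))) ⟩
      φ * E₂ * (E * E) * (dil 1 χ * E₂)
        ≈⟨ solve 4 (λ a e x y → x :* a :* (e :* e) :* (y :* a) := a :* a :* (e :* e) :* (x :* y)) ≈-refl E₂ E φ (dil 1 χ) ⟩
      E₂ * E₂ * (E * E) * (φ * dil 1 χ) ∎)

  -- Dissections of products and of substituted series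

  module Product (a₀ a₁ a₂ a₃ a₄ b₀ b₁ b₂ b₃ b₄ : PowerSeries) where

    -- Classes i and j with i + j ≥ 5 carry: the surplus q⁵ becomes the factor `q` inside a dilated
    -- coefficient.
    class₀ class₁ class₂ class₃ class₄ : PowerSeries
    class₀ = a₀ * b₀ + q * (a₁ * b₄ + a₂ * b₃ + a₃ * b₂ + a₄ * b₁)
    class₁ = a₀ * b₁ + a₁ * b₀ + q * (a₂ * b₄ + a₃ * b₃ + a₄ * b₂)
    class₂ = a₀ * b₂ + a₁ * b₁ + a₂ * b₀ + q * (a₃ * b₄ + a₄ * b₃)
    class₃ = a₀ * b₃ + a₁ * b₂ + a₂ * b₁ + a₃ * b₀ + q * (a₄ * b₄)
    class₄ = a₀ * b₄ + a₁ * b₃ + a₂ * b₂ + a₃ * b₁ + a₄ * b₀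

    private
      ρ : Vec PowerSeries 11
      ρ = q ∷ a₀ ∷ a₁ ∷ a₂ ∷ a₃ ∷ a₄ ∷ b₀ ∷ b₁ ∷ b₂ ∷ b₃ ∷ b₄ ∷ []

      α β : Fin 5 → Polynomial 11
      α i = var (Fin.suc (i Fin.↑ˡ 5))
      β i = var (Fin.suc (5 Fin.↑ʳ i))

      e₀ e₁ e₂ e₃ e₄ : Polynomial 11
      e₀ = α (# 0) :* β (# 0) :+ v₀ :* (α (# 1) :* β (# 4) :+ α (# 2) :* β (# 3) :+ α (# 3) :* β (# 2) :+ α (# 4) :* β (# 1))
      e₁ = α (# 0) :* β (# 1) :+ α (# 1) :* β (# 0) :+ v₀ :* (α (# 2) :* β (# 4) :+ α (# 3) :* β (# 3) :+ α (# 4) :* β (# 2))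
      e₂ = α (# 0) :* β (# 2) :+ α (# 1) :* β (# 1) :+ α (# 2) :* β (# 0) :+ v₀ :* (α (# 3) :* β (# 4) :+ α (# 4) :* β (# 3))
      e₃ = α (# 0) :* β (# 3) :+ α (# 1) :* β (# 2) :+ α (# 2) :* β (# 1) :+ α (# 3) :* β (# 0) :+ v₀ :* (α (# 4) :* β (# 4))
      e₄ = α (# 0) :* β (# 4) :+ α (# 1) :* β (# 3) :+ α (# 2) :* β (# 2) :+ α (# 3) :* β (# 1) :+ α (# 4) :* β (# 0)

    dis-* : dis a₀ a₁ a₂ a₃ a₄ * dis b₀ b₁ b₂ b₃ b₄ ≈ dis class₀ class₁ class₂ class₃ class₄
    dis-* = ≈-trans
      (solve 11 (λ q a₀ a₁ a₂ a₃ a₄ b₀ b₁ b₂ b₃ b₄ →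
         (a₀ :+ q :* a₁ :+ q :* q :* a₂ :+ q :* (q :* q) :* a₃ :+ q :* (q :* (q :* q)) :* a₄)
         :* (b₀ :+ q :* b₁ :+ q :* q :* b₂ :+ q :* (q :* q) :* b₃ :+ q :* (q :* (q :* q)) :* b₄)
         := (a₀ :* b₀ :+ q :* (q :* (q :* (q :* q))) :* (a₁ :* b₄ :+ a₂ :* b₃ :+ a₃ :* b₂ :+ a₄ :* b₁))
         :+ q :* (a₀ :* b₁ :+ a₁ :* b₀ :+ q :* (q :* (q :* (q :* q))) :* (a₂ :* b₄ :+ a₃ :* b₃ :+ a₄ :* b₂))
         :+ q :* q :* (a₀ :* b₂ :+ a₁ :* b₁ :+ a₂ :* b₀ :+ q :* (q :* (q :* (q :* q))) :* (a₃ :* b₄ :+ a₄ :* b₃))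
         :+ q :* (q :* q) :* (a₀ :* b₃ :+ a₁ :* b₂ :+ a₂ :* b₁ :+ a₃ :* b₀ :+ q :* (q :* (q :* (q :* q))) :* (a₄ :* b₄))
         :+ q :* (q :* (q :* q)) :* (a₀ :* b₄ :+ a₁ :* b₃ :+ a₂ :* b₂ :+ a₃ :* b₁ :+ a₄ :* b₀))
         ≈-refl q (d a₀) (d a₁) (d a₂) (d a₃) (d a₄) (d b₀) (d b₁) (d b₂) (d b₃) (d b₄))
      (≈-sym (+-cong (+-cong (+-cong (+-cong
        (≈-trans (D.σ-eval e₀ ρ) (+-congˡ (*-congʳ d-q)))
        (*-congˡ (≈-trans (D.σ-eval e₁ ρ) (+-congˡ (*-congʳ d-q)))))
        (*-congˡ (≈-trans (D.σ-eval e₂ ρ) (+-congˡ (*-congʳ d-q)))))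
        (*-congˡ (≈-trans (D.σ-eval e₃ ρ) (+-congˡ (*-congʳ d-q)))))
        (*-congˡ (D.σ-eval e₄ ρ))))

  module _ {a₀ a₁ a₂ a₃ a₄ b₀ b₁ b₂ b₃ b₄ : PowerSeries} (h : dis a₀ a₁ a₂ a₃ a₄ ≈ dis b₀ b₁ b₂ b₃ b₄) where

    dis-injective₀ : a₀ ≈ b₀
    dis-injective₀ = ≈-trans (≈-sym comp₀-dis) (≈-trans (comp-cong 0 h) comp₀-dis)

    dis-injective₁ : a₁ ≈ b₁
    dis-injective₁ = ≈-trans (≈-sym comp₁-dis) (≈-trans (comp-cong 1 h) comp₁-dis)

    dis-injective₂ : a₂ ≈ b₂
    dis-injective₂ = ≈-trans (≈-sym comp₂-dis) (≈-trans (comp-cong 2 h) comp₂-dis)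

    dis-injective₄ : a₄ ≈ b₄
    dis-injective₄ = ≈-trans (≈-sym comp₄-dis) (≈-trans (comp-cong 4 h) comp₄-dis)

  dis-*-≈ : ∀ {f g a₀ a₁ a₂ a₃ a₄ b₀ b₁ b₂ b₃ b₄} → f ≈ dis a₀ a₁ a₂ a₃ a₄ → g ≈ dis b₀ b₁ b₂ b₃ b₄ →
    let open Product a₀ a₁ a₂ a₃ a₄ b₀ b₁ b₂ b₃ b₄ in f * g ≈ dis class₀ class₁ class₂ class₃ class₄
  dis-*-≈ {a₀ = a₀} {a₁} {a₂} {a₃} {a₄} {b₀} {b₁} {b₂} {b₃} {b₄} p r =
    ≈-trans (*-cong p r) (Product.dis-* a₀ a₁ a₂ a₃ a₄ b₀ b₁ b₂ b₃ b₄)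

  same : ∀ {f g x y} → f ≈ g → f ≈ x → g ≈ y → x ≈ y
  same h p r = ≈-trans (≈-sym p) (≈-trans h r)

  dis-sgn : ∀ {f a₀ a₁ a₂ a₃ a₄} → f ≈ dis a₀ a₁ a₂ a₃ a₄ → sgn f ≈ dis (sgn a₀) (- sgn a₁) (sgn a₂) (- sgn a₃) (sgn a₄)
  dis-sgn {f} {a₀} {a₁} {a₂} {a₃} {a₄} h = begin
    sgn f
      ≈⟨ Sgn.σ-cong h ⟩
    sgn (dis a₀ a₁ a₂ a₃ a₄)
      ≈⟨ Sgn.σ-eval {6} (v₁ :+ v₀ :* v₂ :+ v₀ :* v₀ :* v₃ :+ v₀ :* (v₀ :* v₀) :* var (# 4) :+ v₀ :* (v₀ :* (v₀ :* v₀)) :* var (# 5))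
           (q ∷ d a₀ ∷ d a₁ ∷ d a₂ ∷ d a₃ ∷ d a₄ ∷ []) ⟩
    _ ≈⟨ +-cong (+-cong (+-cong (+-cong (≈-sym (d∘sgn a₀)) (*-cong sgn-q (≈-sym (d∘sgn a₁))))
           (*-cong (*-cong sgn-q sgn-q) (≈-sym (d∘sgn a₂)))) (*-cong (*-cong sgn-q (*-cong sgn-q sgn-q)) (≈-sym (d∘sgn a₃))))
           (*-cong (*-cong sgn-q (*-cong sgn-q (*-cong sgn-q sgn-q))) (≈-sym (d∘sgn a₄))) ⟩
    _ ≈⟨ solve 6 (λ q a b c e f → a :+ (:- q) :* b :+ (:- q) :* (:- q) :* c :+ (:- q) :* ((:- q) :* (:- q)) :* e :+ (:- q) :* ((:- q) :* ((:- q) :* (:- q))) :* f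
           := a :+ q :* (:- b) :+ q :* q :* c :+ q :* (q :* q) :* (:- e) :+ q :* (q :* (q :* q)) :* f)
           ≈-refl q (d (sgn a₀)) (d (sgn a₁)) (d (sgn a₂)) (d (sgn a₃)) (d (sgn a₄)) ⟩
    _ ≈⟨ +-congʳ (+-cong (+-congʳ (+-congˡ (*-congˡ (D.σ-neg (sgn a₁))))) (*-congˡ (D.σ-neg (sgn a₃)))) ⟨
    dis (sgn a₀) (- sgn a₁) (sgn a₂) (- sgn a₃) (sgn a₄) ∎

  -- Class i moves to 2i modulo 5; 6 = 1 + 5 and 8 = 3 + 5 carry a q⁵, which is the factor `q`
  -- beside `a₃` and `a₄`.
  dis-dil₂ : ∀ {f a₀ a₁ a₂ a₃ a₄} → f ≈ dis a₀ a₁ a₂ a₃ a₄ →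
    dil 1 f ≈ dis (dil 1 a₀) (q * dil 1 a₃) (dil 1 a₁) (q * dil 1 a₄) (dil 1 a₂)
  dis-dil₂ {f} {a₀} {a₁} {a₂} {a₃} {a₄} h = begin
    dil 1 f
      ≈⟨ Dil2.σ-cong h ⟩
    dil 1 (dis a₀ a₁ a₂ a₃ a₄)
      ≈⟨ Dil2.σ-eval {6} (v₁ :+ v₀ :* v₂ :+ v₀ :* v₀ :* v₃ :+ v₀ :* (v₀ :* v₀) :* var (# 4) :+ v₀ :* (v₀ :* (v₀ :* v₀)) :* var (# 5))
           (q ∷ d a₀ ∷ d a₁ ∷ d a₂ ∷ d a₃ ∷ d a₄ ∷ []) ⟩
    _ ≈⟨ +-cong (+-cong (+-cong (+-cong (≈-sym (d∘dil₂ a₀)) (*-cong dil₂-q (≈-sym (d∘dil₂ a₁))))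
           (*-cong (*-cong dil₂-q dil₂-q) (≈-sym (d∘dil₂ a₂)))) (*-cong (*-cong dil₂-q (*-cong dil₂-q dil₂-q)) (≈-sym (d∘dil₂ a₃))))
           (*-cong (*-cong dil₂-q (*-cong dil₂-q (*-cong dil₂-q dil₂-q))) (≈-sym (d∘dil₂ a₄))) ⟩
    _ ≈⟨ solve 6 (λ q a b c e f → a :+ q :* q :* b :+ (q :* q) :* (q :* q) :* c :+ (q :* q) :* ((q :* q) :* (q :* q)) :* e :+ (q :* q) :* ((q :* q) :* ((q :* q) :* (q :* q))) :* f
           := a :+ q :* (q :* (q :* (q :* (q :* q))) :* e) :+ q :* q :* b :+ q :* (q :* q) :* (q :* (q :* (q :* (q :* q))) :* f) :+ q :* (q :* (q :* q)) :* c)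
           ≈-refl q (d (dil 1 a₀)) (d (dil 1 a₁)) (d (dil 1 a₂)) (d (dil 1 a₃)) (d (dil 1 a₄)) ⟩
    _ ≈⟨ +-congʳ (+-cong (+-congʳ (+-congˡ (*-congˡ (≈-trans (D.σ-* q _) (*-congʳ d-q)))))
           (*-congˡ (≈-trans (D.σ-* q _) (*-congʳ d-q)))) ⟨
    dis (dil 1 a₀) (q * dil 1 a₃) (dil 1 a₁) (q * dil 1 a₄) (dil 1 a₂) ∎

  -0≈0 : - 0# ≈ 0#
  -0≈0 = solve 0 (:- con 0ℤ := con 0ℤ) ≈-refl

  q*0≈0 : ∀ {x} → x ≈ 0# → q * x ≈ 0#
  q*0≈0 h = ≈-trans (*-congˡ h) (zeroʳ q)

  φ₋-dis : φ₋ ≈ dis (d φ₋) (- sgn φa) 0# 0# (sgn φb)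
  φ₋-dis = ≈-trans (≈-sym sgn-φ) (≈-trans (dis-sgn φ-dis) (dis-cong
    (≈-trans (≈-sym (d∘sgn φ)) (D.σ-cong sgn-φ)) ≈-refl (Sgn.σ-const 0ℤ) (≈-trans (-‿cong (Sgn.σ-const 0ℤ)) -0≈0) ≈-refl))
    where
    sgn-φ : sgn φ ≈ φ₋
    sgn-φ = ≈-trans (Sgn.σ-cong (≈-sym sgn-φ₋)) (sgn∘sgn φ₋)

  E₂-dis : E₂ ≈ dis (dil 1 j₀) 0# (- d E₂) 0# (dil 1 j₂)
  E₂-dis = ≈-trans (dis-dil₂ E-dis) (dis-cong ≈-refl (q*0≈0 (Dil2.σ-const 0ℤ))
    (≈-trans (Dil2.σ-neg (d E)) (-‿cong (≈-sym (d∘dil₂ E)))) (q*0≈0 (Dil2.σ-const 0ℤ)) ≈-refl)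

  E₄-dis : E₄ ≈ dis (dil 1 (dil 1 j₀)) 0# 0# (q * dil 1 (dil 1 j₂)) (- d E₄)
  E₄-dis = ≈-trans (≈-sym (dil₂∘dil₂ E)) (≈-trans (dis-dil₂ E₂-dis) (dis-cong ≈-refl (q*0≈0 (Dil2.σ-const 0ℤ)) (Dil2.σ-const 0ℤ) ≈-refl
    (≈-trans (Dil2.σ-neg (d E₂)) (-‿cong (≈-trans (≈-sym (d∘dil₂ E₂)) (D.σ-cong (dil₂∘dil₂ E)))))))

  E₋-dis : E₋ ≈ dis (sgn j₀) (d E₋) (sgn j₂) 0# 0#
  E₋-dis = ≈-trans (dis-sgn E-dis) (dis-cong ≈-refl
    (≈-trans (-‿cong (≈-trans (Sgn.σ-neg (d E)) (-‿cong (≈-sym (d∘sgn E))))) (solve 1 (λ x → :- (:- x) := x) ≈-refl (d E₋)))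
    ≈-refl (≈-trans (-‿cong (Sgn.σ-const 0ℤ)) -0≈0) (Sgn.σ-const 0ℤ))

  coeff₀-d : ∀ {f} → coeff f 0 ≡ 1ℤ → coeff (d f) 0 ≡ 1ℤ
  coeff₀-d {f} h = ≡.trans (coeff₀-dil 4 f) h

  dE₀ : coeff (d E) 0 ≡ 1ℤ
  dE₀ = coeff₀-d E₀

  coeff₀-dis : ∀ {f a₀ a₁ a₂ a₃ a₄} → f ≈ dis a₀ a₁ a₂ a₃ a₄ → coeff f 0 ≡ coeff a₀ 0
  coeff₀-dis h = ≡.trans (coeff-≡ h 0) (coeff-dis _ _ _ _ _ 0)

  j₀₀ : coeff j₀ 0 ≡ 1ℤ
  j₀₀ = ≡.trans (≡.sym (coeff₀-dis E-dis)) E₀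

  dφ₋*dE₂ : d φ₋ * d E₂ ≈ d E * d E
  dφ₋*dE₂ = ≈-trans (≈-sym (D.σ-* φ₋ E₂)) (≈-trans (D.σ-cong φ₋*E₂) (D.σ-* E E))

  -- n ≡ 2 (mod 5) in E² = φ(-q) E(q²): on the right 12n + 1 = k² + 12 l² forces 5 ∣ k, l.
  j₀*j₂ : j₀ * j₂ ≈ - (d E * d E)
  j₀*j₂ = const*-cancel (+ 2) (begin
    const (+ 2) * (j₀ * j₂)
      ≈⟨ solve 3 (λ x y e → con (+ 2) :* (x :* y) := (x :* y :+ (:- e) :* (:- e) :+ y :* x :+ e :* (con 0ℤ :* con 0ℤ :+ con 0ℤ :* con 0ℤ)) :- e :* e) ≈-refl j₀ j₂ (d E) ⟩
    (j₀ * j₂ + (- d E) * (- d E) + j₂ * j₀ + d E * (0# * 0# + 0# * 0#)) - d E * d E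
      ≈⟨ +-congʳ (+-congˡ (solve 2 (λ e q → e :* (con 0ℤ :* con 0ℤ :+ con 0ℤ :* con 0ℤ) := q :* (con 0ℤ :* con 0ℤ :+ con 0ℤ :* con 0ℤ)) ≈-refl (d E) q)) ⟩
    (j₀ * j₂ + (- d E) * (- d E) + j₂ * j₀ + q * (0# * 0# + 0# * 0#)) - d E * d E
      ≈⟨ +-congʳ (dis-injective₂ (same φ₋*E₂ (dis-*-≈ φ₋-dis E₂-dis) (dis-*-≈ E-dis E-dis))) ⟨
    (d φ₋ * (- d E₂) + (- sgn φa) * 0# + 0# * dil 1 j₀ + q * (0# * dil 1 j₂ + sgn φb * 0#)) - d E * d E
      ≈⟨ solve 8 (λ x y a b c e f q → (x :* (:- y) :+ (:- a) :* con 0ℤ :+ con 0ℤ :* c :+ q :* (con 0ℤ :* e :+ b :* con 0ℤ)) :- f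
           := :- (x :* y) :- f) ≈-refl (d φ₋) (d E₂) (sgn φa) (sgn φb) (dil 1 j₀) (dil 1 j₂) (d E * d E) q ⟩
    - (d φ₋ * d E₂) - d E * d E
      ≈⟨ +-congʳ (-‿cong dφ₋*dE₂) ⟩
    - (d E * d E) - d E * d E
      ≈⟨ solve 1 (λ x → :- x :- x := con (+ 2) :* (:- x)) ≈-refl (d E * d E) ⟩
    const (+ 2) * (- (d E * d E)) ∎)

  -- The Rogers-Ramanujan quotient

  -- R is q^(1/5) over the Rogers-Ramanujan continued fraction, and r its reciprocal.
  opaque
    R r : PowerSeries
    R = j₀ * inv (d E)
    r = d E * inv j₀

    R*dE : R * d E ≈ j₀
    R*dE = ≈-trans (solve 3 (λ j i e → j :* i :* e := (e :* i) :* j) ≈-refl j₀ (inv (d E)) (d E)) (≈-trans (*-congʳ (*-inv (d E) dE₀)) (*-identityˡ j₀))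

    R*r : R * r ≈ 1#
    R*r = ≈-trans (solve 4 (λ j i e k → j :* i :* (e :* k) := (e :* i) :* (j :* k)) ≈-refl j₀ (inv (d E)) (d E) (inv j₀))
      (≈-trans (*-cong (*-inv (d E) dE₀) (*-inv j₀ j₀₀)) (*-identityˡ 1#))

  R₀ : coeff R 0 ≡ 1ℤ
  R₀ = ≡.trans (≡.trans (≡.sym (ℤ.*-identityʳ _)) (cong (coeff R 0 ℤ.*_) (≡.sym dE₀))) (≡.trans (≡.sym (coeff₀-* R (d E))) (≡.trans (coeff-≡ R*dE 0) j₀₀))

  r*dE : - (r * d E) ≈ j₂
  r*dE = *-cancelˡ j₀₀ (begin
    j₀ * (- (r * d E))         ≈⟨ *-congʳ R*dE ⟨
    R * d E * (- (r * d E))    ≈⟨ solve 3 (λ R r e → R :* e :* (:- (r :* e)) := R :* r :* (:- (e :* e))) ≈-refl R r (d E) ⟩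
    R * r * (- (d E * d E))    ≈⟨ *-congʳ R*r ⟩
    1# * (- (d E * d E))       ≈⟨ *-identityˡ _ ⟩
    - (d E * d E)              ≈⟨ j₀*j₂ ⟨
    j₀ * j₂                    ∎)

  E-dis-R : E ≈ dis (R * d E) (- d E) (- (r * d E)) 0# 0#
  E-dis-R = ≈-trans E-dis (dis-cong (≈-sym R*dE) ≈-refl (≈-sym r*dE) ≈-refl ≈-refl)

  -- The 5-dissections of ψ(q²) and φ(q)

  P Y A B : PowerSeries
  P = dil 1 ψ
  Y = q * d P
  A = dil 1 A₁
  B = dil 1 B₁

  P₀ : coeff P 0 ≡ 1ℤ
  P₀ = ≡.trans (coeff₀-dil 1 ψ) ψ₀

  P-dis : P ≈ dis A Y B 0# 0#
  P-dis = ≈-trans (dis-dil₂ ψ-dis) (dis-cong ≈-refl (*-congˡ (≈-sym (d∘dil₂ ψ))) ≈-refl (q*0≈0 (Dil2.σ-const 0ℤ)) (Dil2.σ-const 0ℤ))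

  ψ₋-dis : sgn ψ ≈ dis (sgn A₁) (- sgn B₁) 0# (- d (sgn ψ)) 0#
  ψ₋-dis = ≈-trans (dis-sgn ψ-dis) (dis-cong ≈-refl ≈-refl (Sgn.σ-const 0ℤ) (-‿cong (≈-sym (d∘sgn ψ))) (Sgn.σ-const 0ℤ))

  dil₂φ₋-dis : dil 1 φ₋ ≈ dis (d (dil 1 φ₋)) 0# (dil 1 (- sgn φa)) (q * dil 1 (sgn φb)) 0#
  dil₂φ₋-dis = ≈-trans (dis-dil₂ φ₋-dis) (dis-cong (≈-sym (d∘dil₂ φ₋)) (q*0≈0 (Dil2.σ-const 0ℤ)) ≈-refl ≈-refl (Dil2.σ-const 0ℤ))

  E₋₀ : coeff E₋ 0 ≡ 1ℤ
  E₋₀ = ≡.trans (coeff-sgn-zero E) E₀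

  P*E₂ : P * E₂ ≈ E₄ * E₄
  P*E₂ = ≈-trans (≈-sym (Dil2.σ-* ψ E)) (≈-trans (Dil2.σ-cong ψ*E) (≈-trans (Dil2.σ-* E₂ E₂) (*-cong (dil₂∘dil₂ E) (dil₂∘dil₂ E))))

  ψ₋*E₋ : sgn ψ * E₋ ≈ E₂ * E₂
  ψ₋*E₋ = ≈-trans (≈-sym (Sgn.σ-* ψ E)) (≈-trans (Sgn.σ-cong ψ*E) (≈-trans (Sgn.σ-* E₂ E₂) (*-cong (sgn∘dil₂ E) (sgn∘dil₂ E))))

  -- Of the many ways to write this product, this one is taken for the quadratic form of its right
  -- side, on which `R*B-r*A` relies; `E*φ` serves `R*a-qr*b` in the same way.
  P*E : P * E ≈ sgn ψ * E₄
  P*E = *-cancelˡ (coeff₀-*-one E₂₀ E₋₀) (begin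
    E₂ * E₋ * (P * E)          ≈⟨ solve 4 (λ a b x y → a :* b :* (x :* y) := (x :* a) :* (b :* y)) ≈-refl E₂ E₋ P E ⟩
    P * E₂ * (E₋ * E)          ≈⟨ *-congʳ P*E₂ ⟩
    E₄ * E₄ * (E₋ * E)         ≈⟨ solve 3 (λ a b c → a :* a :* (b :* c) := a :* (b :* c :* a)) ≈-refl E₄ E₋ E ⟩
    E₄ * (E₋ * E * E₄)         ≈⟨ *-congˡ E₋*E*E₄ ⟩
    E₄ * (E₂ * (E₂ * E₂))      ≈⟨ *-congˡ (*-congˡ ψ₋*E₋) ⟨
    E₄ * (E₂ * (sgn ψ * E₋))   ≈⟨ solve 4 (λ a b c x → a :* (b :* (x :* c)) := b :* c :* (x :* a)) ≈-refl E₄ E₂ E₋ (sgn ψ) ⟩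
    E₂ * E₋ * (sgn ψ * E₄)     ∎)

  E*φ : E * φ ≈ E₋ * dil 1 φ₋
  E*φ = *-cancelˡ (coeff₀-*-one E₂₀ E₄₀) (begin
    E₂ * E₄ * (E * φ)          ≈⟨ solve 4 (λ a b x y → a :* b :* (x :* y) := x :* b :* (y :* a)) ≈-refl E₂ E₄ E φ ⟩
    E * E₄ * (φ * E₂)          ≈⟨ *-congˡ φ*E₂ ⟩
    E * E₄ * (E₋ * E₋)         ≈⟨ solve 3 (λ a b c → a :* b :* (c :* c) := c :* (c :* a :* b)) ≈-refl E E₄ E₋ ⟩
    E₋ * (E₋ * E * E₄)         ≈⟨ *-congˡ E₋*E*E₄ ⟩
    E₋ * (E₂ * (E₂ * E₂))      ≈⟨ *-congˡ (*-congˡ dil₂φ₋*E₄) ⟨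
    E₋ * (E₂ * (dil 1 φ₋ * E₄)) ≈⟨ solve 4 (λ a b c x → a :* (b :* (x :* c)) := b :* c :* (a :* x)) ≈-refl E₋ E₂ E₄ (dil 1 φ₋) ⟩
    E₂ * E₄ * (E₋ * dil 1 φ₋)  ∎)

  -- n ≡ 2 (mod 5) in ψ(q²) E(q) = ψ(-q) E(q⁴): on the right 24n + 7 = 3k² + 4l² forces 5 ∣ k, l.
  R*B-r*A : R * B - r * A ≈ const (+ 2) * Y
  R*B-r*A = *-cancelˡ dE₀ (begin
    d E * (R * B - r * A)
      ≈⟨ solve 7 (λ e R r A B Y q → e :* (R :* B :- r :* A)
           := (A :* (:- (r :* e)) :+ Y :* (:- e) :+ B :* (R :* e) :+ q :* (con 0ℤ :* con 0ℤ :+ con 0ℤ :* con 0ℤ)) :+ e :* Y) ≈-refl (d E) R r A B Y q ⟩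
    (A * (- (r * d E)) + Y * (- d E) + B * (R * d E) + q * (0# * 0# + 0# * 0#)) + d E * Y
      ≈⟨ +-congʳ (dis-injective₂ (same P*E (dis-*-≈ P-dis E-dis-R) (dis-*-≈ ψ₋-dis E₄-dis))) ⟩
    (sgn A₁ * 0# + (- sgn B₁) * 0# + 0# * dil 1 (dil 1 j₀) + q * ((- d (sgn ψ)) * (- d E₄) + 0# * (q * dil 1 (dil 1 j₂)))) + d E * Y
      ≈⟨ +-congʳ (solve 7 (λ q a b j x y k → a :* con 0ℤ :+ (:- b) :* con 0ℤ :+ con 0ℤ :* j :+ q :* ((:- x) :* (:- y) :+ con 0ℤ :* (q :* k)) := q :* (x :* y))
           ≈-refl q (sgn A₁) (sgn B₁) (dil 1 (dil 1 j₀)) (d (sgn ψ)) (d E₄) (dil 1 (dil 1 j₂))) ⟩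
    q * (d (sgn ψ) * d E₄) + d E * Y
      ≈⟨ +-congʳ (*-congˡ (≈-trans (≈-sym (D.σ-* (sgn ψ) E₄)) (≈-trans (D.σ-cong (≈-sym P*E)) (D.σ-* P E)))) ⟩
    q * (d P * d E) + d E * Y
      ≈⟨ solve 3 (λ q p e → q :* (p :* e) :+ e :* (q :* p) := e :* (con (+ 2) :* (q :* p))) ≈-refl q (d P) (d E) ⟩
    d E * (const (+ 2) * Y) ∎)

  -- n ≡ 1 (mod 5) in E(q) φ(q) = E(-q) φ(-q²): on the right 24n + 1 = k² + 48l² forces 5 ∣ k, l.
  R*a-qr*b : R * φa - q * (r * φb) ≈ const (+ 2) * d φ
  R*a-qr*b = *-cancelˡ dE₀ (begin
    d E * (R * φa - q * (r * φb))
      ≈⟨ solve 7 (λ e R r a b f q → e :* (R :* a :- q :* (r :* b))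
           := (R :* e :* a :+ (:- e) :* f :+ q :* ((:- (r :* e)) :* b :+ con 0ℤ :* con 0ℤ :+ con 0ℤ :* con 0ℤ)) :+ e :* f) ≈-refl (d E) R r φa φb (d φ) q ⟩
    (R * d E * φa + (- d E) * d φ + q * ((- (r * d E)) * φb + 0# * 0# + 0# * 0#)) + d E * d φ
      ≈⟨ +-congʳ (dis-injective₁ (same E*φ (dis-*-≈ E-dis-R φ-dis) (dis-*-≈ E₋-dis dil₂φ₋-dis))) ⟩
    (sgn j₀ * 0# + d E₋ * d (dil 1 φ₋) + q * (sgn j₂ * 0# + 0# * (q * dil 1 (sgn φb)) + 0# * dil 1 (- sgn φa))) + d E * d φ
      ≈⟨ +-congʳ (solve 7 (λ q j x y k a b → j :* con 0ℤ :+ x :* y :+ q :* (k :* con 0ℤ :+ con 0ℤ :* (q :* b) :+ con 0ℤ :* a) := x :* y)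
           ≈-refl q (sgn j₀) (d E₋) (d (dil 1 φ₋)) (sgn j₂) (dil 1 (- sgn φa)) (dil 1 (sgn φb))) ⟩
    d E₋ * d (dil 1 φ₋) + d E * d φ
      ≈⟨ +-congʳ (≈-trans (≈-sym (D.σ-* E₋ (dil 1 φ₋))) (≈-trans (D.σ-cong (≈-sym E*φ)) (D.σ-* E φ))) ⟩
    d E * d φ + d E * d φ
      ≈⟨ solve 2 (λ e f → e :* f :+ e :* f := e :* (con (+ 2) :* f)) ≈-refl (d E) (d φ) ⟩
    d E * (const (+ 2) * d φ) ∎)

  -- Each of the two linear relations leaves one unknown: `Ψ` is the mean of `R * B` and `r * A`,
  -- and `Φ` is the mean of `R * φa` and `q * (r * φb)`.
  Ψ Φ : PowerSeries
  Ψ = R * B - Y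
  Φ = R * φa - d φ

  A≈ : A ≈ R * (Ψ - Y)
  A≈ = begin
    A                                   ≈⟨ *-identityˡ A ⟨
    1# * A                              ≈⟨ *-congʳ R*r ⟨
    R * r * A                           ≈⟨ solve 5 (λ R r A B Y → R :* r :* A := R :* ((R :* B :- Y) :- Y) :- R :* ((R :* B :- r :* A) :- con (+ 2) :* Y)) ≈-refl R r A B Y ⟩
    R * (Ψ - Y) - R * ((R * B - r * A) - const (+ 2) * Y)
                                        ≈⟨ +-congˡ (-‿cong (*-congˡ (≈-trans (+-congʳ R*B-r*A) (-‿inverseʳ _)))) ⟩
    R * (Ψ - Y) - R * 0#                ≈⟨ solve 2 (λ x y → x :- y :* con 0ℤ := x) ≈-refl (R * (Ψ - Y)) R ⟩
    R * (Ψ - Y)                         ∎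

  B≈ : B ≈ r * (Ψ + Y)
  B≈ = begin
    B               ≈⟨ *-identityˡ B ⟨
    1# * B          ≈⟨ *-congʳ R*r ⟨
    R * r * B       ≈⟨ solve 4 (λ R r B Y → R :* r :* B := r :* (R :* B :- Y :+ Y)) ≈-refl R r B Y ⟩
    r * (Ψ + Y)     ∎

  φa≈ : φa ≈ r * (Φ + d φ)
  φa≈ = begin
    φa              ≈⟨ *-identityˡ φa ⟨
    1# * φa         ≈⟨ *-congʳ R*r ⟨
    R * r * φa      ≈⟨ solve 4 (λ R r B Y → R :* r :* B := r :* (R :* B :- Y :+ Y)) ≈-refl R r φa (d φ) ⟩
    r * (Φ + d φ)   ∎

  q*φb≈ : q * φb ≈ R * (Φ - d φ)
  q*φb≈ = begin
    q * φb                              ≈⟨ *-identityˡ _ ⟨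
    1# * (q * φb)                       ≈⟨ *-congʳ R*r ⟨
    R * r * (q * φb)                    ≈⟨ solve 6 (λ R r q a b f → R :* r :* (q :* b) := R :* ((R :* a :- f) :- f) :- R :* ((R :* a :- q :* (r :* b)) :- con (+ 2) :* f)) ≈-refl R r q φa φb (d φ) ⟩
    R * (Φ - d φ) - R * ((R * φa - q * (r * φb)) - const (+ 2) * d φ)
                                        ≈⟨ +-congˡ (-‿cong (*-congˡ (≈-trans (+-congʳ R*a-qr*b) (-‿inverseʳ _)))) ⟩
    R * (Φ - d φ) - R * 0#              ≈⟨ solve 2 (λ x y → x :- y :* con 0ℤ := x) ≈-refl (R * (Φ - d φ)) R ⟩
    R * (Φ - d φ)                       ∎

  dψ-square : d ψ * d ψ ≈ d φ * d P
  dψ-square = ≈-trans (≈-sym (D.σ-* ψ ψ)) (≈-trans (D.σ-cong ψ-square) (D.σ-* φ P))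

  -- n ≡ 1 (mod 5) in φ(q) ψ(q²) = ψ(q)².
  Φ*Ψ : Φ * Ψ ≈ A₁ * B₁ + d φ * Y
  Φ*Ψ = const*-cancel (+ 2) (begin
    const (+ 2) * (Φ * Ψ)
      ≈⟨ solve 4 (λ F G f Y → con (+ 2) :* (F :* G) := con 1ℤ :* ((F :+ f) :* (G :- Y)) :+ con 1ℤ :* ((F :- f) :* (G :+ Y)) :+ con (+ 2) :* (f :* Y)) ≈-refl Φ Ψ (d φ) Y ⟩
    1# * ((Φ + d φ) * (Ψ - Y)) + 1# * ((Φ - d φ) * (Ψ + Y)) + const (+ 2) * (d φ * Y)
      ≈⟨ +-congʳ (+-cong (*-congʳ (≈-sym R*r)) (*-congʳ (≈-sym R*r))) ⟩
    R * r * ((Φ + d φ) * (Ψ - Y)) + R * r * ((Φ - d φ) * (Ψ + Y)) + const (+ 2) * (d φ * Y)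
      ≈⟨ +-congʳ (+-cong (regroup _ _) (regroup′ _ _)) ⟩
    r * (Φ + d φ) * (R * (Ψ - Y)) + R * (Φ - d φ) * (r * (Ψ + Y)) + const (+ 2) * (d φ * Y)
      ≈⟨ +-congʳ (+-cong (*-cong φa≈ A≈) (*-cong q*φb≈ B≈)) ⟨
    φa * A + q * φb * B + const (+ 2) * (d φ * Y)
      ≈⟨ solve 7 (λ q a b A B f Y → a :* A :+ q :* b :* B :+ con (+ 2) :* (f :* Y)
           := (f :* Y :+ a :* A :+ q :* (con 0ℤ :* con 0ℤ :+ con 0ℤ :* con 0ℤ :+ b :* B)) :+ f :* Y) ≈-refl q φa φb A B (d φ) Y ⟩
    (d φ * Y + φa * A + q * (0# * 0# + 0# * 0# + φb * B)) + d φ * Y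
      ≈⟨ +-congʳ (dis-injective₁ (same ψ-square (dis-*-≈ ψ-dis ψ-dis) (dis-*-≈ φ-dis P-dis))) ⟨
    (A₁ * B₁ + B₁ * A₁ + q * (0# * 0# + d ψ * d ψ + 0# * 0#)) + d φ * Y
      ≈⟨ +-congʳ (+-congˡ (*-congˡ (+-congʳ (+-congˡ dψ-square)))) ⟩
    (A₁ * B₁ + B₁ * A₁ + q * (0# * 0# + d φ * d P + 0# * 0#)) + d φ * Y
      ≈⟨ solve 5 (λ q A B f P → (A :* B :+ B :* A :+ q :* (con 0ℤ :* con 0ℤ :+ f :* P :+ con 0ℤ :* con 0ℤ)) :+ f :* (q :* P)
           := con (+ 2) :* (A :* B :+ f :* (q :* P))) ≈-refl q A₁ B₁ (d φ) (d P) ⟩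
    const (+ 2) * (A₁ * B₁ + d φ * Y) ∎)
    where
    regroup : ∀ x y → R * r * (x * y) ≈ r * x * (R * y)
    regroup = solve 4 (λ R r x y → R :* r :* (x :* y) := r :* x :* (R :* y)) ≈-refl R r
    regroup′ : ∀ x y → R * r * (x * y) ≈ R * x * (r * y)
    regroup′ = solve 4 (λ R r x y → R :* r :* (x :* y) := R :* x :* (r :* y)) ≈-refl R r

  comp-+ : ∀ i f g → comp i (f + g) ≈ comp i f + comp i g
  comp-+ i f g = coeffwise λ n → ≡.trans (coeff-+ f g _) (≡.sym (coeff-+ (comp i f) (comp i g) n))

  comp-const* : ∀ i c f → comp i (const c * f) ≈ const c * comp i f
  comp-const* i c f = coeffwise λ n → ≡.trans (coeff-const* c f _) (≡.sym (coeff-const* c (comp i f) n))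

  comp₀-q* : ∀ f → comp 0 (q * f) ≈ q * comp 4 f
  comp₀-q* f = ≈-trans (comp-cong 0 (begin
    q * f
      ≈⟨ *-congˡ (dissect f) ⟩
    q * dis (comp 0 f) (comp 1 f) (comp 2 f) (comp 3 f) (comp 4 f)
      ≈⟨ solve 6 (λ q a b c e f → q :* (a :+ q :* b :+ q :* q :* c :+ q :* (q :* q) :* e :+ q :* (q :* (q :* q)) :* f)
           := q :* (q :* (q :* (q :* q))) :* f :+ q :* a :+ q :* q :* b :+ q :* (q :* q) :* c :+ q :* (q :* (q :* q)) :* e) ≈-refl q _ _ _ _ _ ⟩
    q * q⁴ * d (comp 4 f) + q * d (comp 0 f) + q² * d (comp 1 f) + q³ * d (comp 2 f) + q⁴ * d (comp 3 f)
      ≈⟨ +-congʳ (+-congʳ (+-congʳ (+-congʳ (≈-trans (D.σ-* q _) (*-congʳ d-q))))) ⟨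
    dis (q * comp 4 f) (comp 0 f) (comp 1 f) (comp 2 f) (comp 3 f) ∎)) comp₀-dis

  comp₀-dil₂ : ∀ f → comp 0 (dil 1 f) ≈ dil 1 (comp 0 f)
  comp₀-dil₂ f = ≈-trans (comp-cong 0 (dis-dil₂ (dissect f))) comp₀-dis

  comp₄-dil₂ : ∀ f → comp 4 (dil 1 f) ≈ dil 1 (comp 2 f)
  comp₄-dil₂ f = ≈-trans (comp-cong 4 (dis-dil₂ (dissect f))) comp₄-dis

  Y-square : dil 1 (d φ) * dil 1 Y ≈ Y * Y
  Y-square = begin
    dil 1 (d φ) * dil 1 (q * d P)
      ≈⟨ *-congˡ (≈-trans (Dil2.σ-* q (d P)) (*-congʳ dil₂-q)) ⟩
    dil 1 (d φ) * (q² * dil 1 (d P))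
      ≈⟨ solve 3 (λ q x y → x :* (q :* q :* y) := q :* q :* (x :* y)) ≈-refl q _ _ ⟩
    q² * (dil 1 (d φ) * dil 1 (d P))
      ≈⟨ *-congˡ (≈-trans (≈-sym (Dil2.σ-* (d φ) (d P))) (≈-trans (Dil2.σ-cong (≈-sym dψ-square)) (≈-trans (Dil2.σ-* (d ψ) (d ψ)) (*-cong (≈-sym (d∘dil₂ ψ)) (≈-sym (d∘dil₂ ψ)))))) ⟩
    q² * (d P * d P)
      ≈⟨ solve 2 (λ q x → q :* q :* (x :* x) := q :* x :* (q :* x)) ≈-refl q (d P) ⟩
    Y * Y ∎

  A*B : A * B ≈ Ψ * Ψ - Y * Y
  A*B = begin
    A * B                             ≈⟨ *-cong A≈ B≈ ⟩
    R * (Ψ - Y) * (r * (Ψ + Y))       ≈⟨ solve 4 (λ R r x y → R :* (x :- y) :* (r :* (x :+ y)) := R :* r :* (x :* x :- y :* y)) ≈-refl R r Ψ Y ⟩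
    R * r * (Ψ * Ψ - Y * Y)           ≈⟨ *-congʳ R*r ⟩
    1# * (Ψ * Ψ - Y * Y)              ≈⟨ *-identityˡ _ ⟩
    Ψ * Ψ - Y * Y                     ∎

  q*φa*φb : q * (φa * φb) ≈ Φ * Φ - d φ * d φ
  q*φa*φb = begin
    q * (φa * φb)                     ≈⟨ solve 3 (λ q a b → q :* (a :* b) := a :* (q :* b)) ≈-refl q φa φb ⟩
    φa * (q * φb)                     ≈⟨ *-cong φa≈ q*φb≈ ⟩
    r * (Φ + d φ) * (R * (Φ - d φ))   ≈⟨ solve 4 (λ R r x y → r :* (x :+ y) :* (R :* (x :- y)) := R :* r :* (x :* x :- y :* y)) ≈-refl R r Φ (d φ) ⟩
    R * r * (Φ * Φ - d φ * d φ)       ≈⟨ *-congʳ R*r ⟩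
    1# * (Φ * Φ - d φ * d φ)          ≈⟨ *-identityˡ _ ⟩
    Φ * Φ - d φ * d φ                 ∎

  -- At q² the product `A₁ * B₁` in `Φ*Ψ` becomes `A * B`, that is Ψ² - Y², and the other term there
  -- is Y² by `Y-square`.
  Ψ-square : Ψ * Ψ ≈ dil 1 Φ * dil 1 Ψ
  Ψ-square = begin
    Ψ * Ψ
      ≈⟨ solve 2 (λ x y → x :* x := (x :* x :- y :* y) :+ y :* y) ≈-refl Ψ Y ⟩
    (Ψ * Ψ - Y * Y) + Y * Y
      ≈⟨ +-cong (≈-sym A*B) (≈-sym Y-square) ⟩
    dil 1 A₁ * dil 1 B₁ + dil 1 (d φ) * dil 1 Y
      ≈⟨ Dil2.σ-eval (v₀ :* v₁ :+ v₂ :* v₃) (A₁ ∷ B₁ ∷ d φ ∷ Y ∷ []) ⟨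
    dil 1 (A₁ * B₁ + d φ * Y)
      ≈⟨ Dil2.σ-cong Φ*Ψ ⟨
    dil 1 (Φ * Ψ)
      ≈⟨ Dil2.σ-* Φ Ψ ⟩
    dil 1 Φ * dil 1 Ψ ∎

  -- n ≡ 0 (mod 5) in φ(q)² = φ(q²)² + 4q ψ(q⁴)².
  Φ-square : Φ * Φ ≈ dil 1 Φ * dil 1 Φ + const (+ 4) * (q * (dil 1 Ψ * dil 1 Ψ))
  Φ-square = const*-cancel (+ 2) (begin
    const (+ 2) * (Φ * Φ)
      ≈⟨ solve 2 (λ x y → con (+ 2) :* x := (con (+ 2) :* x :- y) :+ y) ≈-refl (Φ * Φ) (d φ * d φ) ⟩
    Z + d φ * d φ
      ≈⟨ +-cong class-zero dφ-square ⟩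
    (dil 1 Z + const (+ 4) * (q * dil 1 W)) + (dil 1 (d φ) * dil 1 (d φ) + const (+ 4) * (q * (dil 1 Y * dil 1 Y)))
      ≈⟨ +-congʳ (+-cong
           (Dil2.σ-eval (con (+ 2) :* (v₀ :* v₀) :- v₁ :* v₁) (Φ ∷ d φ ∷ []))
           (*-congˡ (*-congˡ (Dil2.σ-eval (con (+ 2) :* (v₀ :* v₀) :- v₁ :* v₁) (Ψ ∷ Y ∷ []))))) ⟩
    _ ≈⟨ solve 5 (λ q a b c e → ((con (+ 2) :* (a :* a) :- b :* b) :+ con (+ 4) :* (q :* (con (+ 2) :* (c :* c) :- e :* e))) :+ (b :* b :+ con (+ 4) :* (q :* (e :* e)))
           := con (+ 2) :* (a :* a :+ con (+ 4) :* (q :* (c :* c)))) ≈-refl q (dil 1 Φ) (dil 1 (d φ)) (dil 1 Ψ) (dil 1 Y) ⟩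
    const (+ 2) * (dil 1 Φ * dil 1 Φ + const (+ 4) * (q * (dil 1 Ψ * dil 1 Ψ))) ∎)
    where
    Z W : PowerSeries
    Z = const (+ 2) * (Φ * Φ) - d φ * d φ
    W = const (+ 2) * (Ψ * Ψ) - Y * Y
    comp-φφ : comp 0 (φ * φ) ≈ Z
    comp-φφ = begin
      comp 0 (φ * φ)
        ≈⟨ ≈-trans (comp-cong 0 (dis-*-≈ φ-dis φ-dis)) comp₀-dis ⟩
      d φ * d φ + q * (φa * φb + 0# * 0# + 0# * 0# + φb * φa)
        ≈⟨ solve 4 (λ q a b f → f :* f :+ q :* (a :* b :+ con 0ℤ :* con 0ℤ :+ con 0ℤ :* con 0ℤ :+ b :* a) := f :* f :+ con (+ 2) :* (q :* (a :* b))) ≈-refl q φa φb (d φ) ⟩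
      d φ * d φ + const (+ 2) * (q * (φa * φb))
        ≈⟨ +-congˡ (*-congˡ q*φa*φb) ⟩
      d φ * d φ + const (+ 2) * (Φ * Φ - d φ * d φ)
        ≈⟨ solve 2 (λ x y → y :+ con (+ 2) :* (x :- y) := con (+ 2) :* x :- y) ≈-refl (Φ * Φ) (d φ * d φ) ⟩
      Z ∎
    comp-PP : comp 2 (P * P) ≈ W
    comp-PP = begin
      comp 2 (P * P)
        ≈⟨ ≈-trans (comp-cong 2 (dis-*-≈ P-dis P-dis)) comp₂-dis ⟩
      A * B + Y * Y + B * A + q * (0# * 0# + 0# * 0#)
        ≈⟨ solve 4 (λ q a b y → a :* b :+ y :* y :+ b :* a :+ q :* (con 0ℤ :* con 0ℤ :+ con 0ℤ :* con 0ℤ) := con (+ 2) :* (a :* b) :+ y :* y) ≈-refl q A B Y ⟩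
      const (+ 2) * (A * B) + Y * Y
        ≈⟨ +-congʳ (*-congˡ A*B) ⟩
      const (+ 2) * (Ψ * Ψ - Y * Y) + Y * Y
        ≈⟨ solve 2 (λ x y → con (+ 2) :* (x :- y) :+ y := con (+ 2) :* x :- y) ≈-refl (Ψ * Ψ) (Y * Y) ⟩
      W ∎
    class-zero : Z ≈ dil 1 Z + const (+ 4) * (q * dil 1 W)
    class-zero = begin
      Z
        ≈⟨ comp-φφ ⟨
      comp 0 (φ * φ)
        ≈⟨ comp-cong 0 (≈-trans φ-square (+-cong (≈-sym (Dil2.σ-* φ φ)) (*-congˡ (*-cong ≈-refl
             (≈-trans (*-cong (≈-sym (dil₂∘dil₂ ψ)) (≈-sym (dil₂∘dil₂ ψ))) (≈-sym (Dil2.σ-* P P))))))) ⟩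
      comp 0 (dil 1 (φ * φ) + const (+ 4) * (q * dil 1 (P * P)))
        ≈⟨ ≈-trans (comp-+ 0 _ _) (+-cong (comp₀-dil₂ (φ * φ)) (≈-trans (comp-const* 0 (+ 4) _) (*-cong ≈-refl
             (≈-trans (comp₀-q* _) (*-congˡ (comp₄-dil₂ (P * P))))))) ⟩
      dil 1 (comp 0 (φ * φ)) + const (+ 4) * (q * dil 1 (comp 2 (P * P)))
        ≈⟨ +-cong (Dil2.σ-cong comp-φφ) (*-congˡ (*-congˡ (Dil2.σ-cong comp-PP))) ⟩
      dil 1 Z + const (+ 4) * (q * dil 1 W) ∎
    dφ-square : d φ * d φ ≈ dil 1 (d φ) * dil 1 (d φ) + const (+ 4) * (q * (dil 1 Y * dil 1 Y))
    dφ-square = begin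
      d φ * d φ
        ≈⟨ ≈-trans (≈-sym (D.σ-* φ φ)) (D.σ-cong φ-square) ⟩
      d (dil 1 φ * dil 1 φ + const (+ 4) * (q * (dil 3 ψ * dil 3 ψ)))
        ≈⟨ D.σ-eval (v₀ :* v₀ :+ con (+ 4) :* (v₁ :* (v₂ :* v₂))) (dil 1 φ ∷ q ∷ dil 3 ψ ∷ []) ⟩
      d (dil 1 φ) * d (dil 1 φ) + const (+ 4) * (d q * (d (dil 3 ψ) * d (dil 3 ψ)))
        ≈⟨ +-cong (*-cong (d∘dil₂ φ) (d∘dil₂ φ)) (*-congˡ (*-cong d-q (*-cong ddψ ddψ))) ⟩
      dil 1 (d φ) * dil 1 (d φ) + const (+ 4) * (q * q⁴ * (dil 1 (d P) * dil 1 (d P)))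
        ≈⟨ +-congˡ (*-congˡ (solve 2 (λ q x → q :* (q :* (q :* (q :* q))) :* (x :* x) := q :* (q :* q :* x :* (q :* q :* x))) ≈-refl q _)) ⟩
      dil 1 (d φ) * dil 1 (d φ) + const (+ 4) * (q * (q² * dil 1 (d P) * (q² * dil 1 (d P))))
        ≈⟨ +-congˡ (*-congˡ (*-congˡ (*-cong dil-Y dil-Y))) ⟨
      dil 1 (d φ) * dil 1 (d φ) + const (+ 4) * (q * (dil 1 Y * dil 1 Y)) ∎
      where
      ddψ : d (dil 3 ψ) ≈ dil 1 (d P)
      ddψ = ≈-trans (D.σ-cong (≈-sym (dil₂∘dil₂ ψ))) (d∘dil₂ P)
      dil-Y : dil 1 Y ≈ q² * dil 1 (d P)
      dil-Y = ≈-trans (Dil2.σ-* q (d P)) (*-congʳ dil₂-q)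

  ΨΦ-unique : Ψ ≈ P × Φ ≈ φ
  ΨΦ-unique = theta-pair-unique Ψ₀ Φ₀ P₀ φ₀ Ψ-square Φ-square
    (≈-trans (≈-sym (Dil2.σ-* ψ ψ)) (≈-trans (Dil2.σ-cong ψ-square) (Dil2.σ-* φ P)))
    (≈-trans φ-square (+-congˡ (*-congˡ (*-congˡ (*-cong (≈-sym (dil₂∘dil₂ ψ)) (≈-sym (dil₂∘dil₂ ψ)))))))
    where
    Y₀ : coeff Y 0 ≡ 0ℤ
    Y₀ = coeff-q*-zero (d P)
    A₀ : coeff A 0 ≡ 1ℤ
    A₀ = ≡.trans (≡.sym (coeff₀-dis P-dis)) P₀
    Ψ₀ : coeff Ψ 0 ≡ 1ℤ
    Ψ₀ = ≡.trans (≡.sym (≡.trans (coeff-+ Ψ (- Y) 0) (≡.trans (cong (λ z → coeff Ψ 0 ℤ.+ z) (≡.trans (coeff-neg Y 0) (cong ℤ.-_ Y₀))) (ℤ.+-identityʳ _))))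
      (≡.trans (≡.trans (≡.sym (ℤ.*-identityˡ _)) (cong (ℤ._* coeff (Ψ - Y) 0) (≡.sym R₀))) (≡.trans (≡.sym (coeff₀-* R (Ψ - Y))) (≡.trans (≡.sym (coeff-≡ A≈ 0)) A₀)))
    -- `q * φb`, which is `R * (Φ - d φ)`, has no constant term, so `Φ` has that of `d φ`.
    Φ₀ : coeff Φ 0 ≡ 1ℤ
    Φ₀ = ℤ.i-j≡0⇒i≡j (coeff Φ 0) 1ℤ (≡.trans (cong (λ z → coeff Φ 0 ℤ.+ ℤ.- z) (≡.sym dφ₀)) (≡.trans (≡.sym (≡.trans (coeff-+ Φ (- d φ) 0) (cong (λ z → coeff Φ 0 ℤ.+ z) (coeff-neg (d φ) 0))))
      (≡.trans (≡.trans (≡.sym (ℤ.*-identityˡ _)) (cong (ℤ._* coeff (Φ - d φ) 0) (≡.sym R₀)))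
        (≡.trans (≡.sym (coeff₀-* R (Φ - d φ))) (≡.trans (≡.sym (coeff-≡ q*φb≈ 0)) (coeff-q*-zero φb))))))
      where
      dφ₀ : coeff (d φ) 0 ≡ 1ℤ
      dφ₀ = coeff₀-d φ₀

  Ψ≈P : Ψ ≈ P
  Ψ≈P = proj₁ ΨΦ-unique

  Φ≈φ : Φ ≈ φ
  Φ≈φ = proj₂ ΨΦ-unique

  P-dis-R : P ≈ dis (R * (P - Y)) Y (r * (P + Y)) 0# 0#
  P-dis-R = ≈-trans P-dis (dis-cong (≈-trans A≈ (*-congˡ (+-congʳ Ψ≈P))) ≈-refl (≈-trans B≈ (*-congˡ (+-congʳ Ψ≈P))) ≈-refl ≈-refl)

  -- The curve X₁(10) and the sixth power of E(q)/E(q⁵)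

  R₂ r₂ : PowerSeries
  R₂ = dil 1 R
  r₂ = dil 1 r

  R₂*r₂ : R₂ * r₂ ≈ 1#
  R₂*r₂ = ≈-trans (≈-sym (Dil2.σ-* R r)) (≈-trans (Dil2.σ-cong R*r) (Dil2.σ-const 1ℤ))

  E₂-dis-R : E₂ ≈ dis (R₂ * d E₂) 0# (- d E₂) 0# (- (r₂ * d E₂))
  E₂-dis-R = ≈-trans E₂-dis (dis-cong
    (≈-trans (Dil2.σ-cong (≈-sym R*dE)) (≈-trans (Dil2.σ-* R (d E)) (*-congˡ (≈-sym (d∘dil₂ E)))))
    ≈-refl ≈-refl ≈-refl
    (≈-trans (Dil2.σ-cong (≈-sym r*dE)) (≈-trans (Dil2.σ-neg _) (-‿cong (≈-trans (Dil2.σ-* r (d E)) (*-congˡ (≈-sym (d∘dil₂ E))))))))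

  dψ*dE : d ψ * d E ≈ d E₂ * d E₂
  dψ*dE = ≈-trans (≈-sym (D.σ-* ψ E)) (≈-trans (D.σ-cong ψ*E) (D.σ-* E₂ E₂))

  ψE-classes : dis _ _ _ _ _ ≈ dis _ _ _ _ _
  ψE-classes = same ψ*E (dis-*-≈ ψ-dis E-dis-R) (dis-*-≈ E₂-dis-R E₂-dis-R)

  -- Class 0 of ψ(q) E(q) = E(q²)²; the same identity at q⁵ lets the factor `d E` cancel. Classes 1
  -- and 2, treated next, determine `A₁` and `B₁`, and class 0 then becomes an equation between `R`
  -- and `R₂`.
  curve₀ : A₁ * R - q * (d ψ * r) ≈ d ψ * (R₂ * R₂)
  curve₀ = *-cancelˡ dE₀ (begin
    d E * (A₁ * R - q * (d ψ * r))
      ≈⟨ solve 7 (λ q e R r a b p → e :* (a :* R :- q :* (p :* r))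
           := a :* (R :* e) :+ q :* (b :* con 0ℤ :+ con 0ℤ :* con 0ℤ :+ p :* (:- (r :* e)) :+ con 0ℤ :* (:- e))) ≈-refl q (d E) R r A₁ B₁ (d ψ) ⟩
    A₁ * (R * d E) + q * (B₁ * 0# + 0# * 0# + d ψ * (- (r * d E)) + 0# * (- d E))
      ≈⟨ dis-injective₀ ψE-classes ⟩
    R₂ * d E₂ * (R₂ * d E₂) + q * (0# * (- (r₂ * d E₂)) + (- d E₂) * 0# + 0# * (- d E₂) + (- (r₂ * d E₂)) * 0#)
      ≈⟨ solve 4 (λ q R r f → R :* f :* (R :* f) :+ q :* (con 0ℤ :* (:- (r :* f)) :+ (:- f) :* con 0ℤ :+ con 0ℤ :* (:- f) :+ (:- (r :* f)) :* con 0ℤ)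
           := R :* R :* (f :* f)) ≈-refl q R₂ r₂ (d E₂) ⟩
    R₂ * R₂ * (d E₂ * d E₂)
      ≈⟨ *-congˡ dψ*dE ⟨
    R₂ * R₂ * (d ψ * d E)
      ≈⟨ solve 3 (λ R p e → R :* R :* (p :* e) := e :* (p :* (R :* R))) ≈-refl R₂ (d ψ) (d E) ⟩
    d E * (d ψ * (R₂ * R₂)) ∎)

  curve₁ : B₁ * R - A₁ ≈ const (+ 2) * (q * (d ψ * r₂))
  curve₁ = *-cancelˡ dE₀ (begin
    d E * (B₁ * R - A₁)
      ≈⟨ solve 7 (λ q e R r a b p → e :* (b :* R :- a)
           := a :* (:- e) :+ b :* (R :* e) :+ q :* (con 0ℤ :* con 0ℤ :+ p :* con 0ℤ :+ con 0ℤ :* (:- (r :* e)))) ≈-refl q (d E) R r A₁ B₁ (d ψ) ⟩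
    A₁ * (- d E) + B₁ * (R * d E) + q * (0# * 0# + d ψ * 0# + 0# * (- (r * d E)))
      ≈⟨ dis-injective₁ ψE-classes ⟩
    R₂ * d E₂ * 0# + 0# * (R₂ * d E₂) + q * ((- d E₂) * (- (r₂ * d E₂)) + 0# * 0# + (- (r₂ * d E₂)) * (- d E₂))
      ≈⟨ solve 4 (λ q R r f → R :* f :* con 0ℤ :+ con 0ℤ :* (R :* f) :+ q :* ((:- f) :* (:- (r :* f)) :+ con 0ℤ :* con 0ℤ :+ (:- (r :* f)) :* (:- f))
           := con (+ 2) :* (q :* (r :* (f :* f)))) ≈-refl q R₂ r₂ (d E₂) ⟩
    const (+ 2) * (q * (r₂ * (d E₂ * d E₂)))
      ≈⟨ *-congˡ (*-congˡ (*-congˡ dψ*dE)) ⟨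
    const (+ 2) * (q * (r₂ * (d ψ * d E)))
      ≈⟨ solve 4 (λ q r p e → con (+ 2) :* (q :* (r :* (p :* e))) := e :* (con (+ 2) :* (q :* (p :* r)))) ≈-refl q r₂ (d ψ) (d E) ⟩
    d E * (const (+ 2) * (q * (d ψ * r₂))) ∎)

  curve₂ : A₁ * r + B₁ ≈ const (+ 2) * (d ψ * R₂)
  curve₂ = *-cancelˡ dE₀ (begin
    d E * (A₁ * r + B₁)
      ≈⟨ solve 7 (λ q e R r a b p → e :* (a :* r :+ b)
           := :- (a :* (:- (r :* e)) :+ b :* (:- e) :+ con 0ℤ :* (R :* e) :+ q :* (p :* con 0ℤ :+ con 0ℤ :* con 0ℤ))) ≈-refl q (d E) R r A₁ B₁ (d ψ) ⟩
    - (A₁ * (- (r * d E)) + B₁ * (- d E) + 0# * (R * d E) + q * (d ψ * 0# + 0# * 0#))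
      ≈⟨ -‿cong (dis-injective₂ ψE-classes) ⟩
    - (R₂ * d E₂ * (- d E₂) + 0# * 0# + (- d E₂) * (R₂ * d E₂) + q * (0# * (- (r₂ * d E₂)) + (- (r₂ * d E₂)) * 0#))
      ≈⟨ solve 4 (λ q R r f → :- (R :* f :* (:- f) :+ con 0ℤ :* con 0ℤ :+ (:- f) :* (R :* f) :+ q :* (con 0ℤ :* (:- (r :* f)) :+ (:- (r :* f)) :* con 0ℤ))
           := con (+ 2) :* (R :* (f :* f))) ≈-refl q R₂ r₂ (d E₂) ⟩
    const (+ 2) * (R₂ * (d E₂ * d E₂))
      ≈⟨ *-congˡ (*-congˡ dψ*dE) ⟨
    const (+ 2) * (R₂ * (d ψ * d E))
      ≈⟨ solve 3 (λ R p e → con (+ 2) :* (R :* (p :* e)) := e :* (con (+ 2) :* (p :* R))) ≈-refl R₂ (d ψ) (d E) ⟩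
    d E * (const (+ 2) * (d ψ * R₂)) ∎)

  A₁≈ : A₁ ≈ d ψ * (R * R₂ - q * r₂)
  A₁≈ = const*-cancel (+ 2) (begin
    const (+ 2) * A₁
      ≈⟨ solve 4 (λ a b R r → con (+ 2) :* a := R :* (a :* r :+ b) :- (b :* R :- a) :+ a :* (con 1ℤ :- R :* r)) ≈-refl A₁ B₁ R r ⟩
    R * (A₁ * r + B₁) - (B₁ * R - A₁) + A₁ * (1# - R * r)
      ≈⟨ +-cong (+-cong (*-congˡ curve₂) (-‿cong curve₁)) (*-congˡ (+-congˡ (-‿cong R*r))) ⟩
    R * (const (+ 2) * (d ψ * R₂)) - const (+ 2) * (q * (d ψ * r₂)) + A₁ * (1# - 1#)
      ≈⟨ solve 6 (λ q a R S s p → R :* (con (+ 2) :* (p :* S)) :- con (+ 2) :* (q :* (p :* s)) :+ a :* (con 1ℤ :- con 1ℤ)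
           := con (+ 2) :* (p :* (R :* S :- q :* s))) ≈-refl q A₁ R R₂ r₂ (d ψ) ⟩
    const (+ 2) * (d ψ * (R * R₂ - q * r₂)) ∎)

  B₁≈ : B₁ ≈ d ψ * (R₂ + q * (r * r₂))
  B₁≈ = begin
    B₁
      ≈⟨ solve 3 (λ a b r → b := (a :* r :+ b) :- a :* r) ≈-refl A₁ B₁ r ⟩
    (A₁ * r + B₁) - A₁ * r
      ≈⟨ +-cong curve₂ (-‿cong (*-congʳ A₁≈)) ⟩
    const (+ 2) * (d ψ * R₂) - d ψ * (R * R₂ - q * r₂) * r
      ≈⟨ solve 6 (λ q R r S s p → con (+ 2) :* (p :* S) :- p :* (R :* S :- q :* s) :* r := p :* (con (+ 2) :* S :- R :* r :* S :+ q :* (r :* s))) ≈-refl q R r R₂ r₂ (d ψ) ⟩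
    d ψ * (const (+ 2) * R₂ - R * r * R₂ + q * (r * r₂))
      ≈⟨ *-congˡ (+-congʳ (+-congˡ (-‿cong (*-congʳ R*r)))) ⟩
    d ψ * (const (+ 2) * R₂ - 1# * R₂ + q * (r * r₂))
      ≈⟨ solve 3 (λ p S x → p :* (con (+ 2) :* S :- con 1ℤ :* S :+ x) := p :* (S :+ x)) ≈-refl (d ψ) R₂ (q * (r * r₂)) ⟩
    d ψ * (R₂ + q * (r * r₂)) ∎

  dψ₀ : coeff (d ψ) 0 ≡ 1ℤ
  dψ₀ = coeff₀-d ψ₀

  -- The modular curve X₁(10), with coordinates R(q), R(q²).
  curve : (R * R₂ - q * r₂) * R - q * r ≈ R₂ * R₂
  curve = *-cancelˡ dψ₀ (begin
    d ψ * ((R * R₂ - q * r₂) * R - q * r)    ≈⟨ solve 5 (λ p x R q r → p :* (x :* R :- q :* r) := p :* x :* R :- q :* (p :* r)) ≈-refl (d ψ) _ R q r ⟩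
    d ψ * (R * R₂ - q * r₂) * R - q * (d ψ * r) ≈⟨ +-congʳ (*-congʳ A₁≈) ⟨
    A₁ * R - q * (d ψ * r)                   ≈⟨ curve₀ ⟩
    d ψ * (R₂ * R₂)                          ∎)

  κψ κφ : PowerSeries
  κψ = q + R * (R₂ * R₂) - q² * (r * (r₂ * r₂))
  κφ = 1# + R₂ * (r * r) - R * R * r₂

  -- Since `Φ` and `Ψ` are `φ` and `P`, `ψ-square` turns `Φ*Ψ` into a formula for ψ² by the
  -- components of its own dissection, and both `A₁ * B₁` and `d φ * Y` are multiples of the square
  -- of `d ψ`.
  ψ-quotient : ψ * ψ ≈ d ψ * d ψ * κψ
  ψ-quotient = begin
    ψ * ψ
      ≈⟨ ≈-trans ψ-square (*-cong (≈-sym Φ≈φ) (≈-sym Ψ≈P)) ⟩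
    Φ * Ψ
      ≈⟨ Φ*Ψ ⟩
    A₁ * B₁ + d φ * Y
      ≈⟨ +-cong (*-cong A₁≈ B₁≈) (solve 3 (λ f q p → f :* (q :* p) := q :* (f :* p)) ≈-refl (d φ) q (d P)) ⟩
    d ψ * (R * R₂ - q * r₂) * (d ψ * (R₂ + q * (r * r₂))) + q * (d φ * d P)
      ≈⟨ +-congˡ (*-congˡ (≈-sym dψ-square)) ⟩
    d ψ * (R * R₂ - q * r₂) * (d ψ * (R₂ + q * (r * r₂))) + q * (d ψ * d ψ)
      ≈⟨ solve 6 (λ q R r S s p → p :* (R :* S :- q :* s) :* (p :* (S :+ q :* (r :* s))) :+ q :* (p :* p)
           := p :* p :* (q :+ R :* (S :* S) :- q :* q :* (r :* (s :* s)) :+ (R :* r :- con 1ℤ) :* (q :* (S :* s)))) ≈-refl q R r R₂ r₂ (d ψ) ⟩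
    d ψ * d ψ * (κψ + (R * r - 1#) * (q * (R₂ * r₂)))
      ≈⟨ *-congˡ (≈-trans (+-congˡ (*-congʳ (≈-trans (+-congʳ R*r) (-‿inverseʳ 1#)))) (solve 2 (λ x y → x :+ con 0ℤ :* y := x) ≈-refl κψ _)) ⟩
    d ψ * d ψ * κψ ∎

  -- `q*φa*φb` at -q gives the difference φ(-q)² - φ(-q⁵)²; its components `a` and `b` are computed
  -- from classes 0 and 4 of φ(-q) E(q²) = E(q)².
  φ₋-quotient : φ₋ * φ₋ ≈ d φ₋ * d φ₋ * κφ
  φ₋-quotient = *-cancelˡ (coeff₀-*-one dE₂₀ dE₂₀) (begin
    f * f * (φ₋ * φ₋)
      ≈⟨ solve 3 (λ f x y → f :* f :* x := f :* f :* (y :+ (x :- y))) ≈-refl f (φ₋ * φ₋) (d φ₋ * d φ₋) ⟩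
    f * f * (d φ₋ * d φ₋ + (φ₋ * φ₋ - d φ₋ * d φ₋))
      ≈⟨ *-congˡ (+-congˡ product) ⟩
    f * f * (d φ₋ * d φ₋ - q * (a * b))
      ≈⟨ solve 7 (λ f p q a b S s → f :* f :* (p :* p :- q :* (a :* b))
           := f :* f :* (p :* p) :- S :* s :* (f :* (q :* a) :* (f :* b)) :+ (S :* s :- con 1ℤ) :* (f :* f :* (q :* (a :* b)))) ≈-refl f p q a b R₂ r₂ ⟩
    f * f * (p * p) - R₂ * r₂ * (f * (q * a) * (f * b)) + (R₂ * r₂ - 1#) * (f * f * (q * (a * b)))
      ≈⟨ +-cong (+-congˡ (-‿cong (solve 4 (λ S s x y → S :* s :* (x :* y) := (s :* x) :* (S :* y)) ≈-refl R₂ r₂ (f * (q * a)) (f * b)))) (*-congʳ (≈-trans (+-congʳ R₂*r₂) (-‿inverseʳ 1#))) ⟩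
    f * f * (p * p) - r₂ * (f * (q * a)) * (R₂ * (f * b)) + 0# * (f * f * (q * (a * b)))
      ≈⟨ +-congʳ (+-congˡ (-‿cong (*-cong a≈ b≈))) ⟩
    f * f * (p * p) - p * f * (R * R - R₂) * (p * f * (r * r + r₂)) + 0# * (f * f * (q * (a * b)))
      ≈⟨ solve 7 (λ f p R r S s x → f :* f :* (p :* p) :- p :* f :* (R :* R :- S) :* (p :* f :* (r :* r :+ s)) :+ con 0ℤ :* x
           := f :* f :* (p :* p :* ((con 1ℤ :+ S :* (r :* r) :- R :* R :* s) :+ (con 1ℤ :- (R :* r) :* (R :* r)) :+ (S :* s :- con 1ℤ)))) ≈-refl f p R r R₂ r₂ (f * f * (q * (a * b))) ⟩
    f * f * (p * p * (κφ + (1# - R * r * (R * r)) + (R₂ * r₂ - 1#)))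
      ≈⟨ *-congˡ (*-congˡ (+-cong (+-congˡ (+-congˡ (-‿cong (*-cong R*r R*r)))) (+-congʳ R₂*r₂))) ⟩
    f * f * (p * p * (κφ + (1# - 1# * 1#) + (1# - 1#)))
      ≈⟨ *-congˡ (*-congˡ (solve 1 (λ x → x :+ (con 1ℤ :- con 1ℤ :* con 1ℤ) :+ (con 1ℤ :- con 1ℤ) := x) ≈-refl κφ)) ⟩
    f * f * (p * p * κφ) ∎)
    where
    f p a b : PowerSeries
    f = d E₂
    p = d φ₋
    a = sgn φa
    b = sgn φb
    dE₂₀ : coeff f 0 ≡ 1ℤ
    dE₂₀ = coeff₀-d E₂₀
    sgn-φ : sgn φ ≈ φ₋
    sgn-φ = ≈-trans (Sgn.σ-cong (≈-sym sgn-φ₋)) (sgn∘sgn φ₋)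
    product : φ₋ * φ₋ - d φ₋ * d φ₋ ≈ - (q * (a * b))
    product = begin
      φ₋ * φ₋ - d φ₋ * d φ₋
        ≈⟨ +-cong (*-cong sgn-φ sgn-φ) (-‿cong (*-cong dsgn dsgn)) ⟨
      sgn φ * sgn φ - sgn (d φ) * sgn (d φ)
        ≈⟨ Sgn.σ-eval (v₀ :* v₀ :- v₁ :* v₁) (φ ∷ d φ ∷ []) ⟨
      sgn (φ * φ - d φ * d φ)
        ≈⟨ Sgn.σ-cong (≈-trans q*φa*φb (+-congʳ (*-cong Φ≈φ Φ≈φ))) ⟨
      sgn (q * (φa * φb))
        ≈⟨ Sgn.σ-eval (v₀ :* (v₁ :* v₂)) (q ∷ φa ∷ φb ∷ []) ⟩
      sgn q * (a * b)
        ≈⟨ ≈-trans (*-congʳ sgn-q) (solve 2 (λ q x → (:- q) :* x := :- (q :* x)) ≈-refl q (a * b)) ⟩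
      - (q * (a * b)) ∎
      where
      dsgn : sgn (d φ) ≈ d φ₋
      dsgn = ≈-trans (≈-sym (d∘sgn φ)) (D.σ-cong sgn-φ)
    φE-classes : dis _ _ _ _ _ ≈ dis _ _ _ _ _
    φE-classes = same φ₋*E₂ (dis-*-≈ φ₋-dis E₂-dis-R) (dis-*-≈ E-dis-R E-dis-R)
    a≈ : r₂ * (f * (q * a)) ≈ p * f * (R * R - R₂)
    a≈ = begin
      r₂ * (f * (q * a))
        ≈⟨ solve 7 (λ q p a b S s f → s :* (f :* (q :* a))
             := (p :* (S :* f) :+ q :* ((:- a) :* (:- (s :* f)) :+ con 0ℤ :* con 0ℤ :+ con 0ℤ :* (:- f) :+ b :* con 0ℤ)) :- p :* f :* S) ≈-refl q p a b R₂ r₂ f ⟩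
      (p * (R₂ * f) + q * ((- a) * (- (r₂ * f)) + 0# * 0# + 0# * (- f) + b * 0#)) - p * f * R₂
        ≈⟨ +-congʳ (dis-injective₀ φE-classes) ⟩
      (R * d E * (R * d E) + q * ((- d E) * 0# + (- (r * d E)) * 0# + 0# * (- (r * d E)) + 0# * (- d E))) - p * f * R₂
        ≈⟨ +-congʳ (solve 4 (λ q e R r → R :* e :* (R :* e) :+ q :* ((:- e) :* con 0ℤ :+ (:- (r :* e)) :* con 0ℤ :+ con 0ℤ :* (:- (r :* e)) :+ con 0ℤ :* (:- e))
             := R :* R :* (e :* e)) ≈-refl q (d E) R r) ⟩
      R * R * (d E * d E) - p * f * R₂
        ≈⟨ +-congʳ (*-congˡ (≈-sym dφ₋*dE₂)) ⟩
      R * R * (p * f) - p * f * R₂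
        ≈⟨ solve 3 (λ R x S → R :* R :* x :- x :* S := x :* (R :* R :- S)) ≈-refl R (p * f) R₂ ⟩
      p * f * (R * R - R₂) ∎
    b≈ : R₂ * (f * b) ≈ p * f * (r * r + r₂)
    b≈ = begin
      R₂ * (f * b)
        ≈⟨ solve 6 (λ p a b S s f → S :* (f :* b)
             := (p :* (:- (s :* f)) :+ (:- a) :* con 0ℤ :+ con 0ℤ :* (:- f) :+ con 0ℤ :* con 0ℤ :+ b :* (S :* f)) :+ p :* f :* s) ≈-refl p a b R₂ r₂ f ⟩
      (p * (- (r₂ * f)) + (- a) * 0# + 0# * (- f) + 0# * 0# + b * (R₂ * f)) + p * f * r₂
        ≈⟨ +-congʳ (dis-injective₄ φE-classes) ⟩
      (R * d E * 0# + (- d E) * 0# + (- (r * d E)) * (- (r * d E)) + 0# * (- d E) + 0# * (R * d E)) + p * f * r₂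
        ≈⟨ +-congʳ (solve 3 (λ e R r → R :* e :* con 0ℤ :+ (:- e) :* con 0ℤ :+ (:- (r :* e)) :* (:- (r :* e)) :+ con 0ℤ :* (:- e) :+ con 0ℤ :* (R :* e)
             := r :* r :* (e :* e)) ≈-refl (d E) R r) ⟩
      r * r * (d E * d E) + p * f * r₂
        ≈⟨ +-congʳ (*-congˡ (≈-sym dφ₋*dE₂)) ⟩
      r * r * (p * f) + p * f * r₂
        ≈⟨ solve 3 (λ R x S → R :* R :* x :+ x :* S := x :* (R :* R :+ S)) ≈-refl r (p * f) r₂ ⟩
      p * f * (r * r + r₂) ∎

  N N₂ : PowerSeries
  N  = R ^ 5 - const (+ 11) * q - q² * r ^ 5
  N₂ = R₂ ^ 5 - const (+ 11) * q² - q² * q² * r₂ ^ 5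

  dil₂-N : dil 1 N ≈ N₂
  dil₂-N = ≈-trans (Dil2.σ-eval (v₀ :^ 5 :- con (+ 11) :* v₁ :- v₁ :* v₁ :* v₂ :^ 5) (R ∷ q ∷ r ∷ []))
    (+-cong (+-congˡ (-‿cong (*-congˡ dil₂-q))) (-‿cong (*-congʳ (*-cong dil₂-q dil₂-q))))

  1^ : ∀ {x} n → x ≈ 1# → x ^ n ≈ 1#
  1^ zero    h = ≈-refl
  1^ (suc n) h = ≈-trans (*-cong h (1^ n h)) (*-identityˡ 1#)

  coeff₀-^ : ∀ {f} n → coeff f 0 ≡ 1ℤ → coeff (f ^ n) 0 ≡ 1ℤ
  coeff₀-^ zero    h = coeff-const-zero 1ℤ
  coeff₀-^ (suc n) h = coeff₀-*-one h (coeff₀-^ n h)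

  R₂₀ : coeff R₂ 0 ≡ 1ℤ
  R₂₀ = ≡.trans (coeff₀-dil 1 R) R₀

  -- An identity on the modular curve X₁(10); the cofactor of its equation comes from polynomial division.
  N*κψ : N * κψ ≈ N₂ * κφ
  N*κψ = *-cancelˡ (coeff₀-*-one (coeff₀-^ 6 R₀) (coeff₀-^ 6 R₂₀)) (begin
    R ^ 6 * R₂ ^ 6 * (N * κψ)
      ≈⟨ solve 5 (λ q R r S s → R :^ 6 :* S :^ 6 :* ((R :^ 5 :- con (+ 11) :* q :- q :* q :* r :^ 5) :* (q :+ R :* (S :* S) :- q :* q :* (r :* (s :* s))))
           := S :^ 4 :* ((R :^ 10 :- con (+ 11) :* (q :* R :^ 5) :- q :* q :* (R :* r) :^ 5) :* (q :* R :* S :^ 2 :+ R :^ 2 :* S :^ 4 :- q :^ 2 :* ((R :* r) :* (S :* s) :^ 2)))) ≈-refl q R r R₂ r₂ ⟩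
    R₂ ^ 4 * ((R ^ 10 - const (+ 11) * (q * R ^ 5) - q * q * (R * r) ^ 5) * (q * R * R₂ ^ 2 + R ^ 2 * R₂ ^ 4 - q ^ 2 * ((R * r) * (R₂ * r₂) ^ 2)))
      ≈⟨ *-congˡ (*-cong (+-congˡ (-‿cong (*-congˡ (1^ 5 R*r)))) (+-congˡ (-‿cong (*-congˡ (*-cong R*r (1^ 2 R₂*r₂)))))) ⟩
    R₂ ^ 4 * ((R ^ 10 - const (+ 11) * (q * R ^ 5) - q * q * 1#) * (q * R * R₂ ^ 2 + R ^ 2 * R₂ ^ 4 - q ^ 2 * (1# * 1#)))
      ≈⟨ solve 3 (λ q R S → S :^ 4 :* ((R :^ 10 :- con (+ 11) :* (q :* R :^ 5) :- q :* q :* con 1ℤ) :* (q :* R :* S :^ 2 :+ R :^ 2 :* S :^ 4 :- q :^ 2 :* (con 1ℤ :* con 1ℤ)))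
           := R :^ 4 :* ((S :^ 10 :- con (+ 11) :* (q :^ 2 :* S :^ 5) :- q :^ 4) :* (R :^ 2 :* S :+ S :^ 2 :- R :^ 4))
           :+ (R :^ 3 :* S :^ 2 :- q :* R :^ 2 :- q :* S :- R :* S :^ 3)
           :* (q :^ 3 :* (R :^ 6 :- con (+ 2) :* R :^ 4 :* S :+ R :^ 2 :* S :^ 2 :- S :^ 3)
            :+ q :^ 2 :* (R :^ 7 :* S :^ 2 :- con (+ 4) :* R :^ 5 :* S :^ 3 :- con (+ 4) :* R :^ 3 :* S :^ 4 :+ con (+ 2) :* R :* S :^ 5)
            :+ q :* (con (+ 2) :* R :^ 8 :* S :^ 4 :+ con (+ 4) :* R :^ 6 :* S :^ 5 :- con (+ 4) :* R :^ 4 :* S :^ 6 :- R :^ 2 :* S :^ 7)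
            :+ (R :^ 9 :* S :^ 6 :+ R :^ 7 :* S :^ 7 :+ con (+ 2) :* R :^ 5 :* S :^ 8 :+ R :^ 3 :* S :^ 9))) ≈-refl q R R₂ ⟩
    R ^ 4 * ((R₂ ^ 10 - const (+ 11) * (q ^ 2 * R₂ ^ 5) - q ^ 4) * (R ^ 2 * R₂ + R₂ ^ 2 - R ^ 4)) + C * _
      ≈⟨ +-congˡ (≈-trans (*-congʳ C≈0) (zeroˡ _)) ⟩
    R ^ 4 * ((R₂ ^ 10 - const (+ 11) * (q ^ 2 * R₂ ^ 5) - q ^ 4) * (R ^ 2 * R₂ + R₂ ^ 2 - R ^ 4)) + 0#
      ≈⟨ solve 3 (λ q R S → R :^ 4 :* ((S :^ 10 :- con (+ 11) :* (q :^ 2 :* S :^ 5) :- q :^ 4) :* (R :^ 2 :* S :+ S :^ 2 :- R :^ 4)) :+ con 0ℤ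
           := R :^ 4 :* ((S :^ 10 :- con (+ 11) :* (q :^ 2 :* S :^ 5) :- q :^ 4 :* con 1ℤ) :* (R :^ 2 :* S :+ S :^ 2 :* con 1ℤ :- R :^ 4 :* con 1ℤ))) ≈-refl q R R₂ ⟩
    R ^ 4 * ((R₂ ^ 10 - const (+ 11) * (q ^ 2 * R₂ ^ 5) - q ^ 4 * 1#) * (R ^ 2 * R₂ + R₂ ^ 2 * 1# - R ^ 4 * 1#))
      ≈⟨ *-congˡ (*-cong (+-congˡ (-‿cong (*-congˡ (1^ 5 R₂*r₂)))) (+-cong (+-congˡ (*-congˡ (1^ 2 R*r))) (-‿cong (*-congˡ R₂*r₂)))) ⟨
    R ^ 4 * ((R₂ ^ 10 - const (+ 11) * (q ^ 2 * R₂ ^ 5) - q ^ 4 * (R₂ * r₂) ^ 5) * (R ^ 2 * R₂ + R₂ ^ 2 * (R * r) ^ 2 - R ^ 4 * (R₂ * r₂)))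
      ≈⟨ solve 5 (λ q R r S s → R :^ 6 :* S :^ 6 :* ((S :^ 5 :- con (+ 11) :* (q :* q) :- q :* q :* (q :* q) :* s :^ 5) :* (con 1ℤ :+ S :* (r :* r) :- R :* R :* s))
           := R :^ 4 :* ((S :^ 10 :- con (+ 11) :* (q :^ 2 :* S :^ 5) :- q :^ 4 :* (S :* s) :^ 5) :* (R :^ 2 :* S :+ S :^ 2 :* (R :* r) :^ 2 :- R :^ 4 :* (S :* s)))) ≈-refl q R r R₂ r₂ ⟨
    R ^ 6 * R₂ ^ 6 * (N₂ * κφ) ∎)
    where
    -- `curve` times `R * R₂`. In terms of u = q^(1/5)/R and v = q^(2/5)/R₂, the continued fraction
    -- at q and q², it is the classical relation v - u² = u v² (v + u²).
    C : PowerSeries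
    C = R ^ 3 * R₂ ^ 2 - q * R ^ 2 - q * R₂ - R * R₂ ^ 3
    C≈0 : C ≈ 0#
    C≈0 = begin
      R ^ 3 * R₂ ^ 2 - q * R ^ 2 - q * R₂ - R * R₂ ^ 3
        ≈⟨ solve 5 (λ q R r S s → R :^ 3 :* S :^ 2 :- q :* R :^ 2 :- q :* S :- R :* S :^ 3
             := R :* S :* ((R :* S :- q :* s) :* R :- q :* r) :- R :* S :* (S :* S) :+ q :* R :^ 2 :* (S :* s :- con 1ℤ) :+ q :* S :* (R :* r :- con 1ℤ)) ≈-refl q R r R₂ r₂ ⟩
      R * R₂ * ((R * R₂ - q * r₂) * R - q * r) - R * R₂ * (R₂ * R₂) + q * R ^ 2 * (R₂ * r₂ - 1#) + q * R₂ * (R * r - 1#)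
        ≈⟨ +-cong (+-cong (+-congʳ (*-congˡ curve)) (*-congˡ (≈-trans (+-congʳ R₂*r₂) (-‿inverseʳ 1#)))) (*-congˡ (≈-trans (+-congʳ R*r) (-‿inverseʳ 1#))) ⟩
      R * R₂ * (R₂ * R₂) - R * R₂ * (R₂ * R₂) + q * R ^ 2 * 0# + q * R₂ * 0#
        ≈⟨ solve 3 (λ x y z → x :- x :+ y :* con 0ℤ :+ z :* con 0ℤ := con 0ℤ) ≈-refl _ _ _ ⟩
      0# ∎

  dil₂-fixed : ∀ {f} → coeff f 0 ≡ 1ℤ → f ≈ dil 1 f → f ≈ 1#
  dil₂-fixed {f} f₀ h = ≈[]⇒≈ λ n → ≈[]-mono (ℕ.n≤1+n n) (go n)
    where
    go : ∀ n → f ≈[ suc n ] 1#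
    go zero    = below λ { zero _ → ≡.trans f₀ (≡.sym (coeff-const-zero 1ℤ)) ; (suc _) (s≤s ()) }
    go (suc n) = ≈[]-resp h (≈-sym (Dil2.σ-const 1ℤ)) (dil₂-improves (go n))

  inv₀ : ∀ f → coeff f 0 ≡ 1ℤ → coeff (inv f) 0 ≡ 1ℤ
  inv₀ f f₀ = ≡.trans (≡.sym (ℤ.*-identityˡ _)) (≡.trans (cong (ℤ._* coeff (inv f) 0) (≡.sym f₀))
    (≡.trans (≡.sym (coeff₀-* f (inv f))) (≡.trans (coeff-≡ (*-inv f f₀) 0) (coeff-const-zero 1ℤ))))

  N₀ : coeff N 0 ≡ 1ℤ
  N₀ = ≡.trans (coeff-≡ (solve 3 (λ q R r → R :^ 5 :- con (+ 11) :* q :- q :* q :* r :^ 5 := R :^ 5 :+ q :* (:- con (+ 11) :- q :* r :^ 5)) ≈-refl q R r) 0)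
    (≡.trans (coeff-+ _ _ 0) (≡.trans (cong₂ ℤ._+_ (coeff₀-^ 5 R₀) (coeff-q*-zero _)) ≡.refl))

  -- The quotient M of the two sides satisfies M(q) = M(q²), so it is constant.
  N*dE⁶ : N * d E ^ 6 ≈ E ^ 6
  N*dE⁶ = begin
    N * d E ^ 6        ≈⟨ M*E⁶ ⟨
    M * E ^ 6          ≈⟨ *-congʳ (dil₂-fixed M₀ M-fixed) ⟩
    1# * E ^ 6         ≈⟨ *-identityˡ _ ⟩
    E ^ 6              ∎
    where
    M : PowerSeries
    M = N * d E ^ 6 * inv E ^ 6
    M*E⁶ : M * E ^ 6 ≈ N * d E ^ 6
    M*E⁶ = ≈-trans (solve 3 (λ x i e → x :* i :^ 6 :* e :^ 6 := x :* (e :* i) :^ 6) ≈-refl (N * d E ^ 6) (inv E) E)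
      (≈-trans (*-congˡ (1^ 6 (*-inv E E₀))) (solve 1 (λ x → x :* con 1ℤ := x) ≈-refl _))
    M₀ : coeff M 0 ≡ 1ℤ
    M₀ = coeff₀-*-one (coeff₀-*-one N₀ (coeff₀-^ 6 dE₀)) (coeff₀-^ 6 (inv₀ E E₀))
    M₂*E₂⁶ : dil 1 M * E₂ ^ 6 ≈ N₂ * d E₂ ^ 6
    M₂*E₂⁶ = begin
      dil 1 M * E₂ ^ 6             ≈⟨ Dil2.σ-eval (v₀ :* v₁ :^ 6) (M ∷ E ∷ []) ⟨
      dil 1 (M * E ^ 6)            ≈⟨ Dil2.σ-cong M*E⁶ ⟩
      dil 1 (N * d E ^ 6)          ≈⟨ Dil2.σ-eval (v₀ :* v₁ :^ 6) (N ∷ d E ∷ []) ⟩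
      dil 1 N * dil 1 (d E) ^ 6    ≈⟨ *-cong dil₂-N (^-cong (≈-sym (d∘dil₂ E)) (≡.refl {x = 6})) ⟩
      N₂ * d E₂ ^ 6                ∎
    -- E⁶/E₂⁶ = φ₋²/ψ². With the same relation at q⁵, M(q)/M(q²) equals N κψ/(N₂ κφ), so that `N*κψ`
    -- is what makes `M` invariant.
    E⁶ : E ^ 6 * (ψ * ψ) ≈ φ₋ * φ₋ * E₂ ^ 6
    E⁶ = begin
      E ^ 6 * (ψ * ψ)                            ≈⟨ solve 2 (λ e p → e :^ 6 :* (p :* p) := (e :* e) :* (e :* e) :* ((p :* e) :* (p :* e))) ≈-refl E ψ ⟩
      E * E * (E * E) * (ψ * E * (ψ * E))        ≈⟨ *-cong (*-cong φ₋*E₂ φ₋*E₂) (*-cong (≈-sym ψ*E) (≈-sym ψ*E)) ⟨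
      φ₋ * E₂ * (φ₋ * E₂) * (E₂ * E₂ * (E₂ * E₂)) ≈⟨ solve 2 (λ e p → p :* e :* (p :* e) :* (e :* e :* (e :* e)) := p :* p :* e :^ 6) ≈-refl E₂ φ₋ ⟩
      φ₋ * φ₋ * E₂ ^ 6                           ∎
    dE⁶ : d E ^ 6 * (d ψ * d ψ) ≈ d φ₋ * d φ₋ * d E₂ ^ 6
    dE⁶ = begin
      d E ^ 6 * (d ψ * d ψ)        ≈⟨ D.σ-eval (v₀ :^ 6 :* (v₁ :* v₁)) (E ∷ ψ ∷ []) ⟨
      d (E ^ 6 * (ψ * ψ))          ≈⟨ D.σ-cong E⁶ ⟩
      d (φ₋ * φ₋ * E₂ ^ 6)         ≈⟨ D.σ-eval (v₀ :* v₀ :* v₁ :^ 6) (φ₋ ∷ E₂ ∷ []) ⟩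
      d φ₋ * d φ₋ * d E₂ ^ 6       ∎
    M-fixed : M ≈ dil 1 M
    M-fixed = *-cancelˡ {E ^ 6 * E₂ ^ 6 * (ψ * ψ * (d ψ * d ψ))}
      (coeff₀-*-one (coeff₀-*-one (coeff₀-^ 6 E₀) (coeff₀-^ 6 E₂₀)) (coeff₀-*-one (coeff₀-*-one ψ₀ ψ₀) (coeff₀-*-one dψ₀ dψ₀))) (begin
      E ^ 6 * E₂ ^ 6 * (ψ * ψ * (d ψ * d ψ)) * M
        ≈⟨ solve 5 (λ e f x y m → e :* f :* (x :* y) :* m := m :* e :* (f :* x :* y)) ≈-refl (E ^ 6) (E₂ ^ 6) (ψ * ψ) (d ψ * d ψ) M ⟩
      M * E ^ 6 * (E₂ ^ 6 * (ψ * ψ) * (d ψ * d ψ))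
        ≈⟨ *-congʳ M*E⁶ ⟩
      N * d E ^ 6 * (E₂ ^ 6 * (ψ * ψ) * (d ψ * d ψ))
        ≈⟨ solve 5 (λ n e f x y → n :* e :* (f :* x :* y) := n :* x :* (f :* (e :* y))) ≈-refl N (d E ^ 6) (E₂ ^ 6) (ψ * ψ) (d ψ * d ψ) ⟩
      N * (ψ * ψ) * (E₂ ^ 6 * (d E ^ 6 * (d ψ * d ψ)))
        ≈⟨ *-cong (*-congˡ ψ-quotient) (*-congˡ dE⁶) ⟩
      N * (d ψ * d ψ * κψ) * (E₂ ^ 6 * (d φ₋ * d φ₋ * d E₂ ^ 6))
        ≈⟨ solve 6 (λ n k y f p g → n :* (y :* k) :* (f :* (p :* g)) := (n :* k) :* (y :* f :* p :* g)) ≈-refl N κψ (d ψ * d ψ) (E₂ ^ 6) (d φ₋ * d φ₋) (d E₂ ^ 6) ⟩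
      N * κψ * (d ψ * d ψ * E₂ ^ 6 * (d φ₋ * d φ₋) * d E₂ ^ 6)
        ≈⟨ *-congʳ N*κψ ⟩
      N₂ * κφ * (d ψ * d ψ * E₂ ^ 6 * (d φ₋ * d φ₋) * d E₂ ^ 6)
        ≈⟨ solve 6 (λ n k y f p g → (n :* k) :* (y :* f :* p :* g) := (n :* g) :* (p :* k :* f :* y)) ≈-refl N₂ κφ (d ψ * d ψ) (E₂ ^ 6) (d φ₋ * d φ₋) (d E₂ ^ 6) ⟩
      N₂ * d E₂ ^ 6 * (d φ₋ * d φ₋ * κφ * E₂ ^ 6 * (d ψ * d ψ))
        ≈⟨ *-cong (≈-sym M₂*E₂⁶) (*-congʳ (≈-trans (*-congʳ (≈-sym φ₋-quotient)) (≈-sym E⁶))) ⟩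
      dil 1 M * E₂ ^ 6 * (E ^ 6 * (ψ * ψ) * (d ψ * d ψ))
        ≈⟨ solve 5 (λ e f x y m → m :* f :* (e :* x :* y) := e :* f :* (x :* y) :* m) ≈-refl (E ^ 6) (E₂ ^ 6) (ψ * ψ) (d ψ * d ψ) (dil 1 M) ⟩
      E ^ 6 * E₂ ^ 6 * (ψ * ψ * (d ψ * d ψ)) * dil 1 M ∎)

  -- The modular equation of degree 5

  eval-cong : ∀ {n} (p : Polynomial n) {ρ ρ′ : Vec PowerSeries n} → (∀ i → lookup ρ i ≈ lookup ρ′ i) → ⟦ p ⟧ ρ ≈ ⟦ p ⟧ ρ′
  eval-cong (op [+] a b) h = +-cong (eval-cong a h) (eval-cong b h)
  eval-cong (op [*] a b) h = *-cong (eval-cong a h) (eval-cong b h)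
  eval-cong (con c)      h = ≈-refl
  eval-cong (var x)      h = h x
  eval-cong (a :^ n)     h = ^-cong (eval-cong a h) (≡.refl {x = n})
  eval-cong (:- a)       h = -‿cong (eval-cong a h)

  -- F = E(q)/E(q²⁵); w and t are Hauptmoduln of Γ₀(25) and Γ₀(5), and s² = 1 + 22t + 125t².
  dR dr F κ dτ τ t s e w Dw Gw : PowerSeries
  dR = d R
  dr = d r
  F = dR - q - q² * dr
  κ = dR + q² * dr
  e = inv F
  w = q * e
  τ = d E ^ 6 * inv E ^ 6
  t = q * τ
  dτ = d τ
  s = (R ^ 5 + q² * r ^ 5) * τ
  Dw = 1# + const (+ 5) * w + const (+ 15) * (w * w) + const (+ 25) * (w * (w * w)) + const (+ 25) * (w * (w * (w * w)))
  Gw = 1# + const (+ 10) * w + const (+ 45) * (w * w) + const (+ 100) * (w * (w * w)) + const (+ 125) * (w * (w * (w * w)))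

  dR*dr : dR * dr ≈ 1#
  dR*dr = ≈-trans (≈-sym (D.σ-* R r)) (≈-trans (D.σ-cong R*r) (D.σ-const 1ℤ))

  private
    vars vars₅ : Vec PowerSeries 3
    vars  = q ∷ R ∷ r ∷ []
    vars₅ = q * q⁴ ∷ dR ∷ dr ∷ []

    d-vars : ∀ i → lookup (map d vars) i ≈ lookup vars₅ i
    d-vars Fin.zero                      = d-q
    d-vars (Fin.suc Fin.zero)            = ≈-refl
    d-vars (Fin.suc (Fin.suc Fin.zero))  = ≈-refl

  d-eval : ∀ p → d (⟦ p ⟧ vars) ≈ ⟦ p ⟧ vars₅
  d-eval p = ≈-trans (D.σ-eval p vars) (eval-cong p {map d vars} {vars₅} d-vars)

  dis-polynomial : ∀ {f} (p₀ p₁ p₂ p₃ p₄ : Polynomial 3) →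
    f ≈ ⟦ p₀ ⟧ vars₅ + q * ⟦ p₁ ⟧ vars₅ + q² * ⟦ p₂ ⟧ vars₅ + q³ * ⟦ p₃ ⟧ vars₅ + q⁴ * ⟦ p₄ ⟧ vars₅ →
    f ≈ dis (⟦ p₀ ⟧ vars) (⟦ p₁ ⟧ vars) (⟦ p₂ ⟧ vars) (⟦ p₃ ⟧ vars) (⟦ p₄ ⟧ vars)
  dis-polynomial p₀ p₁ p₂ p₃ p₄ h = ≈-trans h (≈-sym (+-cong (+-cong (+-cong (+-cong (d-eval p₀)
    (*-congˡ (d-eval p₁))) (*-congˡ (d-eval p₂))) (*-congˡ (d-eval p₃))) (*-congˡ (d-eval p₄))))

  -- Allows normalisation modulo the relation R r = 1 at q⁵: `k` is the explicit cofactor of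
  -- `dR * dr - 1#`.
  mod-R*r : ∀ {x y} k → x ≈ y + (dR * dr - 1#) * k → x ≈ y
  mod-R*r {x} {y} k h = ≈-trans h (≈-trans (+-congˡ (*-congʳ (≈-trans (+-congʳ dR*dr) (-‿inverseʳ 1#))))
    (solve 2 (λ y k → y :+ con 0ℤ :* k := y) ≈-refl y k))

  E≈ddE*F : E ≈ d (d E) * F
  E≈ddE*F = begin
    E
      ≈⟨ E-dis-R ⟩
    dis (R * d E) (- d E) (- (r * d E)) 0# 0#
      ≈⟨ +-cong (+-cong (+-cong (+-cong (D.σ-* R (d E)) (*-congˡ (D.σ-neg (d E)))) (*-congˡ (D.σ-eval (:- (v₀ :* v₁)) (r ∷ d E ∷ []))))
           (*-congˡ (D.σ-const 0ℤ))) (*-congˡ (D.σ-const 0ℤ)) ⟩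
    dR * d (d E) + q * (- d (d E)) + q² * (- (dr * d (d E))) + q³ * 0# + q⁴ * 0#
      ≈⟨ solve 4 (λ q R r e → R :* e :+ q :* (:- e) :+ q :* q :* (:- (r :* e)) :+ q :* (q :* q) :* con 0ℤ :+ q :* (q :* (q :* q)) :* con 0ℤ
           := e :* (R :- q :- q :* q :* r)) ≈-refl q dR dr (d (d E)) ⟩
    d (d E) * F ∎

  P≈ : P ≈ κ * d P - F * d Y
  P≈ = begin
    P
      ≈⟨ P-dis-R ⟩
    dis (R * (P - Y)) Y (r * (P + Y)) 0# 0#
      ≈⟨ +-cong (+-cong (+-cong (+-congʳ (D.σ-eval (v₀ :* (v₁ :- v₂)) (R ∷ P ∷ Y ∷ []))) (*-congˡ (D.σ-eval (v₀ :* (v₁ :+ v₂)) (r ∷ P ∷ Y ∷ []))))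
           (*-congˡ (D.σ-const 0ℤ))) (*-congˡ (D.σ-const 0ℤ)) ⟩
    dR * (d P - d Y) + q * d Y + q² * (dr * (d P + d Y)) + q³ * 0# + q⁴ * 0#
      ≈⟨ solve 5 (λ q R r x y → R :* (x :- y) :+ q :* y :+ q :* q :* (r :* (x :+ y)) :+ q :* (q :* q) :* con 0ℤ :+ q :* (q :* (q :* q)) :* con 0ℤ
           := (R :+ q :* q :* r) :* x :- (R :- q :- q :* q :* r) :* y) ≈-refl q dR dr (d P) (d Y) ⟩
    κ * d P - F * d Y ∎

  q-head : ∀ {f} g x → coeff g 0 ≡ 1ℤ → f ≈ g + q * x → coeff f 0 ≡ 1ℤ
  q-head g x g₀ h = ≡.trans (coeff-≡ h 0) (≡.trans (coeff-+ g (q * x) 0) (≡.trans (cong₂ ℤ._+_ g₀ (coeff-q*-zero x)) ≡.refl))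

  F₀ : coeff F 0 ≡ 1ℤ
  F₀ = q-head dR (- 1# - q * dr) (coeff₀-d R₀) (solve 3 (λ q R r → R :- q :- q :* q :* r := R :+ q :* (:- con 1ℤ :- q :* r)) ≈-refl q dR dr)

  κ₀ : coeff κ 0 ≡ 1ℤ
  κ₀ = q-head dR (q * dr) (coeff₀-d R₀) (solve 3 (λ q R r → R :+ q :* q :* r := R :+ q :* (q :* r)) ≈-refl q dR dr)

  F*e : F * e ≈ 1#
  F*e = *-inv F F₀

  e₀ : coeff e 0 ≡ 1ℤ
  e₀ = inv₀ F F₀

  τ₀ : coeff τ 0 ≡ 1ℤ
  τ₀ = coeff₀-*-one (coeff₀-^ 6 dE₀) (coeff₀-^ 6 (inv₀ E E₀))

  τ*E⁶ : τ * E ^ 6 ≈ d E ^ 6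
  τ*E⁶ = ≈-trans (solve 3 (λ x i e → x :* i :^ 6 :* e :^ 6 := x :* (e :* i) :^ 6) ≈-refl (d E ^ 6) (inv E) E)
    (≈-trans (*-congˡ (1^ 6 (*-inv E E₀))) (solve 1 (λ x → x :* con 1ℤ := x) ≈-refl _))

  N*τ : N * τ ≈ 1#
  N*τ = *-cancelˡ (coeff₀-^ 6 E₀) (begin
    E ^ 6 * (N * τ)    ≈⟨ solve 3 (λ e n x → e :* (n :* x) := n :* (x :* e)) ≈-refl (E ^ 6) N τ ⟩
    N * (τ * E ^ 6)    ≈⟨ *-congˡ τ*E⁶ ⟩
    N * d E ^ 6        ≈⟨ N*dE⁶ ⟩
    E ^ 6              ≈⟨ solve 1 (λ x → x := x :* con 1ℤ) ≈-refl _ ⟩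
    E ^ 6 * 1#         ∎)

  -- `d N` is the norm of `F`, the product of R(q⁵) - ζq - ζ²q²/R(q⁵) over the fifth roots of unity
  -- ζ, and hence divisible by `F`. The coefficients 5, 15, 25, 25 of its expansion reappear in
  -- `Dw`.
  dN≈ : d N ≈ F ^ 5 + const (+ 5) * q * F ^ 4 + const (+ 15) * q ^ 2 * F ^ 3 + const (+ 25) * q ^ 3 * F ^ 2 + const (+ 25) * q ^ 4 * F
  dN≈ = begin
    d N
      ≈⟨ d-eval (v₁ :^ 5 :- con (+ 11) :* v₀ :- v₀ :* v₀ :* v₂ :^ 5) ⟩
    dR ^ 5 - const (+ 11) * (q * q⁴) - q * q⁴ * (q * q⁴) * dr ^ 5
      ≈⟨ mod-R*r _ (≈-sym certificate) ⟨
    F ^ 5 + const (+ 5) * q * F ^ 4 + const (+ 15) * q ^ 2 * F ^ 3 + const (+ 25) * q ^ 3 * F ^ 2 + const (+ 25) * q ^ 4 * F ∎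
    where
    certificate : _ ≈ F ^ 5 + const (+ 5) * q * F ^ 4 + const (+ 15) * q ^ 2 * F ^ 3 + const (+ 25) * q ^ 3 * F ^ 2 + const (+ 25) * q ^ 4 * F
    certificate = solve 3 (λ q R r → let f = R :- q :- q :* q :* r in
      (R :^ 5 :- con (+ 11) :* (q :* (q :* (q :* (q :* q)))) :- q :* (q :* (q :* (q :* q))) :* (q :* (q :* (q :* (q :* q)))) :* r :^ 5) :+ (R :* r :- con 1ℤ) :* (:- (con (+ 5) :* q :^ 2 :* R :^ 3) :+ con (+ 10) :* q :^ 4 :* R :^ 2 :* r :- con (+ 5) :* q :^ 4 :* R :- con (+ 10) :* q :^ 6 :* R :* r :^ 2 :+ con (+ 5) :* q :^ 6 :* r :+ con (+ 5) :* q :^ 8 :* r :^ 3)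
        := f :^ 5 :+ con (+ 5) :* q :* f :^ 4 :+ con (+ 15) :* q :^ 2 :* f :^ 3 :+ con (+ 25) :* q :^ 3 :* f :^ 2 :+ con (+ 25) :* q :^ 4 :* f) ≈-refl q dR dr

  d-t : d t ≈ q * q⁴ * dτ
  d-t = ≈-trans (D.σ-* q τ) (*-congʳ d-q)

  dN*dτ : d N * dτ ≈ 1#
  dN*dτ = ≈-trans (≈-sym (D.σ-* N τ)) (≈-trans (D.σ-cong N*τ) (D.σ-const 1ℤ))

  module Sums where
    -- The Horner scheme of `dN≈`: d N = F S₄, S₄ = F S₃ + 25q⁴, S₃ = F S₂ + 25q³, S₂ = F S₁ + 15q².
    -- Hence 1/F is `S₄` times a series in q⁵.
    S₁ S₂ S₃ S₄ : PowerSeries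
    S₁ = F + const (+ 5) * q
    S₂ = F ^ 2 + const (+ 5) * q * F + const (+ 15) * q ^ 2
    S₃ = F ^ 3 + const (+ 5) * q * F ^ 2 + const (+ 15) * q ^ 2 * F + const (+ 25) * q ^ 3
    S₄ = F ^ 4 + const (+ 5) * q * F ^ 3 + const (+ 15) * q ^ 2 * F ^ 2 + const (+ 25) * q ^ 3 * F + const (+ 25) * q ^ 4

    S₁-dis : S₁ ≈ dis _ _ _ _ _
    S₁-dis = dis-polynomial (v₁) (con (+ 4)) (:- (v₂)) (con 0ℤ) (con 0ℤ)
      (mod-R*r _ (solve 3 (λ q R r → let f = R :- q :- q :* q :* r ; Q = q :* (q :* (q :* (q :* q))) in (f :+ con (+ 5) :* q)
        := (R) :+ q :* (con (+ 4)) :+ q :* q :* (:- (r)) :+ q :* (q :* q) :* (con 0ℤ) :+ q :* (q :* (q :* q)) :* (con 0ℤ)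
        :+ (R :* r :- con 1ℤ) :* (con 0ℤ)) ≈-refl q dR dr))

    κ*S₁-dis : κ * S₁ ≈ dis _ _ _ _ _
    κ*S₁-dis = dis-polynomial (v₁ :^ 2) (con (+ 4) :* v₁) (con 0ℤ) (con (+ 4) :* v₂) (:- (v₂ :^ 2))
      (mod-R*r _ (solve 3 (λ q R r → let f = R :- q :- q :* q :* r ; Q = q :* (q :* (q :* (q :* q))) in (R :+ q :* q :* r) :* (f :+ con (+ 5) :* q)
        := (R :^ 2) :+ q :* (con (+ 4) :* R) :+ q :* q :* (con 0ℤ) :+ q :* (q :* q) :* (con (+ 4) :* r) :+ q :* (q :* (q :* q)) :* (:- (r :^ 2))
        :+ (R :* r :- con 1ℤ) :* (con 0ℤ)) ≈-refl q dR dr))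

    S₂-dis : S₂ ≈ dis _ _ _ _ _
    S₂-dis = dis-polynomial (v₁ :^ 2) (con (+ 3) :* v₁) (con (+ 9)) (:- (con (+ 3) :* v₂)) (v₂ :^ 2)
      (mod-R*r _ (solve 3 (λ q R r → let f = R :- q :- q :* q :* r ; Q = q :* (q :* (q :* (q :* q))) in (f :^ 2 :+ con (+ 5) :* q :* f :+ con (+ 15) :* q :^ 2)
        := (R :^ 2) :+ q :* (con (+ 3) :* R) :+ q :* q :* (con (+ 9)) :+ q :* (q :* q) :* (:- (con (+ 3) :* r)) :+ q :* (q :* (q :* q)) :* (r :^ 2)
        :+ (R :* r :- con 1ℤ) :* (:- (con (+ 2) :* q :^ 2))) ≈-refl q dR dr))

    κ*S₂-dis : κ * S₂ ≈ dis _ _ _ _ _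
    κ*S₂-dis = dis-polynomial (v₁ :^ 3 :- con (+ 3) :* v₀ :* v₂ :^ 2) (con (+ 3) :* v₁ :^ 2 :+ v₀ :* v₂ :^ 3) (con (+ 10) :* v₁) (con 0ℤ) (con (+ 10) :* v₂)
      (mod-R*r _ (solve 3 (λ q R r → let f = R :- q :- q :* q :* r ; Q = q :* (q :* (q :* (q :* q))) in (R :+ q :* q :* r) :* (f :^ 2 :+ con (+ 5) :* q :* f :+ con (+ 15) :* q :^ 2)
        := (R :^ 3 :- con (+ 3) :* Q :* r :^ 2) :+ q :* (con (+ 3) :* R :^ 2 :+ Q :* r :^ 3) :+ q :* q :* (con (+ 10) :* R) :+ q :* (q :* q) :* (con 0ℤ) :+ q :* (q :* (q :* q)) :* (con (+ 10) :* r)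
        :+ (R :* r :- con 1ℤ) :* (:- (q :^ 2 :* R) :- q :^ 4 :* r)) ≈-refl q dR dr))

    S₃-dis : S₃ ≈ dis _ _ _ _ _
    S₃-dis = dis-polynomial (v₁ :^ 3 :+ con (+ 2) :* v₀ :* v₂ :^ 2) (con (+ 2) :* v₁ :^ 2 :- v₀ :* v₂ :^ 3) (con (+ 5) :* v₁) (con (+ 10)) (:- (con (+ 5) :* v₂))
      (mod-R*r _ (solve 3 (λ q R r → let f = R :- q :- q :* q :* r ; Q = q :* (q :* (q :* (q :* q))) in (f :^ 3 :+ con (+ 5) :* q :* f :^ 2 :+ con (+ 15) :* q :^ 2 :* f :+ con (+ 25) :* q :^ 3)
        := (R :^ 3 :+ con (+ 2) :* Q :* r :^ 2) :+ q :* (con (+ 2) :* R :^ 2 :- Q :* r :^ 3) :+ q :* q :* (con (+ 5) :* R) :+ q :* (q :* q) :* (con (+ 10)) :+ q :* (q :* (q :* q)) :* (:- (con (+ 5) :* r))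
        :+ (R :* r :- con 1ℤ) :* (:- (con (+ 3) :* q :^ 2 :* R) :- con (+ 4) :* q :^ 3 :+ con (+ 3) :* q :^ 4 :* r)) ≈-refl q dR dr))

    κ*S₃-dis : κ * S₃ ≈ dis _ _ _ _ _
    κ*S₃-dis = dis-polynomial (v₁ :^ 4 :+ con (+ 12) :* v₀ :* v₂) (con (+ 2) :* v₁ :^ 3 :- con (+ 6) :* v₀ :* v₂ :^ 2) (con (+ 6) :* v₁ :^ 2 :+ con (+ 2) :* v₀ :* v₂ :^ 3) (con (+ 12) :* v₁ :- v₀ :* v₂ :^ 4) (con 0ℤ)
      (mod-R*r _ (solve 3 (λ q R r → let f = R :- q :- q :* q :* r ; Q = q :* (q :* (q :* (q :* q))) in (R :+ q :* q :* r) :* (f :^ 3 :+ con (+ 5) :* q :* f :^ 2 :+ con (+ 15) :* q :^ 2 :* f :+ con (+ 25) :* q :^ 3)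
        := (R :^ 4 :+ con (+ 12) :* Q :* r) :+ q :* (con (+ 2) :* R :^ 3 :- con (+ 6) :* Q :* r :^ 2) :+ q :* q :* (con (+ 6) :* R :^ 2 :+ con (+ 2) :* Q :* r :^ 3) :+ q :* (q :* q) :* (con (+ 12) :* R :- Q :* r :^ 4) :+ q :* (q :* (q :* q)) :* (con 0ℤ)
        :+ (R :* r :- con 1ℤ) :* (:- (con (+ 2) :* q :^ 2 :* R :^ 2) :- con (+ 2) :* q :^ 3 :* R :- con (+ 2) :* q :^ 5 :* r :+ con (+ 2) :* q :^ 6 :* r :^ 2)) ≈-refl q dR dr))

    S₄-dis : S₄ ≈ dis _ _ _ _ _
    S₄-dis = dis-polynomial (v₁ :^ 4 :- con (+ 3) :* v₀ :* v₂) (v₁ :^ 3 :+ con (+ 2) :* v₀ :* v₂ :^ 2) (con (+ 2) :* v₁ :^ 2 :- v₀ :* v₂ :^ 3) (con (+ 3) :* v₁ :+ v₀ :* v₂ :^ 4) (con (+ 5))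
      (mod-R*r _ (solve 3 (λ q R r → let f = R :- q :- q :* q :* r ; Q = q :* (q :* (q :* (q :* q))) in (f :^ 4 :+ con (+ 5) :* q :* f :^ 3 :+ con (+ 15) :* q :^ 2 :* f :^ 2 :+ con (+ 25) :* q :^ 3 :* f :+ con (+ 25) :* q :^ 4)
        := (R :^ 4 :- con (+ 3) :* Q :* r) :+ q :* (R :^ 3 :+ con (+ 2) :* Q :* r :^ 2) :+ q :* q :* (con (+ 2) :* R :^ 2 :- Q :* r :^ 3) :+ q :* (q :* q) :* (con (+ 3) :* R :+ Q :* r :^ 4) :+ q :* (q :* (q :* q)) :* (con (+ 5))
        :+ (R :* r :- con 1ℤ) :* (:- (con (+ 4) :* q :^ 2 :* R :^ 2) :- con (+ 3) :* q :^ 3 :* R :+ con (+ 6) :* q :^ 4 :* R :* r :- con (+ 6) :* q :^ 4 :+ con (+ 3) :* q :^ 5 :* r :- con (+ 4) :* q :^ 6 :* r :^ 2)) ≈-refl q dR dr))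

    κ*S₄-dis : κ * S₄ ≈ dis _ _ _ _ _
    κ*S₄-dis = dis-polynomial (v₁ :^ 5 :+ v₀ :^ 2 :* v₂ :^ 5) (v₁ :^ 4 :+ con (+ 7) :* v₀ :* v₂) (con (+ 3) :* v₁ :^ 3 :- con (+ 4) :* v₀ :* v₂ :^ 2) (con (+ 4) :* v₁ :^ 2 :+ con (+ 3) :* v₀ :* v₂ :^ 3) (con (+ 7) :* v₁ :- v₀ :* v₂ :^ 4)
      (mod-R*r _ (solve 3 (λ q R r → let f = R :- q :- q :* q :* r ; Q = q :* (q :* (q :* (q :* q))) in (R :+ q :* q :* r) :* (f :^ 4 :+ con (+ 5) :* q :* f :^ 3 :+ con (+ 15) :* q :^ 2 :* f :^ 2 :+ con (+ 25) :* q :^ 3 :* f :+ con (+ 25) :* q :^ 4)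
        := (R :^ 5 :+ Q :^ 2 :* r :^ 5) :+ q :* (R :^ 4 :+ con (+ 7) :* Q :* r) :+ q :* q :* (con (+ 3) :* R :^ 3 :- con (+ 4) :* Q :* r :^ 2) :+ q :* (q :* q) :* (con (+ 4) :* R :^ 2 :+ con (+ 3) :* Q :* r :^ 3) :+ q :* (q :* (q :* q)) :* (con (+ 7) :* R :- Q :* r :^ 4)
        :+ (R :* r :- con 1ℤ) :* (:- (con (+ 3) :* q :^ 2 :* R :^ 3) :- con (+ 2) :* q :^ 3 :* R :^ 2 :+ con (+ 2) :* q :^ 4 :* R :^ 2 :* r :- con (+ 4) :* q :^ 4 :* R :+ con (+ 2) :* q :^ 6 :* R :* r :^ 2 :- con (+ 4) :* q :^ 6 :* r :+ con (+ 2) :* q :^ 7 :* r :^ 2 :- con (+ 3) :* q :^ 8 :* r :^ 3)) ≈-refl q dR dr))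

  open Sums

  e≈ : e ≈ dτ * S₄
  e≈ = begin
    e
      ≈⟨ *-identityˡ e ⟨
    1# * e
      ≈⟨ *-congʳ (≈-trans (≈-sym dN*dτ) (*-congʳ dN≈)) ⟩
    _ ≈⟨ solve 4 (λ q F x e → (F :^ 5 :+ con (+ 5) :* q :* F :^ 4 :+ con (+ 15) :* q :^ 2 :* F :^ 3 :+ con (+ 25) :* q :^ 3 :* F :^ 2 :+ con (+ 25) :* q :^ 4 :* F) :* x :* e
           := (F :* e) :* (x :* (F :^ 4 :+ con (+ 5) :* q :* F :^ 3 :+ con (+ 15) :* q :^ 2 :* F :^ 2 :+ con (+ 25) :* q :^ 3 :* F :+ con (+ 25) :* q :^ 4))) ≈-refl q F dτ e ⟩
    F * e * (dτ * S₄)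
      ≈⟨ ≈-trans (*-congʳ F*e) (*-identityˡ _) ⟩
    dτ * S₄ ∎

  -- One Horner step, e S₄ = S₃ + 25q⁴ e: a part with explicit 5-dissection, and a multiple of
  -- `d t`, which `U` lets pass. The next three lemmas continue likewise.
  ew≈ : e * w ≈ dτ * (q * S₃) + d t * (const (+ 25) * e)
  ew≈ = begin
    e * w
      ≈⟨ *-congʳ e≈ ⟩
    dτ * S₄ * (q * e)
      ≈⟨ solve 4 (λ q F x e → x :* (F :^ 4 :+ con (+ 5) :* q :* F :^ 3 :+ con (+ 15) :* q :^ 2 :* F :^ 2 :+ con (+ 25) :* q :^ 3 :* F :+ con (+ 25) :* q :^ 4) :* (q :* e)
           := (F :* e) :* (x :* (q :* (F :^ 3 :+ con (+ 5) :* q :* F :^ 2 :+ con (+ 15) :* q :^ 2 :* F :+ con (+ 25) :* q :^ 3))) :+ q :* (q :* (q :* (q :* q))) :* x :* (con (+ 25) :* e)) ≈-refl q F dτ e ⟩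
    F * e * (dτ * (q * S₃)) + q * q⁴ * dτ * (const (+ 25) * e)
      ≈⟨ +-cong (≈-trans (*-congʳ F*e) (*-identityˡ _)) (*-congʳ (≈-sym d-t)) ⟩
    dτ * (q * S₃) + d t * (const (+ 25) * e) ∎

  eww≈ : e * w * w ≈ dτ * (q² * S₂) + d t * (const (+ 25) * e + const (+ 25) * (e * w))
  eww≈ = begin
    e * w * w
      ≈⟨ *-congʳ ew≈ ⟩
    (dτ * (q * S₃) + d t * (const (+ 25) * e)) * (q * e)
      ≈⟨ solve 5 (λ q F x e T → (x :* (q :* (F :^ 3 :+ con (+ 5) :* q :* F :^ 2 :+ con (+ 15) :* q :^ 2 :* F :+ con (+ 25) :* q :^ 3)) :+ T :* (con (+ 25) :* e)) :* (q :* e)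
           := (F :* e) :* (x :* (q :* q :* (F :^ 2 :+ con (+ 5) :* q :* F :+ con (+ 15) :* q :^ 2))) :+ (q :* (q :* (q :* (q :* q))) :* x :* (con (+ 25) :* e) :+ T :* (con (+ 25) :* (e :* (q :* e))))) ≈-refl q F dτ e (d t) ⟩
    F * e * (dτ * (q² * S₂)) + (q * q⁴ * dτ * (const (+ 25) * e) + d t * (const (+ 25) * (e * w)))
      ≈⟨ +-cong (≈-trans (*-congʳ F*e) (*-identityˡ _)) (+-congʳ (*-congʳ (≈-sym d-t))) ⟩
    dτ * (q² * S₂) + (d t * (const (+ 25) * e) + d t * (const (+ 25) * (e * w)))
      ≈⟨ +-congˡ (distribˡ _ _ _) ⟨
    dτ * (q² * S₂) + d t * (const (+ 25) * e + const (+ 25) * (e * w)) ∎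

  ewww≈ : e * w * w * w ≈ dτ * (q³ * S₁) + d t * (const (+ 15) * e + const (+ 25) * (e * w) + const (+ 25) * (e * w * w))
  ewww≈ = begin
    e * w * w * w
      ≈⟨ *-congʳ eww≈ ⟩
    (dτ * (q² * S₂) + d t * (const (+ 25) * e + const (+ 25) * (e * w))) * (q * e)
      ≈⟨ solve 5 (λ q F x e T → (x :* (q :* q :* (F :^ 2 :+ con (+ 5) :* q :* F :+ con (+ 15) :* q :^ 2)) :+ T :* (con (+ 25) :* e :+ con (+ 25) :* (e :* (q :* e)))) :* (q :* e)
           := (F :* e) :* (x :* (q :* (q :* q) :* (F :+ con (+ 5) :* q))) :+ (q :* (q :* (q :* (q :* q))) :* x :* (con (+ 15) :* e) :+ T :* (con (+ 25) :* (e :* (q :* e)) :+ con (+ 25) :* (e :* (q :* e) :* (q :* e))))) ≈-refl q F dτ e (d t) ⟩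
    F * e * (dτ * (q³ * S₁)) + (q * q⁴ * dτ * (const (+ 15) * e) + d t * (const (+ 25) * (e * w) + const (+ 25) * (e * w * w)))
      ≈⟨ +-cong (≈-trans (*-congʳ F*e) (*-identityˡ _)) (+-congʳ (*-congʳ (≈-sym d-t))) ⟩
    dτ * (q³ * S₁) + (d t * (const (+ 15) * e) + d t * (const (+ 25) * (e * w) + const (+ 25) * (e * w * w)))
      ≈⟨ +-congˡ (solve 4 (λ T a b c → T :* a :+ T :* (b :+ c) := T :* (a :+ b :+ c)) ≈-refl (d t) _ _ _) ⟩
    dτ * (q³ * S₁) + d t * (const (+ 15) * e + const (+ 25) * (e * w) + const (+ 25) * (e * w * w)) ∎

  ewwww≈ : e * w * w * w * w ≈ dτ * q⁴ + d t * (const (+ 5) * e + const (+ 15) * (e * w) + const (+ 25) * (e * w * w) + const (+ 25) * (e * w * w * w))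
  ewwww≈ = begin
    e * w * w * w * w
      ≈⟨ *-congʳ ewww≈ ⟩
    (dτ * (q³ * S₁) + d t * (const (+ 15) * e + const (+ 25) * (e * w) + const (+ 25) * (e * w * w))) * (q * e)
      ≈⟨ solve 5 (λ q F x e T → (x :* (q :* (q :* q) :* (F :+ con (+ 5) :* q)) :+ T :* (con (+ 15) :* e :+ con (+ 25) :* (e :* (q :* e)) :+ con (+ 25) :* (e :* (q :* e) :* (q :* e)))) :* (q :* e)
           := (F :* e) :* (x :* (q :* (q :* (q :* q)))) :+ (q :* (q :* (q :* (q :* q))) :* x :* (con (+ 5) :* e) :+ T :* (con (+ 15) :* (e :* (q :* e)) :+ con (+ 25) :* (e :* (q :* e) :* (q :* e)) :+ con (+ 25) :* (e :* (q :* e) :* (q :* e) :* (q :* e))))) ≈-refl q F dτ e (d t) ⟩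
    F * e * (dτ * q⁴) + (q * q⁴ * dτ * (const (+ 5) * e) + d t * (const (+ 15) * (e * w) + const (+ 25) * (e * w * w) + const (+ 25) * (e * w * w * w)))
      ≈⟨ +-cong (≈-trans (*-congʳ F*e) (*-identityˡ _)) (+-congʳ (*-congʳ (≈-sym d-t))) ⟩
    dτ * q⁴ + (d t * (const (+ 5) * e) + d t * (const (+ 15) * (e * w) + const (+ 25) * (e * w * w) + const (+ 25) * (e * w * w * w)))
      ≈⟨ +-congˡ (solve 5 (λ T a b c e → T :* a :+ T :* (b :+ c :+ e) := T :* (a :+ b :+ c :+ e)) ≈-refl (d t) _ _ _ _) ⟩
    dτ * q⁴ + d t * (const (+ 5) * e + const (+ 15) * (e * w) + const (+ 25) * (e * w * w) + const (+ 25) * (e * w * w * w)) ∎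

  w⁵≈ : w * (w * (w * (w * w))) ≈ d t * Dw
  w⁵≈ = begin
    w * (w * (w * (w * w)))
      ≈⟨ solve 2 (λ q e → q :* e :* (q :* e :* (q :* e :* (q :* e :* (q :* e)))) := q :* (e :* (q :* e) :* (q :* e) :* (q :* e) :* (q :* e))) ≈-refl q e ⟩
    q * (e * w * w * w * w)
      ≈⟨ *-congˡ ewwww≈ ⟩
    q * (dτ * q⁴ + d t * (const (+ 5) * e + const (+ 15) * (e * w) + const (+ 25) * (e * w * w) + const (+ 25) * (e * w * w * w)))
      ≈⟨ solve 4 (λ q e x T → q :* (x :* (q :* (q :* (q :* q))) :+ T :* (con (+ 5) :* e :+ con (+ 15) :* (e :* (q :* e)) :+ con (+ 25) :* (e :* (q :* e) :* (q :* e)) :+ con (+ 25) :* (e :* (q :* e) :* (q :* e) :* (q :* e))))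
           := q :* (q :* (q :* (q :* q))) :* x :+ T :* (con (+ 5) :* (q :* e) :+ con (+ 15) :* (q :* e :* (q :* e)) :+ con (+ 25) :* (q :* e :* (q :* e :* (q :* e))) :+ con (+ 25) :* (q :* e :* (q :* e :* (q :* e :* (q :* e)))))) ≈-refl q e dτ (d t) ⟩
    q * q⁴ * dτ + d t * (const (+ 5) * w + const (+ 15) * (w * w) + const (+ 25) * (w * (w * w)) + const (+ 25) * (w * (w * (w * w))))
      ≈⟨ +-congʳ (≈-sym d-t) ⟩
    d t + d t * (const (+ 5) * w + const (+ 15) * (w * w) + const (+ 25) * (w * (w * w)) + const (+ 25) * (w * (w * (w * w))))
      ≈⟨ solve 5 (λ T a b c e → T :+ T :* (a :+ b :+ c :+ e) := T :* (con 1ℤ :+ a :+ b :+ c :+ e)) ≈-refl (d t) _ _ _ _ ⟩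
    d t * Dw ∎

  Dw*dτ : Dw * dτ ≈ e ^ 5
  Dw*dτ = begin
    Dw * dτ
      ≈⟨ *-identityˡ _ ⟨
    1# * (Dw * dτ)
      ≈⟨ *-congʳ (1^ 5 F*e) ⟨
    (F * e) ^ 5 * (Dw * dτ)
      ≈⟨ solve 4 (λ q F e x → (F :* e) :^ 5 :* ((con 1ℤ :+ con (+ 5) :* (q :* e) :+ con (+ 15) :* (q :* e :* (q :* e)) :+ con (+ 25) :* (q :* e :* (q :* e :* (q :* e))) :+ con (+ 25) :* (q :* e :* (q :* e :* (q :* e :* (q :* e))))) :* x)
           := e :^ 5 :* ((F :^ 5 :+ con (+ 5) :* q :* F :^ 4 :* (F :* e) :+ con (+ 15) :* q :^ 2 :* F :^ 3 :* (F :* e) :^ 2 :+ con (+ 25) :* q :^ 3 :* F :^ 2 :* (F :* e) :^ 3 :+ con (+ 25) :* q :^ 4 :* F :* (F :* e) :^ 4) :* x)) ≈-refl q F e dτ ⟩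
    _ ≈⟨ *-congˡ (*-congʳ (+-cong (+-cong (+-cong (+-congˡ (*-congˡ F*e)) (*-congˡ (1^ 2 F*e))) (*-congˡ (1^ 3 F*e))) (*-congˡ (1^ 4 F*e)))) ⟩
    _ ≈⟨ solve 4 (λ q F e x → e :^ 5 :* ((F :^ 5 :+ con (+ 5) :* q :* F :^ 4 :* con 1ℤ :+ con (+ 15) :* q :^ 2 :* F :^ 3 :* con 1ℤ :+ con (+ 25) :* q :^ 3 :* F :^ 2 :* con 1ℤ :+ con (+ 25) :* q :^ 4 :* F :* con 1ℤ) :* x)
           := e :^ 5 :* ((F :^ 5 :+ con (+ 5) :* q :* F :^ 4 :+ con (+ 15) :* q :^ 2 :* F :^ 3 :+ con (+ 25) :* q :^ 3 :* F :^ 2 :+ con (+ 25) :* q :^ 4 :* F) :* x)) ≈-refl q F e dτ ⟩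
    _ ≈⟨ *-congˡ (≈-trans (*-congʳ (≈-sym dN≈)) dN*dτ) ⟩
    e ^ 5 * 1#
      ≈⟨ solve 1 (λ x → x :* con 1ℤ := x) ≈-refl _ ⟩
    e ^ 5 ∎

  dτ₀ : coeff dτ 0 ≡ 1ℤ
  dτ₀ = coeff₀-d τ₀

  -- `τ * dτ` telescopes to E(q²⁵)⁶/E(q)⁶ = e⁶. Comparison with `Dw*dτ` turns the equation of `w`
  -- over t(q⁵) into an expression of t(q) itself as a polynomial in `w`.
  τ≈ : τ ≈ e * Dw
  τ≈ = *-cancelˡ dτ₀ (*-cancelˡ (coeff₀-*-one (coeff₀-^ 6 E₀) (coeff₀-^ 6 dE₀)) (begin
    E ^ 6 * d E ^ 6 * (dτ * τ)
      ≈⟨ solve 4 (λ a b x y → a :* b :* (x :* y) := (y :* a) :* (x :* b)) ≈-refl (E ^ 6) (d E ^ 6) dτ τ ⟩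
    τ * E ^ 6 * (dτ * d E ^ 6)
      ≈⟨ *-cong τ*E⁶ (≈-trans (≈-sym (D.σ-eval (v₀ :* v₁ :^ 6) (τ ∷ E ∷ []))) (≈-trans (D.σ-cong τ*E⁶) (D.σ-eval (v₀ :^ 6) (d E ∷ [])))) ⟩
    d E ^ 6 * d (d E) ^ 6
      ≈⟨ *-congˡ (^-cong ddE≈ (≡.refl {x = 6})) ⟩
    d E ^ 6 * (E * e) ^ 6
      ≈⟨ solve 3 (λ a b e → b :* (a :* e) :^ 6 := a :^ 6 :* b :* (e :* e :^ 5)) ≈-refl E (d E ^ 6) e ⟩
    E ^ 6 * d E ^ 6 * (e * e ^ 5)
      ≈⟨ *-congˡ (*-congˡ Dw*dτ) ⟨
    E ^ 6 * d E ^ 6 * (e * (Dw * dτ))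
      ≈⟨ *-congˡ (solve 3 (λ e x y → e :* (x :* y) := y :* (e :* x)) ≈-refl e Dw dτ) ⟩
    E ^ 6 * d E ^ 6 * (dτ * (e * Dw)) ∎))
    where
    ddE≈ : d (d E) ≈ E * e
    ddE≈ = ≈-sym (≈-trans (*-congʳ E≈ddE*F) (≈-trans (*-assoc _ _ _) (≈-trans (*-congˡ F*e) (solve 1 (λ x → x :* con 1ℤ := x) ≈-refl _))))

  t≈ : t ≈ w * Dw
  t≈ = ≈-trans (*-congˡ τ≈) (≈-sym (*-assoc q e Dw))

  -- κ² = (F + q)² + 4q², because the two summands of `κ` have product q².
  κe-square : κ * e * (κ * e) ≈ 1# + const (+ 2) * w + const (+ 5) * (w * w)
  κe-square = begin
    κ * e * (κ * e)
      ≈⟨ solve 4 (λ q R r e → (R :+ q :* q :* r) :* e :* ((R :+ q :* q :* r) :* e)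
           := ((R :- q :- q :* q :* r) :* e) :* ((R :- q :- q :* q :* r) :* e) :+ con (+ 2) :* (q :* e :* ((R :- q :- q :* q :* r) :* e)) :+ con (+ 5) :* (q :* e :* (q :* e)) :+ con (+ 4) :* (q :* e :* (q :* e)) :* (R :* r :- con 1ℤ)) ≈-refl q dR dr e ⟩
    F * e * (F * e) + const (+ 2) * (w * (F * e)) + const (+ 5) * (w * w) + const (+ 4) * (w * w) * (dR * dr - 1#)
      ≈⟨ +-cong (+-congʳ (+-cong (*-cong F*e F*e) (*-congˡ (*-congˡ F*e)))) (*-congˡ (≈-trans (+-congʳ dR*dr) (-‿inverseʳ 1#))) ⟩
    1# * 1# + const (+ 2) * (w * 1#) + const (+ 5) * (w * w) + const (+ 4) * (w * w) * 0#
      ≈⟨ solve 1 (λ w → con 1ℤ :* con 1ℤ :+ con (+ 2) :* (w :* con 1ℤ) :+ con (+ 5) :* (w :* w) :+ con (+ 4) :* (w :* w) :* con 0ℤ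
           := con 1ℤ :+ con (+ 2) :* w :+ con (+ 5) :* (w :* w)) ≈-refl w ⟩
    1# + const (+ 2) * w + const (+ 5) * (w * w) ∎

  -- (R⁵ + q² r⁵)² = (N + 11q)² + 4q², and N τ = 1.
  s-square : s * s ≈ 1# + const (+ 22) * t + const (+ 125) * (t * t)
  s-square = begin
    s * s
      ≈⟨ solve 4 (λ q R r x → (R :^ 5 :+ q :* q :* r :^ 5) :* x :* ((R :^ 5 :+ q :* q :* r :^ 5) :* x)
           := ((R :^ 5 :- con (+ 11) :* q :- q :* q :* r :^ 5) :* x :+ con (+ 11) :* (q :* x)) :* ((R :^ 5 :- con (+ 11) :* q :- q :* q :* r :^ 5) :* x :+ con (+ 11) :* (q :* x)) :+ con (+ 4) :* (q :* x :* (q :* x)) :* (R :* r) :^ 5) ≈-refl q R r τ ⟩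
    (N * τ + const (+ 11) * t) * (N * τ + const (+ 11) * t) + const (+ 4) * (t * t) * (R * r) ^ 5
      ≈⟨ +-cong (*-cong (+-congʳ N*τ) (+-congʳ N*τ)) (*-congˡ (1^ 5 R*r)) ⟩
    (1# + const (+ 11) * t) * (1# + const (+ 11) * t) + const (+ 4) * (t * t) * 1#
      ≈⟨ solve 1 (λ t → (con 1ℤ :+ con (+ 11) :* t) :* (con 1ℤ :+ con (+ 11) :* t) :+ con (+ 4) :* (t :* t) :* con 1ℤ
           := con 1ℤ :+ con (+ 22) :* t :+ con (+ 125) :* (t :* t)) ≈-refl t ⟩
    1# + const (+ 22) * t + const (+ 125) * (t * t) ∎

  -- With t = w Dw, the polynomial 1 + 22t + 125t² factors as (1 + 2w + 5w²) Gw², which is the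
  -- origin of `Gw`; the constant terms fix the sign of the root.
  s≈ : s ≈ κ * e * Gw
  s≈ = sqrt-unique s₀ (coeff₀-*-one (coeff₀-*-one κ₀ e₀) Gw₀) (begin
    s * s
      ≈⟨ s-square ⟩
    1# + const (+ 22) * t + const (+ 125) * (t * t)
      ≈⟨ +-cong (+-congˡ (*-congˡ t≈)) (*-congˡ (*-cong t≈ t≈)) ⟩
    1# + const (+ 22) * (w * Dw) + const (+ 125) * (w * Dw * (w * Dw))
      ≈⟨ solve 1 (λ w → let D = con 1ℤ :+ con (+ 5) :* w :+ con (+ 15) :* (w :* w) :+ con (+ 25) :* (w :* (w :* w)) :+ con (+ 25) :* (w :* (w :* (w :* w)))
                            G = con 1ℤ :+ con (+ 10) :* w :+ con (+ 45) :* (w :* w) :+ con (+ 100) :* (w :* (w :* w)) :+ con (+ 125) :* (w :* (w :* (w :* w)))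
           in con 1ℤ :+ con (+ 22) :* (w :* D) :+ con (+ 125) :* (w :* D :* (w :* D)) := (con 1ℤ :+ con (+ 2) :* w :+ con (+ 5) :* (w :* w)) :* (G :* G)) ≈-refl w ⟩
    (1# + const (+ 2) * w + const (+ 5) * (w * w)) * (Gw * Gw)
      ≈⟨ *-congʳ κe-square ⟨
    κ * e * (κ * e) * (Gw * Gw)
      ≈⟨ solve 2 (λ x y → x :* x :* (y :* y) := x :* y :* (x :* y)) ≈-refl (κ * e) Gw ⟩
    κ * e * Gw * (κ * e * Gw) ∎)
    where
    s₀ : coeff s 0 ≡ 1ℤ
    s₀ = coeff₀-*-one (q-head (R ^ 5) (q * r ^ 5) (coeff₀-^ 5 R₀) (solve 3 (λ q R r → R :^ 5 :+ q :* q :* r :^ 5 := R :^ 5 :+ q :* (q :* r :^ 5)) ≈-refl q R r)) τ₀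
    Gw₀ : coeff Gw 0 ≡ 1ℤ
    Gw₀ = q-head 1# _ (coeff-const-zero 1ℤ) (solve 2 (λ q e → let w = q :* e in
      con 1ℤ :+ con (+ 10) :* w :+ con (+ 45) :* (w :* w) :+ con (+ 100) :* (w :* (w :* w)) :+ con (+ 125) :* (w :* (w :* (w :* w)))
      := con 1ℤ :+ q :* (con (+ 10) :* e :+ con (+ 45) :* (e :* w) :+ con (+ 100) :* (e :* (w :* w)) :+ con (+ 125) :* (e :* (w :* (w :* w))))) ≈-refl q e)

  -- Extraction of every fifth coefficient

  U : PowerSeries → PowerSeries
  U = comp 0

  U-cong : ∀ {f g} → f ≈ g → U f ≈ U g
  U-cong = comp-cong 0

  U-+ : ∀ f g → U (f + g) ≈ U f + U g
  U-+ = comp-+ 0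

  U-const* : ∀ c f → U (const c * f) ≈ const c * U f
  U-const* = comp-const* 0

  U-d* : ∀ a f → U (d a * f) ≈ a * U f
  U-d* a f = ≈-trans (U-cong (begin
    d a * f
      ≈⟨ *-congˡ (dissect f) ⟩
    d a * dis (comp 0 f) (comp 1 f) (comp 2 f) (comp 3 f) (comp 4 f)
      ≈⟨ solve 7 (λ q a x₀ x₁ x₂ x₃ x₄ → a :* (x₀ :+ q :* x₁ :+ q :* q :* x₂ :+ q :* (q :* q) :* x₃ :+ q :* (q :* (q :* q)) :* x₄)
           := a :* x₀ :+ q :* (a :* x₁) :+ q :* q :* (a :* x₂) :+ q :* (q :* q) :* (a :* x₃) :+ q :* (q :* (q :* q)) :* (a :* x₄)) ≈-refl q (d a) _ _ _ _ _ ⟩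
    _ ≈⟨ +-cong (+-cong (+-cong (+-cong (D.σ-* a _) (*-congˡ (D.σ-* a _))) (*-congˡ (D.σ-* a _))) (*-congˡ (D.σ-* a _))) (*-congˡ (D.σ-* a _)) ⟨
    dis (a * comp 0 f) (a * comp 1 f) (a * comp 2 f) (a * comp 3 f) (a * comp 4 f) ∎)) comp₀-dis

  q*dis : ∀ a₀ a₁ a₂ a₃ a₄ → q * dis a₀ a₁ a₂ a₃ a₄ ≈ dis (q * a₄) a₀ a₁ a₂ a₃
  q*dis a₀ a₁ a₂ a₃ a₄ = ≈-trans
    (solve 6 (λ q a b c e f → q :* (a :+ q :* b :+ q :* q :* c :+ q :* (q :* q) :* e :+ q :* (q :* (q :* q)) :* f)
       := q :* (q :* (q :* (q :* q))) :* f :+ q :* a :+ q :* q :* b :+ q :* (q :* q) :* c :+ q :* (q :* (q :* q)) :* e) ≈-refl q _ _ _ _ _)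
    (+-congʳ (+-congʳ (+-congʳ (+-congʳ (≈-sym (≈-trans (D.σ-* q _) (*-congʳ d-q)))))))

  U-q : ∀ {f a₀ a₁ a₂ a₃ a₄} → f ≈ dis a₀ a₁ a₂ a₃ a₄ → U (q * f) ≈ q * a₄
  U-q h = ≈-trans (U-cong (≈-trans (*-congˡ h) (q*dis _ _ _ _ _))) comp₀-dis

  U-q² : ∀ {f a₀ a₁ a₂ a₃ a₄} → f ≈ dis a₀ a₁ a₂ a₃ a₄ → U (q² * f) ≈ q * a₃
  U-q² h = ≈-trans (U-cong (*-assoc q q _)) (U-q (≈-trans (*-congˡ h) (q*dis _ _ _ _ _)))

  U-q³ : ∀ {f a₀ a₁ a₂ a₃ a₄} → f ≈ dis a₀ a₁ a₂ a₃ a₄ → U (q³ * f) ≈ q * a₂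
  U-q³ h = ≈-trans (U-cong (≈-trans (*-assoc q q² _) (*-congˡ (*-assoc q q _)))) (U-q (≈-trans (*-congˡ (≈-trans (*-congˡ h) (q*dis _ _ _ _ _))) (q*dis _ _ _ _ _)))

  U-q⁴ : ∀ {f a₀ a₁ a₂ a₃ a₄} → f ≈ dis a₀ a₁ a₂ a₃ a₄ → U (q⁴ * f) ≈ q * a₁
  U-q⁴ h = ≈-trans (U-cong (≈-trans (*-assoc q q³ _) (*-congˡ (≈-trans (*-assoc q q² _) (*-congˡ (*-assoc q q _))))))
    (U-q (≈-trans (*-congˡ (≈-trans (*-congˡ (≈-trans (*-congˡ h) (q*dis _ _ _ _ _))) (q*dis _ _ _ _ _))) (q*dis _ _ _ _ _)))

  5ₛ : PowerSeries
  5ₛ = const (+ 5)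

  -- 5-adic lattices

  -- The ℤ-span of the 5ᵃ xᵐ b with m ≥ l and a ≥ (h m - c)/2.
  data Lat (h c l : ℕ) (b x : PowerSeries) : PowerSeries → Set where
    gen : ∀ {f} a m z → l ℕ.≤ m → h ℕ.* m ℕ.≤ 2 ℕ.* a ℕ.+ c → f ≈ const z * (5ₛ ^ a * (x ^ m * b)) → Lat h c l b x f
    add : ∀ {f g k} → Lat h c l b x f → Lat h c l b x g → k ≈ f + g → Lat h c l b x k

  module _ {h l : ℕ} {b x : PowerSeries} where

    lat-≈ : ∀ {c f g} → g ≈ f → Lat h c l b x f → Lat h c l b x g
    lat-≈ p (gen a m z l≤m ≤a r) = gen a m z l≤m ≤a (≈-trans p r)
    lat-≈ p (add u v r)          = add u v (≈-trans p r)

    lat-const* : ∀ {c f} z → Lat h c l b x f → Lat h c l b x (const z * f)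
    lat-const* z (gen a m z′ l≤m ≤a r) = gen a m (z ℤ.* z′) l≤m ≤a
      (≈-trans (*-congˡ r) (≈-trans (≈-sym (*-assoc _ _ _)) (*-congʳ (≈-sym (const-* z z′)))))
    lat-const* z (add u v r) = add (lat-const* z u) (lat-const* z v) (≈-trans (*-congˡ r) (distribˡ _ _ _))

    lat-mono : ∀ {c c′ f} → c ℕ.≤ c′ → Lat h c l b x f → Lat h c′ l b x f
    lat-mono c≤c′ (gen a m z l≤m ≤a r) = gen a m z l≤m (ℕ.≤-trans ≤a (ℕ.+-monoʳ-≤ (2 ℕ.* a) c≤c′)) r
    lat-mono c≤c′ (add u v r)          = add (lat-mono c≤c′ u) (lat-mono c≤c′ v) r

    lat-weaken : ∀ {c l′ f} → l′ ℕ.≤ l → Lat h c l b x f → Lat h c l′ b x f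
    lat-weaken l′≤l (gen a m z l≤m ≤a r) = gen a m z (ℕ.≤-trans l′≤l l≤m) ≤a r
    lat-weaken l′≤l (add u v r)          = add (lat-weaken l′≤l u) (lat-weaken l′≤l v) r

    lat-5* : ∀ {c c′ f} → c′ ℕ.≤ 2 ℕ.+ c → Lat h c′ l b x f → Lat h c l b x (const (+ 5) * f)
    lat-5* {c} c′≤2+c (gen a m z l≤m ≤a r) = gen (suc a) m z l≤m
      (ℕ.≤-trans ≤a (ℕ.≤-trans (ℕ.+-monoʳ-≤ (2 ℕ.* a) c′≤2+c) (ℕ.≤-reflexive
        (solveℕ 2 (λ a c → nat 2 ⊗ a ⊕ (nat 2 ⊕ c) ⊜ nat 2 ⊗ (nat 1 ⊕ a) ⊕ c) ≡.refl a c))))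
      (≈-trans (*-congˡ r) (solve 4 (λ f z a y → f :* (z :* (a :* y)) := z :* (f :* a :* y)) ≈-refl 5ₛ (const z) _ _))
    lat-5* c′≤2+c (add u v r) = add (lat-5* c′≤2+c u) (lat-5* c′≤2+c v) (≈-trans (*-congˡ r) (distribˡ _ _ _))

    lat-25* : ∀ {c c′ f} → c′ ℕ.≤ 4 ℕ.+ c → Lat h c′ l b x f → Lat h c l b x (const (+ 25) * f)
    lat-25* {c} c′≤4+c u = lat-≈ (solve 1 (λ x → con (+ 25) :* x := con (+ 5) :* (con (+ 5) :* x)) ≈-refl _) (lat-5* {c} {2 ℕ.+ c} ℕ.≤-refl (lat-5* c′≤4+c u))

    lat-15* : ∀ {c c′ f} → c′ ℕ.≤ 2 ℕ.+ c → Lat h c′ l b x f → Lat h c l b x (const (+ 15) * f)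
    lat-15* c′≤2+c u = lat-≈ (solve 1 (λ x → con (+ 15) :* x := con (+ 3) :* (con (+ 5) :* x)) ≈-refl _) (lat-const* (+ 3) (lat-5* c′≤2+c u))

    lat-5^* : ∀ {c c′ f} a → c′ ℕ.≤ 2 ℕ.* a ℕ.+ c → Lat h c′ l b x f → Lat h c l b x (5ₛ ^ a * f)
    lat-5^* zero c′≤ u = lat-≈ (*-identityˡ _) (lat-mono c′≤ u)
    lat-5^* {c} (suc a) c′≤ u = lat-≈ (*-assoc _ _ _) (lat-5* {c} {2 ℕ.+ c} ℕ.≤-refl (lat-5^* a (ℕ.≤-trans c′≤ (ℕ.≤-reflexive
      (solveℕ 2 (λ a c → nat 2 ⊗ (nat 1 ⊕ a) ⊕ c ⊜ nat 2 ⊗ a ⊕ (nat 2 ⊕ c)) ≡.refl a c))) u))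

    lat-x* : ∀ {c f} → Lat h c l b x f → Lat h (h ℕ.+ c) (suc l) b x (x * f)
    lat-x* {c} (gen a m z l≤m ≤a r) = gen a (suc m) z (s≤s l≤m)
      (ℕ.≤-trans (ℕ.≤-reflexive (ℕ.*-suc h m)) (ℕ.≤-trans (ℕ.+-monoʳ-≤ h ≤a) (ℕ.≤-reflexive
        (solveℕ 3 (λ h a c → h ⊕ (a ⊕ c) ⊜ a ⊕ (h ⊕ c)) ≡.refl h (2 ℕ.* a) c))))
      (≈-trans (*-congˡ r) (solve 5 (λ x z a y b → x :* (z :* (a :* (y :* b))) := z :* (a :* (x :* y :* b))) ≈-refl x (const z) _ _ b))
    lat-x* (add u v r) = add (lat-x* u) (lat-x* v) (≈-trans (*-congˡ r) (distribˡ _ _ _))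

  lat-x*′ : ∀ {h c l b x f} → Lat h c l b x f → Lat h (h ℕ.+ c) l b x (x * f)
  lat-x*′ {l = l} u = lat-weaken (ℕ.n≤1+n l) (lat-x* u)

  -- The coefficient of wᵐ in `Dw`, and likewise in `Gw`, has valuation at least m/2. This dictates
  -- the slope h = 1 for `w`, at which these factors leave the offset unchanged.
  Dw*-lat : ∀ {c l f} → Lat 1 c l 1# w f → Lat 1 c l 1# w (Dw * f)
  Dw*-lat {c} {l} {f} u = add (add (add (add u
      (lat-5* (ℕ.n≤1+n _) u₁) ≈-refl)
      (lat-15* ℕ.≤-refl u₂) ≈-refl)
      (lat-25* (ℕ.n≤1+n _) u₃) ≈-refl)
      (lat-25* ℕ.≤-refl u₄)
      (solve 2 (λ w f → (con 1ℤ :+ con (+ 5) :* w :+ con (+ 15) :* (w :* w) :+ con (+ 25) :* (w :* (w :* w)) :+ con (+ 25) :* (w :* (w :* (w :* w)))) :* f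
        := f :+ con (+ 5) :* (w :* f) :+ con (+ 15) :* (w :* (w :* f)) :+ con (+ 25) :* (w :* (w :* (w :* f))) :+ con (+ 25) :* (w :* (w :* (w :* (w :* f))))) ≈-refl w f)
    where
    u₁ = lat-x*′ u
    u₂ = lat-x*′ u₁
    u₃ = lat-x*′ u₂
    u₄ = lat-x*′ u₃

  Gw*-lat : ∀ {c l f} → Lat 1 c l 1# w f → Lat 1 c l 1# w (Gw * f)
  Gw*-lat {c} {l} {f} u = add (add (add (add u
      (lat-const* (+ 2) (lat-5* (ℕ.n≤1+n _) u₁)) ≈-refl)
      (lat-const* (+ 9) (lat-5* ℕ.≤-refl u₂)) ≈-refl)
      (lat-const* (+ 4) (lat-25* (ℕ.n≤1+n _) u₃)) ≈-refl)
      (lat-const* (+ 5) (lat-25* ℕ.≤-refl u₄))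
      (solve 2 (λ w f → (con 1ℤ :+ con (+ 10) :* w :+ con (+ 45) :* (w :* w) :+ con (+ 100) :* (w :* (w :* w)) :+ con (+ 125) :* (w :* (w :* (w :* w)))) :* f
        := f :+ con (+ 2) :* (con (+ 5) :* (w :* f)) :+ con (+ 9) :* (con (+ 5) :* (w :* (w :* f))) :+ con (+ 4) :* (con (+ 25) :* (w :* (w :* (w :* f)))) :+ con (+ 5) :* (con (+ 25) :* (w :* (w :* (w :* (w :* f)))))) ≈-refl w f)
    where
    u₁ = lat-x*′ u
    u₂ = lat-x*′ u₁
    u₃ = lat-x*′ u₂
    u₄ = lat-x*′ u₃

  -- 1 + 2w + 5w² misses the bound m/2 only at w, by half a factor 5: one unit of the offset.
  κe²*-lat : ∀ {c l f} → Lat 1 c l 1# w f → Lat 1 (suc c) l 1# w (κ * e * (κ * e) * f)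
  κe²*-lat {c} {l} {f} u = add (add (lat-mono (ℕ.n≤1+n c) u) (lat-const* (+ 2) u₁) ≈-refl) (lat-5* (s≤s (s≤s (ℕ.n≤1+n c))) (lat-x*′ u₁))
      (≈-trans (*-congʳ κe-square) (solve 2 (λ w f → (con 1ℤ :+ con (+ 2) :* w :+ con (+ 5) :* (w :* w)) :* f
        := f :+ con (+ 2) :* (w :* f) :+ con (+ 5) :* (w :* (w :* f))) ≈-refl w f))
    where
    u₁ = lat-x*′ u

  t*-lat : ∀ {c l f} → Lat 1 c l 1# w f → Lat 1 (suc c) (suc l) 1# w (t * f)
  t*-lat u = lat-≈ (≈-trans (*-congʳ t≈) (*-assoc w Dw _)) (lat-x* (Dw*-lat u))

  t^-lat : ∀ m → Lat 1 m m 1# w (t ^ m)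
  t^-lat zero    = gen 0 0 1ℤ z≤n z≤n (solve 0 (con 1ℤ := con 1ℤ :* (con 1ℤ :* (con 1ℤ :* con 1ℤ))) ≈-refl)
  t^-lat (suc m) = t*-lat (t^-lat m)

  t^suc-lat : ∀ m → Lat 1 (suc m) 1 1# w (t ^ suc m)
  t^suc-lat m = lat-weaken (s≤s z≤n) (t^-lat (suc m))

  recurrence : ∀ g k → U (g * w ^ (5 ℕ.+ k)) ≈
    t * U (g * w ^ k) + const (+ 5) * (t * U (g * w ^ (1 ℕ.+ k))) + const (+ 15) * (t * U (g * w ^ (2 ℕ.+ k))) + const (+ 25) * (t * U (g * w ^ (3 ℕ.+ k))) + const (+ 25) * (t * U (g * w ^ (4 ℕ.+ k)))
  recurrence g k = begin
    U (g * (w * (w * (w * (w * (w * w ^ k))))))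
      ≈⟨ U-cong (solve 3 (λ w x g → g :* (w :* (w :* (w :* (w :* (w :* x))))) := (w :* (w :* (w :* (w :* w)))) :* (g :* x)) ≈-refl w (w ^ k) g) ⟩
    U (w * (w * (w * (w * w))) * (g * w ^ k))
      ≈⟨ U-cong (≈-trans (*-congʳ w⁵≈) (*-assoc _ _ _)) ⟩
    U (d t * (Dw * (g * w ^ k)))
      ≈⟨ U-d* t _ ⟩
    t * U (Dw * (g * w ^ k))
      ≈⟨ *-congˡ (≈-trans (U-cong (solve 3 (λ w g x → (con 1ℤ :+ con (+ 5) :* w :+ con (+ 15) :* (w :* w) :+ con (+ 25) :* (w :* (w :* w)) :+ con (+ 25) :* (w :* (w :* (w :* w)))) :* (g :* x)
           := g :* x :+ con (+ 5) :* (g :* (w :* x)) :+ con (+ 15) :* (g :* (w :* (w :* x))) :+ con (+ 25) :* (g :* (w :* (w :* (w :* x)))) :+ con (+ 25) :* (g :* (w :* (w :* (w :* (w :* x)))))) ≈-refl w g (w ^ k)))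
           (≈-trans (U-+ _ _) (+-cong (≈-trans (U-+ _ _) (+-cong (≈-trans (U-+ _ _) (+-cong (≈-trans (U-+ _ _) (+-congˡ (U-const* _ _))) (U-const* _ _))) (U-const* _ _))) (U-const* _ _)))) ⟩
    t * (U (g * w ^ k) + const (+ 5) * U (g * w ^ (1 ℕ.+ k)) + const (+ 15) * U (g * w ^ (2 ℕ.+ k)) + const (+ 25) * U (g * w ^ (3 ℕ.+ k)) + const (+ 25) * U (g * w ^ (4 ℕ.+ k)))
      ≈⟨ solve 6 (λ t a b c e f → t :* (a :+ con (+ 5) :* b :+ con (+ 15) :* c :+ con (+ 25) :* e :+ con (+ 25) :* f)
           := t :* a :+ con (+ 5) :* (t :* b) :+ con (+ 15) :* (t :* c) :+ con (+ 25) :* (t :* e) :+ con (+ 25) :* (t :* f)) ≈-refl t _ _ _ _ _ ⟩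
    _ ∎

  -- The modular equation propagates a bound for U(g wᵏ) from k < 5 to all k.
  module Tower (g b : PowerSeries) (c : ℕ) where

    -- `l = 1` records divisibility by `t`, available for k ≥ 1 in both uses; at k = 0 the values of
    -- `U` are 1 and `s`.
    Good : ℕ → ℕ → Set
    Good l k = Lat 5 (k ℕ.+ c) l b t (U (g * w ^ k))

    module _ (u₀ : Good 0 0) (u₁ : Good 1 1) (u₂ : Good 1 2) (u₃ : Good 1 3) (u₄ : Good 1 4) where

      private
        -- Five powers of `w` are traded for one `t`, hence the slope 5 in `t`; the factors 5, 15,
        -- 25, 25 pay for the larger offsets of the four later terms.
        combine : ∀ k l → Good l k → Good 1 (1 ℕ.+ k) → Good 1 (2 ℕ.+ k) → Good 1 (3 ℕ.+ k) → Good 1 (4 ℕ.+ k) → Good 1 (5 ℕ.+ k)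
        combine k l x₀ x₁ x₂ x₃ x₄ = add (add (add (add
          (lat-weaken (s≤s z≤n) (lat-x* x₀))
          (lat-5* (ℕ.n≤1+n _) (lat-x*′ x₁)) ≈-refl)
          (lat-15* ℕ.≤-refl (lat-x*′ x₂)) ≈-refl)
          (lat-25* (ℕ.n≤1+n _) (lat-x*′ x₃)) ≈-refl)
          (lat-25* ℕ.≤-refl (lat-x*′ x₄)) (recurrence g k)

        go : ∀ k → Good 1 (1 ℕ.+ k) × Good 1 (2 ℕ.+ k) × Good 1 (3 ℕ.+ k) × Good 1 (4 ℕ.+ k) × Good 1 (5 ℕ.+ k)
        go zero    = u₁ , u₂ , u₃ , u₄ , combine 0 0 u₀ u₁ u₂ u₃ u₄
        go (suc k) with go k
        ... | x₁ , x₂ , x₃ , x₄ , x₅ = x₂ , x₃ , x₄ , x₅ , combine (suc k) 1 x₁ x₂ x₃ x₄ x₅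

      good : ∀ k → Good 1 (suc k)
      good k = proj₁ (go k)

      private
        U-gen : ∀ {f} a m z → f ≈ const z * (5ₛ ^ a * (w ^ m * 1#)) → U (g * f) ≈ const z * (5ₛ ^ a * U (g * w ^ m))
        U-gen {f} a m z r = begin
          U (g * f)
            ≈⟨ U-cong (≈-trans (*-congˡ r) (solve 4 (λ g z a x → g :* (z :* (a :* (x :* con 1ℤ))) := z :* (a :* (g :* x))) ≈-refl g (const z) _ _)) ⟩
          U (const z * (5ₛ ^ a * (g * w ^ m)))
            ≈⟨ U-const* z _ ⟩
          const z * U (5ₛ ^ a * (g * w ^ m))
            ≈⟨ *-congˡ (≈-trans (U-cong (*-congʳ (≈-sym (≈-trans (D.σ-^ 5ₛ a) (^-cong (D.σ-const (+ 5)) (≡.refl {x = a})))))) (U-d* (5ₛ ^ a) _)) ⟩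
          const z * (5ₛ ^ a * U (g * w ^ m)) ∎

        U-add : ∀ {f f₁ f₂} → f ≈ f₁ + f₂ → U (g * f) ≈ U (g * f₁) + U (g * f₂)
        U-add r = ≈-trans (U-cong (≈-trans (*-congˡ r) (distribˡ _ _ _))) (U-+ _ _)

        shift : ∀ m a i → 1 ℕ.* m ℕ.≤ 2 ℕ.* a ℕ.+ i → m ℕ.+ c ℕ.≤ 2 ℕ.* a ℕ.+ (i ℕ.+ c)
        shift m a i h = ℕ.≤-trans (ℕ.+-monoˡ-≤ c (ℕ.≤-trans (ℕ.≤-reflexive (≡.sym (ℕ.*-identityˡ m))) h)) (ℕ.≤-reflexive (ℕ.+-assoc (2 ℕ.* a) i c))

      U-lat₁ : ∀ {i f} → Lat 1 i 1 1# w f → Lat 5 (i ℕ.+ c) 1 b t (U (g * f))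
      U-lat₁ {i} (gen a (suc m) z l≤m ≤a r) = lat-≈ (U-gen a (suc m) z r) (lat-const* z (lat-5^* a (shift (suc m) a i ≤a) (good m)))
      U-lat₁ (add u v r) = add (U-lat₁ u) (U-lat₁ v) (U-add r)

      U-lat₀ : ∀ {i f} → Lat 1 i 0 1# w f → Lat 5 (i ℕ.+ c) 0 b t (U (g * f))
      U-lat₀ {i} (gen a zero z l≤m ≤a r) = lat-≈ (U-gen a zero z r) (lat-const* z (lat-5^* a (shift zero a i ≤a) u₀))
      U-lat₀ {i} (gen a (suc m) z l≤m ≤a r) = lat-≈ (U-gen a (suc m) z r) (lat-const* z (lat-5^* a (shift (suc m) a i ≤a) (lat-weaken z≤n (good m))))
      U-lat₀ (add u v r) = add (U-lat₀ u) (U-lat₀ v) (U-add r)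

  open Sums

  -- Values of U on low powers of w

  κ-dis : κ ≈ dis R 0# r 0# 0#
  κ-dis = ≈-trans (solve 3 (λ q R r → R :+ q :* q :* r := R :+ q :* con 0ℤ :+ q :* q :* r :+ q :* (q :* q) :* con 0ℤ :+ q :* (q :* (q :* q)) :* con 0ℤ) ≈-refl q dR dr)
    (≈-sym (+-cong (+-cong (+-congʳ (+-congˡ (*-congˡ (D.σ-const 0ℤ)))) (*-congˡ (D.σ-const 0ℤ))) (*-congˡ (D.σ-const 0ℤ))))

  private
    split : ∀ f x {y z} → U f ≈ y → U x ≈ z → U (dτ * f + d t * x) ≈ τ * y + t * z
    split f x p r = ≈-trans (U-+ _ _) (+-cong (≈-trans (U-d* τ f) (*-congˡ p)) (≈-trans (U-d* t x) (*-congˡ r)))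

    τ*q : ∀ c x → τ * (q * const c) + x ≈ const c * t + x
    τ*q c = solve 4 (λ q x c y → x :* (q :* c) :+ y := c :* (q :* x) :+ y) ≈-refl q τ (const c)

    τ*0 : ∀ x → τ * (q * 0#) + x ≈ x
    τ*0 = solve 3 (λ q x y → x :* (q :* con 0ℤ) :+ y := y) ≈-refl q τ

    W Z : ℕ → PowerSeries
    W k = U (1# * w ^ k)
    Z k = U (κ * e * w ^ k)

    U-w : ∀ {x} k → x ≈ w ^ k → U x ≈ W k
    U-w k h = U-cong (≈-trans h (≈-sym (*-identityˡ _)))

    U-κ : ∀ {x} k → x ≈ κ * e * w ^ k → U x ≈ Z k
    U-κ k = U-cong

    U-1 : U 1# ≈ 1#
    U-1 = coeffwise λ { zero → ≡.refl ; (suc n) → ≡.trans (coeff-const-suc 1ℤ _) (≡.sym (coeff-const-suc 1ℤ n)) }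

    W₀ : W 0 ≈ 1#
    W₀ = ≈-trans (U-cong (*-identityˡ 1#)) U-1

    -- For k = 1, ..., 4 the new contribution to `W k` is class 5 - k of the Horner polynomial with
    -- index 5 - k. These classes are the constants 5, 10, 9, 4.
    W₁ : W 1 ≈ const (+ 5) * t
    W₁ = begin
      U (1# * (q * e * 1#))    ≈⟨ U-cong (≈-trans (solve 2 (λ q e → con 1ℤ :* (q :* e :* con 1ℤ) := e :* q) ≈-refl q e) (*-congʳ e≈)) ⟩
      U (dτ * S₄ * q)          ≈⟨ U-cong (solve 3 (λ x y q → x :* y :* q := x :* (q :* y)) ≈-refl dτ S₄ q) ⟩
      U (dτ * (q * S₄))        ≈⟨ ≈-trans (U-d* τ _) (*-congˡ (U-q S₄-dis)) ⟩
      τ * (q * const (+ 5))    ≈⟨ solve 2 (λ x q → x :* (q :* con (+ 5)) := con (+ 5) :* (q :* x)) ≈-refl τ q ⟩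
      const (+ 5) * t          ∎

    W₂ : W 2 ≈ const (+ 10) * t + t * (const (+ 25) * W 1)
    W₂ = begin
      U (1# * (w * (w * 1#)))
        ≈⟨ U-cong (≈-trans (solve 2 (λ q e → con 1ℤ :* (q :* e :* (q :* e :* con 1ℤ)) := q :* (e :* (q :* e))) ≈-refl q e) (*-congˡ ew≈)) ⟩
      U (q * (dτ * (q * S₃) + d t * (const (+ 25) * e)))
        ≈⟨ U-cong (solve 5 (λ q x S T e → q :* (x :* (q :* S) :+ T :* (con (+ 25) :* e)) := x :* (q :* q :* S) :+ T :* (con (+ 25) :* (q :* e))) ≈-refl q dτ S₃ (d t) e) ⟩
      U (dτ * (q² * S₃) + d t * (const (+ 25) * w))
        ≈⟨ split _ _ (U-q² S₃-dis) (≈-trans (U-const* _ _) (*-congˡ (U-w 1 (solve 1 (λ w → w := w :* con 1ℤ) ≈-refl w)))) ⟩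
      τ * (q * const (+ 10)) + t * (const (+ 25) * W 1)
        ≈⟨ τ*q (+ 10) _ ⟩
      const (+ 10) * t + t * (const (+ 25) * W 1) ∎

    W₃ : W 3 ≈ const (+ 9) * t + t * (const (+ 25) * W 1 + const (+ 25) * W 2)
    W₃ = begin
      U (1# * (w * (w * (w * 1#))))
        ≈⟨ U-cong (≈-trans (solve 2 (λ q e → con 1ℤ :* (q :* e :* (q :* e :* (q :* e :* con 1ℤ))) := q :* (e :* (q :* e) :* (q :* e))) ≈-refl q e) (*-congˡ eww≈)) ⟩
      U (q * (dτ * (q² * S₂) + d t * (const (+ 25) * e + const (+ 25) * (e * w))))
        ≈⟨ U-cong (solve 5 (λ q x S T e → q :* (x :* (q :* q :* S) :+ T :* (con (+ 25) :* e :+ con (+ 25) :* (e :* (q :* e))))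
             := x :* (q :* (q :* q) :* S) :+ T :* (con (+ 25) :* (q :* e) :+ con (+ 25) :* (q :* e :* (q :* e)))) ≈-refl q dτ S₂ (d t) e) ⟩
      U (dτ * (q³ * S₂) + d t * (const (+ 25) * w + const (+ 25) * (w * w)))
        ≈⟨ split _ _ (U-q³ S₂-dis) (≈-trans (U-+ _ _) (+-cong
             (≈-trans (U-const* _ _) (*-congˡ (U-w 1 (solve 1 (λ w → w := w :* con 1ℤ) ≈-refl w))))
             (≈-trans (U-const* _ _) (*-congˡ (U-w 2 (solve 1 (λ w → w :* w := w :* (w :* con 1ℤ)) ≈-refl w)))))) ⟩
      τ * (q * const (+ 9)) + t * (const (+ 25) * W 1 + const (+ 25) * W 2)
        ≈⟨ τ*q (+ 9) _ ⟩
      const (+ 9) * t + t * (const (+ 25) * W 1 + const (+ 25) * W 2) ∎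

    W₄ : W 4 ≈ const (+ 4) * t + t * (const (+ 15) * W 1 + const (+ 25) * W 2 + const (+ 25) * W 3)
    W₄ = begin
      U (1# * (w * (w * (w * (w * 1#)))))
        ≈⟨ U-cong (≈-trans (solve 2 (λ q e → con 1ℤ :* (q :* e :* (q :* e :* (q :* e :* (q :* e :* con 1ℤ)))) := q :* (e :* (q :* e) :* (q :* e) :* (q :* e))) ≈-refl q e) (*-congˡ ewww≈)) ⟩
      U (q * (dτ * (q³ * S₁) + d t * (const (+ 15) * e + const (+ 25) * (e * w) + const (+ 25) * (e * w * w))))
        ≈⟨ U-cong (solve 5 (λ q x S T e → q :* (x :* (q :* (q :* q) :* S) :+ T :* (con (+ 15) :* e :+ con (+ 25) :* (e :* (q :* e)) :+ con (+ 25) :* (e :* (q :* e) :* (q :* e))))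
             := x :* (q :* (q :* (q :* q)) :* S) :+ T :* (con (+ 15) :* (q :* e) :+ con (+ 25) :* (q :* e :* (q :* e)) :+ con (+ 25) :* (q :* e :* (q :* e :* (q :* e))))) ≈-refl q dτ S₁ (d t) e) ⟩
      U (dτ * (q⁴ * S₁) + d t * (const (+ 15) * w + const (+ 25) * (w * w) + const (+ 25) * (w * (w * w))))
        ≈⟨ split _ _ (U-q⁴ S₁-dis) (≈-trans (U-+ _ _) (+-cong (≈-trans (U-+ _ _) (+-cong
             (≈-trans (U-const* _ _) (*-congˡ (U-w 1 (solve 1 (λ w → w := w :* con 1ℤ) ≈-refl w))))
             (≈-trans (U-const* _ _) (*-congˡ (U-w 2 (solve 1 (λ w → w :* w := w :* (w :* con 1ℤ)) ≈-refl w))))))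
             (≈-trans (U-const* _ _) (*-congˡ (U-w 3 (solve 1 (λ w → w :* (w :* w) := w :* (w :* (w :* con 1ℤ))) ≈-refl w)))))) ⟩
      τ * (q * const (+ 4)) + t * (const (+ 15) * W 1 + const (+ 25) * W 2 + const (+ 25) * W 3)
        ≈⟨ τ*q (+ 4) _ ⟩
      const (+ 4) * t + t * (const (+ 15) * W 1 + const (+ 25) * W 2 + const (+ 25) * W 3) ∎

    κe≈ : κ * e ≈ dτ * (κ * S₄)
    κe≈ = ≈-trans (*-congˡ e≈) (solve 3 (λ k x S → k :* (x :* S) := x :* (k :* S)) ≈-refl κ dτ S₄)

    -- Class 0 of κ S₄ is R⁵ + q² r⁵: this is how `s` enters.
    Z₀ : Z 0 ≈ s
    Z₀ = begin
      U (κ * e * 1#)                    ≈⟨ U-cong (≈-trans (solve 1 (λ x → x :* con 1ℤ := x) ≈-refl (κ * e)) κe≈) ⟩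
      U (dτ * (κ * S₄))                 ≈⟨ ≈-trans (U-d* τ _) (*-congˡ (≈-trans (U-cong κ*S₄-dis) comp₀-dis)) ⟩
      τ * (R ^ 5 + q ^ 2 * r ^ 5)       ≈⟨ solve 4 (λ q R r x → x :* (R :^ 5 :+ q :^ 2 :* r :^ 5) := (R :^ 5 :+ q :* q :* r :^ 5) :* x) ≈-refl q R r τ ⟩
      s                                 ∎

    -- The class of κ S₃ selected by `U` vanishes, as do those of κ S₂, κ S₁ and κ for the next
    -- three values. So every `Z k` is `s` times a polynomial in `t`.
    Z₁ : Z 1 ≈ t * (const (+ 25) * Z 0)
    Z₁ = begin
      U (κ * e * (w * 1#))
        ≈⟨ U-cong (≈-trans (solve 3 (λ k w e → k :* e :* (w :* con 1ℤ) := k :* (e :* w)) ≈-refl κ w e) (*-congˡ ew≈)) ⟩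
      U (κ * (dτ * (q * S₃) + d t * (const (+ 25) * e)))
        ≈⟨ U-cong (solve 6 (λ q k x S T e → k :* (x :* (q :* S) :+ T :* (con (+ 25) :* e)) := x :* (q :* (k :* S)) :+ T :* (con (+ 25) :* (k :* e))) ≈-refl q κ dτ S₃ (d t) e) ⟩
      U (dτ * (q * (κ * S₃)) + d t * (const (+ 25) * (κ * e)))
        ≈⟨ split _ _ (U-q κ*S₃-dis) (≈-trans (U-const* _ _) (*-congˡ (U-κ 0 (solve 1 (λ x → x := x :* con 1ℤ) ≈-refl (κ * e))))) ⟩
      τ * (q * 0#) + t * (const (+ 25) * Z 0)
        ≈⟨ τ*0 _ ⟩
      t * (const (+ 25) * Z 0) ∎

    Z₂ : Z 2 ≈ t * (const (+ 25) * Z 0 + const (+ 25) * Z 1)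
    Z₂ = begin
      U (κ * e * (w * (w * 1#)))
        ≈⟨ U-cong (≈-trans (solve 3 (λ k w e → k :* e :* (w :* (w :* con 1ℤ)) := k :* (e :* w :* w)) ≈-refl κ w e) (*-congˡ eww≈)) ⟩
      U (κ * (dτ * (q² * S₂) + d t * (const (+ 25) * e + const (+ 25) * (e * w))))
        ≈⟨ U-cong (solve 7 (λ q k x S T e w → k :* (x :* (q :* q :* S) :+ T :* (con (+ 25) :* e :+ con (+ 25) :* (e :* w)))
             := x :* (q :* q :* (k :* S)) :+ T :* (con (+ 25) :* (k :* e :* con 1ℤ) :+ con (+ 25) :* (k :* e :* (w :* con 1ℤ)))) ≈-refl q κ dτ S₂ (d t) e w) ⟩
      U (dτ * (q² * (κ * S₂)) + d t * (const (+ 25) * (κ * e * w ^ 0) + const (+ 25) * (κ * e * w ^ 1)))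
        ≈⟨ split _ _ (U-q² κ*S₂-dis) (≈-trans (U-+ _ _) (+-cong (U-const* _ _) (U-const* _ _))) ⟩
      τ * (q * 0#) + t * (const (+ 25) * Z 0 + const (+ 25) * Z 1)
        ≈⟨ τ*0 _ ⟩
      t * (const (+ 25) * Z 0 + const (+ 25) * Z 1) ∎

    Z₃ : Z 3 ≈ t * (const (+ 15) * Z 0 + const (+ 25) * Z 1 + const (+ 25) * Z 2)
    Z₃ = begin
      U (κ * e * (w * (w * (w * 1#))))
        ≈⟨ U-cong (≈-trans (solve 3 (λ k w e → k :* e :* (w :* (w :* (w :* con 1ℤ))) := k :* (e :* w :* w :* w)) ≈-refl κ w e) (*-congˡ ewww≈)) ⟩
      U (κ * (dτ * (q³ * S₁) + d t * (const (+ 15) * e + const (+ 25) * (e * w) + const (+ 25) * (e * w * w))))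
        ≈⟨ U-cong (solve 7 (λ q k x S T e w → k :* (x :* (q :* (q :* q) :* S) :+ T :* (con (+ 15) :* e :+ con (+ 25) :* (e :* w) :+ con (+ 25) :* (e :* w :* w)))
             := x :* (q :* (q :* q) :* (k :* S)) :+ T :* (con (+ 15) :* (k :* e :* con 1ℤ) :+ con (+ 25) :* (k :* e :* (w :* con 1ℤ)) :+ con (+ 25) :* (k :* e :* (w :* (w :* con 1ℤ))))) ≈-refl q κ dτ S₁ (d t) e w) ⟩
      U (dτ * (q³ * (κ * S₁)) + d t * (const (+ 15) * (κ * e * w ^ 0) + const (+ 25) * (κ * e * w ^ 1) + const (+ 25) * (κ * e * w ^ 2)))
        ≈⟨ split _ _ (U-q³ κ*S₁-dis) (≈-trans (U-+ _ _) (+-cong (≈-trans (U-+ _ _) (+-cong (U-const* _ _) (U-const* _ _))) (U-const* _ _))) ⟩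
      τ * (q * 0#) + t * (const (+ 15) * Z 0 + const (+ 25) * Z 1 + const (+ 25) * Z 2)
        ≈⟨ τ*0 _ ⟩
      t * (const (+ 15) * Z 0 + const (+ 25) * Z 1 + const (+ 25) * Z 2) ∎

    Z₄ : Z 4 ≈ t * (const (+ 5) * Z 0 + const (+ 15) * Z 1 + const (+ 25) * Z 2 + const (+ 25) * Z 3)
    Z₄ = begin
      U (κ * e * (w * (w * (w * (w * 1#)))))
        ≈⟨ U-cong (≈-trans (solve 3 (λ k w e → k :* e :* (w :* (w :* (w :* (w :* con 1ℤ)))) := k :* (e :* w :* w :* w :* w)) ≈-refl κ w e) (*-congˡ ewwww≈)) ⟩
      U (κ * (dτ * q⁴ + d t * (const (+ 5) * e + const (+ 15) * (e * w) + const (+ 25) * (e * w * w) + const (+ 25) * (e * w * w * w))))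
        ≈⟨ U-cong (solve 6 (λ q k x T e w → k :* (x :* (q :* (q :* (q :* q))) :+ T :* (con (+ 5) :* e :+ con (+ 15) :* (e :* w) :+ con (+ 25) :* (e :* w :* w) :+ con (+ 25) :* (e :* w :* w :* w)))
             := x :* (q :* (q :* (q :* q)) :* k) :+ T :* (con (+ 5) :* (k :* e :* con 1ℤ) :+ con (+ 15) :* (k :* e :* (w :* con 1ℤ)) :+ con (+ 25) :* (k :* e :* (w :* (w :* con 1ℤ))) :+ con (+ 25) :* (k :* e :* (w :* (w :* (w :* con 1ℤ)))))) ≈-refl q κ dτ (d t) e w) ⟩
      U (dτ * (q⁴ * κ) + d t * (const (+ 5) * (κ * e * w ^ 0) + const (+ 15) * (κ * e * w ^ 1) + const (+ 25) * (κ * e * w ^ 2) + const (+ 25) * (κ * e * w ^ 3)))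
        ≈⟨ split _ _ (U-q⁴ κ-dis) (≈-trans (U-+ _ _) (+-cong (≈-trans (U-+ _ _) (+-cong (≈-trans (U-+ _ _) (+-cong (U-const* _ _) (U-const* _ _))) (U-const* _ _))) (U-const* _ _))) ⟩
      τ * (q * 0#) + t * (const (+ 5) * Z 0 + const (+ 15) * Z 1 + const (+ 25) * Z 2 + const (+ 25) * Z 3)
        ≈⟨ τ*0 _ ⟩
      t * (const (+ 5) * Z 0 + const (+ 15) * Z 1 + const (+ 25) * Z 2 + const (+ 25) * Z 3) ∎

    ≤-dec : ∀ m n {_ : T (m ℕ.≤ᵇ n)} → m ℕ.≤ n
    ≤-dec m n {h} = ℕ.≤ᵇ⇒≤ m n h

    -- The offset 2 is forced by U(w) = 5t and by the term 9t of U(w³). With the factor κ e the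
    -- offset 0 is enough.
    module WT = Tower 1# 1# 2
    module ZT = Tower (κ * e) s 0

    W₀-lat : WT.Good 0 0
    W₀-lat = gen 0 0 1ℤ z≤n z≤n (≈-trans W₀ (solve 0 (con 1ℤ := con 1ℤ :* (con 1ℤ :* (con 1ℤ :* con 1ℤ))) ≈-refl))

    t-lat : ∀ {c} a z → 5 ℕ.≤ 2 ℕ.* a ℕ.+ c → Lat 5 c 1 1# t (const z * 5ₛ ^ a * t)
    t-lat a z h = gen a 1 z (s≤s z≤n) h (solve 3 (λ z a x → z :* a :* x := z :* (a :* (x :* con 1ℤ :* con 1ℤ))) ≈-refl (const z) (5ₛ ^ a) t)

    W₁-lat : WT.Good 1 1
    W₁-lat = lat-≈ (≈-trans W₁ (solve 1 (λ t → con (+ 5) :* t := con 1ℤ :* con (+ 5) :^ 1 :* t) ≈-refl t)) (t-lat 1 1ℤ (≤-dec 5 5))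

    W₂-lat : WT.Good 1 2
    W₂-lat = add (t-lat 1 (+ 2) (≤-dec 5 6)) (lat-25* (≤-dec 8 8) (lat-x*′ W₁-lat))
      (≈-trans W₂ (solve 2 (λ t x → con (+ 10) :* t :+ t :* (con (+ 25) :* x) := con (+ 2) :* con (+ 5) :^ 1 :* t :+ con (+ 25) :* (t :* x)) ≈-refl t (W 1)))

    W₃-lat : WT.Good 1 3
    W₃-lat = add (add (t-lat 0 (+ 9) (≤-dec 5 5)) (lat-25* (≤-dec 8 9) (lat-x*′ W₁-lat)) ≈-refl) (lat-25* (≤-dec 9 9) (lat-x*′ W₂-lat))
      (≈-trans W₃ (solve 3 (λ t x y → con (+ 9) :* t :+ t :* (con (+ 25) :* x :+ con (+ 25) :* y) := con (+ 9) :* con 1ℤ :* t :+ con (+ 25) :* (t :* x) :+ con (+ 25) :* (t :* y)) ≈-refl t (W 1) (W 2)))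

    W₄-lat : WT.Good 1 4
    W₄-lat = add (add (add (t-lat 0 (+ 4) (≤-dec 5 6)) (lat-15* (≤-dec 8 8) (lat-x*′ W₁-lat)) ≈-refl) (lat-25* (≤-dec 9 10) (lat-x*′ W₂-lat)) ≈-refl) (lat-25* (≤-dec 10 10) (lat-x*′ W₃-lat))
      (≈-trans W₄ (solve 4 (λ t x y z → con (+ 4) :* t :+ t :* (con (+ 15) :* x :+ con (+ 25) :* y :+ con (+ 25) :* z)
        := con (+ 4) :* con 1ℤ :* t :+ con (+ 15) :* (t :* x) :+ con (+ 25) :* (t :* y) :+ con (+ 25) :* (t :* z)) ≈-refl t (W 1) (W 2) (W 3)))

    Z₀-lat : ZT.Good 0 0
    Z₀-lat = gen 0 0 1ℤ z≤n z≤n (≈-trans Z₀ (solve 1 (λ s → s := con 1ℤ :* (con 1ℤ :* (con 1ℤ :* s))) ≈-refl s))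

    Z₁-lat : ZT.Good 1 1
    Z₁-lat = lat-≈ (≈-trans Z₁ (solve 2 (λ t x → t :* (con (+ 25) :* x) := con (+ 25) :* (t :* x)) ≈-refl t (Z 0))) (lat-25* (≤-dec 5 5) (lat-x* Z₀-lat))

    Z₂-lat : ZT.Good 1 2
    Z₂-lat = add (lat-25* (≤-dec 5 6) (lat-x* Z₀-lat)) (lat-25* (≤-dec 6 6) (lat-x*′ Z₁-lat))
      (≈-trans Z₂ (solve 3 (λ t x y → t :* (con (+ 25) :* x :+ con (+ 25) :* y) := con (+ 25) :* (t :* x) :+ con (+ 25) :* (t :* y)) ≈-refl t (Z 0) (Z 1)))

    Z₃-lat : ZT.Good 1 3
    Z₃-lat = add (add (lat-15* (≤-dec 5 5) (lat-x* Z₀-lat)) (lat-25* (≤-dec 6 7) (lat-x*′ Z₁-lat)) ≈-refl) (lat-25* (≤-dec 7 7) (lat-x*′ Z₂-lat))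
      (≈-trans Z₃ (solve 4 (λ t x y z → t :* (con (+ 15) :* x :+ con (+ 25) :* y :+ con (+ 25) :* z) := con (+ 15) :* (t :* x) :+ con (+ 25) :* (t :* y) :+ con (+ 25) :* (t :* z)) ≈-refl t (Z 0) (Z 1) (Z 2)))

    Z₄-lat : ZT.Good 1 4
    Z₄-lat = add (add (add (lat-5* (≤-dec 5 6) (lat-x* Z₀-lat)) (lat-15* (≤-dec 6 6) (lat-x*′ Z₁-lat)) ≈-refl) (lat-25* (≤-dec 7 8) (lat-x*′ Z₂-lat)) ≈-refl) (lat-25* (≤-dec 8 8) (lat-x*′ Z₃-lat))
      (≈-trans Z₄ (solve 5 (λ t x y z v → t :* (con (+ 5) :* x :+ con (+ 15) :* y :+ con (+ 25) :* z :+ con (+ 25) :* v)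
        := con (+ 5) :* (t :* x) :+ con (+ 15) :* (t :* y) :+ con (+ 25) :* (t :* z) :+ con (+ 25) :* (t :* v)) ≈-refl t (Z 0) (Z 1) (Z 2) (Z 3)))

  U-lat : ∀ {c f} → Lat 1 c 1 1# w f → Lat 5 (c ℕ.+ 2) 1 1# t (U f)
  U-lat u = lat-≈ (U-cong (≈-sym (*-identityˡ _))) (WT.U-lat₁ W₀-lat W₁-lat W₂-lat W₃-lat W₄-lat u)

  U-lat₀ : ∀ {c f} → Lat 1 c 0 1# w f → Lat 5 (c ℕ.+ 2) 0 1# t (U f)
  U-lat₀ u = lat-≈ (U-cong (≈-sym (*-identityˡ _))) (WT.U-lat₀ W₀-lat W₁-lat W₂-lat W₃-lat W₄-lat u)

  U-κe-lat : ∀ {c f} → Lat 1 c 1 1# w f → Lat 5 (c ℕ.+ 0) 1 s t (U (κ * e * f))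
  U-κe-lat = ZT.U-lat₁ Z₀-lat Z₁-lat Z₂-lat Z₃-lat Z₄-lat

  U-κe-lat₀ : ∀ {c f} → Lat 1 c 0 1# w f → Lat 5 (c ℕ.+ 0) 0 s t (U (κ * e * f))
  U-κe-lat₀ = ZT.U-lat₀ Z₀-lat Z₁-lat Z₂-lat Z₃-lat Z₄-lat

  -- The two steps of the iteration and their gain of a factor 5

  valuation-bound : ∀ {i m a b k c₁ c₂ c₃} → 4 ℕ.* i ℕ.≤ 2 ℕ.* a ℕ.+ c₁ → 5 ℕ.* m ℕ.+ c₃ ℕ.≤ 2 ℕ.* b ℕ.+ (i ℕ.+ c₂) →
    c₁ ℕ.+ 4 ℕ.* c₂ ℕ.< 8 ℕ.* k ℕ.+ 4 ℕ.* (c₃ ℕ.+ m) → 2 ℕ.* m ℕ.< a ℕ.+ b ℕ.+ k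
  valuation-bound {i} {m} {a} {b} {k} {c₁} {c₂} {c₃} h₁ h₂ h₃ with 2 ℕ.* m ℕ.<? a ℕ.+ b ℕ.+ k
  ... | yes 2m< = 2m<
  ... | no 2m≮ = ⊥-elim (ℕ.<-irrefl ≡.refl (ℕ.≤-<-trans chain (ℕ.<-≤-trans (ℕ.+-monoʳ-< (8 ℕ.* b ℕ.+ 2 ℕ.* a) h₃)
      (ℕ.+-monoˡ-≤ _ (ℕ.+-monoʳ-≤ (8 ℕ.* b) (ℕ.*-monoˡ-≤ a {2} {8} (s≤s (s≤s z≤n))))))))
    where
    -- If a + b + k ≤ 2m, four times the second bound with the first inserted contradicts the third.
    -- Up to offsets, a ≥ 2i and b ≥ (5m - i)/2, so a + b is at least 5m/2; the third hypothesis
    -- says that the offsets do not eat up this surplus over 2m.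
    chain : 8 ℕ.* b ℕ.+ 8 ℕ.* a ℕ.+ (8 ℕ.* k ℕ.+ 4 ℕ.* (c₃ ℕ.+ m)) ℕ.≤ 8 ℕ.* b ℕ.+ 2 ℕ.* a ℕ.+ (c₁ ℕ.+ 4 ℕ.* c₂)
    chain = ℕ.≤-trans (ℕ.≤-reflexive (solveℕ 5 (λ a b k c m → nat 8 ⊗ b ⊕ nat 8 ⊗ a ⊕ (nat 8 ⊗ k ⊕ nat 4 ⊗ (c ⊕ m))
          ⊜ nat 8 ⊗ (a ⊕ b ⊕ k) ⊕ nat 4 ⊗ (c ⊕ m)) ≡.refl a b k c₃ m))
      (ℕ.≤-trans (ℕ.+-monoˡ-≤ (4 ℕ.* (c₃ ℕ.+ m)) (ℕ.*-monoʳ-≤ 8 (ℕ.≮⇒≥ 2m≮)))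
      (ℕ.≤-trans (ℕ.≤-reflexive (solveℕ 2 (λ c m → nat 8 ⊗ (nat 2 ⊗ m) ⊕ nat 4 ⊗ (c ⊕ m)
          ⊜ nat 4 ⊗ (nat 5 ⊗ m ⊕ c)) ≡.refl c₃ m))
      (ℕ.≤-trans (ℕ.*-monoʳ-≤ 4 h₂)
      (ℕ.≤-trans (ℕ.≤-reflexive (solveℕ 3 (λ b i c → nat 4 ⊗ (nat 2 ⊗ b ⊕ (i ⊕ c))
          ⊜ nat 8 ⊗ b ⊕ (nat 4 ⊗ i ⊕ nat 4 ⊗ c)) ≡.refl b i c₂))
      (ℕ.≤-trans (ℕ.+-monoʳ-≤ (8 ℕ.* b) (ℕ.+-monoˡ-≤ (4 ℕ.* c₂) h₁))
      (ℕ.≤-reflexive (solveℕ 4 (λ a b c₁ c → nat 8 ⊗ b ⊕ (nat 2 ⊗ a ⊕ c₁ ⊕ nat 4 ⊗ c)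
          ⊜ nat 8 ⊗ b ⊕ nat 2 ⊗ a ⊕ (c₁ ⊕ nat 4 ⊗ c)) ≡.refl a b c₁ c₂)))))))

  FiveTimes : (PowerSeries → Set) → PowerSeries → Set
  FiveTimes Q f = ∃ λ h → Q h × f ≈ 5ₛ * h

  -- Treats one input term 5ᵃ tⁱ of a lattice with offset `c₁`. Its image under `U` has offset i +
  -- c₂ - c₃, and 2k and `l′` describe the target lattice. `positive` is needed because the strict
  -- bound 2m < a + b + k does not exclude a + b = 0 while 2m < k, when no factor 5 could be split
  -- off.
  module Rescale (i c₁ c₂ c₃ k l l′ a : ℕ) (4i≤ : 4 ℕ.* i ℕ.≤ 2 ℕ.* a ℕ.+ c₁)
    (slack : ∀ m → l ℕ.≤ m → c₁ ℕ.+ 4 ℕ.* c₂ ℕ.< 8 ℕ.* k ℕ.+ 4 ℕ.* (c₃ ℕ.+ m))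
    (positive : ∀ m b → l ℕ.≤ m → 2 ℕ.* m ℕ.< a ℕ.+ b ℕ.+ k → 1 ℕ.≤ a ℕ.+ b) (l′≤l : l′ ℕ.≤ l) where

    rescale : ∀ {c b b′ p x} → c ℕ.+ c₃ ≡ i ℕ.+ c₂ → p * b ≈ b′ → Lat 5 c l b t x → FiveTimes (Lat 4 (2 ℕ.* k) l′ b′ t) (5ₛ ^ a * (p * x))
    rescale {c} {b} {b′} {p} c≡ pb≈ (gen {f} a′ m z l≤m ≤a r) = exact (a ℕ.+ a′) ≡.refl (positive m a′ l≤m 2m<) 2m<
      where
      2m< : 2 ℕ.* m ℕ.< a ℕ.+ a′ ℕ.+ k
      2m< = valuation-bound {i} {m} {a} {a′} {k} {c₁} {c₂} {c₃} 4i≤ (ℕ.≤-trans (ℕ.+-monoˡ-≤ c₃ ≤a) (ℕ.≤-reflexive (≡.trans (ℕ.+-assoc (2 ℕ.* a′) c c₃) (cong (2 ℕ.* a′ ℕ.+_) c≡)))) (slack m l≤m)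
      exact : ∀ n → n ≡ a ℕ.+ a′ → 1 ℕ.≤ n → 2 ℕ.* m ℕ.< n ℕ.+ k → FiveTimes (Lat 4 (2 ℕ.* k) l′ b′ t) (5ₛ ^ a * (p * f))
      exact (suc n) n≡ _ (s≤s 2m≤) = const z * (5ₛ ^ n * (t ^ m * b′)) , gen n m z (ℕ.≤-trans l′≤l l≤m) 4m≤ ≈-refl , (begin
        5ₛ ^ a * (p * f)
          ≈⟨ *-congˡ (*-congˡ r) ⟩
        5ₛ ^ a * (p * (const z * (5ₛ ^ a′ * (t ^ m * b))))
          ≈⟨ solve 6 (λ A p z B t b → A :* (p :* (z :* (B :* (t :* b)))) := (A :* B) :* (z :* (t :* (p :* b)))) ≈-refl (5ₛ ^ a) p (const z) (5ₛ ^ a′) (t ^ m) b ⟩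
        5ₛ ^ a * 5ₛ ^ a′ * (const z * (t ^ m * (p * b)))
          ≈⟨ *-cong (≈-trans (≈-sym (^-homo-* 5ₛ a a′)) (^-cong ≈-refl (≡.sym n≡))) (*-congˡ (*-congˡ pb≈)) ⟩
        5ₛ * 5ₛ ^ n * (const z * (t ^ m * b′))
          ≈⟨ solve 4 (λ f A z x → f :* A :* (z :* x) := f :* (z :* (A :* x))) ≈-refl 5ₛ (5ₛ ^ n) (const z) (t ^ m * b′) ⟩
        5ₛ * (const z * (5ₛ ^ n * (t ^ m * b′))) ∎)
        where
        4m≤ : 4 ℕ.* m ℕ.≤ 2 ℕ.* n ℕ.+ 2 ℕ.* k
        4m≤ = ℕ.≤-trans (ℕ.≤-reflexive (ℕ.*-assoc 2 2 m)) (ℕ.≤-trans (ℕ.*-monoʳ-≤ 2 2m≤) (ℕ.≤-reflexive (ℕ.*-distribˡ-+ 2 n k)))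
    rescale c≡ pb≈ (add {f} {g} u v r) with rescale c≡ pb≈ u | rescale c≡ pb≈ v
    ... | h₁ , u′ , e₁ | h₂ , v′ , e₂ = h₁ + h₂ , add u′ v′ ≈-refl ,
      ≈-trans (*-congˡ (≈-trans (*-congˡ r) (distribˡ _ f g))) (≈-trans (distribˡ _ _ _) (≈-trans (+-cong e₁ e₂) (≈-sym (distribˡ _ _ _))))

  lat-0 : ∀ {h c l b x} → Lat h c l b x 0#
  lat-0 {h} {c} {l} = gen (h ℕ.* l) l 0ℤ ℕ.≤-refl (ℕ.≤-trans (ℕ.m≤n*m (h ℕ.* l) 2) (ℕ.m≤m+n _ c)) (≈-sym (zeroˡ _))

  -- The slope 2 (h = 4) and the offsets are such that each of the two steps gains a factor 5.
  Even Odd : PowerSeries → Set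
  Even g = ∃₂ λ x y → Lat 4 4 0 P t x × Lat 4 0 0 (Y * s) t y × g ≈ x + y
  Odd g  = ∃₂ λ x y → Lat 4 2 1 (P * s) t x × Lat 4 4 1 Y t y × g ≈ x + y

  module _ {h₁ c₁ l₁ h₂ c₂ l₂ : ℕ} {b₁ b₂ : PowerSeries} where
    private
      Pair : PowerSeries → Set
      Pair g = ∃₂ λ x y → Lat h₁ c₁ l₁ b₁ t x × Lat h₂ c₂ l₂ b₂ t y × g ≈ x + y

    pair-+ : ∀ {f g} → Pair f → Pair g → Pair (f + g)
    pair-+ (x , y , u , v , p) (x′ , y′ , u′ , v′ , p′) = x + x′ , y + y′ , add u u′ ≈-refl , add v v′ ≈-refl ,
      ≈-trans (+-cong p p′) (solve 4 (λ x y x′ y′ → (x :+ y) :+ (x′ :+ y′) := (x :+ x′) :+ (y :+ y′)) ≈-refl x y x′ y′)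

    fiveTimes-+ : ∀ {f g k} → FiveTimes Pair f → FiveTimes Pair g → k ≈ f + g → FiveTimes Pair k
    fiveTimes-+ (h , u , p) (h′ , u′ , p′) r = h + h′ , pair-+ u u′ , ≈-trans r (≈-trans (+-cong p p′) (≈-sym (distribˡ _ _ _)))

    pair-linear : ∀ {f g k} z → FiveTimes (Lat h₁ c₁ l₁ b₁ t) f → FiveTimes (Lat h₂ c₂ l₂ b₂ t) g → k ≈ const z * (f - g) → FiveTimes Pair k
    pair-linear z (x , u , p) (y , v , p′) r = const z * x + const (ℤ.- z) * y ,
      (const z * x , const (ℤ.- z) * y , lat-const* z u , lat-const* (ℤ.- z) v , ≈-refl) ,
      ≈-trans r (≈-trans (*-congˡ (+-cong p (-‿cong p′))) (≈-trans
        (solve 4 (λ z f x y → z :* (f :* x :- f :* y) := f :* (z :* x :+ (:- z) :* y)) ≈-refl (const z) 5ₛ x y)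
        (*-congˡ (+-congˡ (*-congʳ (≈-sym (const-neg z)))))))

    pair-left : ∀ {f k} z → FiveTimes (Lat h₁ c₁ l₁ b₁ t) f → k ≈ const z * f → FiveTimes Pair k
    pair-left z (x , u , p) r = const z * x , (const z * x , 0# , lat-const* z u , lat-0 , ≈-sym (+-identityʳ _)) ,
      ≈-trans r (≈-trans (*-congˡ p) (solve 3 (λ z f x → z :* (f :* x) := f :* (z :* x)) ≈-refl (const z) 5ₛ x))

  U-5^* : ∀ a f → U (5ₛ ^ a * f) ≈ 5ₛ ^ a * U f
  U-5^* a f = ≈-trans (U-cong (*-congʳ (≈-sym (≈-trans (D.σ-^ 5ₛ a) (^-cong (D.σ-const (+ 5)) (≡.refl {x = a})))))) (U-d* (5ₛ ^ a) f)

  U-difference : ∀ z a x y f g → U (const z * (5ₛ ^ a * (d x * f - d y * g))) ≈ const z * (5ₛ ^ a * (x * U f) - 5ₛ ^ a * (y * U g))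
  U-difference z a x y f g = begin
    U (const z * (5ₛ ^ a * (d x * f - d y * g)))
      ≈⟨ ≈-trans (U-const* z _) (*-congˡ (U-5^* a _)) ⟩
    const z * (5ₛ ^ a * U (d x * f - d y * g))
      ≈⟨ *-congˡ (*-congˡ (≈-trans (U-cong (solve 2 (λ x y → x :- y := x :+ con (ℤ.- 1ℤ) :* y) ≈-refl _ _)) (≈-trans (U-+ _ _) (+-cong (U-d* x f) (≈-trans (U-const* _ _) (*-congˡ (U-d* y g))))))) ⟩
    const z * (5ₛ ^ a * (x * U f + const (ℤ.- 1ℤ) * (y * U g)))
      ≈⟨ solve 4 (λ z a x y → z :* (a :* (x :+ con (ℤ.- 1ℤ) :* y)) := z :* (a :* x :- a :* y)) ≈-refl (const z) (5ₛ ^ a) _ _ ⟩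
    const z * (5ₛ ^ a * (x * U f) - 5ₛ ^ a * (y * U g)) ∎

  -- The operator taking the numerator of a generating series with denominator E(q)² to that of
  -- its progression 5n + 4, with denominator q E(q⁵)².
  A-step : PowerSeries → PowerSeries
  A-step g = U (q * (e * e * g))

  A-step-+ : ∀ {f g k} → k ≈ f + g → A-step k ≈ A-step f + A-step g
  A-step-+ {f} {g} r = ≈-trans (U-cong (≈-trans (*-congˡ (*-congˡ r))
    (solve 4 (λ q e f g → q :* (e :* e :* (f :+ g)) := q :* (e :* e :* f) :+ q :* (e :* e :* g)) ≈-refl q e f g))) (U-+ _ _)

  -- By `P≈` and F e = 1, q e² tᵐ P = d P · κ e w tᵐ - d Y · w tᵐ. The dilated factors leave `U`;
  -- the first term gives multiples of `P * s`, the second multiples of `Y`.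
  A-step-P : ∀ {g} → Lat 4 4 0 P t g → FiveTimes Odd (A-step g)
  A-step-P (add u v r) = fiveTimes-+ (A-step-P u) (A-step-P v) (A-step-+ r)
  A-step-P {g} (gen a m z _ 4m≤ r) = pair-linear z
    (Rescale.rescale m 4 1 0 1 1 1 a 4m≤ (λ { (suc _) _ → ℕ.m<m+n 8 (s≤s z≤n) }) (positive 1 (s≤s z≤n)) ℕ.≤-refl (lemma m 0) ≈-refl (U-κe-lat wt^m))
    (Rescale.rescale m 4 3 0 2 1 1 a 4m≤ (λ { (suc _) _ → ℕ.m<m+n 16 (s≤s z≤n) }) (positive 2 ℕ.≤-refl) ℕ.≤-refl (lemma m 2) (solve 1 (λ x → x :* con 1ℤ := x) ≈-refl Y) (U-lat wt^m))
    (≈-trans (U-cong (begin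
      q * (e * e * g)
        ≈⟨ *-congˡ (*-congˡ (≈-trans r (*-congˡ (*-congˡ (*-congˡ P≈))))) ⟩
      q * (e * e * (const z * (5ₛ ^ a * (t ^ m * (κ * d P - F * d Y)))))
        ≈⟨ solve 9 (λ q e z A x k p F y → q :* (e :* e :* (z :* (A :* (x :* (k :* p :- F :* y)))))
             := z :* (A :* (p :* (k :* e :* (q :* e :* x)) :- (F :* e) :* (y :* (q :* e :* x))))) ≈-refl q e (const z) (5ₛ ^ a) (t ^ m) κ (d P) F (d Y) ⟩
      const z * (5ₛ ^ a * (d P * (κ * e * (w * t ^ m)) - F * e * (d Y * (w * t ^ m))))
        ≈⟨ *-congˡ (*-congˡ (+-congˡ (-‿cong (≈-trans (*-congʳ F*e) (*-identityˡ _))))) ⟩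
      const z * (5ₛ ^ a * (d P * (κ * e * (w * t ^ m)) - d Y * (w * t ^ m))) ∎))
      (U-difference z a P Y _ _))
    where
    wt^m : Lat 1 (1 ℕ.+ m) 1 1# w (w * t ^ m)
    wt^m = lat-weaken (s≤s z≤n) (lat-x* (t^-lat m))
    lemma : ∀ m c → suc m ℕ.+ c ℕ.+ 0 ≡ m ℕ.+ (1 ℕ.+ c)
    lemma m c = ≡.trans (ℕ.+-identityʳ _) (≡.sym (ℕ.+-suc m c))
    positive : ∀ k → k ℕ.≤ 2 → ∀ m b → 1 ℕ.≤ m → 2 ℕ.* m ℕ.< a ℕ.+ b ℕ.+ k → 1 ℕ.≤ a ℕ.+ b
    positive k k≤2 m b 1≤m h = ℕ.+-cancelʳ-≤ 2 1 (a ℕ.+ b) (ℕ.≤-trans (s≤s (ℕ.*-monoʳ-≤ 2 1≤m)) (ℕ.≤-trans h (ℕ.+-monoʳ-≤ (a ℕ.+ b) k≤2)))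

  -- With `Y = q * d P` and `s = κ e Gw` the argument of `U` is d P · κ e w² Gw tᵐ, so that only
  -- multiples of `P * s` arise.
  A-step-Ys : ∀ {g} → Lat 4 0 0 (Y * s) t g → FiveTimes Odd (A-step g)
  A-step-Ys (add u v r) = fiveTimes-+ (A-step-Ys u) (A-step-Ys v) (A-step-+ r)
  A-step-Ys {g} (gen a m z _ 4m≤ r) = pair-left z
    (Rescale.rescale m 0 2 0 1 1 1 a 4m≤ (λ { (suc _) _ → ℕ.m<m+n 8 (s≤s z≤n) })
      (λ m b 1≤m h → ℕ.+-cancelʳ-≤ 1 1 (a ℕ.+ b) (ℕ.≤-trans (ℕ.≤-trans (ℕ.*-monoʳ-≤ 2 1≤m) (ℕ.n≤1+n _)) h)) ℕ.≤-refl (lemma m) ≈-refl (U-κe-lat wwGt^m))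
    (≈-trans (U-cong (begin
      q * (e * e * g)
        ≈⟨ *-congˡ (*-congˡ (≈-trans r (*-congˡ (*-congˡ (*-congˡ (*-congˡ s≈)))))) ⟩
      q * (e * e * (const z * (5ₛ ^ a * (t ^ m * (q * d P * (κ * e * Gw))))))
        ≈⟨ solve 8 (λ q e z A x k p G → q :* (e :* e :* (z :* (A :* (x :* (q :* p :* (k :* e :* G))))))
             := z :* (A :* (p :* (k :* e :* (q :* e :* (q :* e :* (G :* x))))))) ≈-refl q e (const z) (5ₛ ^ a) (t ^ m) κ (d P) Gw ⟩
      const z * (5ₛ ^ a * (d P * (κ * e * (w * (w * (Gw * t ^ m)))))) ∎))
      (≈-trans (U-const* z _) (*-congˡ (≈-trans (U-5^* a _) (*-congˡ (U-d* P _))))))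
    where
    wwGt^m : Lat 1 (2 ℕ.+ m) 1 1# w (w * (w * (Gw * t ^ m)))
    wwGt^m = lat-weaken (s≤s z≤n) (lat-x* (lat-x* (Gw*-lat (t^-lat m))))
    lemma : ∀ m → suc (suc m) ℕ.+ 0 ℕ.+ 0 ≡ m ℕ.+ 2
    lemma m = ≡.trans (ℕ.+-identityʳ _) (≡.trans (ℕ.+-identityʳ _) (ℕ.+-comm 2 m))

  A-step-Even : ∀ {g} → Even g → FiveTimes Odd (A-step g)
  A-step-Even (x , y , u , v , p) = fiveTimes-+ (A-step-P u) (A-step-Ys v) (A-step-+ p)

  -- Likewise for the progression 5n, back to the denominator E(q)².
  B-step : PowerSeries → Set
  B-step g = ∃ λ g° → g ≈ q * g° × FiveTimes Even (U g°)

  B-step-+ : ∀ {f g k} → k ≈ f + g → B-step f → B-step g → B-step k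
  B-step-+ r (f° , p , u) (g° , p′ , u′) = f° + g° , ≈-trans r (≈-trans (+-cong p p′) (≈-sym (distribˡ _ _ _))) , fiveTimes-+ u u′ (U-+ f° g°)

  -- The factor `q` to be removed is taken from one `t = q * τ`. The rest is written in `w` by τ = e
  -- Dw, s = κ e Gw and `P≈`, which leaves (κ e)² beside P and κ e beside Y.
  B-step-Ps : ∀ {g} → Lat 4 2 1 (P * s) t g → B-step g
  B-step-Ps (add u v r) = B-step-+ r (B-step-Ps u) (B-step-Ps v)
  B-step-Ps {g} (gen a (suc j) z _ 4m≤ r) = const z * (5ₛ ^ a * (τ * t ^ j * (P * s))) ,
    ≈-trans r (solve 6 (λ z A q x y b → z :* (A :* (q :* x :* y :* b)) := q :* (z :* (A :* (x :* y :* b)))) ≈-refl (const z) (5ₛ ^ a) q τ (t ^ j) (P * s)) ,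
    pair-linear z
      (Rescale.rescale (suc j) 2 2 0 2 0 0 a 4m≤ (λ m _ → ℕ.≤-trans (ℕ.m≤m+n 11 5) (ℕ.m≤m+n 16 _)) (λ m b _ _ → ℕ.≤-trans 1≤a (ℕ.m≤m+n a b)) ℕ.≤-refl
        (ℕ.+-identityʳ _) (solve 1 (λ x → x :* con 1ℤ := x) ≈-refl P) (U-lat₀ (κe²*-lat GDt^j)))
      -- `GDt^j` has offset j, one less than the exponent j + 1 of the input. The factor (κ e)² uses
      -- up this unit in the P part; here it survives as `c₃ = 1`.
      (Rescale.rescale (suc j) 2 0 1 0 0 0 a 4m≤ (λ m _ → ℕ.≤-trans (ℕ.m≤m+n 3 1) (ℕ.*-monoʳ-≤ 4 (s≤s z≤n))) (λ m b _ _ → ℕ.≤-trans 1≤a (ℕ.m≤m+n a b)) ℕ.≤-refl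
        (ℕ.+-comm (j ℕ.+ 0) 1) ≈-refl (U-κe-lat₀ GDt^j))
      (≈-trans (U-cong (begin
        const z * (5ₛ ^ a * (τ * t ^ j * (P * s)))
          ≈⟨ *-congˡ (*-congˡ (*-cong (*-congʳ τ≈) (*-cong P≈ s≈))) ⟩
        const z * (5ₛ ^ a * (e * Dw * t ^ j * ((κ * d P - F * d Y) * (κ * e * Gw))))
          ≈⟨ solve 10 (λ e z A x k p F y D G → z :* (A :* (e :* D :* x :* ((k :* p :- F :* y) :* (k :* e :* G))))
               := z :* (A :* (p :* (k :* e :* (k :* e) :* (G :* (D :* x))) :- (F :* e) :* (y :* (k :* e :* (G :* (D :* x))))))) ≈-refl e (const z) (5ₛ ^ a) (t ^ j) κ (d P) F (d Y) Dw Gw ⟩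
        const z * (5ₛ ^ a * (d P * (κ * e * (κ * e) * (Gw * (Dw * t ^ j))) - F * e * (d Y * (κ * e * (Gw * (Dw * t ^ j))))))
          ≈⟨ *-congˡ (*-congˡ (+-congˡ (-‿cong (≈-trans (*-congʳ F*e) (*-identityˡ _))))) ⟩
        const z * (5ₛ ^ a * (d P * (κ * e * (κ * e) * (Gw * (Dw * t ^ j))) - d Y * (κ * e * (Gw * (Dw * t ^ j))))) ∎))
        (U-difference z a P Y _ _))
    where
    GDt^j : Lat 1 j 0 1# w (Gw * (Dw * t ^ j))
    GDt^j = lat-weaken z≤n (Gw*-lat (Dw*-lat (t^-lat j)))
    -- 4(j + 1) ≤ 2a + 2 already puts a factor 5 into the coefficient. The output may contain t⁰,
    -- where nothing else would supply one; hence `Odd` begins at t¹.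
    1≤a : 1 ℕ.≤ a
    1≤a = ℕ.*-cancelˡ-≤ 2 (ℕ.+-cancelʳ-≤ 2 2 (2 ℕ.* a) (ℕ.≤-trans (ℕ.*-monoʳ-≤ 4 (s≤s z≤n)) 4m≤))

  -- Here `Y` itself supplies the factor `q`, so no `t` is given up and the image starts at t¹.
  B-step-Y : ∀ {g} → Lat 4 4 1 Y t g → B-step g
  B-step-Y (add u v r) = B-step-+ r (B-step-Y u) (B-step-Y v)
  B-step-Y {g} (gen a (suc j) z _ 4m≤ r) = const z * (5ₛ ^ a * (d P * t ^ suc j)) ,
    ≈-trans r (solve 5 (λ z A q x y → z :* (A :* (x :* (q :* y))) := q :* (z :* (A :* (y :* x)))) ≈-refl (const z) (5ₛ ^ a) q (t ^ suc j) (d P)) ,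
    pair-left z
      (Rescale.rescale (suc j) 4 2 0 2 1 0 a 4m≤ (λ { m _ → ℕ.≤-trans (ℕ.m≤m+n 13 3) (ℕ.m≤m+n 16 _) })
        (λ m b 1≤m h → ℕ.+-cancelʳ-≤ 2 1 (a ℕ.+ b) (ℕ.≤-trans (s≤s (ℕ.*-monoʳ-≤ 2 1≤m)) h)) z≤n
        (ℕ.+-identityʳ _) (solve 1 (λ x → x :* con 1ℤ := x) ≈-refl P) (U-lat (t^suc-lat j)))
      (≈-trans (U-const* z _) (*-congˡ (≈-trans (U-5^* a _) (*-congˡ (U-d* P _)))))

  B-step-Odd : ∀ {g} → Odd g → B-step g
  B-step-Odd (x , y , u , v , p) = B-step-+ p (B-step-Ps u) (B-step-Y v)

  -- The generating series of cψ₂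

  coeff-q^ : ∀ k n → coeff (q ^ k) n ≡ (if n ℕ.≡ᵇ k then 1ℤ else 0ℤ)
  coeff-q^ zero    zero    = coeff-const-zero 1ℤ
  coeff-q^ zero    (suc n) = coeff-const-suc 1ℤ n
  coeff-q^ (suc k) zero    = coeff-q*-zero (q ^ k)
  coeff-q^ (suc k) (suc n) = ≡.trans (coeff-q*-suc (q ^ k) n) (coeff-q^ k n)

  oneMinusQ≈ : ∀ k → series (oneMinusQ (suc k)) ≈ 1# - q ^ suc k
  oneMinusQ≈ k = coeffwise λ n → ≡.sym (≡.trans (coeff-+ 1# (- q ^ suc k) n) (≡.trans (cong (λ z → coeff 1# n ℤ.+ z) (≡.trans (coeff-neg (q ^ suc k) n) (cong ℤ.-_ (coeff-q^ (suc k) n)))) (go n)))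
    where
    go : ∀ n → coeff 1# n ℤ.+ ℤ.- (if n ℕ.≡ᵇ suc k then 1ℤ else 0ℤ) ≡ oneMinusQ (suc k) n
    go zero    = cong (ℤ._+ 0ℤ) (coeff-const-zero 1ℤ)
    go (suc n) with suc n ℕ.≡ᵇ suc k
    ... | true  = cong (ℤ._+ -1ℤ) (coeff-const-suc 1ℤ n)
    ... | false = cong (ℤ._+ 0ℤ) (coeff-const-suc 1ℤ n)

  coeff-q^*-+ : ∀ k f n → coeff (q ^ k * f) (k ℕ.+ n) ≡ coeff f n
  coeff-q^*-+ zero    f n = coeff-≡ (*-identityˡ f) n
  coeff-q^*-+ (suc k) f n = ≡.trans (coeff-≡ (*-assoc q (q ^ k) f) (suc k ℕ.+ n)) (≡.trans (coeff-q*-suc (q ^ k * f) (k ℕ.+ n)) (coeff-q^*-+ k f n))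

  -- The coefficients of the geometric series g are periodic, which gives g = 1 + qᴷ g once the
  -- indices below K are checked separately.
  invOneMinusQ≈ : ∀ k → (1# - q ^ suc k) * series (invOneMinusQ (suc k)) ≈ 1#
  invOneMinusQ≈ k = begin
    (1# - q ^ K) * g       ≈⟨ solve 2 (λ x g → (con 1ℤ :- x) :* g := g :- x :* g) ≈-refl (q ^ K) g ⟩
    g - q ^ K * g          ≈⟨ +-congʳ (coeffwise periodic) ⟩
    1# + q ^ K * g - q ^ K * g ≈⟨ solve 1 (λ x → con 1ℤ :+ x :- x := con 1ℤ) ≈-refl (q ^ K * g) ⟩
    1#                     ∎
    where
    K = suc k
    g = series (invOneMinusQ K)
    low : ∀ n → n ℕ.< K → coeff g n ≡ coeff 1# n
    low zero    _   = ≡.sym (coeff-const-zero 1ℤ)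
    low (suc n) n<K = ≡.trans (cong (λ x → if x ℕ.≡ᵇ 0 then 1ℤ else 0ℤ) (m<n⇒m%n≡m n<K)) (≡.sym (coeff-const-suc 1ℤ n))
    high : ∀ m → coeff g (K ℕ.+ m) ≡ coeff g m
    high m = cong (λ x → if x ℕ.≡ᵇ 0 then 1ℤ else 0ℤ) (≡.trans (cong (_% K) (ℕ.+-comm K m)) ([m+n]%n≡m%n m K))
    at : ∀ m → coeff g (K ℕ.+ m) ≡ coeff (1# + q ^ K * g) (K ℕ.+ m)
    at m = ≡.trans (high m) (≡.sym (≡.trans (coeff-+ 1# _ (K ℕ.+ m)) (≡.trans (cong₂ ℤ._+_ (coeff-const-suc 1ℤ (k ℕ.+ m)) (coeff-q^*-+ K g m)) (ℤ.+-identityˡ _))))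
    periodic : ∀ n → coeff g n ≡ coeff (1# + q ^ K * g) n
    periodic n with n ℕ.<? K
    ... | yes n<K = ≡.trans (low n n<K) (≡.sym (≡.trans (coeff-+ 1# _ n) (≡.trans (cong (λ z → coeff 1# n ℤ.+ z)
      (≡.trans (coeff-< (q^*≈[]0 {K} g ℕ.≤-refl) n n<K) (coeff-0 n))) (ℤ.+-identityʳ _))))
      where
      coeff-0 : ∀ n → coeff 0# n ≡ 0ℤ
      coeff-0 zero    = coeff-const-zero 0ℤ
      coeff-0 (suc n) = coeff-const-suc 0ℤ n
    ... | no n≮K = ≡.subst (λ n → coeff g n ≡ coeff (1# + q ^ K * g) n) (ℕ.m+[n∸m]≡n (ℕ.≮⇒≥ n≮K)) (at (n ℕ.∸ K))

  series-⊛ : ∀ {f g a b} → series f ≈ a → series g ≈ b → series (f ⊛ g) ≈ a * b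
  series-⊛ {f} {g} p r = ≈-trans (coeffwise λ n → ≡.sym (coeff-⊛ (series f) (series g) n)) (*-cong p r)

  series-one : series one ≈ 1#
  series-one = coeffwise λ { zero → ≡.sym (coeff-const-zero 1ℤ) ; (suc n) → ≡.sym (coeff-const-suc 1ℤ n) }

  module _ (k : ℕ) where
    private
      module K = Subst (dilₛ k)

      factor : ℕ → ℕ
      factor N = suc k ℕ.* N ℕ.+ suc k

      factor≡ : ∀ N → factor N ≡ suc (k ℕ.+ suc k ℕ.* N)
      factor≡ N = ℕ.+-comm (suc k ℕ.* N) (suc k)

      dil-factor : ∀ N → dil k (1# - q ^ suc N) ≈ 1# - q ^ suc (k ℕ.+ suc k ℕ.* N)
      dil-factor N = ≈-trans (K.σ-+ _ _) (+-cong (K.σ-const 1ℤ) (≈-trans (K.σ-neg _) (-‿cong (begin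
        dil k (q ^ suc N)          ≈⟨ ≈-trans (K.σ-^ q (suc N)) (^-cong K.σ-q (≡.refl {x = suc N})) ⟩
        (q ^ suc k) ^ suc N        ≈⟨ ^-assocʳ q (suc k) (suc N) ⟩
        q ^ (suc k ℕ.* suc N)      ≈⟨ ^-cong ≈-refl (ℕ.*-suc (suc k) N) ⟩
        q ^ suc (k ℕ.+ suc k ℕ.* N) ∎))))

    prodTo-oneMinusQ : ∀ N → series (prodTo N oneMinusQ (suc k) (suc k)) ≈ dil k (eulerTo N)
    prodTo-oneMinusQ zero    = ≈-trans series-one (≈-sym (K.σ-const 1ℤ))
    prodTo-oneMinusQ (suc N) = ≈-trans (series-⊛ (prodTo-oneMinusQ N) (≈-trans (reflexive (cong (λ m → series (oneMinusQ m)) (factor≡ N))) (oneMinusQ≈ _)))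
      (≈-trans (*-congˡ (≈-sym (dil-factor N))) (≈-sym (K.σ-* _ _)))

    prodTo-inverse : ∀ N → dil k (eulerTo N) * series (prodTo N invOneMinusQ (suc k) (suc k)) ≈ 1#
    prodTo-inverse zero    = ≈-trans (*-cong (K.σ-const 1ℤ) series-one) (*-identityˡ 1#)
    prodTo-inverse (suc N) = begin
      dil k (eulerTo N * (1# - q ^ suc N)) * series (prodTo (suc N) invOneMinusQ (suc k) (suc k))
        ≈⟨ *-cong (≈-trans (K.σ-* _ _) (*-congˡ (dil-factor N))) (series-⊛ ≈-refl (reflexive (cong (λ m → series (invOneMinusQ m)) (factor≡ N)))) ⟩
      dil k (eulerTo N) * (1# - q ^ suc M) * (series (prodTo N invOneMinusQ (suc k) (suc k)) * series (invOneMinusQ (suc M)))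
        ≈⟨ solve 4 (λ a b x y → a :* b :* (x :* y) := a :* x :* (b :* y)) ≈-refl _ _ _ _ ⟩
      dil k (eulerTo N) * series (prodTo N invOneMinusQ (suc k) (suc k)) * ((1# - q ^ suc M) * series (invOneMinusQ (suc M)))
        ≈⟨ *-cong (prodTo-inverse N) (invOneMinusQ≈ _) ⟩
      1# * 1#
        ≈⟨ *-identityˡ 1# ⟩
      1# ∎
      where
      M = k ℕ.+ suc k ℕ.* N

    qPoch≈ : series (qPoch (suc k) (suc k)) ≈ dil k E
    qPoch≈ = coeffwise λ n → ≡.trans (coeff-≡ (prodTo-oneMinusQ (suc n)) n)
      (≡.sym (coeff-< (K.cong-[] (suc n) (E-≈[] (suc n) ℕ.≤-refl)) n ℕ.≤-refl))

    qPochInv≈ : series (qPochInv (suc k) (suc k)) ≈ inv (dil k E)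
    qPochInv≈ = coeffwise λ n → coeff-< (truncated (suc n)) n ℕ.≤-refl
      where
      I : ℕ → PowerSeries
      I n = series (prodTo n invOneMinusQ (suc k) (suc k))
      dilE*inv : dil k E * inv (dil k E) ≈ 1#
      dilE*inv = *-inv (dil k E) (≡.trans (coeff₀-dil k E) E₀)
      -- The full and the finite product agree modulo `qⁿ`, so their inverses do: each inverse is
      -- multiplied by 1, written as the other product times the other inverse.
      truncated : ∀ n → I n ≈[ n ] inv (dil k E)
      truncated n = ≈[]-resp
        (≈-trans (≈-sym (*-identityˡ _)) (≈-trans (*-congʳ (≈-sym dilE*inv)) (solve 3 (λ a b c → a :* b :* c := b :* (a :* c)) ≈-refl _ _ _)))
        (≈-trans (≈-sym (*-identityˡ _)) (≈-trans (*-comm _ _) (*-congˡ (≈-sym (prodTo-inverse n)))))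
        (*-cong-[] ≈[]-refl (*-cong-[] (K.cong-[] n (E-≈[] n ℕ.≤-refl)) ≈[]-refl))

  i : PowerSeries
  i = inv E

  E*i : E * i ≈ 1#
  E*i = *-inv E E₀

  cψ₂-series : series cψ₂ ≈ P * (i * i)
  cψ₂-series = begin
    series cψ₂
      ≈⟨ series-⊛ (series-⊛ (series-⊛ (series-⊛ (qPoch≈ 3) (qPoch≈ 3)) inverse) inverse) (qPochInv≈ 1) ⟩
    E₄ * E₄ * i * i * inv E₂
      ≈⟨ *-congʳ (*-congʳ (*-congʳ P*E₂)) ⟨
    P * E₂ * i * i * inv E₂
      ≈⟨ solve 4 (λ p e i j → p :* e :* i :* i :* j := p :* (i :* i) :* (e :* j)) ≈-refl P E₂ i (inv E₂) ⟩
    P * (i * i) * (E₂ * inv E₂)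
      ≈⟨ ≈-trans (*-congˡ (*-inv E₂ E₂₀)) (solve 1 (λ x → x :* con 1ℤ := x) ≈-refl _) ⟩
    P * (i * i) ∎
    where
    dil₁ : ∀ f → dil 0 f ≈ f
    dil₁ = σ-unique (dilₛ 0) identityₛ ≈-refl
    inverse : series (qPochInv 1 1) ≈ i
    inverse = ≈-trans (qPochInv≈ 0) (*-cancelˡ E₀ (≈-trans (*-congʳ (≈-sym (dil₁ E)))
      (≈-trans (*-inv (dil 0 E) (≡.trans (coeff₀-dil 0 E) E₀)) (≈-sym E*i))))

  -- Inverts `E≈ddE*F`: the denominator becomes `e` times a series in q²⁵, which passes through `U`
  -- as one in q⁵.
  i≈ : i ≈ e * d (d i)
  i≈ = *-cancelˡ E₀ (≈-trans E*i (≈-sym (begin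
    E * (e * d (d i))           ≈⟨ *-congʳ E≈ddE*F ⟩
    d (d E) * F * (e * d (d i)) ≈⟨ solve 4 (λ x F e y → x :* F :* (e :* y) := (F :* e) :* (x :* y)) ≈-refl (d (d E)) F e (d (d i)) ⟩
    F * e * (d (d E) * d (d i)) ≈⟨ *-cong F*e (≈-trans (≈-sym (≈-trans (D.σ-cong (D.σ-* E i)) (D.σ-* _ _))) (≈-trans (D.σ-cong (≈-trans (D.σ-cong E*i) (D.σ-const 1ℤ))) (D.σ-const 1ℤ))) ⟩
    1# * 1#                     ≈⟨ *-identityˡ 1# ⟩
    1#                          ∎)))

  -- Induction on the exponent of 5

  EvenState OddState : ℕ → PowerSeries → Set
  EvenState α L = ∃ λ g → Even g × L ≈ 5ₛ ^ α * (g * (i * i))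
  OddState α L  = ∃ λ g → Odd g × q * L ≈ 5ₛ ^ α * (g * (d i * d i))

  even⇒odd : ∀ {α L} → EvenState α L → OddState (suc α) (comp 4 L)
  even⇒odd {α} {L} (g , u , p) = let h , v , r = A-step-Even u in h , v , (begin
    q * comp 4 L
      -- `U` extracts class 0, and class 4 of `L` is class 0 of `q * L` up to a factor `q`; hence
      -- the `q` in `OddState`.
      ≈⟨ comp₀-q* L ⟨
    U (q * L)
      ≈⟨ U-cong (*-congˡ (≈-trans p (*-congˡ (*-congˡ (*-cong i≈ i≈))))) ⟩
    U (q * (5ₛ ^ α * (g * (e * d (d i) * (e * d (d i))))))
      ≈⟨ U-cong (≈-trans (solve 5 (λ q A g e x → q :* (A :* (g :* (e :* x :* (e :* x)))) := A :* ((x :* x) :* (q :* (e :* e :* g)))) ≈-refl q (5ₛ ^ α) g e (d (d i)))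
           (*-congˡ (*-congʳ (≈-sym (D.σ-* (d i) (d i)))))) ⟩
    U (5ₛ ^ α * (d (d i * d i) * (q * (e * e * g))))
      ≈⟨ ≈-trans (U-5^* α _) (*-congˡ (U-d* _ _)) ⟩
    5ₛ ^ α * (d i * d i * A-step g)
      ≈⟨ *-congˡ (*-congˡ r) ⟩
    5ₛ ^ α * (d i * d i * (5ₛ * h))
      ≈⟨ solve 4 (λ A x f h → A :* (x :* (f :* h)) := f :* A :* (h :* x)) ≈-refl (5ₛ ^ α) (d i * d i) 5ₛ h ⟩
    5ₛ ^ suc α * (h * (d i * d i)) ∎)

  odd⇒even : ∀ {α L} → OddState α L → EvenState (suc α) (comp 0 L)
  odd⇒even {α} {L} (g , u , p) = let g° , g≈ , h , v , r = B-step-Odd u in h , v , (begin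
    U L
      ≈⟨ U-cong (q*-cancel (≈-trans p (≈-trans (*-congˡ (*-congʳ g≈)) (solve 4 (λ A q g x → A :* (q :* g :* x) := q :* (A :* (x :* g))) ≈-refl (5ₛ ^ α) q g° (d i * d i))))) ⟩
    U (5ₛ ^ α * (d i * d i * g°))
      ≈⟨ ≈-trans (U-5^* α _) (*-congˡ (≈-trans (U-cong (*-congʳ (≈-sym (D.σ-* i i)))) (U-d* _ _))) ⟩
    5ₛ ^ α * (i * i * U g°)
      ≈⟨ *-congˡ (*-congˡ r) ⟩
    5ₛ ^ α * (i * i * (5ₛ * h))
      ≈⟨ solve 4 (λ A x f h → A :* (x :* (f :* h)) := f :* A :* (h :* x)) ≈-refl (5ₛ ^ α) (i * i) 5ₛ h ⟩
    5ₛ ^ suc α * (h * (i * i)) ∎)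

  -- L has the coefficients cψ₂(n) with 5^α ∣ 6n + 1, at m = ((6n + 1)/5^α - c)/6.
  Progression : ℕ → ℕ → PowerSeries → Set
  Progression c α L = ∀ n → 5 ℕ.^ α ∣ℕ 6 ℕ.* n ℕ.+ 1 → ∃ λ m → cψ₂ n ≡ coeff L m × 6 ℕ.* n ℕ.+ 1 ≡ 5 ℕ.^ α ℕ.* (6 ℕ.* m ℕ.+ c)

  -- `level` alternates between the two cases, so they correspond to even and odd α. The constants 1
  -- and 5 are the residues of 5^α modulo 6, which are their own inverses.
  Level : ℕ → Set
  Level α = (∃ λ L → EvenState α L × Progression 1 α L) ⊎ (∃ λ L → OddState α L × Progression 5 α L)

  private
    quotient-∣ : ∀ {α n x} → 5 ℕ.^ suc α ∣ℕ 6 ℕ.* n ℕ.+ 1 → 6 ℕ.* n ℕ.+ 1 ≡ 5 ℕ.^ α ℕ.* x → 5 ∣ℕ x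
    quotient-∣ {α} {n} {x} h eq = ℕ∣.*-cancelˡ-∣ (5 ℕ.^ α) {{ℕ.m^n≢0 5 α}} (≡.subst₂ _∣ℕ_ (ℕ.*-comm 5 (5 ℕ.^ α)) eq h)

    5∣6m+1 : ∀ m → 5 ∣ℕ 6 ℕ.* m ℕ.+ 1 → ∃ λ k → m ≡ 4 ℕ.+ k ℕ.* 5
    5∣6m+1 m h with ℕ∣.∣m+n∣m⇒∣n {5} {5 ℕ.* m} (≡.subst (5 ∣ℕ_) (solveℕ 1 (λ m → nat 6 ⊗ m ⊕ nat 1 ⊜ nat 5 ⊗ m ⊕ (nat 1 ⊕ m)) ≡.refl m) h) (ℕ∣.m∣m*n m)
    ... | ℕ∣.divides (suc k) eq = k , ℕ.suc-injective eq

    5∣6m+5 : ∀ m → 5 ∣ℕ 6 ℕ.* m ℕ.+ 5 → ∃ λ k → m ≡ k ℕ.* 5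
    5∣6m+5 m h with ℕ∣.∣m+n∣m⇒∣n {5} {5 ℕ.* suc m} (≡.subst (5 ∣ℕ_) (solveℕ 1 (λ m → nat 6 ⊗ m ⊕ nat 5 ⊜ nat 5 ⊗ (nat 1 ⊕ m) ⊕ m) ≡.refl m) h) (ℕ∣.m∣m*n (suc m))
    ... | ℕ∣.divides k eq = k , eq

  level : ∀ α → Level α
  level zero    = inj₁ (series cψ₂ ,
    (P , (P , 0# , gen 0 0 1ℤ z≤n z≤n (solve 1 (λ p → p := con 1ℤ :* (con 1ℤ :* (con 1ℤ :* p))) ≈-refl P) , lat-0 , ≈-sym (+-identityʳ P)) ,
      ≈-trans cψ₂-series (≈-sym (*-identityˡ _))) ,
    λ n _ → n , ≡.refl , ≡.sym (ℕ.*-identityˡ _))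
  level (suc α) with level α
  ... | inj₁ (L , state , progression) = inj₂ (comp 4 L , even⇒odd {α} state , next)
    where
    next : Progression 5 (suc α) (comp 4 L)
    next n h =
      let m , c≡ , eq = progression n (ℕ∣.∣-trans (ℕ∣.n∣m*n 5) h)
          k , m≡ = 5∣6m+1 m (quotient-∣ {α} {n} h eq)
      in k , ≡.trans c≡ (cong (coeff L) m≡) , ≡.trans eq (≡.trans (cong (5 ℕ.^ α ℕ.*_) (≡.trans (cong (λ m → 6 ℕ.* m ℕ.+ 1) m≡) (solveℕ 1 (λ k → nat 6 ⊗ (nat 4 ⊕ k ⊗ nat 5) ⊕ nat 1
        ⊜ nat 5 ⊗ (nat 6 ⊗ k ⊕ nat 5)) ≡.refl k)))
        (solveℕ 2 (λ x y → x ⊗ (nat 5 ⊗ y) ⊜ nat 5 ⊗ x ⊗ y) ≡.refl (5 ℕ.^ α) (6 ℕ.* k ℕ.+ 5)))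
  ... | inj₂ (L , state , progression) = inj₁ (comp 0 L , odd⇒even {α} state , next)
    where
    next : Progression 1 (suc α) (comp 0 L)
    next n h =
      let m , c≡ , eq = progression n (ℕ∣.∣-trans (ℕ∣.n∣m*n 5) h)
          k , m≡ = 5∣6m+5 m (quotient-∣ {α} {n} h eq)
      in k , ≡.trans c≡ (cong (coeff L) m≡) , ≡.trans eq (≡.trans (cong (5 ℕ.^ α ℕ.*_) (≡.trans (cong (λ m → 6 ℕ.* m ℕ.+ 5) m≡) (solveℕ 1 (λ k → nat 6 ⊗ (k ⊗ nat 5) ⊕ nat 5
        ⊜ nat 5 ⊗ (nat 6 ⊗ k ⊕ nat 1)) ≡.refl k)))
        (solveℕ 2 (λ x y → x ⊗ (nat 5 ⊗ y) ⊜ nat 5 ⊗ x ⊗ y) ≡.refl (5 ℕ.^ α) (6 ℕ.* k ℕ.+ 1)))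

  5ₛ^ : ∀ a → 5ₛ ^ a ≈ const (+ (5 ℕ.^ a))
  5ₛ^ zero    = ≈-refl
  5ₛ^ (suc a) = ≈-trans (*-congˡ (5ₛ^ a)) (≈-trans (≈-sym (const-* (+ 5) _)) (const-cong (≡.sym (ℤ.pos-* 5 (5 ℕ.^ a)))))

  5^∣coeff : ∀ {f} α x n → f ≈ 5ₛ ^ α * x → + (5 ℕ.^ α) ∣ coeff f n
  5^∣coeff {f} α x n h = ≡.subst (5 ℕ.^ α ∣ℕ_) (≡.trans (≡.sym (ℤ.abs-* (+ (5 ℕ.^ α)) (coeff x n)))
    (cong ℤ.∣_∣ (≡.sym (≡.trans (coeff-≡ (≈-trans h (*-congʳ (5ₛ^ α))) n) (coeff-const* _ x n))))) (ℕ∣.m∣m*n _)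

  5^∣cψ₂ : ∀ n α → 5 ℕ.^ α ∣ℕ 6 ℕ.* n ℕ.+ 1 → + (5 ℕ.^ α) ∣ cψ₂ n
  5^∣cψ₂ n α h with level α
  ... | inj₁ (L , (g , _ , p) , progression) = let m , c≡ , _ = progression n h in
    ≡.subst (+ (5 ℕ.^ α) ∣_) (≡.sym c≡) (5^∣coeff α _ m p)
  ... | inj₂ (L , (g , _ , p) , progression) = let m , c≡ , _ = progression n h in
    -- The odd state describes `q * L`, whose coefficient at `suc m` is that of `L` at `m`.
    ≡.subst (+ (5 ℕ.^ α) ∣_) (≡.sym (≡.trans c≡ (≡.sym (coeff-q*-suc L m)))) (5^∣coeff α _ (suc m) p)

open import Data.Nat using (ℕ; _≤_; _*_; _+_; _^_)
open import Data.Integer using (ℤ; +_)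

theorem1p2 : (n α : ℕ) → 1 ≤ n → 1 ≤ α → (5 ^ α) ∣ℕ (6 * n + 1) →
    (+ (5 ^ α)) ∣ cψ₂ n
theorem1p2 n α _ _ = CψCongruence.5^∣cψ₂ n α
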